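{- Let $a_1, a_2 \in \mathbb{Q}$ with $a_2 \neq 0$ and $a_1^2 + 4a_2 \neq 0$, and suppose both roots $c_1, c_2$ of $f(x) = x^2 - a_1 x - a_2$ are rational (they are then nonzero and distinct). Let $b$ be a positive integer and let $u = (u_n)_{n=-\infty}^{\infty}$ be a sequence with every term in $\mathbb{Z}[1/b]$ such that $u_{n+2} = a_1 u_{n+1} + a_2 u_n$ for all $n \in \mathbb{Z}$. Write $u_n = b_1 c_1^n + b_2 c_2^n$ for all $n \in \mathbb{Z}$, with $b_1, b_2 \in \mathbb{Q}$, and assume $b_1 \neq 0$ and $b_2 \neq 0$. Put $B = -b_2/b_1$ and $C = c_1/c_2$. Suppose that at least one of the following holds: (1) $C^m = B$ for some $m \in \mathbb{Z}$; (2) $(C, B) = (1, -1)$; (3) $B^k C^\ell \notin \{1, -1\}$ for all $k \in \mathbb{Z} \setminus \{0\}$ and all $\ell \in \mathbb{Z}$. Then no term $u_n$ is zero if and only if there are infinitely many primes $p$ such that $\gcd(b, p) = 1$ and $u_n \notin p\mathbb{Z}[1/b]$ for every $n \in \mathbb{Z}$.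
   Context: For a prime $p$ not dividing $b$, the condition $u_n \notin p\mathbb{Z}[1/b]$ means that $u_n$ is not divisible by $p$ in $\mathbb{Z}[1/b]$, i.e. $u_n \neq 0$ and the $p$-adic valuation of $u_n$ is $0$. The rational numbers $b_1, b_2$ with $u_n = b_1 c_1^n + b_2 c_2^n$ for all $n$ exist and are unique because $c_1 \neq c_2$. -}

module Defs where

open import Data.Nat as ℕ using (ℕ; zero; suc)
open import Data.Nat.Divisibility using (_∣_)
open import Data.Integer as ℤ using (ℤ; +_; -[1+_])
open import Data.Rational using (ℚ; mkℚ; 0ℚ; 1ℚ; _*_; 1/_; _/_)
open import Data.Product using (Σ; ∃; _×_)
open import Relation.Binary.PropositionalEquality using (_≡_)

-- Total multiplicative inverse on ℚ (inv 0 = 0); only ever applied to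
-- nonzero rationals in the statement, where it is the usual inverse 1/q.
inv : ℚ → ℚ
inv (mkℚ (+ zero) d c) = 0ℚ
inv q@(mkℚ (+ suc n) d c) = 1/ q
inv q@(mkℚ -[1+ n ] d c) = 1/ q

_^ℕ_ : ℚ → ℕ → ℚ
q ^ℕ zero = 1ℚ
q ^ℕ suc n = q * (q ^ℕ n)

_^ℤ_ : ℚ → ℤ → ℚ
q ^ℤ (+ n) = q ^ℕ n
q ^ℤ -[1+ n ] = inv (q ^ℕ suc n)

InZ[1/_] : ℕ → ℚ → Set
InZ[1/ b ] q = ∃ λ (k : ℕ) → ℚ.denominatorℕ q ∣ b ℕ.^ k

InpZ[1/_] : ℕ → ℕ → ℚ → Set
InpZ[1/ b ] p q = ∃ λ (x : ℚ) → InZ[1/ b ] x × q ≡ ((+ p) / 1) * x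

{-# OPTIONS --safe #-}

-- A prime p not dividing the relevant numerators and denominators divides some u n exactly when C ^ n ≡ B modulo p
-- for some n. So suppose that B is a power of C modulo almost every prime, although B and C are multiplicatively
-- independent. Choose a large prime ℓ such that the valuations of B and C at two primes make B C ^ j and C non-ℓ-th
-- powers. By Kummer theory y ^ ℓ = B defines a field of degree ℓ over K = ℚ(ζ, C ^ (1/ℓ)), n = [K : ℚ], whereas B is
-- an ℓ-th power in K modulo almost every integer. The latter is refuted by counting. If α and α′ in K are close to
-- integers a and a′ with a a′ ≈ X, the pigeonhole principle gives a small β in K(y) that is divisible by α and by α′ when
-- two different roots of B modulo α α′ are substituted for y; as the norm of β is bounded by a multiple of α α′, the
-- pair (α, α′) is almost determined by β. There are ≫ X ^ n log X such pairs but only O(X ^ n) such β.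
module Submission where

open import Algebra.Bundles using (CommutativeRing; CommutativeSemiring)
open import Algebra.Structures using (IsCommutativeRing)
open import Algebra.Solver.Ring.AlmostCommutativeRing using (AlmostCommutativeRing; fromCommutativeRing; _-Raw-AlmostCommutative⟶_)
import Algebra.Solver.Ring
import Algebra.Properties.CommutativeSemiring.Binomial as Binomial
import Algebra.Properties.CommutativeSemiring.Exp
import Algebra.Properties.Group
import Algebra.Properties.Monoid.Mult as Mult
import Algebra.Properties.Semiring.Sum as Sum
open import Data.Empty using (⊥; ⊥-elim)
open import Data.Fin.Base as Fin using (Fin; toℕ; fromℕ; fromℕ<; inject₁; combine; remQuot)
open import Data.Fin.Properties as Fin using (toℕ<n; toℕ-injective; toℕ-fromℕ; toℕ-inject₁; fromℕ<-injective; combine-injective; combine-remQuot; pigeonhole)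
open import Data.Integer as ℤ using (ℤ; +_; -[1+_])
import Data.Integer.DivMod as ℤ
import Data.Integer.Properties as ℤ
open import Data.List.Base using ([]; _∷_)
open import Data.List.Relation.Unary.All using (All; []; _∷_)
open import Data.Maybe.Base as Maybe using (Maybe)
open import Data.Nat as ℕ using (ℕ; zero; suc; _≤_; _<_; _>_; s≤s; z≤n; NonZero; _⊔_; _%_; _!)
import Data.Nat.Properties as ℕ
open import Data.Nat.Combinatorics using (nCn≡1; k![n∸k]!∣n!) renaming (_C_ to _choose_)
open import Data.Nat.Combinatorics.Specification using (nCk≡n!/k![n-k]!)
open import Data.Nat.Coprimality as Coprimality using (Coprime; coprime?)
open import Data.Nat.Divisibility as ℕ∣ using () renaming (_∣_ to _∣ℕ_)
open import Data.Nat.DivMod using (m/n*n≡m; m≡m%n+[m/n]*n; m%n<n; [m+n]%n≡m%n; [m+kn]%n≡m%n; %-distribˡ-*; m<n⇒m%n≡m; m*n%n≡0)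
open import Data.Nat.GCD using (gcd; gcd[m,n]∣m; gcd[m,n]∣n; gcd-greatest; module Bézout)
open import Data.Nat.Induction using (<-wellFounded)
open import Data.Nat.ListAction using () renaming (product to productℕ)
open import Data.Nat.Primality using (Prime; prime?; euclidsLemma; prime⇒nonZero; prime⇒nonTrivial; prime⇒irreducible)
open import Data.Nat.Primality.Factorisation using (factorise; PrimeFactorisation)
open import Data.Nat.Solver using (module +-*-Solver)
open import Data.Product using (Σ; ∃; ∃₂; _×_; _,_; proj₁; proj₂)
open import Data.Sum using (_⊎_; inj₁; inj₂; [_,_]′)
open import Data.Vec.Base as Vec using (Vec; []; _∷_; replicate; map; zipWith; lookup; head)
open import Data.Vec.Properties using (≡-dec; lookup-map; lookup-zipWith; lookup-replicate)
open import Function.Base using (_∘_)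
open import Function.Bundles using (_⇔_; mk⇔)
open import Induction.WellFounded using (Acc; acc)
open import Level using (0ℓ)
open import Relation.Binary.Definitions using (DecidableEquality; Tri; tri<; tri≈; tri>)
open import Relation.Binary.PropositionalEquality using (_≡_; _≢_; refl; sym; trans; cong; cong₂; subst; isEquivalence; module ≡-Reasoning)
open import Relation.Nullary using (¬_; ¬?; Dec; yes; no)
open import Relation.Nullary.Decidable using (dec⇒maybe; _×-dec_)

-- Rings with a map from ℤ

-- Hypothesis (1) produces a zero term and (2) would make the roots coincide, so the work lies in
-- (3). Valuations do not see signs, and so (3) is used in the form that B ^ k C ^ l has absolute
-- value different from 1. Fractions f / g are replaced by f g ^ (ℓ - 1), which has the same class
-- modulo ℓ-th powers. Primes modulo which B is no ℓ-th power would usually come from Chebotarev's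
-- theorem; the count needs only lattice points and relative norms. For this purpose K is replaced
-- by an order with the sup norm of the coordinates. An element α close to an integer a plays the
-- part of an ideal of norm about a ^ n: up to constants, division by α behaves like division by a,
-- without embeddings or volumes. Units and small common factors would leave the pair only almost
-- determined; all α are therefore taken congruent to 1 modulo a number Q divisible by all small
-- integers, and β then determines the pair. The factor log X counts the dyadic ways to split X. The
-- count refutes a root modulo one composite W; roots modulo its primes would combine to such a root
-- by Hensel lifting and the Chinese remainder theorem.

record Ring : Set₁ where
  infixl 6 _+_
  infixl 7 _*_
  infix 8 -_
  field
    Carrier : Set
    _+_ _*_ : Carrier → Carrier → Carrier
    -_ : Carrier → Carrier
    0# 1# : Carrier
    isCommutativeRing : IsCommutativeRing _≡_ _+_ _*_ -_ 0# 1#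
    _≟_ : DecidableEquality Carrier
    ι : ℤ → Carrier
    ι-+ : ∀ m n → ι (m ℤ.+ n) ≡ ι m + ι n
    ι-* : ∀ m n → ι (m ℤ.* n) ≡ ι m * ι n
    ι-1 : ι (+ 1) ≡ 1#

  commutativeRing : CommutativeRing 0ℓ 0ℓ
  commutativeRing = record { isCommutativeRing = isCommutativeRing }

  open CommutativeRing commutativeRing public
    using (+-assoc; +-comm; +-identityˡ; +-identityʳ; -‿inverseˡ; -‿inverseʳ; *-assoc; *-comm; *-identityˡ; *-identityʳ; distribˡ; distribʳ; zeroˡ; zeroʳ; commutativeSemiring; ring; +-group)
  open Algebra.Properties.CommutativeSemiring.Exp commutativeSemiring public
    using (_^_; ^-homo-*; ^-assocʳ; ^-distrib-*)

  ι-0 : ι (+ 0) ≡ 0#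
  ι-0 = Algebra.Properties.Group.identityʳ-unique +-group (ι (+ 0)) (ι (+ 0)) (sym (ι-+ (+ 0) (+ 0)))

  ι-neg : ∀ m → ι (ℤ.- m) ≡ - ι m
  ι-neg m = Algebra.Properties.Group.inverseʳ-unique +-group (ι m) (ι (ℤ.- m))
    (trans (sym (ι-+ m (ℤ.- m))) (trans (cong ι (ℤ.+-inverseʳ m)) ι-0))

  -- The coefficient map of the solver agrees with ι, but sends the literals 0 and 1 to 0# and 1# definitionally.
  coefficient : ℤ → Carrier
  coefficient (+ 0) = 0#
  coefficient (+ 1) = 1#
  coefficient n = ι n

  coefficient≡ι : ∀ n → coefficient n ≡ ι n
  coefficient≡ι (+ 0) = sym ι-0
  coefficient≡ι (+ 1) = sym ι-1
  coefficient≡ι (+ suc (suc n)) = refl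
  coefficient≡ι -[1+ n ] = refl

  almostCommutativeRing : AlmostCommutativeRing 0ℓ 0ℓ
  almostCommutativeRing = fromCommutativeRing commutativeRing

  coefficientMorphism : ℤ.+-*-rawRing -Raw-AlmostCommutative⟶ almostCommutativeRing
  coefficientMorphism = record
    { ⟦_⟧ = coefficient
    ; +-homo = λ m n → trans (coefficient≡ι (m ℤ.+ n)) (trans (ι-+ m n) (sym (cong₂ _+_ (coefficient≡ι m) (coefficient≡ι n))))
    ; *-homo = λ m n → trans (coefficient≡ι (m ℤ.* n)) (trans (ι-* m n) (sym (cong₂ _*_ (coefficient≡ι m) (coefficient≡ι n))))
    ; -‿homo = λ m → trans (coefficient≡ι (ℤ.- m)) (trans (ι-neg m) (cong -_ (sym (coefficient≡ι m))))
    ; 0-homo = refl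
    ; 1-homo = refl
    }

  coefficient-≟ : ∀ m n → Maybe (coefficient m ≡ coefficient n)
  coefficient-≟ m n = Maybe.map (cong coefficient) (dec⇒maybe (m ℤ.≟ n))

  module Solver = Algebra.Solver.Ring ℤ.+-*-rawRing almostCommutativeRing coefficientMorphism coefficient-≟

  ιₙ : ℕ → Carrier
  ιₙ n = ι (+ n)

  ιₙ-* : ∀ m n → ιₙ (m ℕ.* n) ≡ ιₙ m * ιₙ n
  ιₙ-* m n = trans (cong ι (ℤ.pos-* m n)) (ι-* (+ m) (+ n))

  ιₙ-+ : ∀ m n → ιₙ (m ℕ.+ n) ≡ ιₙ m + ιₙ n
  ιₙ-+ m n = ι-+ (+ m) (+ n)

  ιₙ-suc : ∀ n → ιₙ (suc n) ≡ 1# + ιₙ n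
  ιₙ-suc n = trans (ιₙ-+ 1 n) (cong (_+ ιₙ n) ι-1)

  infix 4 _∣_
  _∣_ : Carrier → Carrier → Set
  a ∣ b = ∃ λ c → b ≡ a * c

  ∣-refl : ∀ a → a ∣ a
  ∣-refl a = 1# , sym (*-identityʳ a)

  ∣-trans : ∀ {a b c} → a ∣ b → b ∣ c → a ∣ c
  ∣-trans {a} (x , refl) (y , refl) = x * y , *-assoc a x y

  ∣-*ʳ : ∀ {a b} c → a ∣ b → a ∣ b * c
  ∣-*ʳ {a} c (x , refl) = x * c , *-assoc a x c

  ∣-+ : ∀ {a b c} → a ∣ b → a ∣ c → a ∣ b + c
  ∣-+ {a} (x , refl) (y , refl) = x + y , sym (distribˡ a x y)

  ∣0 : ∀ a → a ∣ 0#
  ∣0 a = 0# , sym (zeroʳ a)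

  ιₙ-∣ : ∀ {m n} → (∃ λ k → n ≡ m ℕ.* k) → ιₙ m ∣ ιₙ n
  ιₙ-∣ {m} (k , refl) = ιₙ k , ιₙ-* m k

  0^suc : ∀ n → 0# ^ suc n ≡ 0#
  0^suc n = zeroˡ _

  1^ : ∀ n → 1# ^ n ≡ 1#
  1^ zero = refl
  1^ (suc n) = trans (*-identityˡ _) (1^ n)

  ∑ : ℕ → (ℕ → Carrier) → Carrier
  ∑ zero f = 0#
  ∑ (suc n) f = ∑ n f + f n

  ∏ : ℕ → (ℕ → Carrier) → Carrier
  ∏ zero f = 1#
  ∏ (suc n) f = ∏ n f * f n

  ∑-cong : ∀ n {f g : ℕ → Carrier} → (∀ i → i < n → f i ≡ g i) → ∑ n f ≡ ∑ n g
  ∑-cong zero e = refl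
  ∑-cong (suc n) e = cong₂ _+_ (∑-cong n (λ i i<n → e i (ℕ.m≤n⇒m≤1+n i<n))) (e n ℕ.≤-refl)

  ∑-zero : ∀ n {f : ℕ → Carrier} → (∀ i → i < n → f i ≡ 0#) → ∑ n f ≡ 0#
  ∑-zero zero e = refl
  ∑-zero (suc n) e = trans (cong₂ _+_ (∑-zero n (λ i i<n → e i (ℕ.m≤n⇒m≤1+n i<n))) (e n ℕ.≤-refl)) (+-identityˡ 0#)

  ∑-*ʳ : ∀ n (f : ℕ → Carrier) c → ∑ n f * c ≡ ∑ n (λ i → f i * c)
  ∑-*ʳ zero f c = zeroˡ c
  ∑-*ʳ (suc n) f c = trans (distribʳ c (∑ n f) (f n)) (cong (_+ f n * c) (∑-*ʳ n f c))

  ∑-+ : ∀ n (f g : ℕ → Carrier) → ∑ n (λ i → f i + g i) ≡ ∑ n f + ∑ n g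
  ∑-+ zero f g = sym (+-identityˡ 0#)
  ∑-+ (suc n) f g = trans (cong (_+ (f n + g n)) (∑-+ n f g))
    (Solver.solve 4 (λ a b c d → (a :+ b) :+ (c :+ d) := (a :+ c) :+ (b :+ d)) refl (∑ n f) (∑ n g) (f n) (g n))
    where open Solver using (_:+_; _:=_)

  ∑-const : ∀ n c → ∑ n (λ _ → c) ≡ ιₙ n * c
  ∑-const zero c = sym (trans (cong (_* c) ι-0) (zeroˡ c))
  ∑-const (suc n) c = trans (cong (_+ c) (∑-const n c))
    (trans (Solver.solve 2 (λ x c → x :* c :+ c := (con (+ 1) :+ x) :* c) refl (ιₙ n) c) (cong (_* c) (sym (ιₙ-suc n))))
    where open Solver using (_:+_; _:*_; _:=_; con)

  ∑-shift : ∀ n (f : ℕ → Carrier) → ∑ (suc n) f ≡ f 0 + ∑ n (λ i → f (suc i))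
  ∑-shift zero f = +-comm 0# (f 0)
  ∑-shift (suc n) f = trans (cong (_+ f (suc n)) (∑-shift n f)) (+-assoc _ _ _)

  ∏-cong : ∀ n {f g : ℕ → Carrier} → (∀ i → i < n → f i ≡ g i) → ∏ n f ≡ ∏ n g
  ∏-cong zero e = refl
  ∏-cong (suc n) e = cong₂ _*_ (∏-cong n (λ i i<n → e i (ℕ.m≤n⇒m≤1+n i<n))) (e n ℕ.≤-refl)

  ∏-shift : ∀ n (f : ℕ → Carrier) → ∏ (suc n) f ≡ f 0 * ∏ n (λ i → f (suc i))
  ∏-shift zero f = *-comm 1# (f 0)
  ∏-shift (suc n) f = trans (cong (_* f (suc n)) (∏-shift n f)) (*-assoc _ _ _)

  -- geom n x y = x^(n-1) + x^(n-2) y + ... + y^(n-1)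
  geom : ℕ → Carrier → Carrier → Carrier
  geom zero x y = 0#
  geom (suc n) x y = x ^ n + y * geom n x y

  geom-telescope : ∀ n x y → (x + - y) * geom n x y ≡ x ^ n + - (y ^ n)
  geom-telescope zero x y = trans (zeroʳ _) (sym (-‿inverseʳ 1#))
  geom-telescope (suc n) x y = begin
    (x + - y) * (x ^ n + y * g)              ≡⟨ solve 4 (λ x y p g → (x :- y) :* (p :+ y :* g) := (x :- y) :* p :+ y :* ((x :- y) :* g)) refl x y (x ^ n) g ⟩
    (x + - y) * x ^ n + y * ((x + - y) * g)  ≡⟨ cong (λ t → (x + - y) * x ^ n + y * t) (geom-telescope n x y) ⟩
    (x + - y) * x ^ n + y * (x ^ n + - (y ^ n)) ≡⟨ solve 4 (λ x y p q → (x :- y) :* p :+ y :* (p :- q) := x :* p :- y :* q) refl x y (x ^ n) (y ^ n) ⟩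
    x * x ^ n + - (y * y ^ n)                ∎
    where
    open ≡-Reasoning
    open Solver using (solve; _:+_; _:-_; _:*_; _:=_)
    g = geom n x y

  x-y≡0⇒x≡y : ∀ {x y} → x + - y ≡ 0# → x ≡ y
  x-y≡0⇒x≡y {x} {y} e = trans (solve 2 (λ x y → x := (x :- y) :+ y) refl x y) (trans (cong (_+ y) e) (+-identityˡ y))
    where open Solver using (solve; _:+_; _:-_; _:=_)

  IsDomain : Set
  IsDomain = ∀ a b → a * b ≡ 0# → a ≡ 0# ⊎ b ≡ 0#

  module Domain (domain : IsDomain) where

    *-≢0 : ∀ {a b} → a ≢ 0# → b ≢ 0# → a * b ≢ 0#
    *-≢0 {a} {b} a≢0 b≢0 e with domain a b e
    ... | inj₁ a≡0 = a≢0 a≡0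
    ... | inj₂ b≡0 = b≢0 b≡0

    *-cancelˡ : ∀ {a} b c → a ≢ 0# → a * b ≡ a * c → b ≡ c
    *-cancelˡ {a} b c a≢0 e with domain a (b + - c) (trans (solve 3 (λ a b c → a :* (b :- c) := a :* b :- a :* c) refl a b c) (trans (cong (_+ - (a * c)) e) (-‿inverseʳ _)))
      where open Solver using (solve; _:*_; _:-_; _:=_)
    ... | inj₁ a≡0 = ⊥-elim (a≢0 a≡0)
    ... | inj₂ b-c≡0 = x-y≡0⇒x≡y b-c≡0

    ^-≢0 : ∀ {a} n → a ≢ 0# → 1# ≢ 0# → a ^ n ≢ 0#
    ^-≢0 zero a≢0 1≢0 = 1≢0
    ^-≢0 (suc n) a≢0 1≢0 = *-≢0 a≢0 (^-≢0 n a≢0 1≢0)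

ℤ-ring : Ring
ℤ-ring = record
  { Carrier = ℤ
  ; isCommutativeRing = ℤ.+-*-isCommutativeRing
  ; _≟_ = ℤ._≟_
  ; ι = λ n → n
  ; ι-+ = λ _ _ → refl
  ; ι-* = λ _ _ → refl
  ; ι-1 = refl
  }

-- Congruences and the Frobenius map

prime⇒≢1 : ∀ {p} → Prime p → p ≢ 1
prime⇒≢1 pp refl with () ← prime⇒nonTrivial pp

prime∤1 : ∀ {p} → Prime p → ¬ (p ∣ℕ 1)
prime∤1 pp p∣1 = prime⇒≢1 pp (ℕ∣.∣1⇒≡1 p∣1)

prime∤! : ∀ {p} → Prime p → ∀ k → k < p → ¬ (p ∣ℕ k !)
prime∤! pp zero k<p p∣ = prime∤1 pp p∣
prime∤! pp (suc k) k<p p∣ with euclidsLemma (suc k) (k !) pp p∣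
... | inj₁ p∣k = ℕ.<⇒≱ k<p (ℕ∣.∣⇒≤ p∣k)
... | inj₂ p∣k! = prime∤! pp k (ℕ.<-trans (ℕ.n<1+n k) k<p) p∣k!

-- `p` divides p !, which is the binomial coefficient times k ! (p - k) !, but it divides neither
-- factorial because all their factors are below `p`.
prime∣C : ∀ {p} → Prime p → ∀ k → 0 < k → k < p → p ∣ℕ (p choose k)
prime∣C {p} pp k 0<k k<p with euclidsLemma (p choose k) (k ! ℕ.* (p ℕ.∸ k) !) pp p∣C*d
  where
  instance
    d≢0 : NonZero (k ! ℕ.* (p ℕ.∸ k) !)
    d≢0 = k ℕ.!* (p ℕ.∸ k) !≢0
  C*d≡p! : (p choose k) ℕ.* (k ! ℕ.* (p ℕ.∸ k) !) ≡ p !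
  C*d≡p! = trans (cong (ℕ._* (k ! ℕ.* (p ℕ.∸ k) !)) (nCk≡n!/k![n-k]! (ℕ.<⇒≤ k<p))) (m/n*n≡m (k![n∸k]!∣n! (ℕ.<⇒≤ k<p)))
  p∣p! : ∀ n → NonZero n → n ∣ℕ n !
  p∣p! (suc n) _ = ℕ∣.m∣m*n (n !)
  p∣C*d : p ∣ℕ (p choose k) ℕ.* (k ! ℕ.* (p ℕ.∸ k) !)
  p∣C*d = subst (p ∣ℕ_) (sym C*d≡p!) (p∣p! p (prime⇒nonZero pp))
... | inj₁ p∣C = p∣C
... | inj₂ p∣d with euclidsLemma (k !) ((p ℕ.∸ k) !) pp p∣d
...   | inj₁ p∣k! = ⊥-elim (prime∤! pp k k<p p∣k!)
...   | inj₂ p∣! = ⊥-elim (prime∤! pp (p ℕ.∸ k) (ℕ.∸-monoʳ-< {p} {k} {0} 0<k (ℕ.<⇒≤ k<p)) p∣!)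

prime∤⇒coprime : ∀ {p n} → Prime p → ¬ (p ∣ℕ n) → Coprime p n
prime∤⇒coprime pp p∤n (d∣p , d∣n) with prime⇒irreducible pp d∣p
... | inj₁ d≡1 = d≡1
... | inj₂ refl = ⊥-elim (p∤n d∣n)

module Congruences (R : Ring) where
  open Ring R
  open Solver using (solve; _:+_; _:-_; _:*_; :-_; _:=_; con)
  open ≡-Reasoning

  infix 4 _≡_[mod_]
  _≡_[mod_] : Carrier → Carrier → Carrier → Set
  x ≡ y [mod m ] = m ∣ (x + - y)

  mod-reflexive : ∀ {x y m} → x ≡ y → x ≡ y [mod m ]
  mod-reflexive {x} {m = m} refl = 0# , trans (-‿inverseʳ x) (sym (zeroʳ m))

  mod-sym : ∀ {x y m} → x ≡ y [mod m ] → y ≡ x [mod m ]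
  mod-sym {x} {y} {m} (c , e) = - c , (begin
    y + - x      ≡⟨ solve 2 (λ x y → y :- x := :- (x :- y)) refl x y ⟩
    - (x + - y)  ≡⟨ cong -_ e ⟩
    - (m * c)    ≡⟨ solve 2 (λ m c → :- (m :* c) := m :* (:- c)) refl m c ⟩
    m * - c      ∎)

  mod-trans : ∀ {x y z m} → x ≡ y [mod m ] → y ≡ z [mod m ] → x ≡ z [mod m ]
  mod-trans {x} {y} {z} {m} p q = subst (m ∣_) (solve 3 (λ x y z → (x :- y) :+ (y :- z) := x :- z) refl x y z) (∣-+ p q)

  mod-+ : ∀ {x x′ y y′ m} → x ≡ x′ [mod m ] → y ≡ y′ [mod m ] → x + y ≡ x′ + y′ [mod m ]
  mod-+ {x} {x′} {y} {y′} {m} p q = subst (m ∣_) (solve 4 (λ x x′ y y′ → (x :- x′) :+ (y :- y′) := (x :+ y) :- (x′ :+ y′)) refl x x′ y y′) (∣-+ p q)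

  mod-* : ∀ {x x′ y y′ m} → x ≡ x′ [mod m ] → y ≡ y′ [mod m ] → x * y ≡ x′ * y′ [mod m ]
  mod-* {x} {x′} {y} {y′} {m} p q = subst (m ∣_)
    (solve 4 (λ x x′ y y′ → (x :- x′) :* y :+ (y :- y′) :* x′ := (x :* y) :- (x′ :* y′)) refl x x′ y y′) (∣-+ (∣-*ʳ y p) (∣-*ʳ x′ q))

  mod-^ : ∀ {x y m} n → x ≡ y [mod m ] → x ^ n ≡ y ^ n [mod m ]
  mod-^ zero p = mod-reflexive refl
  mod-^ (suc n) p = mod-* p (mod-^ n p)

  mod-∣ : ∀ {x y m n} → n ∣ m → x ≡ y [mod m ] → x ≡ y [mod n ]
  mod-∣ = ∣-trans

  ∣⇒≡0 : ∀ {x m} → m ∣ x → x ≡ 0# [mod m ]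
  ∣⇒≡0 {x} {m} = subst (m ∣_) (solve 1 (λ x → x := x :- con (+ 0)) refl x)

  ≡0⇒∣ : ∀ {x m} → x ≡ 0# [mod m ] → m ∣ x
  ≡0⇒∣ {x} {m} = subst (m ∣_) (solve 1 (λ x → x :- con (+ 0) := x) refl x)

  mod⇒∣ : ∀ {x y m} → x ≡ y [mod m ] → m ∣ x → m ∣ y
  mod⇒∣ p q = ≡0⇒∣ (mod-trans (mod-sym p) (∣⇒≡0 q))

  bézout : ∀ {m n} → Coprime m n → ∃₂ λ s t → ι s * ιₙ m + ι t * ιₙ n ≡ 1#
  bézout {m} {n} c with Coprimality.coprime-Bézout c
  ... | Bézout.+- x y e = + x , ℤ.- + y , (begin
    ιₙ x * ιₙ m + ι (ℤ.- + y) * ιₙ n  ≡⟨ cong (λ t → ιₙ x * ιₙ m + t * ιₙ n) (ι-neg (+ y)) ⟩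
    ιₙ x * ιₙ m + - ιₙ y * ιₙ n       ≡⟨ cong (_+ - ιₙ y * ιₙ n) (trans (sym (ιₙ-* x m)) (trans (cong ιₙ (sym e)) (trans (ιₙ-suc (y ℕ.* n)) (cong (λ z → 1# + z) (ιₙ-* y n))))) ⟩
    1# + ιₙ y * ιₙ n + - ιₙ y * ιₙ n  ≡⟨ solve 2 (λ y n → con (+ 1) :+ y :* n :+ :- y :* n := con (+ 1)) refl (ιₙ y) (ιₙ n) ⟩
    1#                                ∎)
  ... | Bézout.-+ x y e = ℤ.- + x , + y , (begin
    ι (ℤ.- + x) * ιₙ m + ιₙ y * ιₙ n  ≡⟨ cong (λ t → t * ιₙ m + ιₙ y * ιₙ n) (ι-neg (+ x)) ⟩
    - ιₙ x * ιₙ m + ιₙ y * ιₙ n       ≡⟨ cong (λ z → - ιₙ x * ιₙ m + z) (trans (sym (ιₙ-* y n)) (trans (cong ιₙ (sym e)) (trans (ιₙ-suc (x ℕ.* m)) (cong (λ z → 1# + z) (ιₙ-* x m))))) ⟩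
    - ιₙ x * ιₙ m + (1# + ιₙ x * ιₙ m)  ≡⟨ solve 2 (λ y n → :- y :* n :+ (con (+ 1) :+ y :* n) := con (+ 1)) refl (ιₙ x) (ιₙ m) ⟩
    1#                                ∎)

  coprime-∣ : ∀ {m n a} → Coprime m n → ιₙ m ∣ ιₙ n * a → ιₙ m ∣ a
  coprime-∣ {m} {n} {a} c (x , e) with bézout c
  ... | s , t , st = ι s * a + ι t * x , (begin
    a                                      ≡⟨ sym (*-identityˡ a) ⟩
    1# * a                                 ≡⟨ cong (_* a) (sym st) ⟩
    (ι s * ιₙ m + ι t * ιₙ n) * a           ≡⟨ solve 5 (λ s m t n a → (s :* m :+ t :* n) :* a := m :* (s :* a) :+ t :* (n :* a)) refl (ι s) (ιₙ m) (ι t) (ιₙ n) a ⟩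
    ιₙ m * (ι s * a) + ι t * (ιₙ n * a)     ≡⟨ cong (λ z → ιₙ m * (ι s * a) + ι t * z) e ⟩
    ιₙ m * (ι s * a) + ι t * (ιₙ m * x)     ≡⟨ solve 5 (λ s m t a x → m :* (s :* a) :+ t :* (m :* x) := m :* (s :* a :+ t :* x)) refl (ι s) (ιₙ m) (ι t) a x ⟩
    ιₙ m * (ι s * a + ι t * x)              ∎)

  module _ {p : ℕ} (pp : Prime p) where
    private
      module S = CommutativeSemiring commutativeSemiring
      open Mult S.+-monoid using () renaming (_×_ to _×ₘ_; ×-assocˡ to ×-assoc)
      open Sum S.semiring using (sum; sum-init-last; sum-cong-≗)

      ×≡ι* : ∀ n x → n ×ₘ x ≡ ιₙ n * x
      ×≡ι* zero x = sym (trans (cong (_* x) ι-0) (zeroˡ x))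
      ×≡ι* (suc n) x = begin
        x + n ×ₘ x         ≡⟨ cong (λ z → x + z) (×≡ι* n x) ⟩
        x + ιₙ n * x       ≡⟨ solve 2 (λ n x → x :+ n :* x := (con (+ 1) :+ n) :* x) refl (ιₙ n) x ⟩
        (1# + ιₙ n) * x    ≡⟨ cong (_* x) (sym (ιₙ-suc n)) ⟩
        ιₙ (suc n) * x     ∎

      ∣-sum : ∀ {m} n (f : Fin n → Carrier) → (∀ i → m ∣ f i) → m ∣ sum f
      ∣-sum zero f h = ∣0 _
      ∣-sum (suc n) f h = ∣-+ (h Fin.zero) (∣-sum n (λ i → f (Fin.suc i)) (λ i → h (Fin.suc i)))

    freshman : ∀ x y → (x + y) ^ p ≡ x ^ p + y ^ p [mod ιₙ p ]
    freshman x y = go p refl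
      where
      -- The exponent is generalised to `n` with `n ≡ p`, so that matching on `suc n` exposes the
      -- first and the last binomial term.
      go : ∀ n → n ≡ p → (x + y) ^ n ≡ x ^ n + y ^ n [mod ιₙ p ]
      go zero e with () ← prime⇒nonZero (subst Prime (sym e) pp)
      go (suc n) e = subst (ιₙ p ∣_) expansion (∣-sum n middle middle∣)
        where
        open Binomial commutativeSemiring using (binomialTerm) renaming (theorem to binomial)
        term = binomialTerm x y (suc n)
        middle : Fin n → Carrier
        middle i = term (Fin.suc (inject₁ i))
        middle∣ : ∀ i → ιₙ p ∣ middle i
        middle∣ i with subst (_∣ℕ (suc n choose k)) e (prime∣C (subst Prime (sym e) pp) k (s≤s z≤n) k<)
          where
          k = toℕ (Fin.suc (inject₁ i))
          k< : k < suc n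
          k< = s≤s (subst (_< n) (sym (toℕ-inject₁ i)) (toℕ<n i))
        ... | ℕ∣.divides c eq = ιₙ c * monomial , (begin
          middle i                   ≡⟨ ×≡ι* (suc n choose suc (toℕ (inject₁ i))) monomial ⟩
          ιₙ (suc n choose suc (toℕ (inject₁ i))) * monomial  ≡⟨ cong (λ z → ιₙ z * monomial) (trans eq (ℕ.*-comm c p)) ⟩
          ιₙ (p ℕ.* c) * monomial     ≡⟨ cong (_* monomial) (ιₙ-* p c) ⟩
          ιₙ p * ιₙ c * monomial      ≡⟨ *-assoc _ _ _ ⟩
          ιₙ p * (ιₙ c * monomial)    ∎)
          where
          monomial = x ^ suc (toℕ (inject₁ i)) * y ^ (suc n ℕ.∸ suc (toℕ (inject₁ i)))
        first : term Fin.zero ≡ y ^ suc n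
        first = trans (+-identityʳ _) (*-identityˡ _)
        last : term (fromℕ (suc n)) ≡ x ^ suc n
        last = go′ _ (toℕ-fromℕ (suc n))
          where
          go′ : ∀ k → k ≡ suc n → (suc n choose k) ×ₘ (x ^ k * y ^ (suc n ℕ.∸ k)) ≡ x ^ suc n
          go′ _ refl = trans (cong₂ (λ c d → c ×ₘ (x ^ suc n * y ^ d)) (nCn≡1 (suc n)) (ℕ.n∸n≡0 (suc n))) (trans (+-identityʳ _) (*-identityʳ _))
        expansion : sum middle ≡ (x + y) ^ suc n + - (x ^ suc n + y ^ suc n)
        expansion = begin
          sum middle
            ≡⟨ solve 3 (λ m a b → m := (a :+ (m :+ b)) :- (b :+ a)) refl (sum middle) (y ^ suc n) (x ^ suc n) ⟩
          (y ^ suc n + (sum middle + x ^ suc n)) + - (x ^ suc n + y ^ suc n)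
            ≡⟨ cong (_+ - (x ^ suc n + y ^ suc n)) (sym (trans (binomial (suc n) x y) (cong₂ _+_ first (trans (sum-init-last (λ i → term (Fin.suc i))) (cong (λ z → sum middle + z) last))))) ⟩
          (x + y) ^ suc n + - (x ^ suc n + y ^ suc n) ∎

    private
      0^p : 0# ^ p ≡ 0#
      0^p = go p refl
        where
        go : ∀ n → n ≡ p → 0# ^ n ≡ 0#
        go zero e with () ← prime⇒nonZero (subst Prime (sym e) pp)
        go (suc n) e = 0^suc n

      fermatₙ : ∀ n → ιₙ n ^ p ≡ ιₙ n [mod ιₙ p ]
      fermatₙ zero = mod-reflexive (trans (cong (_^ p) ι-0) (trans 0^p (sym ι-0)))
      fermatₙ (suc n) = subst (λ z → z ^ p ≡ z [mod ιₙ p ]) (sym (ιₙ-suc n))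
        (mod-trans (freshman 1# (ιₙ n)) (mod-+ (mod-reflexive (1^ p)) (fermatₙ n)))

    -- For negative integers the parity of `p` is avoided: `freshman` applied to a + (- a) = 0 gives
    -- (- a) ^ p ≡ - (a ^ p), also for p = 2.
    fermat : ∀ a → ι a ^ p ≡ ι a [mod ιₙ p ]
    fermat (+ n) = fermatₙ n
    fermat -[1+ n ] = subst (λ z → z ^ p ≡ z [mod ιₙ p ]) (sym (ι-neg (+ suc n))) (subst (ιₙ p ∣_) lemma (∣-+ (mod-sym zero-power) (mod-sym (fermatₙ (suc n)))))
      where
      a = ιₙ (suc n)
      zero-power : (a + - a) ^ p ≡ a ^ p + (- a) ^ p [mod ιₙ p ]
      zero-power = freshman a (- a)
      lemma : (a ^ p + (- a) ^ p + - ((a + - a) ^ p)) + (a + - (a ^ p)) ≡ (- a) ^ p + - (- a)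
      lemma = trans (cong (λ z → (a ^ p + (- a) ^ p + - z) + (a + - (a ^ p))) (trans (cong (_^ p) (-‿inverseʳ a)) 0^p))
        (solve 3 (λ a b c → (b :+ c :- con (+ 0)) :+ (a :- b) := c :- (:- a)) refl a (a ^ p) ((- a) ^ p))

-- Orders and their monogenic extensions

-- A ring that is free of finite rank over ℤ, with the sup norm of the coordinates.
record Order : Set₁ where
  field
    ring : Ring
  open Ring ring public hiding (ring)
  field
    rank : ℕ
    ‖_‖ : Carrier → ℕ
    ‖1‖ : ‖ 1# ‖ ≡ 1
    ‖ι*‖ : ∀ n a → ‖ ι n * a ‖ ≡ ℤ.∣ n ∣ ℕ.* ‖ a ‖
    ‖‖≡0 : ∀ a → ‖ a ‖ ≡ 0 → a ≡ 0#
    ‖+‖ : ∀ a b → ‖ a + b ‖ ≤ ‖ a ‖ ℕ.+ ‖ b ‖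
    -- The sup norm is submultiplicative only up to the structure constants of the basis, which `κ`
    -- absorbs.
    κ : ℕ
    ‖*‖ : ∀ a b → ‖ a * b ‖ ≤ κ ℕ.* (‖ a ‖ ℕ.* ‖ b ‖)
    divMod : ∀ m → .{{NonZero m}} → ∀ a → ∃₂ λ q r → a ≡ ιₙ m * q + r × ‖ r ‖ < m × m ℕ.* ‖ q ‖ ≤ ‖ a ‖ ℕ.+ m
    -- Lower and upper lattice point counts in a ball for the pigeonhole arguments: `box` lists k ^
    -- rank different elements of norm at most `k`, and `code` embeds this ball into a set of (2k +
    -- 1) ^ rank elements.
    box : ∀ k → Fin (k ℕ.^ rank) → Carrier
    box-injective : ∀ k i j → box k i ≡ box k j → i ≡ j
    ‖box‖ : ∀ k i → ‖ box k i ‖ ≤ k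
    code : ∀ k → Carrier → Fin (suc (2 ℕ.* k) ℕ.^ rank)
    code-injective : ∀ k a b → ‖ a ‖ ≤ k → ‖ b ‖ ≤ k → code k a ≡ code k b → a ≡ b

ℤ-order : Order
ℤ-order = record
  { ring = ℤ-ring
  ; rank = 1
  ; ‖_‖ = ℤ.∣_∣
  ; ‖1‖ = refl
  ; ‖ι*‖ = ℤ.abs-*
  ; ‖‖≡0 = λ _ → ℤ.∣i∣≡0⇒i≡0
  ; ‖+‖ = ℤ.∣i+j∣≤∣i∣+∣j∣
  ; κ = 1
  ; ‖*‖ = λ a b → ℕ.≤-reflexive (trans (ℤ.abs-* a b) (sym (ℕ.*-identityˡ _)))
  ; divMod = divMod
  ; box = λ k i → + toℕ i
  ; box-injective = λ k i j e → toℕ-injective (ℤ.+-injective e)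
  ; ‖box‖ = λ k i → ℕ.≤-trans (ℕ.<⇒≤ (toℕ<n i)) (ℕ.≤-reflexive (ℕ.*-identityʳ k))
  ; code = λ k a → fromℕ< (code< k a)
  ; code-injective = λ k a b a≤k b≤k e → code-injective k a b a≤k b≤k (fromℕ<-injective _ _ (code< k a) (code< k b) e)
  }
  where
  divMod : ∀ m → .{{_ : NonZero m}} → ∀ a → ∃₂ λ q r → a ≡ + m ℤ.* q ℤ.+ r × ℤ.∣ r ∣ < m × m ℕ.* ℤ.∣ q ∣ ≤ ℤ.∣ a ∣ ℕ.+ m
  divMod m a = q , + r , eq , ℤ.n%ℕd<d a m , bound
    where
    q = a ℤ./ℕ m
    r = a ℤ.%ℕ m
    eq : a ≡ + m ℤ.* q ℤ.+ + r
    eq = trans (ℤ.a≡a%ℕn+[a/ℕn]*n a m) (trans (ℤ.+-comm (+ r) (q ℤ.* + m)) (cong (ℤ._+ + r) (ℤ.*-comm q (+ m))))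
    mq : + m ℤ.* q ≡ a ℤ.+ ℤ.- + r
    mq = trans (Solver.solve 2 (λ x r → x := (x :+ r) :- r) refl (+ m ℤ.* q) (+ r)) (cong (ℤ._+ ℤ.- + r) (sym eq))
      where
      open Ring ℤ-ring using (module Solver)
      open Solver using (_:=_; _:+_; _:-_)
    bound : m ℕ.* ℤ.∣ q ∣ ≤ ℤ.∣ a ∣ ℕ.+ m
    bound = begin
      m ℕ.* ℤ.∣ q ∣            ≡⟨ sym (ℤ.abs-* (+ m) q) ⟩
      ℤ.∣ + m ℤ.* q ∣          ≡⟨ cong ℤ.∣_∣ mq ⟩
      ℤ.∣ a ℤ.+ ℤ.- + r ∣      ≤⟨ ℤ.∣i+j∣≤∣i∣+∣j∣ a (ℤ.- + r) ⟩
      ℤ.∣ a ∣ ℕ.+ ℤ.∣ ℤ.- + r ∣  ≡⟨ cong (λ z → ℤ.∣ a ∣ ℕ.+ z) (ℤ.∣-i∣≡∣i∣ (+ r)) ⟩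
      ℤ.∣ a ∣ ℕ.+ r            ≤⟨ ℕ.+-monoʳ-≤ ℤ.∣ a ∣ (ℕ.<⇒≤ (ℤ.n%ℕd<d a m)) ⟩
      ℤ.∣ a ∣ ℕ.+ m            ∎
      where open ℕ.≤-Reasoning
  -- The shift by `k` moves the interval from -k to k onto that from 0 to 2k, where reduction modulo
  -- 2k + 1 is the identity.
  encode : ℕ → ℤ → ℕ
  encode k a = (a ℤ.+ + k) ℤ.%ℕ suc (2 ℕ.* k)
  code< : ∀ k a → encode k a < suc (2 ℕ.* k) ℕ.^ 1
  code< k a = subst (encode k a <_) (sym (ℕ.*-identityʳ _)) (ℤ.n%ℕd<d (a ℤ.+ + k) (suc (2 ℕ.* k)))
  nonneg : ∀ k a → ℤ.∣ a ∣ ≤ k → ∃ λ n → a ℤ.+ + k ≡ + n × n < suc (2 ℕ.* k)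
  nonneg k (+ n) n≤k = n ℕ.+ k , refl , s≤s (ℕ.≤-trans (ℕ.+-monoˡ-≤ k n≤k) (ℕ.≤-reflexive (cong (λ z → k ℕ.+ z) (sym (ℕ.+-identityʳ k)))))
  nonneg k -[1+ n ] n<k = k ℕ.∸ suc n , ℤ.⊖-≥ n<k , s≤s (ℕ.≤-trans (ℕ.m∸n≤m k (suc n)) (ℕ.m≤m+n k _))
  small : ∀ k a → ℤ.∣ a ∣ ≤ k → a ℤ.+ + k ≡ + encode k a
  small k a a≤k with nonneg k a a≤k
  ... | n , e , n< rewrite e = cong +_ (sym (ℤm n<))
    where
    ℤm : n < suc (2 ℕ.* k) → n ℕ.% suc (2 ℕ.* k) ≡ n
    ℤm = m<n⇒m%n≡m
  code-injective : ∀ k a b → ℤ.∣ a ∣ ≤ k → ℤ.∣ b ∣ ≤ k → encode k a ≡ encode k b → a ≡ b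
  code-injective k a b a≤k b≤k e = Algebra.Properties.Group.∙-cancelʳ (Ring.+-group ℤ-ring) (+ k) a b (trans (small k a a≤k) (trans (cong +_ e) (sym (small k b b≤k))))

-- The extension R[y] of R, where y is a root of the monic polynomial y ^ m = f₀ + f₁ y + ... + f₍ₘ₋₁₎ y ^ (m - 1) with m = suc m′.
module Extension (R : Order) (m′ : ℕ) (f : Vec (Order.Carrier R) (suc m′)) where
  open Order R
  open Solver using (solve; _:+_; _:*_; _:=_; :-_)

  m : ℕ
  m = suc m′

  V : Set
  V = Vec Carrier m

  infixl 6 _⊕_
  infixr 7 _∙_
  _⊕_ : ∀ {n} → Vec Carrier n → Vec Carrier n → Vec Carrier n
  _⊕_ = zipWith _+_

  _∙_ : ∀ {n} → Carrier → Vec Carrier n → Vec Carrier n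
  r ∙ v = map (r *_) v

  ⊖_ : ∀ {n} → Vec Carrier n → Vec Carrier n
  ⊖_ = map -_

  𝟎 : ∀ {n} → Vec Carrier n
  𝟎 = replicate _ 0#

  ⊕-assoc : ∀ {n} (u v w : Vec Carrier n) → (u ⊕ v) ⊕ w ≡ u ⊕ (v ⊕ w)
  ⊕-assoc [] [] [] = refl
  ⊕-assoc (x ∷ u) (y ∷ v) (z ∷ w) = cong₂ _∷_ (+-assoc x y z) (⊕-assoc u v w)

  ⊕-comm : ∀ {n} (u v : Vec Carrier n) → u ⊕ v ≡ v ⊕ u
  ⊕-comm [] [] = refl
  ⊕-comm (x ∷ u) (y ∷ v) = cong₂ _∷_ (+-comm x y) (⊕-comm u v)

  ⊕-identityˡ : ∀ {n} (v : Vec Carrier n) → 𝟎 ⊕ v ≡ v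
  ⊕-identityˡ [] = refl
  ⊕-identityˡ (x ∷ v) = cong₂ _∷_ (+-identityˡ x) (⊕-identityˡ v)

  ⊕-identityʳ : ∀ {n} (v : Vec Carrier n) → v ⊕ 𝟎 ≡ v
  ⊕-identityʳ v = trans (⊕-comm v 𝟎) (⊕-identityˡ v)

  ⊖-inverseʳ : ∀ {n} (v : Vec Carrier n) → v ⊕ ⊖ v ≡ 𝟎
  ⊖-inverseʳ [] = refl
  ⊖-inverseʳ (x ∷ v) = cong₂ _∷_ (-‿inverseʳ x) (⊖-inverseʳ v)

  ∙-⊕ : ∀ {n} r (u v : Vec Carrier n) → r ∙ (u ⊕ v) ≡ r ∙ u ⊕ r ∙ v
  ∙-⊕ r [] [] = refl
  ∙-⊕ r (x ∷ u) (y ∷ v) = cong₂ _∷_ (distribˡ r x y) (∙-⊕ r u v)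

  +-∙ : ∀ {n} r s (v : Vec Carrier n) → (r + s) ∙ v ≡ r ∙ v ⊕ s ∙ v
  +-∙ r s [] = refl
  +-∙ r s (x ∷ v) = cong₂ _∷_ (distribʳ x r s) (+-∙ r s v)

  *-∙ : ∀ {n} r s (v : Vec Carrier n) → (r * s) ∙ v ≡ r ∙ s ∙ v
  *-∙ r s [] = refl
  *-∙ r s (x ∷ v) = cong₂ _∷_ (*-assoc r s x) (*-∙ r s v)

  ∙-comm : ∀ {n} r s (v : Vec Carrier n) → r ∙ s ∙ v ≡ s ∙ r ∙ v
  ∙-comm r s v = trans (sym (*-∙ r s v)) (trans (cong (_∙ v) (*-comm r s)) (*-∙ s r v))

  ∙-𝟎 : ∀ {n} r → r ∙ 𝟎 {n} ≡ 𝟎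
  ∙-𝟎 {zero} r = refl
  ∙-𝟎 {suc n} r = cong₂ _∷_ (zeroʳ r) (∙-𝟎 r)

  0∙ : ∀ {n} (v : Vec Carrier n) → 0# ∙ v ≡ 𝟎
  0∙ [] = refl
  0∙ (x ∷ v) = cong₂ _∷_ (zeroˡ x) (0∙ v)

  1∙ : ∀ {n} (v : Vec Carrier n) → 1# ∙ v ≡ v
  1∙ [] = refl
  1∙ (x ∷ v) = cong₂ _∷_ (*-identityˡ x) (1∙ v)

  ⊕-interchange : ∀ {n} (a b c d : Vec Carrier n) → (a ⊕ b) ⊕ (c ⊕ d) ≡ (a ⊕ c) ⊕ (b ⊕ d)
  ⊕-interchange [] [] [] [] = refl
  ⊕-interchange (a ∷ as) (b ∷ bs) (c ∷ cs) (d ∷ ds) =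
    cong₂ _∷_ (solve 4 (λ a b c d → (a :+ b) :+ (c :+ d) := (a :+ c) :+ (b :+ d)) refl a b c d) (⊕-interchange as bs cs ds)

  -- Pushing x in at the front of v leaves shift x v and drops carry x v at the end.
  shift : ∀ {n} → Carrier → Vec Carrier n → Vec Carrier n
  shift x [] = []
  shift x (v ∷ vs) = x ∷ shift v vs

  carry : ∀ {n} → Carrier → Vec Carrier n → Carrier
  carry x [] = x
  carry x (v ∷ vs) = carry v vs

  shift-⊕ : ∀ {n} x y (u v : Vec Carrier n) → shift (x + y) (u ⊕ v) ≡ shift x u ⊕ shift y v
  shift-⊕ x y [] [] = refl
  shift-⊕ x y (u ∷ us) (v ∷ vs) = cong (x + y ∷_) (shift-⊕ u v us vs)

  carry-⊕ : ∀ {n} x y (u v : Vec Carrier n) → carry (x + y) (u ⊕ v) ≡ carry x u + carry y v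
  carry-⊕ x y [] [] = refl
  carry-⊕ x y (u ∷ us) (v ∷ vs) = carry-⊕ u v us vs

  shift-∙ : ∀ {n} r x (v : Vec Carrier n) → shift (r * x) (r ∙ v) ≡ r ∙ shift x v
  shift-∙ r x [] = refl
  shift-∙ r x (v ∷ vs) = cong (r * x ∷_) (shift-∙ r v vs)

  carry-∙ : ∀ {n} r x (v : Vec Carrier n) → carry (r * x) (r ∙ v) ≡ r * carry x v
  carry-∙ r x [] = refl
  carry-∙ r x (v ∷ vs) = carry-∙ r v vs

  -- The top coefficient falls out as the carry and re-enters through y ^ m = f.
  y· : V → V
  y· v = shift 0# v ⊕ carry 0# v ∙ f

  y·-⊕ : ∀ u v → y· (u ⊕ v) ≡ y· u ⊕ y· v
  y·-⊕ u v = begin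
    shift 0# (u ⊕ v) ⊕ carry 0# (u ⊕ v) ∙ f
      ≡⟨ cong₂ _⊕_ (trans (cong (λ z → shift z (u ⊕ v)) (sym (+-identityˡ 0#))) (shift-⊕ 0# 0# u v))
                   (trans (cong (λ z → carry z (u ⊕ v) ∙ f) (sym (+-identityˡ 0#))) (trans (cong (_∙ f) (carry-⊕ 0# 0# u v)) (+-∙ _ _ f))) ⟩
    (shift 0# u ⊕ shift 0# v) ⊕ (carry 0# u ∙ f ⊕ carry 0# v ∙ f)
      ≡⟨ ⊕-interchange _ _ _ _ ⟩
    y· u ⊕ y· v ∎
    where open ≡-Reasoning

  y·-∙ : ∀ r v → y· (r ∙ v) ≡ r ∙ y· v
  y·-∙ r v = begin
    shift 0# (r ∙ v) ⊕ carry 0# (r ∙ v) ∙ f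
      ≡⟨ cong₂ _⊕_ (trans (cong (λ z → shift z (r ∙ v)) (sym (zeroʳ r))) (shift-∙ r 0# v))
                   (trans (cong (λ z → carry z (r ∙ v) ∙ f) (sym (zeroʳ r))) (trans (cong (_∙ f) (carry-∙ r 0# v)) (*-∙ _ _ f))) ⟩
    r ∙ shift 0# v ⊕ r ∙ carry 0# v ∙ f
      ≡⟨ sym (∙-⊕ r _ _) ⟩
    r ∙ y· v ∎
    where open ≡-Reasoning

  y·-𝟎 : y· 𝟎 ≡ 𝟎
  y·-𝟎 = trans (cong y· (sym (0∙ 𝟎))) (trans (y·-∙ 0# 𝟎) (0∙ _))

  -- Horner's scheme for (a₀ + a₁ y + a₂ y² + ...) v.
  horner : ∀ {n} → Vec Carrier n → V → V
  horner [] v = 𝟎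
  horner (a ∷ as) v = a ∙ v ⊕ y· (horner as v)

  horner-⊕ : ∀ {n} (as : Vec Carrier n) u v → horner as (u ⊕ v) ≡ horner as u ⊕ horner as v
  horner-⊕ [] u v = sym (⊕-identityˡ 𝟎)
  horner-⊕ (a ∷ as) u v = trans (cong₂ _⊕_ (∙-⊕ a u v) (trans (cong y· (horner-⊕ as u v)) (y·-⊕ _ _))) (⊕-interchange _ _ _ _)

  horner-∙ : ∀ {n} (as : Vec Carrier n) r v → horner as (r ∙ v) ≡ r ∙ horner as v
  horner-∙ [] r v = sym (∙-𝟎 r)
  horner-∙ (a ∷ as) r v = trans (cong₂ _⊕_ (∙-comm a r v) (trans (cong y· (horner-∙ as r v)) (y·-∙ r _))) (sym (∙-⊕ r _ _))

  horner-y· : ∀ {n} (as : Vec Carrier n) v → horner as (y· v) ≡ y· (horner as v)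
  horner-y· [] v = sym y·-𝟎
  horner-y· (a ∷ as) v = trans (cong₂ _⊕_ (sym (y·-∙ a v)) (cong y· (horner-y· as v))) (sym (y·-⊕ _ _))

  -- Both sides are polynomials in the single operator `y·`, and such operators commute. Together
  -- with `⊗-identityʳ` this yields commutativity and associativity of the product without computing
  -- structure constants.
  horner-comm : ∀ {n k} (as : Vec Carrier n) (bs : Vec Carrier k) v → horner as (horner bs v) ≡ horner bs (horner as v)
  horner-comm [] bs v = sym (trans (cong (horner bs) (sym (0∙ 𝟎))) (trans (horner-∙ bs 0# 𝟎) (0∙ _)))
  horner-comm (a ∷ as) bs v = begin
    a ∙ horner bs v ⊕ y· (horner as (horner bs v))  ≡⟨ cong₂ _⊕_ (sym (horner-∙ bs a v)) (cong y· (horner-comm as bs v)) ⟩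
    horner bs (a ∙ v) ⊕ y· (horner bs (horner as v)) ≡⟨ cong (horner bs (a ∙ v) ⊕_) (sym (horner-y· bs _)) ⟩
    horner bs (a ∙ v) ⊕ horner bs (y· (horner as v)) ≡⟨ sym (horner-⊕ bs _ _) ⟩
    horner bs (a ∙ v ⊕ y· (horner as v))            ∎
    where open ≡-Reasoning

  const : Carrier → V
  const r = r ∷ 𝟎

  𝟏 : V
  𝟏 = const 1#

  pad : ∀ {n} k → Vec Carrier n → Vec Carrier k
  pad zero as = []
  pad (suc k) [] = 0# ∷ pad k []
  pad (suc k) (a ∷ as) = a ∷ pad k as

  pad-[] : ∀ k → pad k [] ≡ 𝟎
  pad-[] zero = refl
  pad-[] (suc k) = cong (0# ∷_) (pad-[] k)

  pad-id : ∀ {n} (as : Vec Carrier n) → pad n as ≡ as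
  pad-id [] = refl
  pad-id (a ∷ as) = cong (a ∷_) (pad-id as)

  shift-pad : ∀ {n} k x (as : Vec Carrier n) → shift x (pad k as) ≡ pad k (x ∷ as)
  shift-pad zero x as = refl
  shift-pad (suc k) x [] = cong (x ∷_) (trans (shift-pad k 0# []) (pad-0 k))
    where
    pad-0 : ∀ k → pad k (0# ∷ []) ≡ pad k []
    pad-0 zero = refl
    pad-0 (suc k) = refl
  shift-pad (suc k) x (a ∷ as) = cong (x ∷_) (shift-pad k a as)

  carry-pad : ∀ {n} k x (as : Vec Carrier n) → n < k → carry x (pad k as) ≡ 0#
  carry-pad (suc zero) x [] n<k = refl
  carry-pad (suc (suc k)) x [] n<k = carry-pad (suc k) 0# [] (s≤s z≤n)
  carry-pad (suc k) x (a ∷ as) (s≤s n<k) = carry-pad k a as n<k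

  y·-pad : ∀ {n} (as : Vec Carrier n) → n < m → y· (pad m as) ≡ pad m (0# ∷ as)
  y·-pad as n<m = trans (cong₂ _⊕_ (shift-pad m 0# as) (trans (cong (_∙ f) (carry-pad m 0# as n<m)) (0∙ f))) (⊕-identityʳ _)

  -- Up to degree m - 1 no carry occurs, so Horner's scheme merely rebuilds the coefficient vector.
  -- For n = m this makes `𝟏` a right unit.
  horner-𝟏 : ∀ {n} (as : Vec Carrier n) → n ≤ m → horner as 𝟏 ≡ pad m as
  horner-𝟏 [] n≤m = sym (pad-[] m)
  horner-𝟏 (a ∷ as) n<m = begin
    a ∙ 𝟏 ⊕ y· (horner as 𝟏)       ≡⟨ cong₂ (λ u v → u ⊕ y· v) (cong₂ _∷_ (*-identityʳ a) (∙-𝟎 a)) (horner-𝟏 as (ℕ.<⇒≤ n<m)) ⟩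
    const a ⊕ y· (pad m as)        ≡⟨ cong (const a ⊕_) (y·-pad as n<m) ⟩
    (a + 0#) ∷ (𝟎 ⊕ pad m′ as)     ≡⟨ cong₂ _∷_ (+-identityʳ a) (⊕-identityˡ _) ⟩
    a ∷ pad m′ as                  ∎
    where open ≡-Reasoning

  infixl 7 _⊗_
  _⊗_ : V → V → V
  _⊗_ = horner

  ⊗-identityʳ : ∀ v → v ⊗ 𝟏 ≡ v
  ⊗-identityʳ v = trans (horner-𝟏 v ℕ.≤-refl) (pad-id v)

  ⊗-comm : ∀ u v → u ⊗ v ≡ v ⊗ u
  ⊗-comm u v = trans (cong (u ⊗_) (sym (⊗-identityʳ v))) (trans (horner-comm u v 𝟏) (cong (v ⊗_) (⊗-identityʳ u)))

  ⊗-assoc : ∀ u v w → (u ⊗ v) ⊗ w ≡ u ⊗ (v ⊗ w)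
  ⊗-assoc u v w = trans (⊗-comm (u ⊗ v) w) (trans (horner-comm w u v) (cong (u ⊗_) (⊗-comm w v)))

  ⊗-identityˡ : ∀ v → 𝟏 ⊗ v ≡ v
  ⊗-identityˡ v = trans (⊗-comm 𝟏 v) (⊗-identityʳ v)

  const-⊗ : ∀ r v → const r ⊗ v ≡ r ∙ v
  const-⊗ r v = trans (cong (r ∙ v ⊕_) (trans (cong y· (horner-𝟎 m′)) y·-𝟎)) (⊕-identityʳ _)
    where
    horner-𝟎 : ∀ n → horner (𝟎 {n}) v ≡ 𝟎
    horner-𝟎 zero = refl
    horner-𝟎 (suc n) = trans (cong₂ _⊕_ (0∙ v) (trans (cong y· (horner-𝟎 n)) y·-𝟎)) (⊕-identityˡ 𝟎)

  isCommutativeRing-⊕-⊗ : IsCommutativeRing _≡_ _⊕_ _⊗_ ⊖_ 𝟎 𝟏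
  isCommutativeRing-⊕-⊗ = record
    { isRing = record
      { +-isAbelianGroup = record
        { isGroup = record
          { isMonoid = record
            { isSemigroup = record
              { isMagma = record { isEquivalence = isEquivalence ; ∙-cong = cong₂ _⊕_ }
              ; assoc = ⊕-assoc }
            ; identity = ⊕-identityˡ , ⊕-identityʳ }
          ; inverse = (λ v → trans (⊕-comm (⊖ v) v) (⊖-inverseʳ v)) , ⊖-inverseʳ
          ; ⁻¹-cong = cong ⊖_ }
        ; comm = ⊕-comm }
      ; *-cong = cong₂ _⊗_
      ; *-assoc = ⊗-assoc
      ; *-identity = ⊗-identityˡ , ⊗-identityʳ
      ; distrib = horner-⊕ , (λ u v w → trans (⊗-comm (v ⊕ w) u) (trans (horner-⊕ u v w) (cong₂ _⊕_ (⊗-comm u v) (⊗-comm u w)))) }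
    ; *-comm = ⊗-comm }

  const-+ : ∀ r s → const (r + s) ≡ const r ⊕ const s
  const-+ r s = cong (r + s ∷_) (sym (⊕-identityˡ 𝟎))

  const-* : ∀ r s → const (r * s) ≡ const r ⊗ const s
  const-* r s = sym (trans (const-⊗ r (const s)) (cong (r * s ∷_) (∙-𝟎 r)))

  extensionRing : Ring
  extensionRing = record
    { Carrier = V
    ; isCommutativeRing = isCommutativeRing-⊕-⊗
    ; _≟_ = ≡-dec _≟_
    ; ι = const ∘ ι
    ; ι-+ = λ a b → trans (cong const (ι-+ a b)) (const-+ _ _)
    ; ι-* = λ a b → trans (cong const (ι-* a b)) (const-* _ _)
    ; ι-1 = cong const ι-1
    }

  -- Sup norm and lattice point counts of an extension

  norm : ∀ {n} → Vec Carrier n → ℕ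
  norm [] = 0
  norm (x ∷ v) = ‖ x ‖ ⊔ norm v

  ‖0‖ : ‖ 0# ‖ ≡ 0
  ‖0‖ = trans (cong ‖_‖ (sym (trans (cong (_* 0#) ι-0) (zeroˡ 0#)))) (‖ι*‖ (+ 0) 0#)

  norm-𝟎 : ∀ n → norm (𝟎 {n}) ≡ 0
  norm-𝟎 zero = refl
  norm-𝟎 (suc n) = cong₂ _⊔_ ‖0‖ (norm-𝟎 n)

  norm-⊕ : ∀ {n} (u v : Vec Carrier n) → norm (u ⊕ v) ≤ norm u ℕ.+ norm v
  norm-⊕ [] [] = z≤n
  norm-⊕ (x ∷ u) (y ∷ v) = ℕ.⊔-lub
    (ℕ.≤-trans (‖+‖ x y) (ℕ.+-mono-≤ (ℕ.m≤m⊔n ‖ x ‖ (norm u)) (ℕ.m≤m⊔n ‖ y ‖ (norm v))))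
    (ℕ.≤-trans (norm-⊕ u v) (ℕ.+-mono-≤ (ℕ.m≤n⊔m ‖ x ‖ (norm u)) (ℕ.m≤n⊔m ‖ y ‖ (norm v))))

  norm-∙ : ∀ {n} r (v : Vec Carrier n) → norm (r ∙ v) ≤ κ ℕ.* (‖ r ‖ ℕ.* norm v)
  norm-∙ r [] = z≤n
  norm-∙ r (x ∷ v) = ℕ.⊔-lub
    (ℕ.≤-trans (‖*‖ r x) (ℕ.*-monoʳ-≤ κ (ℕ.*-monoʳ-≤ ‖ r ‖ (ℕ.m≤m⊔n _ _))))
    (ℕ.≤-trans (norm-∙ r v) (ℕ.*-monoʳ-≤ κ (ℕ.*-monoʳ-≤ ‖ r ‖ (ℕ.m≤n⊔m ‖ x ‖ _))))

  norm-ι∙ : ∀ {k} n (v : Vec Carrier k) → norm (ι n ∙ v) ≡ ℤ.∣ n ∣ ℕ.* norm v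
  norm-ι∙ n [] = sym (ℕ.*-zeroʳ ℤ.∣ n ∣)
  norm-ι∙ n (x ∷ v) = trans (cong₂ _⊔_ (‖ι*‖ n x) (norm-ι∙ n v)) (sym (ℕ.*-distribˡ-⊔ ℤ.∣ n ∣ _ _))

  norm≡0 : ∀ {n} (v : Vec Carrier n) → norm v ≡ 0 → v ≡ 𝟎
  norm≡0 [] e = refl
  norm≡0 (x ∷ v) e = cong₂ _∷_
    (‖‖≡0 x (ℕ.n≤0⇒n≡0 (ℕ.≤-trans (ℕ.m≤m⊔n _ _) (ℕ.≤-reflexive e))))
    (norm≡0 v (ℕ.n≤0⇒n≡0 (ℕ.≤-trans (ℕ.m≤n⊔m ‖ x ‖ _) (ℕ.≤-reflexive e))))

  norm-shift : ∀ {n} x (v : Vec Carrier n) → norm (shift x v) ≤ ‖ x ‖ ⊔ norm v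
  norm-shift x [] = z≤n
  norm-shift x (v ∷ vs) = ℕ.⊔-mono-≤ (ℕ.≤-refl {‖ x ‖}) (norm-shift v vs)

  norm-carry : ∀ {n} x (v : Vec Carrier n) → ‖ carry x v ‖ ≤ ‖ x ‖ ⊔ norm v
  norm-carry x [] = ℕ.m≤m⊔n _ _
  norm-carry x (v ∷ vs) = ℕ.≤-trans (norm-carry v vs) (ℕ.m≤n⊔m ‖ x ‖ _)

  norm-y· : ∀ v → norm (y· v) ≤ suc (κ ℕ.* norm f) ℕ.* norm v
  norm-y· v = begin
    norm (y· v)                                 ≤⟨ norm-⊕ (shift 0# v) (carry 0# v ∙ f) ⟩
    norm (shift 0# v) ℕ.+ norm (carry 0# v ∙ f) ≤⟨ ℕ.+-mono-≤ (ℕ.≤-trans (norm-shift 0# v) 0⊔) (ℕ.≤-trans (norm-∙ _ f) (ℕ.*-monoʳ-≤ κ (ℕ.*-monoˡ-≤ (norm f) (ℕ.≤-trans (norm-carry 0# v) 0⊔)))) ⟩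
    norm v ℕ.+ κ ℕ.* (norm v ℕ.* norm f)         ≡⟨ cong (λ z → norm v ℕ.+ κ ℕ.* z) (ℕ.*-comm (norm v) (norm f)) ⟩
    norm v ℕ.+ κ ℕ.* (norm f ℕ.* norm v)         ≡⟨ cong (λ z → norm v ℕ.+ z) (sym (ℕ.*-assoc κ (norm f) (norm v))) ⟩
    suc (κ ℕ.* norm f) ℕ.* norm v                ∎
    where
    open ℕ.≤-Reasoning
    0⊔ : ‖ 0# ‖ ⊔ norm v ≤ norm v
    0⊔ = ℕ.≤-reflexive (cong (_⊔ norm v) ‖0‖)

  hornerBound : ℕ → ℕ
  hornerBound zero = 0
  hornerBound (suc n) = κ ℕ.+ suc (κ ℕ.* norm f) ℕ.* hornerBound n

  norm-horner : ∀ {n} (as : Vec Carrier n) v → norm (horner as v) ≤ hornerBound n ℕ.* (norm as ℕ.* norm v)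
  norm-horner [] v = ℕ.≤-reflexive (norm-𝟎 m)
  norm-horner {suc n} (a ∷ as) v = begin
    norm (a ∙ v ⊕ y· (horner as v))                    ≤⟨ norm-⊕ (a ∙ v) (y· (horner as v)) ⟩
    norm (a ∙ v) ℕ.+ norm (y· (horner as v))           ≤⟨ ℕ.+-mono-≤ (norm-∙ a v) (ℕ.≤-trans (norm-y· (horner as v)) (ℕ.*-monoʳ-≤ c (norm-horner as v))) ⟩
    κ ℕ.* (‖ a ‖ ℕ.* N) ℕ.+ c ℕ.* (K ℕ.* (norm as ℕ.* N)) ≤⟨ ℕ.+-mono-≤ (ℕ.*-monoʳ-≤ κ (ℕ.*-monoˡ-≤ N (ℕ.m≤m⊔n ‖ a ‖ (norm as)))) (ℕ.*-monoʳ-≤ c (ℕ.*-monoʳ-≤ K (ℕ.*-monoˡ-≤ N (ℕ.m≤n⊔m ‖ a ‖ (norm as))))) ⟩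
    κ ℕ.* X ℕ.+ c ℕ.* (K ℕ.* X)                        ≡⟨ cong (λ z → κ ℕ.* X ℕ.+ z) (sym (ℕ.*-assoc c K X)) ⟩
    κ ℕ.* X ℕ.+ c ℕ.* K ℕ.* X                          ≡⟨ sym (ℕ.*-distribʳ-+ X κ (c ℕ.* K)) ⟩
    (κ ℕ.+ c ℕ.* K) ℕ.* X                              ∎
    where
    open ℕ.≤-Reasoning
    N = norm v
    c = suc (κ ℕ.* norm f)
    K = hornerBound n
    X = norm (a ∷ as) ℕ.* N

  divModV : ∀ d → .{{_ : NonZero d}} → ∀ {n} (v : Vec Carrier n) → ∃₂ λ q r → v ≡ ιₙ d ∙ q ⊕ r × norm r < d × d ℕ.* norm q ≤ norm v ℕ.+ d
  divModV d [] = [] , [] , refl , ℕ.>-nonZero⁻¹ d , ℕ.≤-trans (ℕ.≤-reflexive (ℕ.*-zeroʳ d)) z≤n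
  divModV d (x ∷ v) with divMod d x | divModV d v
  ... | q , r , e , r<d , dq≤ | qs , rs , es , rs<d , dqs≤ =
    q ∷ qs , r ∷ rs , cong₂ _∷_ e es , ℕ.⊔-lub r<d rs<d , (begin
      d ℕ.* (‖ q ‖ ⊔ norm qs)          ≡⟨ ℕ.*-distribˡ-⊔ d _ _ ⟩
      d ℕ.* ‖ q ‖ ⊔ d ℕ.* norm qs      ≤⟨ ℕ.⊔-lub (ℕ.≤-trans dq≤ (ℕ.+-monoˡ-≤ d (ℕ.m≤m⊔n _ _))) (ℕ.≤-trans dqs≤ (ℕ.+-monoˡ-≤ d (ℕ.m≤n⊔m ‖ x ‖ _))) ⟩
      ‖ x ‖ ⊔ norm v ℕ.+ d             ∎)
    where open ℕ.≤-Reasoning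

  private
    ^-split : ∀ k n → k ℕ.^ (suc n ℕ.* rank) ≡ k ℕ.^ rank ℕ.* k ℕ.^ (n ℕ.* rank)
    ^-split k n = ℕ.^-distribˡ-+-* k rank (n ℕ.* rank)

    subst-injective : ∀ {a b} (e : a ≡ b) {i j : Fin a} → subst Fin e i ≡ subst Fin e j → i ≡ j
    subst-injective refl h = h

  boxV : ∀ k n → Fin (k ℕ.^ (n ℕ.* rank)) → Vec Carrier n
  boxV k zero i = []
  boxV k (suc n) i with remQuot {k ℕ.^ rank} (k ℕ.^ (n ℕ.* rank)) (subst Fin (^-split k n) i)
  ... | i₁ , i₂ = box k i₁ ∷ boxV k n i₂

  boxV-injective : ∀ k n i j → boxV k n i ≡ boxV k n j → i ≡ j
  boxV-injective k zero Fin.zero Fin.zero e = refl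
  boxV-injective k (suc n) i j e = subst-injective (^-split k n) (begin
    i′                                        ≡⟨ sym (combine-remQuot {a} b i′) ⟩
    combine (proj₁ (remQuot {a} b i′)) (proj₂ (remQuot {a} b i′))
      ≡⟨ cong₂ combine (box-injective k _ _ (cong Vec.head e)) (boxV-injective k n _ _ (cong Vec.tail e)) ⟩
    combine (proj₁ (remQuot {a} b j′)) (proj₂ (remQuot {a} b j′))  ≡⟨ combine-remQuot {a} b j′ ⟩
    j′                                        ∎)
    where
    open ≡-Reasoning
    a = k ℕ.^ rank
    b = k ℕ.^ (n ℕ.* rank)
    i′ = subst Fin (^-split k n) i
    j′ = subst Fin (^-split k n) j

  norm-boxV : ∀ k n i → norm (boxV k n i) ≤ k
  norm-boxV k zero i = z≤n
  norm-boxV k (suc n) i = ℕ.⊔-lub (‖box‖ k _) (norm-boxV k n _)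

  codeV : ∀ k {n} → Vec Carrier n → Fin (suc (2 ℕ.* k) ℕ.^ (n ℕ.* rank))
  codeV k [] = Fin.zero
  codeV k {suc n} (x ∷ v) = subst Fin (sym (^-split (suc (2 ℕ.* k)) n)) (combine (code k x) (codeV k v))

  codeV-injective : ∀ k {n} (u v : Vec Carrier n) → norm u ≤ k → norm v ≤ k → codeV k u ≡ codeV k v → u ≡ v
  codeV-injective k [] [] u≤k v≤k e = refl
  codeV-injective k {suc n} (x ∷ u) (y ∷ v) u≤k v≤k e
    with combine-injective (code k x) (codeV k u) (code k y) (codeV k v) (subst-injective (sym (^-split (suc (2 ℕ.* k)) n)) e)
  ... | e₁ , e₂ = cong₂ _∷_
    (code-injective k x y (ℕ.≤-trans (ℕ.m≤m⊔n _ _) u≤k) (ℕ.≤-trans (ℕ.m≤m⊔n _ _) v≤k) e₁)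
    (codeV-injective k u v (ℕ.≤-trans (ℕ.m≤n⊔m ‖ x ‖ _) u≤k) (ℕ.≤-trans (ℕ.m≤n⊔m ‖ y ‖ _) v≤k) e₂)

  extension : Order
  extension = record
    { ring = extensionRing
    ; rank = m ℕ.* rank
    ; ‖_‖ = norm
    ; ‖1‖ = cong₂ _⊔_ ‖1‖ (norm-𝟎 m′)
    ; ‖ι*‖ = λ n v → trans (cong norm (const-⊗ (ι n) v)) (norm-ι∙ n v)
    ; ‖‖≡0 = norm≡0
    ; ‖+‖ = norm-⊕
    ; κ = hornerBound m
    ; ‖*‖ = norm-horner
    ; divMod = λ d v → divMod′ d v (divModV d v)
    ; box = λ k → boxV k m
    ; box-injective = λ k → boxV-injective k m
    ; ‖box‖ = λ k → norm-boxV k m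
    ; code = λ k → codeV k
    ; code-injective = λ k → codeV-injective k
    }
    where
    divMod′ : ∀ d (v : V) → (∃₂ λ q r → v ≡ ιₙ d ∙ q ⊕ r × norm r < d × d ℕ.* norm q ≤ norm v ℕ.+ d) →
              ∃₂ λ q r → v ≡ const (ιₙ d) ⊗ q ⊕ r × norm r < d × d ℕ.* norm q ≤ norm v ℕ.+ d
    divMod′ d v (q , r , e , bounds) = q , r , trans e (cong (_⊕ r) (sym (const-⊗ (ιₙ d) q))) , bounds

-- Kummer extensions

inverse-mod : ∀ {k n} .{{_ : NonZero n}} → Coprime k n → ∃ λ x → (k ℕ.* x) % n ≡ 1 % n
inverse-mod {k} {suc n} c with Coprimality.coprime-Bézout c
... | Bézout.+- x y e = x , trans (cong (_% suc n) (trans (ℕ.*-comm k x) (sym e))) ([m+kn]%n≡m%n 1 y (suc n))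
-- Here k x ≡ -1, and n ≡ -1 modulo `suc n`, so x n is the inverse.
... | Bézout.-+ x y e = x ℕ.* n , (begin
  (k ℕ.* (x ℕ.* n)) % suc n                  ≡⟨ sym ([m+n]%n≡m%n (k ℕ.* (x ℕ.* n)) (suc n)) ⟩
  (k ℕ.* (x ℕ.* n) ℕ.+ suc n) % suc n         ≡⟨ cong (_% suc n) lemma ⟩
  (1 ℕ.+ n ℕ.* y ℕ.* suc n) % suc n           ≡⟨ [m+kn]%n≡m%n 1 (n ℕ.* y) (suc n) ⟩
  1 % suc n                                  ∎)
  where
  open ≡-Reasoning
  lemma : k ℕ.* (x ℕ.* n) ℕ.+ suc n ≡ 1 ℕ.+ n ℕ.* y ℕ.* suc n
  lemma = begin
    k ℕ.* (x ℕ.* n) ℕ.+ suc n      ≡⟨ ℕ.+-suc _ n ⟩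
    suc (k ℕ.* (x ℕ.* n) ℕ.+ n)    ≡⟨ cong suc (trans (cong (ℕ._+ n) (trans (sym (ℕ.*-assoc k x n)) (cong (ℕ._* n) (ℕ.*-comm k x)))) (ℕ.+-comm _ n)) ⟩
    suc (suc (x ℕ.* k) ℕ.* n)      ≡⟨ cong suc (trans (cong (ℕ._* n) e) (trans (ℕ.*-comm (y ℕ.* suc n) n) (sym (ℕ.*-assoc n y (suc n))))) ⟩
    suc (n ℕ.* y ℕ.* suc n)        ∎

module Characteristic0 (R : Order) where
  open Order R

  ‖0‖ : ‖ 0# ‖ ≡ 0
  ‖0‖ = trans (cong ‖_‖ (sym (trans (cong (_* 0#) ι-0) (zeroˡ 0#)))) (‖ι*‖ (+ 0) 0#)

  1≢0 : 1# ≢ 0#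
  1≢0 e with () ← trans (sym ‖1‖) (trans (cong ‖_‖ e) ‖0‖)

  ι*≡0 : ∀ n a → ι n * a ≡ 0# → n ≡ + 0 ⊎ a ≡ 0#
  ι*≡0 n a e with ℕ.m*n≡0⇒m≡0∨n≡0 ℤ.∣ n ∣ (trans (sym (‖ι*‖ n a)) (trans (cong ‖_‖ e) ‖0‖))
  ... | inj₁ p = inj₁ (ℤ.∣i∣≡0⇒i≡0 p)
  ... | inj₂ p = inj₂ (‖‖≡0 a p)

  ‖ι‖ : ∀ n → ‖ ι n ‖ ≡ ℤ.∣ n ∣
  ‖ι‖ n = trans (cong ‖_‖ (sym (*-identityʳ (ι n)))) (trans (‖ι*‖ n 1#) (trans (cong (ℤ.∣ n ∣ ℕ.*_) ‖1‖) (ℕ.*-identityʳ _)))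

module Generator (R : Order) (m′ : ℕ) (f : Vec (Order.Carrier R) (suc m′)) where
  open Order R
  open Extension R m′ f
  module S = Ring extensionRing

  -- Writing it as `y· 𝟏` and not as a coordinate vector covers m = 1, where y is the scalar f₀;
  -- this happens for ℤ[ζ] with ℓ = 2 and ζ = -1.
  𝐲 : V
  𝐲 = y· 𝟏

  𝐲⊗ : ∀ v → 𝐲 ⊗ v ≡ y· v
  𝐲⊗ v = trans (⊗-comm 𝐲 v) (trans (horner-y· v 𝟏) (cong y· (⊗-identityʳ v)))

  private
    E : ∀ k → Vec Carrier (suc k)
    E zero = 1# ∷ []
    E (suc k) = 0# ∷ E k

    𝐲^ : ∀ k → k ≤ m′ → 𝐲 S.^ k ≡ pad m (E k)
    𝐲^ zero _ = cong (1# ∷_) (sym (pad-[] m′))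
    𝐲^ (suc k) k<m′ = trans (𝐲⊗ _) (trans (cong y· (𝐲^ k (ℕ.<⇒≤ k<m′))) (y·-pad (E k) (s≤s k<m′)))

    shift-E : ∀ k → shift 0# (E k) ≡ 𝟎
    shift-E zero = refl
    shift-E (suc k) = cong (0# ∷_) (shift-E k)

    carry-E : ∀ k x → carry x (E k) ≡ 1#
    carry-E zero x = refl
    carry-E (suc k) x = carry-E k 0#

  𝐲^m≡f : 𝐲 S.^ m ≡ f
  𝐲^m≡f = begin
    𝐲 ⊗ 𝐲 S.^ m′                                    ≡⟨ 𝐲⊗ _ ⟩
    y· (𝐲 S.^ m′)                                   ≡⟨ cong y· (trans (𝐲^ m′ ℕ.≤-refl) (pad-id (E m′))) ⟩
    shift 0# (E m′) ⊕ carry 0# (E m′) ∙ f           ≡⟨ cong₂ _⊕_ (shift-E m′) (trans (cong (_∙ f) (carry-E m′ 0#)) (1∙ f)) ⟩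
    𝟎 ⊕ f                                           ≡⟨ ⊕-identityˡ f ⟩
    f                                               ∎
    where open ≡-Reasoning

  ∑-𝐲^ : ∀ k → horner (replicate k 1#) 𝟏 ≡ S.∑ k (λ i → 𝐲 S.^ i)
  ∑-𝐲^ zero = refl
  ∑-𝐲^ (suc k) = begin
    1# ∙ 𝟏 ⊕ y· (horner (replicate k 1#) 𝟏)    ≡⟨ cong₂ _⊕_ (1∙ 𝟏) (trans (cong y· (∑-𝐲^ k)) (y·-∑ k)) ⟩
    𝟏 ⊕ S.∑ k (λ i → 𝐲 S.^ suc i)             ≡⟨ sym (S.∑-shift k (λ i → 𝐲 S.^ i)) ⟩
    S.∑ (suc k) (λ i → 𝐲 S.^ i)               ∎
    where
    open ≡-Reasoning
    y·-∑ : ∀ k → y· (S.∑ k (λ i → 𝐲 S.^ i)) ≡ S.∑ k (λ i → 𝐲 S.^ suc i)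
    y·-∑ zero = y·-𝟎
    y·-∑ (suc k) = trans (y·-⊕ _ _) (cong₂ _⊕_ (y·-∑ k) (sym (𝐲⊗ _)))

-- R[y] with y ^ ℓ = b, where ζ is a primitive ℓ-th root of unity of R.
module RootExtension
  (R : Order) (m′ : ℕ) (prime-ℓ : Prime (suc m′))
  (ζ : Order.Carrier R) (ζ^ℓ≡1 : Order._^_ R ζ (suc m′) ≡ Order.1# R)
  (∑ζ≡0 : ∀ j → 0 < j → j < suc m′ → Order.∑ R (suc m′) (λ i → Order._^_ R ζ (i ℕ.* j)) ≡ Order.0# R)
  (domain : Order.IsDomain R)
  (b : Order.Carrier R)
  where
  open Order R
  open Domain domain
  open Characteristic0 R

  ℓ : ℕ
  ℓ = suc m′

  open Extension R m′ (b ∷ replicate m′ 0#) public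
  open Generator R m′ (b ∷ replicate m′ 0#) public

  -- Otherwise all summands in `∑ζ≡0` would be 1 and ℓ would vanish.
  ζ^≢1 : ∀ j → 0 < j → j < ℓ → ζ ^ j ≢ 1#
  ζ^≢1 j 0<j j<ℓ e with ι*≡0 (+ ℓ) 1# (trans (sym (∑-const ℓ 1#)) (trans (∑-cong ℓ (λ i _ → sym (ones i))) (∑ζ≡0 j 0<j j<ℓ)))
    where
    ones : ∀ i → ζ ^ (i ℕ.* j) ≡ 1#
    ones i = trans (cong (ζ ^_) (ℕ.*-comm i j)) (trans (sym (^-assocʳ ζ j i)) (trans (cong (_^ i) e) (1^ i)))
  ... | inj₂ 1≡0 = 1≢0 1≡0

  ζ^[nℓ]≡1 : ∀ n → ζ ^ (n ℕ.* ℓ) ≡ 1#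
  ζ^[nℓ]≡1 n = trans (cong (ζ ^_) (ℕ.*-comm n ℓ)) (trans (sym (^-assocʳ ζ ℓ n)) (trans (cong (_^ n) ζ^ℓ≡1) (1^ n)))

  ζ^-% : ∀ n → ζ ^ n ≡ ζ ^ (n % ℓ)
  ζ^-% n = begin
    ζ ^ n                              ≡⟨ cong (ζ ^_) (m≡m%n+[m/n]*n n ℓ) ⟩
    ζ ^ (n % ℓ ℕ.+ n ℕ./ ℓ ℕ.* ℓ)       ≡⟨ ^-homo-* ζ (n % ℓ) _ ⟩
    ζ ^ (n % ℓ) * ζ ^ (n ℕ./ ℓ ℕ.* ℓ)   ≡⟨ cong (ζ ^ (n % ℓ) *_) (ζ^[nℓ]≡1 (n ℕ./ ℓ)) ⟩
    ζ ^ (n % ℓ) * 1#                   ≡⟨ *-identityʳ _ ⟩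
    ζ ^ (n % ℓ)                        ∎
    where open ≡-Reasoning

  -- The powers ζ ^ j exhaust the ℓ-th roots of unity: geom ℓ (ζ ^ j u) v is annihilated by ζ ^ j u - v,
  -- and these sums add up to ℓ v ^ (ℓ - 1) over all j.
  equal-powers : ∀ u v → v ≢ 0# → u ^ ℓ ≡ v ^ ℓ → ∃ λ j → ζ ^ j * u ≡ v
  equal-powers u v v≢0 e = search ℓ (λ sum≡0 → sum≢0 (trans (sym (total m′ ℕ.≤-refl)) sum≡0))
    where
    open ≡-Reasoning
    sum≢0 : ιₙ ℓ * v ^ m′ ≢ 0#
    sum≢0 h with ι*≡0 (+ ℓ) (v ^ m′) h
    ... | inj₂ h′ = ^-≢0 m′ v≢0 1≢0 h′
    total : ∀ n → suc n ≤ ℓ → ∑ ℓ (λ j → geom (suc n) (ζ ^ j * u) v) ≡ ιₙ ℓ * v ^ n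
    total zero _ = trans (∑-cong ℓ (λ j _ → trans (cong (λ z → 1# + z) (zeroʳ v)) (+-identityʳ 1#))) (∑-const ℓ 1#)
    total (suc n) n<ℓ = begin
      ∑ ℓ (λ j → (ζ ^ j * u) ^ suc n + v * geom (suc n) (ζ ^ j * u) v)
        ≡⟨ ∑-+ ℓ _ _ ⟩
      ∑ ℓ (λ j → (ζ ^ j * u) ^ suc n) + ∑ ℓ (λ j → v * geom (suc n) (ζ ^ j * u) v)
        ≡⟨ cong₂ _+_ vanish (trans (∑-cong ℓ (λ j _ → *-comm v _)) (sym (∑-*ʳ ℓ _ v))) ⟩
      0# + ∑ ℓ (λ j → geom (suc n) (ζ ^ j * u) v) * v
        ≡⟨ trans (+-identityˡ _) (cong (_* v) (total n (ℕ.<⇒≤ n<ℓ))) ⟩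
      ιₙ ℓ * v ^ n * v
        ≡⟨ trans (*-assoc _ _ _) (cong (ιₙ ℓ *_) (*-comm _ v)) ⟩
      ιₙ ℓ * v ^ suc n ∎
      where
      vanish : ∑ ℓ (λ j → (ζ ^ j * u) ^ suc n) ≡ 0#
      vanish = begin
        ∑ ℓ (λ j → (ζ ^ j * u) ^ suc n)             ≡⟨ ∑-cong ℓ (λ j _ → trans (^-distrib-* (ζ ^ j) u (suc n)) (cong (_* u ^ suc n) (^-assocʳ ζ j (suc n)))) ⟩
        ∑ ℓ (λ j → ζ ^ (j ℕ.* suc n) * u ^ suc n)   ≡⟨ sym (∑-*ʳ ℓ _ (u ^ suc n)) ⟩
        ∑ ℓ (λ j → ζ ^ (j ℕ.* suc n)) * u ^ suc n   ≡⟨ cong (_* u ^ suc n) (∑ζ≡0 (suc n) (s≤s z≤n) n<ℓ) ⟩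
        0# * u ^ suc n                              ≡⟨ zeroˡ _ ⟩
        0#                                          ∎
    annihilate : ∀ j → (ζ ^ j * u + - v) * geom ℓ (ζ ^ j * u) v ≡ 0#
    annihilate j = trans (geom-telescope ℓ (ζ ^ j * u) v) (trans (cong (_+ - (v ^ ℓ)) power) (-‿inverseʳ _))
      where
      power : (ζ ^ j * u) ^ ℓ ≡ v ^ ℓ
      power = trans (^-distrib-* (ζ ^ j) u ℓ) (trans (cong₂ _*_ (trans (^-assocʳ ζ j ℓ) (ζ^[nℓ]≡1 j)) e) (*-identityˡ _))
    search : ∀ n → ¬ (∑ n (λ j → geom ℓ (ζ ^ j * u) v) ≡ 0#) → ∃ λ j → ζ ^ j * u ≡ v
    search zero h = ⊥-elim (h refl)
    search (suc n) h = [ (λ p → n , x-y≡0⇒x≡y p) , (λ p → search n (λ q → h (trans (cong₂ _+_ q p) (+-identityˡ 0#)))) ]′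
      (domain (ζ ^ n * u + - v) (geom ℓ (ζ ^ n * u) v) (annihilate n))

  lookup-ext : ∀ {n} {u v : Vec Carrier n} → (∀ j → lookup u j ≡ lookup v j) → u ≡ v
  lookup-ext {u = []} {[]} e = refl
  lookup-ext {u = x ∷ u} {y ∷ v} e = cong₂ _∷_ (e Fin.zero) (lookup-ext (λ j → e (Fin.suc j)))

  -- twist g is the substitution y ↦ g y.
  twist : ∀ {n} → Carrier → Vec Carrier n → Vec Carrier n
  twist g [] = []
  twist g (v ∷ vs) = v ∷ g ∙ twist g vs

  lookup-twist : ∀ {n} g (v : Vec Carrier n) j → lookup (twist g v) j ≡ g ^ toℕ j * lookup v j
  lookup-twist g (v ∷ vs) Fin.zero = sym (*-identityˡ v)
  lookup-twist g (v ∷ vs) (Fin.suc j) = trans (lookup-map j (g *_) (twist g vs)) (trans (cong (g *_) (lookup-twist g vs j)) (sym (*-assoc g _ _)))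

  twist-⊕ : ∀ {n} g (u v : Vec Carrier n) → twist g (u ⊕ v) ≡ twist g u ⊕ twist g v
  twist-⊕ g [] [] = refl
  twist-⊕ g (x ∷ u) (y ∷ v) = cong (x + y ∷_) (trans (cong (g ∙_) (twist-⊕ g u v)) (∙-⊕ g _ _))

  twist-∙ : ∀ {n} g r (v : Vec Carrier n) → twist g (r ∙ v) ≡ r ∙ twist g v
  twist-∙ g r [] = refl
  twist-∙ g r (x ∷ v) = cong (r * x ∷_) (trans (cong (g ∙_) (twist-∙ g r v)) (∙-comm g r _))

  twist-𝟎 : ∀ {n} g → twist g (𝟎 {n}) ≡ 𝟎
  twist-𝟎 {zero} g = refl
  twist-𝟎 {suc n} g = cong (0# ∷_) (trans (cong (g ∙_) (twist-𝟎 g)) (∙-𝟎 g))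

  twist-const : ∀ g r → twist g (const r) ≡ const r
  twist-const g r = cong (r ∷_) (trans (cong (g ∙_) (twist-𝟎 g)) (∙-𝟎 g))

  twist-twist : ∀ {n} g h (v : Vec Carrier n) → twist g (twist h v) ≡ twist (g * h) v
  twist-twist g h [] = refl
  twist-twist g h (x ∷ v) = cong (x ∷_) (trans (cong (g ∙_) (trans (twist-∙ g h _) (cong (h ∙_) (twist-twist g h v)))) (sym (*-∙ g h _)))

  twist-1 : ∀ {n} (v : Vec Carrier n) → twist 1# v ≡ v
  twist-1 [] = refl
  twist-1 (x ∷ v) = cong (x ∷_) (trans (1∙ _) (twist-1 v))

  twist-shift : ∀ {n} g x (v : Vec Carrier n) → twist g (shift x v) ≡ shift x (g ∙ twist g v)
  twist-shift g x [] = refl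
  twist-shift g x (v ∷ vs) = cong (x ∷_) (trans (cong (g ∙_) (twist-shift g v vs)) (sym (shift-∙ g v _)))

  twist-carry : ∀ {n} g x (v : Vec Carrier n) → carry x (g ∙ twist g v) ≡ g ^ n * carry x v
  twist-carry g x [] = sym (*-identityˡ x)
  twist-carry g x (v ∷ vs) = trans (carry-∙ g v (g ∙ twist g vs)) (trans (cong (g *_) (twist-carry g v vs)) (sym (*-assoc g _ _)))

  y·-∷ : ∀ v vs → y· (v ∷ vs) ≡ carry v vs * b ∷ shift v vs
  y·-∷ v vs = cong₂ _∷_ (+-identityˡ _) (trans (cong (shift v vs ⊕_) (∙-𝟎 (carry v vs))) (⊕-identityʳ _))

  -- The assumption on `g` is what the wrap-around needs: a coefficient of y ^ (ℓ - 1) carries g ^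
  -- (ℓ - 1), and one more factor `g` has to turn this into 1 when y ^ ℓ becomes b.
  twist-y· : ∀ g → g ^ ℓ ≡ 1# → ∀ v → twist g (y· v) ≡ g ∙ y· (twist g v)
  twist-y· g g^ℓ≡1 (v ∷ vs) = begin
    twist g (y· (v ∷ vs))                                              ≡⟨ cong (twist g) (y·-∷ v vs) ⟩
    carry v vs * b ∷ g ∙ twist g (shift v vs)                          ≡⟨ cong₂ _∷_ coordinate (cong (g ∙_) (twist-shift g v vs)) ⟩
    g * (carry v (g ∙ twist g vs) * b) ∷ g ∙ shift v (g ∙ twist g vs)  ≡⟨ cong (g ∙_) (sym (y·-∷ v _)) ⟩
    g ∙ y· (v ∷ g ∙ twist g vs)                                        ∎
    where
    open ≡-Reasoning
    coordinate : carry v vs * b ≡ g * (carry v (g ∙ twist g vs) * b)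
    coordinate = begin
      carry v vs * b                     ≡⟨ sym (*-identityˡ _) ⟩
      1# * (carry v vs * b)              ≡⟨ cong (_* (carry v vs * b)) (sym g^ℓ≡1) ⟩
      g * g ^ m′ * (carry v vs * b)      ≡⟨ solve 4 (λ g h c b → g :* h :* (c :* b) := g :* (h :* c :* b)) refl g (g ^ m′) (carry v vs) b ⟩
      g * (g ^ m′ * carry v vs * b)      ≡⟨ cong (λ z → g * (z * b)) (sym (twist-carry g v vs)) ⟩
      g * (carry v (g ∙ twist g vs) * b) ∎
      where open Solver using (solve; _:*_; _:=_)

  horner-∙ˡ : ∀ {n} r (as : Vec Carrier n) v → horner (r ∙ as) v ≡ r ∙ horner as v
  horner-∙ˡ r [] v = sym (∙-𝟎 r)
  horner-∙ˡ r (a ∷ as) v = trans (cong₂ _⊕_ (*-∙ r a v) (trans (cong y· (horner-∙ˡ r as v)) (y·-∙ r _))) (sym (∙-⊕ r _ _))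

  twist-⊗ : ∀ g → g ^ ℓ ≡ 1# → ∀ {n} (as : Vec Carrier n) v → twist g (horner as v) ≡ horner (twist g as) (twist g v)
  twist-⊗ g g^ℓ≡1 [] v = twist-𝟎 g
  twist-⊗ g g^ℓ≡1 (a ∷ as) v = trans (twist-⊕ g _ _) (cong₂ _⊕_ (twist-∙ g a v) (begin
    twist g (y· (horner as v))                   ≡⟨ twist-y· g g^ℓ≡1 _ ⟩
    g ∙ y· (twist g (horner as v))               ≡⟨ cong (λ z → g ∙ y· z) (twist-⊗ g g^ℓ≡1 as v) ⟩
    g ∙ y· (horner (twist g as) (twist g v))     ≡⟨ sym (y·-∙ g _) ⟩
    y· (g ∙ horner (twist g as) (twist g v))     ≡⟨ cong y· (sym (horner-∙ˡ g (twist g as) (twist g v))) ⟩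
    y· (horner (g ∙ twist g as) (twist g v))     ∎))
    where open ≡-Reasoning

  σ : ℕ → V → V
  σ k = twist (ζ ^ k)

  σ-⊗ : ∀ k u v → σ k (u ⊗ v) ≡ σ k u ⊗ σ k v
  σ-⊗ k u v = twist-⊗ (ζ ^ k) (trans (^-assocʳ ζ k ℓ) (ζ^[nℓ]≡1 k)) u v

  σ-σ : ∀ j k v → σ j (σ k v) ≡ σ (j ℕ.+ k) v
  σ-σ j k v = trans (twist-twist _ _ v) (cong (λ z → twist z v) (sym (^-homo-* ζ j k)))

  σ-% : ∀ k v → σ k v ≡ σ (k % ℓ) v
  σ-% k v = cong (λ z → twist z v) (ζ^-% k)

  σ-0 : ∀ v → σ 0 v ≡ v
  σ-0 = twist-1

  σ-ℓ : ∀ v → σ ℓ v ≡ v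
  σ-ℓ v = trans (cong (λ z → twist z v) ζ^ℓ≡1) (twist-1 v)

  σ-∣ : ∀ k {u v} → u S.∣ v → σ k u S.∣ σ k v
  σ-∣ k {u} (w , refl) = σ k w , σ-⊗ k u w

  -- The relative norm: the factors are the conjugates under y ↦ ζ ^ i y.
  ν : V → V
  ν v = S.∏ ℓ (λ i → σ i v)

  -- `σ 1` multiplies the coordinate of y ^ j by ζ ^ j, which differs from 1 for 0 < j < ℓ; in a
  -- domain such a coordinate can only be fixed if it is zero.
  fixed⇒const : ∀ v → σ 1 v ≡ v → v ≡ const (head v)
  fixed⇒const v@(x ∷ vs) e = cong (x ∷_) (lookup-ext (λ j → trans (zeros j) (sym (lookup-replicate j 0#))))
    where
    open Solver using (solve; _:*_; _:-_; _:=_; con)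
    zeros : ∀ j → lookup vs j ≡ 0#
    zeros j with domain (ζ ^ toℕ (Fin.suc j) + - 1#) (lookup vs j) (begin
      (ζ ^ suc (toℕ j) + - 1#) * lookup vs j           ≡⟨ solve 2 (λ z w → (z :- con (+ 1)) :* w := z :* w :- w) refl (ζ ^ suc (toℕ j)) (lookup vs j) ⟩
      ζ ^ suc (toℕ j) * lookup vs j + - lookup vs j    ≡⟨ cong (λ z → z ^ suc (toℕ j) * lookup vs j + - lookup vs j) (sym (*-identityʳ ζ)) ⟩
      (ζ ^ 1) ^ suc (toℕ j) * lookup vs j + - lookup vs j  ≡⟨ cong (_+ - lookup vs j) (sym (lookup-twist (ζ ^ 1) v (Fin.suc j))) ⟩
      lookup (σ 1 v) (Fin.suc j) + - lookup vs j       ≡⟨ cong (λ w → lookup w (Fin.suc j) + - lookup vs j) e ⟩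
      lookup vs j + - lookup vs j                      ≡⟨ -‿inverseʳ _ ⟩
      0#                                               ∎)
      where open ≡-Reasoning
    ... | inj₁ p = ⊥-elim (ζ^≢1 (suc (toℕ j)) (s≤s z≤n) (s≤s (toℕ<n j)) (x-y≡0⇒x≡y p))
    ... | inj₂ p = p

  -- `σ 1` permutes the factors cyclically, since `σ ℓ` is the identity.
  ν≡const : ∀ v → ν v ≡ const (head (ν v))
  ν≡const v = fixed⇒const (ν v) (begin
    σ 1 (S.∏ ℓ (λ i → σ i v))          ≡⟨ σ-∏ ℓ _ ⟩
    S.∏ ℓ (λ i → σ 1 (σ i v))          ≡⟨ S.∏-cong ℓ (λ i _ → σ-σ 1 i v) ⟩
    S.∏ m′ (λ i → σ (suc i) v) ⊗ σ ℓ v ≡⟨ cong (S.∏ m′ (λ i → σ (suc i) v) ⊗_) (trans (σ-ℓ v) (sym (σ-0 v))) ⟩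
    S.∏ m′ (λ i → σ (suc i) v) ⊗ σ 0 v ≡⟨ ⊗-comm (S.∏ m′ (λ i → σ (suc i) v)) (σ 0 v) ⟩
    σ 0 v ⊗ S.∏ m′ (λ i → σ (suc i) v) ≡⟨ sym (S.∏-shift m′ (λ i → σ i v)) ⟩
    ν v                                ∎)
    where
    open ≡-Reasoning
    σ-∏ : ∀ n f → σ 1 (S.∏ n f) ≡ S.∏ n (λ i → σ 1 (f i))
    σ-∏ zero f = twist-const _ 1#
    σ-∏ (suc n) f = trans (σ-⊗ 1 (S.∏ n f) (f n)) (cong (_⊗ σ 1 (f n)) (σ-∏ n f))

  ∣ν : ∀ v → v S.∣ ν v
  ∣ν v = S.∏ m′ (λ i → σ (suc i) v) , trans (S.∏-shift m′ (λ i → σ i v)) (cong (_⊗ S.∏ m′ (λ i → σ (suc i) v)) (σ-0 v))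

  -- This is the relative trace: in the coordinate of y ^ j the factors ζ ^ (i j) add up to zero
  -- unless j = 0.
  ∑-σ : ∀ v → S.∑ ℓ (λ i → σ i v) ≡ const (ιₙ ℓ * head v)
  ∑-σ v@(x ∷ vs) = lookup-ext coordinates
    where
    lookup-∑ : ∀ n (f : ℕ → V) j → lookup (S.∑ n f) j ≡ ∑ n (λ i → lookup (f i) j)
    lookup-∑ zero f j = lookup-replicate j 0#
    lookup-∑ (suc n) f j = trans (lookup-zipWith _+_ j (S.∑ n f) (f n)) (cong (_+ lookup (f n) j) (lookup-∑ n f j))
    coordinates : ∀ j → lookup (S.∑ ℓ (λ i → σ i v)) j ≡ lookup (const (ιₙ ℓ * x)) j
    coordinates Fin.zero = trans (lookup-∑ ℓ (λ i → σ i v) Fin.zero) (∑-const ℓ x)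
    coordinates (Fin.suc j) = begin
      lookup (S.∑ ℓ (λ i → σ i v)) (Fin.suc j)         ≡⟨ lookup-∑ ℓ (λ i → σ i v) (Fin.suc j) ⟩
      ∑ ℓ (λ i → lookup (σ i v) (Fin.suc j))           ≡⟨ ∑-cong ℓ (λ i _ → trans (lookup-twist (ζ ^ i) v (Fin.suc j)) (cong (_* lookup vs j) (^-assocʳ ζ i (suc (toℕ j))))) ⟩
      ∑ ℓ (λ i → ζ ^ (i ℕ.* suc (toℕ j)) * lookup vs j)  ≡⟨ sym (∑-*ʳ ℓ _ (lookup vs j)) ⟩
      ∑ ℓ (λ i → ζ ^ (i ℕ.* suc (toℕ j))) * lookup vs j  ≡⟨ cong (_* lookup vs j) (∑ζ≡0 (suc (toℕ j)) (s≤s z≤n) (s≤s (toℕ<n j))) ⟩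
      0# * lookup vs j                                 ≡⟨ zeroˡ _ ⟩
      0#                                               ≡⟨ sym (lookup-replicate j 0#) ⟩
      lookup (const (ιₙ ℓ * x)) (Fin.suc j)            ∎
      where open ≡-Reasoning

  ∙≡𝟎 : ∀ {n} r (v : Vec Carrier n) → r ≢ 0# → r ∙ v ≡ 𝟎 → v ≡ 𝟎
  ∙≡𝟎 r [] r≢0 e = refl
  ∙≡𝟎 r (x ∷ v) r≢0 e with domain r x (cong Vec.head e)
  ... | inj₁ r≡0 = ⊥-elim (r≢0 r≡0)
  ... | inj₂ x≡0 = cong₂ _∷_ x≡0 (∙≡𝟎 r v r≢0 (cong Vec.tail e))

  -- Adjoining an ℓ-th root of a non-power to a domain gives a domain

  module _ (no-root : ∀ u t → u ^ ℓ ≡ t ^ ℓ * b → t ≡ 0#) where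

    b≢0 : b ≢ 0#
    b≢0 refl = 1≢0 (no-root 0# 1# (trans (0^suc m′) (sym (zeroʳ _))))

    private
      -- A greedy product of conjugates of β. It is supported on a minimal intersection of
      -- translates of the support of β, hence orthogonal to its own conjugates.
      ε : V → ℕ → V
      ε β zero = β
      ε β (suc k) with (ε β k ⊗ σ (suc k) β) S.≟ 𝟎
      ... | yes _ = ε β k
      ... | no _ = ε β k ⊗ σ (suc k) β

      ε≢𝟎 : ∀ β → β ≢ 𝟎 → ∀ k → ε β k ≢ 𝟎
      ε≢𝟎 β β≢𝟎 zero = β≢𝟎
      ε≢𝟎 β β≢𝟎 (suc k) with (ε β k ⊗ σ (suc k) β) S.≟ 𝟎
      ... | yes _ = ε≢𝟎 β β≢𝟎 k
      ... | no ≢𝟎 = ≢𝟎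

      ⊗-𝟎-factor : ∀ u v w → u ⊗ w ≡ 𝟎 → (u ⊗ v) ⊗ w ≡ 𝟎
      ⊗-𝟎-factor u v w e = trans (⊗-assoc u v w) (trans (cong (u ⊗_) (⊗-comm v w)) (trans (sym (⊗-assoc u w v)) (trans (cong (_⊗ v) e) (S.zeroˡ v))))

      -- A conjugate that was multiplied in divides the product; one that was skipped annihilated
      -- the product at that stage and still does after further multiplications.
      ε-dichotomy : ∀ β k i → i ≤ k → (σ i β S.∣ ε β k) ⊎ (ε β k ⊗ σ i β ≡ 𝟎)
      ε-dichotomy β zero zero _ = inj₁ (subst (S._∣ β) (sym (σ-0 β)) (S.∣-refl β))
      ε-dichotomy β (suc k) i i≤k with (ε β k ⊗ σ (suc k) β) S.≟ 𝟎 | ℕ.m≤n⇒m<n∨m≡n i≤k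
      ... | yes ≡𝟎 | inj₂ refl = inj₂ ≡𝟎
      ... | yes ≡𝟎 | inj₁ (s≤s i≤k′) = ε-dichotomy β k i i≤k′
      ... | no _ | inj₂ refl = inj₁ (ε β k , ⊗-comm (ε β k) (σ (suc k) β))
      ... | no _ | inj₁ (s≤s i≤k′) with ε-dichotomy β k i i≤k′
      ...   | inj₁ p = inj₁ (S.∣-*ʳ {σ i β} {ε β k} (σ (suc k) β) p)
      ...   | inj₂ p = inj₂ (⊗-𝟎-factor (ε β k) (σ (suc k) β) (σ i β) p)

      -- If no conjugate was skipped, the product is the full partial norm; for k = ℓ - 1 this is
      -- `ν β`.
      ε-total : ∀ β k → ε β k ≡ S.∏ (suc k) (λ i → σ i β) ⊎ ∃ λ i → ε β k ⊗ σ i β ≡ 𝟎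
      ε-total β zero = inj₁ (sym (trans (⊗-identityˡ _) (σ-0 β)))
      ε-total β (suc k) with (ε β k ⊗ σ (suc k) β) S.≟ 𝟎
      ... | yes ≡𝟎 = inj₂ (suc k , ≡𝟎)
      ... | no _ with ε-total β k
      ...   | inj₁ p = inj₁ (cong (_⊗ σ (suc k) β) p)
      ...   | inj₂ (i , p) = inj₂ (i , ⊗-𝟎-factor (ε β k) (σ (suc k) β) (σ i β) p)

      module ZeroDivisor (β : V) (β≢𝟎 : β ≢ 𝟎) (ν≡𝟎 : ν β ≡ 𝟎) where

        e : V
        e = ε β m′

        e≢𝟎 : e ≢ 𝟎
        e≢𝟎 = ε≢𝟎 β β≢𝟎 m′

        missing : ∃ λ i → e ⊗ σ i β ≡ 𝟎
        missing with ε-total β m′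
        ... | inj₁ p = ⊥-elim (e≢𝟎 (trans p ν≡𝟎))
        ... | inj₂ p = p

        dichotomy : ∀ i → (σ i β S.∣ e) ⊎ (e ⊗ σ i β ≡ 𝟎)
        dichotomy i with ε-dichotomy β m′ (i % ℓ) (ℕ.≤-pred (m%n<n i ℓ))
        ... | inj₁ p = inj₁ (subst (S._∣ e) (sym (σ-% i β)) p)
        ... | inj₂ p = inj₂ (trans (cong (e ⊗_) (σ-% i β)) p)

        -- Suppose that e σₖ(e) is nonzero. If σ (t k) β divides e, then σ ((t + 1) k) β divides
        -- σₖ(e), so it cannot annihilate e and by `dichotomy` divides e as well. As ℓ is prime, the
        -- multiples of k reach every conjugate, also the missing one, which does annihilate e.
        orthogonal : ∀ k → 0 < k → k < ℓ → e ⊗ σ k e ≡ 𝟎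
        orthogonal k 0<k k<ℓ with (e ⊗ σ k e) S.≟ 𝟎
        ... | yes p = p
        ... | no ≢𝟎 = ⊥-elim (next≢𝟎 t (trans (cong (e ⊗_) same) (proj₂ missing)))
          where
          divides : ∀ t → σ (t ℕ.* k) β S.∣ e
          next≢𝟎 : ∀ t → e ⊗ σ (suc t ℕ.* k) β ≢ 𝟎
          divides zero with dichotomy 0
          ... | inj₁ p = p
          ... | inj₂ p = subst (S._∣ e) (sym (σ-0 β)) (start m′)
            where
            start : ∀ k → β S.∣ ε β k
            start zero = S.∣-refl β
            start (suc k) with (ε β k ⊗ σ (suc k) β) S.≟ 𝟎
            ... | yes _ = start k
            ... | no _ = S.∣-*ʳ {β} {ε β k} (σ (suc k) β) (start k)
          divides (suc t) with dichotomy (suc t ℕ.* k)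
          ... | inj₁ p = p
          ... | inj₂ p = ⊥-elim (next≢𝟎 t p)
          next≢𝟎 t h with σ-∣ k {σ (t ℕ.* k) β} {e} (divides t)
          ... | w , eq = ≢𝟎 (begin
            e ⊗ σ k e                              ≡⟨ cong (e ⊗_) eq ⟩
            e ⊗ (σ k (σ (t ℕ.* k) β) ⊗ w)          ≡⟨ cong (λ z → e ⊗ (z ⊗ w)) (σ-σ k (t ℕ.* k) β) ⟩
            e ⊗ (σ (suc t ℕ.* k) β ⊗ w)            ≡⟨ sym (⊗-assoc e (σ (suc t ℕ.* k) β) w) ⟩
            (e ⊗ σ (suc t ℕ.* k) β) ⊗ w            ≡⟨ cong (_⊗ w) h ⟩
            𝟎 ⊗ w                                  ≡⟨ S.zeroˡ w ⟩
            𝟎                                      ∎)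
            where open ≡-Reasoning
          coprime-k-ℓ : Coprime k ℓ
          coprime-k-ℓ = Coprimality.sym (prime∤⇒coprime prime-ℓ (λ ℓ∣k → ℕ.<⇒≱ k<ℓ (ℕ∣.∣⇒≤ {{ℕ.>-nonZero 0<k}} ℓ∣k)))
          x = proj₁ (inverse-mod {k} {ℓ} coprime-k-ℓ)
          kx≡1 = proj₂ (inverse-mod {k} {ℓ} coprime-k-ℓ)
          i = proj₁ missing
          -- t + 1 is a positive multiple of the inverse of k times i
          t = m′ ℕ.+ x ℕ.* i
          exponent : (suc t ℕ.* k) % ℓ ≡ i % ℓ
          exponent = begin
            (suc t ℕ.* k) % ℓ                       ≡⟨ cong (_% ℓ) (trans (ℕ.*-distribʳ-+ k ℓ (x ℕ.* i)) (trans (ℕ.+-comm (ℓ ℕ.* k) _) (cong (λ z → x ℕ.* i ℕ.* k ℕ.+ z) (ℕ.*-comm ℓ k)))) ⟩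
            (x ℕ.* i ℕ.* k ℕ.+ k ℕ.* ℓ) % ℓ          ≡⟨ [m+kn]%n≡m%n (x ℕ.* i ℕ.* k) k ℓ ⟩
            (x ℕ.* i ℕ.* k) % ℓ                     ≡⟨ cong (_% ℓ) (trans (ℕ.*-comm (x ℕ.* i) k) (sym (ℕ.*-assoc k x i))) ⟩
            (k ℕ.* x ℕ.* i) % ℓ                     ≡⟨ %-distribˡ-* (k ℕ.* x) i ℓ ⟩
            ((k ℕ.* x) % ℓ ℕ.* (i % ℓ)) % ℓ          ≡⟨ cong (λ z → (z ℕ.* (i % ℓ)) % ℓ) kx≡1 ⟩
            (1 % ℓ ℕ.* (i % ℓ)) % ℓ                  ≡⟨ sym (%-distribˡ-* 1 i ℓ) ⟩
            (1 ℕ.* i) % ℓ                           ≡⟨ cong (_% ℓ) (ℕ.*-identityˡ i) ⟩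
            i % ℓ                                   ∎
            where open ≡-Reasoning
          same : σ (suc t ℕ.* k) β ≡ σ i β
          same = trans (σ-% (suc t ℕ.* k) β) (trans (cong (λ z → σ z β) exponent) (sym (σ-% i β)))

        -- By orthogonality only the summand i = 0 of the trace of w e survives multiplication by e.
        -- Thus e behaves like a scaled idempotent that cuts out a component of rank one over R.
        trace : ∀ w → e ⊗ (w ⊗ e) ≡ (ιₙ ℓ * head (w ⊗ e)) ∙ e
        trace w = sym (begin
          (ιₙ ℓ * head (w ⊗ e)) ∙ e                      ≡⟨ sym (const-⊗ (ιₙ ℓ * head (w ⊗ e)) e) ⟩
          const (ιₙ ℓ * head (w ⊗ e)) ⊗ e                ≡⟨ cong (_⊗ e) (sym (∑-σ (w ⊗ e))) ⟩
          S.∑ ℓ (λ i → σ i (w ⊗ e)) ⊗ e                  ≡⟨ S.∑-*ʳ ℓ (λ i → σ i (w ⊗ e)) e ⟩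
          S.∑ ℓ (λ i → σ i (w ⊗ e) ⊗ e)                  ≡⟨ S.∑-shift m′ (λ i → σ i (w ⊗ e) ⊗ e) ⟩
          σ 0 (w ⊗ e) ⊗ e ⊕ S.∑ m′ (λ i → σ (suc i) (w ⊗ e) ⊗ e)  ≡⟨ cong₂ _⊕_ (trans (cong (_⊗ e) (σ-0 (w ⊗ e))) (⊗-comm (w ⊗ e) e)) (S.∑-zero m′ vanish) ⟩
          e ⊗ (w ⊗ e) ⊕ 𝟎                                ≡⟨ ⊕-identityʳ (e ⊗ (w ⊗ e)) ⟩
          e ⊗ (w ⊗ e)                                    ∎)
          where
          open ≡-Reasoning
          vanish : ∀ i → i < m′ → σ (suc i) (w ⊗ e) ⊗ e ≡ 𝟎
          vanish i i<m′ = begin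
            σ (suc i) (w ⊗ e) ⊗ e              ≡⟨ cong (_⊗ e) (σ-⊗ (suc i) w e) ⟩
            (σ (suc i) w ⊗ σ (suc i) e) ⊗ e    ≡⟨ ⊗-assoc (σ (suc i) w) (σ (suc i) e) e ⟩
            σ (suc i) w ⊗ (σ (suc i) e ⊗ e)    ≡⟨ cong (σ (suc i) w ⊗_) (trans (⊗-comm (σ (suc i) e) e) (orthogonal (suc i) (s≤s z≤n) (s≤s i<m′))) ⟩
            σ (suc i) w ⊗ 𝟎                    ≡⟨ S.zeroʳ (σ (suc i) w) ⟩
            𝟎                                  ∎

        t u : Carrier
        t = ιₙ ℓ * head (𝟏 ⊗ e)
        u = ιₙ ℓ * head (𝐲 ⊗ e)

        e² : e ⊗ e ≡ t ∙ e
        e² = trans (cong (e ⊗_) (sym (⊗-identityˡ e))) (trace 𝟏)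

        u∙e : u ∙ e ≡ t ∙ (𝐲 ⊗ e)
        u∙e = begin
          u ∙ e            ≡⟨ sym (trace 𝐲) ⟩
          e ⊗ (𝐲 ⊗ e)      ≡⟨ trans (sym (⊗-assoc e 𝐲 e)) (trans (cong (_⊗ e) (⊗-comm e 𝐲)) (⊗-assoc 𝐲 e e)) ⟩
          𝐲 ⊗ (e ⊗ e)      ≡⟨ cong (𝐲 ⊗_) e² ⟩
          𝐲 ⊗ (t ∙ e)      ≡⟨ horner-∙ 𝐲 t e ⟩
          t ∙ (𝐲 ⊗ e)      ∎
          where open ≡-Reasoning

        u^∙e : ∀ k → u ^ k ∙ e ≡ t ^ k ∙ (𝐲 S.^ k ⊗ e)
        u^∙e zero = cong (1# ∙_) (sym (⊗-identityˡ e))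
        u^∙e (suc k) = begin
          (u * u ^ k) ∙ e                        ≡⟨ *-∙ u (u ^ k) e ⟩
          u ∙ u ^ k ∙ e                          ≡⟨ cong (u ∙_) (u^∙e k) ⟩
          u ∙ t ^ k ∙ (𝐲 S.^ k ⊗ e)              ≡⟨ ∙-comm u (t ^ k) (𝐲 S.^ k ⊗ e) ⟩
          t ^ k ∙ u ∙ (𝐲 S.^ k ⊗ e)              ≡⟨ cong (t ^ k ∙_) (sym (horner-∙ (𝐲 S.^ k) u e)) ⟩
          t ^ k ∙ (𝐲 S.^ k ⊗ (u ∙ e))            ≡⟨ cong (λ z → t ^ k ∙ (𝐲 S.^ k ⊗ z)) u∙e ⟩
          t ^ k ∙ (𝐲 S.^ k ⊗ (t ∙ (𝐲 ⊗ e)))      ≡⟨ cong (t ^ k ∙_) (horner-∙ (𝐲 S.^ k) t (𝐲 ⊗ e)) ⟩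
          t ^ k ∙ t ∙ (𝐲 S.^ k ⊗ (𝐲 ⊗ e))        ≡⟨ trans (∙-comm (t ^ k) t (𝐲 S.^ k ⊗ (𝐲 ⊗ e))) (sym (*-∙ t (t ^ k) (𝐲 S.^ k ⊗ (𝐲 ⊗ e)))) ⟩
          (t * t ^ k) ∙ (𝐲 S.^ k ⊗ (𝐲 ⊗ e))      ≡⟨ cong (t ^ suc k ∙_) (trans (sym (⊗-assoc (𝐲 S.^ k) 𝐲 e)) (cong (_⊗ e) (⊗-comm (𝐲 S.^ k) 𝐲))) ⟩
          t ^ suc k ∙ (𝐲 S.^ suc k ⊗ e)          ∎
          where open ≡-Reasoning

        -- On the component of e the generator y acts as u / t, whence (u ^ ℓ - t ^ ℓ b) e = 0.
        -- Since e is nonzero, u / t would be an ℓ-th root of b if t were nonzero.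
        t≡0 : t ≡ 0#
        t≡0 with (u ^ ℓ + - (t ^ ℓ * b)) ≟ 0#
        ... | yes p = no-root u t (x-y≡0⇒x≡y p)
        ... | no ≢0 = ⊥-elim (e≢𝟎 (∙≡𝟎 _ e ≢0 (begin
          (u ^ ℓ + - (t ^ ℓ * b)) ∙ e                ≡⟨ +-∙ _ _ e ⟩
          u ^ ℓ ∙ e ⊕ (- (t ^ ℓ * b)) ∙ e            ≡⟨ cong (_⊕ (- (t ^ ℓ * b)) ∙ e) (begin
            u ^ ℓ ∙ e                          ≡⟨ u^∙e ℓ ⟩
            t ^ ℓ ∙ (𝐲 S.^ ℓ ⊗ e)              ≡⟨ cong (λ z → t ^ ℓ ∙ (z ⊗ e)) 𝐲^m≡f ⟩
            t ^ ℓ ∙ (const b ⊗ e)              ≡⟨ cong (t ^ ℓ ∙_) (const-⊗ b e) ⟩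
            t ^ ℓ ∙ b ∙ e                      ≡⟨ sym (*-∙ _ b e) ⟩
            (t ^ ℓ * b) ∙ e                    ∎) ⟩
          (t ^ ℓ * b) ∙ e ⊕ (- (t ^ ℓ * b)) ∙ e      ≡⟨ sym (+-∙ _ _ e) ⟩
          (t ^ ℓ * b + - (t ^ ℓ * b)) ∙ e            ≡⟨ cong (_∙ e) (-‿inverseʳ _) ⟩
          0# ∙ e                                     ≡⟨ 0∙ e ⟩
          𝟎                                          ∎)))
          where open ≡-Reasoning

        -- With t = 0 the element e squares to zero, so `trace w` shows that the trace of w e
        -- annihilates e; that trace is ℓ times the head.
        head≡0 : ∀ w → head (w ⊗ e) ≡ 0#
        head≡0 w with ι*≡0 (+ ℓ) (head (w ⊗ e)) ιℓ*head≡0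
          where
          open ≡-Reasoning
          w-e² : e ⊗ (w ⊗ e) ≡ 𝟎
          w-e² = begin
            e ⊗ (w ⊗ e)    ≡⟨ trans (sym (⊗-assoc e w e)) (trans (cong (_⊗ e) (⊗-comm e w)) (⊗-assoc w e e)) ⟩
            w ⊗ (e ⊗ e)    ≡⟨ cong (w ⊗_) (trans e² (trans (cong (_∙ e) t≡0) (0∙ e))) ⟩
            w ⊗ 𝟎          ≡⟨ S.zeroʳ w ⟩
            𝟎              ∎
          ιℓ*head≡0 : ιₙ ℓ * head (w ⊗ e) ≡ 0#
          ιℓ*head≡0 with (ιₙ ℓ * head (w ⊗ e)) ≟ 0#
          ... | yes p = p
          ... | no ≢0 = ⊥-elim (e≢𝟎 (∙≡𝟎 _ e ≢0 (trans (sym (trace w)) w-e²)))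
        ... | inj₂ p = p

        -- As y · y ^ (ℓ - 1) = b is nonzero, coordinate j + 1 of w e is up to the factor b
        -- coordinate j of (y ^ (ℓ - 1) w) e, and coordinate 0 always vanishes. The index `j` only
        -- drives the recursion, because `inject₁ j′` is not structurally smaller than `Fin.suc j′`.
        coordinate≡0 : ∀ {n} (j : Fin n) (w : V) → (j′ : Fin ℓ) → toℕ j′ ≡ toℕ j → lookup (w ⊗ e) j′ ≡ 0#
        coordinate≡0 j w Fin.zero _ = trans (head-lookup (w ⊗ e)) (head≡0 w)
          where
          head-lookup : ∀ (v : V) → lookup v Fin.zero ≡ head v
          head-lookup (x ∷ v) = refl
        coordinate≡0 (Fin.suc j) w (Fin.suc j′) j≡ with domain b (lookup (w ⊗ e) (Fin.suc j′)) (begin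
          b * lookup (w ⊗ e) (Fin.suc j′)                ≡⟨ sym (lookup-map (Fin.suc j′) (b *_) (w ⊗ e)) ⟩
          lookup (b ∙ (w ⊗ e)) (Fin.suc j′)              ≡⟨ cong (λ v → lookup v (Fin.suc j′)) (sym (const-⊗ b (w ⊗ e))) ⟩
          lookup (const b ⊗ (w ⊗ e)) (Fin.suc j′)        ≡⟨ cong (λ v → lookup v (Fin.suc j′)) (trans (cong (_⊗ (w ⊗ e)) (sym 𝐲^m≡f)) (trans (⊗-assoc 𝐲 (𝐲 S.^ m′) (w ⊗ e)) (𝐲⊗ (𝐲 S.^ m′ ⊗ (w ⊗ e))))) ⟩
          lookup (y· (𝐲 S.^ m′ ⊗ (w ⊗ e))) (Fin.suc j′)  ≡⟨ lookup-y· (𝐲 S.^ m′ ⊗ (w ⊗ e)) j′ ⟩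
          lookup (𝐲 S.^ m′ ⊗ (w ⊗ e)) (inject₁ j′)       ≡⟨ cong (λ v → lookup v (inject₁ j′)) (sym (⊗-assoc (𝐲 S.^ m′) w e)) ⟩
          lookup ((𝐲 S.^ m′ ⊗ w) ⊗ e) (inject₁ j′)       ≡⟨ coordinate≡0 j (𝐲 S.^ m′ ⊗ w) (inject₁ j′) (trans (toℕ-inject₁ j′) (ℕ.suc-injective j≡)) ⟩
          0#                                             ∎)
          where
          open ≡-Reasoning
          lookup-shift : ∀ {n} x (v : Vec Carrier n) j → lookup (shift x v) j ≡ lookup (x ∷ v) (inject₁ j)
          lookup-shift x (v ∷ vs) Fin.zero = refl
          lookup-shift x (v ∷ vs) (Fin.suc j) = lookup-shift v vs j
          lookup-y· : ∀ v j → lookup (y· v) (Fin.suc j) ≡ lookup v (inject₁ j)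
          lookup-y· (v ∷ vs) j = trans (cong (λ z → lookup z (Fin.suc j)) (y·-∷ v vs)) (lookup-shift v vs j)
        ... | inj₁ b≡0 = ⊥-elim (b≢0 b≡0)
        ... | inj₂ p = p

        absurd : ⊥
        absurd = e≢𝟎 (trans (sym (⊗-identityˡ e)) (lookup-ext (λ j → trans (coordinate≡0 j 𝟏 j refl) (sym (lookup-replicate j 0#)))))

    ν≢𝟎 : ∀ β → β ≢ 𝟎 → ν β ≢ 𝟎
    ν≢𝟎 β β≢𝟎 ν≡𝟎 = ZeroDivisor.absurd β β≢𝟎 ν≡𝟎

    -- Multiplying β γ = 0 by the cofactor of β in its norm leaves a nonzero scalar times γ.
    extension-domain : S.IsDomain
    extension-domain β γ βγ≡𝟎 with β S.≟ 𝟎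
    ... | yes p = inj₁ p
    ... | no β≢𝟎 = inj₂ (∙≡𝟎 r γ (λ r≡0 → ν≢𝟎 β β≢𝟎 (trans (ν≡const β) (cong const r≡0))) (begin
      r ∙ γ          ≡⟨ sym (const-⊗ r γ) ⟩
      const r ⊗ γ    ≡⟨ cong (_⊗ γ) (trans (sym (ν≡const β)) (proj₂ (∣ν β))) ⟩
      (β ⊗ w) ⊗ γ    ≡⟨ ⊗-𝟎-factor β w γ βγ≡𝟎 ⟩
      𝟎              ∎))
      where
      open ≡-Reasoning
      r = head (ν β)
      w = proj₁ (∣ν β)

-- Divisibility in an order

n<m^n : ∀ m n → 1 < m → n < m ℕ.^ n
n<m^n m zero 1<m = s≤s z≤n
n<m^n m (suc n) 1<m = begin-strict
  suc n                  <⟨ s≤s (n<m^n m n 1<m) ⟩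
  1 ℕ.+ m ℕ.^ n          ≤⟨ ℕ.+-monoˡ-≤ (m ℕ.^ n) (ℕ.m^n>0 m {{ℕ.>-nonZero (ℕ.<-trans (s≤s z≤n) 1<m)}} n) ⟩
  m ℕ.^ n ℕ.+ m ℕ.^ n    ≡⟨ cong (λ z → m ℕ.^ n ℕ.+ z) (sym (ℕ.+-identityʳ (m ℕ.^ n))) ⟩
  2 ℕ.* m ℕ.^ n          ≤⟨ ℕ.*-monoˡ-≤ (m ℕ.^ n) 1<m ⟩
  m ℕ.* m ℕ.^ n          ∎
  where open ℕ.≤-Reasoning

^-distribʳ-* : ∀ n a b → (a ℕ.* b) ℕ.^ n ≡ a ℕ.^ n ℕ.* b ℕ.^ n
^-distribʳ-* zero a b = refl
^-distribʳ-* (suc n) a b = trans (cong (a ℕ.* b ℕ.*_) (^-distribʳ-* n a b)) (ℕ.[m*n]*[o*p]≡[m*o]*[n*p] a b (a ℕ.^ n) (b ℕ.^ n))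

prime⇒1< : ∀ {p} → Prime p → 1 < p
prime⇒1< {suc (suc p)} _ = s≤s (s≤s z≤n)
prime⇒1< {suc zero} pp with () ← prime⇒nonTrivial pp

module OrderArithmetic (R : Order) where
  open Order R
  open Characteristic0 R public
  open Congruences ring public
  open Solver using (solve; _:+_; _:-_; _:*_; _:=_; :-_; con)

  ιₙ-^ : ∀ m n → ιₙ (m ℕ.^ n) ≡ ιₙ m ^ n
  ιₙ-^ m zero = ι-1
  ιₙ-^ m (suc n) = trans (ιₙ-* m (m ℕ.^ n)) (cong (ιₙ m *_) (ιₙ-^ m n))

  ‖-‖ : ∀ a → ‖ - a ‖ ≡ ‖ a ‖
  ‖-‖ a = trans (cong ‖_‖ (trans (solve 1 (λ a → :- a := (:- con (+ 1)) :* a) refl a) (cong (_* a) (trans (cong -_ (sym ι-1)) (sym (ι-neg (+ 1)))))))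
    (trans (‖ι*‖ -[1+ 0 ] a) (ℕ.*-identityˡ ‖ a ‖))

  ‖-‖≤ : ∀ a b → ‖ a + - b ‖ ≤ ‖ a ‖ ℕ.+ ‖ b ‖
  ‖-‖≤ a b = ℕ.≤-trans (‖+‖ a (- b)) (ℕ.≤-reflexive (cong (λ z → ‖ a ‖ ℕ.+ z) (‖-‖ b)))

  ιₙ*-cancel : ∀ m .{{_ : NonZero m}} {a b} → ιₙ m * a ≡ ιₙ m * b → a ≡ b
  ιₙ*-cancel m {a} {b} e with ι*≡0 (+ m) (a + - b) (trans (solve 3 (λ m a b → m :* (a :- b) := m :* a :- m :* b) refl (ιₙ m) a b) (trans (cong (_+ - (ιₙ m * b)) e) (-‿inverseʳ _)))
  ... | inj₁ m≡0 = ⊥-elim (ℕ.≢-nonZero⁻¹ m (ℤ.+-injective m≡0))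
  ... | inj₂ p = x-y≡0⇒x≡y p

  small-multiple : ∀ m {a} → ιₙ m ∣ a → ‖ a ‖ < m → a ≡ 0#
  small-multiple m (c , refl) small with ‖ c ‖ in eq
  ... | zero = trans (cong (ιₙ m *_) (‖‖≡0 c eq)) (zeroʳ _)
  ... | suc k = ⊥-elim (ℕ.<⇒≱ small (ℕ.≤-trans (ℕ.m≤m*n m (suc k)) (ℕ.≤-reflexive (sym (trans (‖ι*‖ (+ m) c) (cong (m ℕ.*_) eq))))))

  ∣-dec : ∀ m .{{_ : NonZero m}} a → Dec (ιₙ m ∣ a)
  ∣-dec m a with divMod m a
  ... | q , r , e , r<m , _ with r ≟ 0#
  ...   | yes refl = yes (q , trans e (+-identityʳ _))
  ...   | no r≢0 = no (λ { (c , e′) → r≢0 (small-multiple m (c + - q , (begin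
    r                             ≡⟨ solve 2 (λ r x → r := (x :+ r) :- x) refl r (ιₙ m * q) ⟩
    ιₙ m * q + r + - (ιₙ m * q)   ≡⟨ cong (_+ - (ιₙ m * q)) (trans (sym e) e′) ⟩
    ιₙ m * c + - (ιₙ m * q)       ≡⟨ solve 3 (λ m c q → m :* c :- m :* q := m :* (c :- q)) refl (ιₙ m) c q ⟩
    ιₙ m * (c + - q)              ∎)) r<m) })
    where open ≡-Reasoning

  ∣ι⇒∣ℕ : ∀ m n → ιₙ m ∣ ι n → m ∣ℕ ℤ.∣ n ∣
  ∣ι⇒∣ℕ m n (c , e) = ℕ∣.divides ‖ c ‖ (trans (sym (‖ι‖ n)) (trans (cong ‖_‖ e) (trans (‖ι*‖ (+ m) c) (ℕ.*-comm m ‖ c ‖))))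

  ∣ℕ⇒∣ι : ∀ m n → m ∣ℕ ℤ.∣ n ∣ → ιₙ m ∣ ι n
  ∣ℕ⇒∣ι m (+ n) (ℕ∣.divides k e) = ιₙ-∣ (k , trans e (ℕ.*-comm k m))
  ∣ℕ⇒∣ι m -[1+ n ] (ℕ∣.divides k e) with ιₙ-∣ {m} {suc n} (k , trans e (ℕ.*-comm k m))
  ... | c , e′ = - c , trans (ι-neg (+ suc n)) (trans (cong -_ e′) (solve 2 (λ m c → :- (m :* c) := m :* (:- c)) refl (ιₙ m) c))

  content : ∀ q → 1 < q → ∀ a → a ≢ 0# → ∃₂ λ i a′ → a ≡ ιₙ (q ℕ.^ i) * a′ × ¬ (ιₙ q ∣ a′)
  content q 1<q a a≢0 = go a a≢0 (<-wellFounded ‖ a ‖)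
    where
    instance
      q≢0 : NonZero q
      q≢0 = ℕ.>-nonZero (ℕ.<-trans (s≤s z≤n) 1<q)
    go : ∀ a → a ≢ 0# → Acc _<_ ‖ a ‖ → ∃₂ λ i a′ → a ≡ ιₙ (q ℕ.^ i) * a′ × ¬ (ιₙ q ∣ a′)
    go a a≢0 (acc rec) with ∣-dec q a
    ... | no q∤a = 0 , a , sym (trans (cong (_* a) ι-1) (*-identityˡ a)) , q∤a
    ... | yes (c , refl) with go c (λ { refl → a≢0 (zeroʳ _) }) (rec smaller)
      where
      c≢0 : NonZero ‖ c ‖
      c≢0 = ℕ.≢-nonZero (λ ‖c‖≡0 → a≢0 (trans (cong (ιₙ q *_) (‖‖≡0 c ‖c‖≡0)) (zeroʳ _)))
      smaller : ‖ c ‖ < ‖ ιₙ q * c ‖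
      smaller = ℕ.<-≤-trans (ℕ.<-≤-trans (ℕ.m<m*n ‖ c ‖ q {{c≢0}} 1<q) (ℕ.≤-reflexive (ℕ.*-comm ‖ c ‖ q))) (ℕ.≤-reflexive (sym (‖ι*‖ (+ q) c)))
    ...   | i , a′ , e , q∤a′ = suc i , a′ , trans (cong (ιₙ q *_) e) (trans (sym (*-assoc _ _ a′)) (cong (_* a′) (sym (ιₙ-* q (q ℕ.^ i))))) , q∤a′

  exponents-unique : ∀ q .{{_ : NonZero q}} m n {a b} → ¬ (ιₙ q ∣ a) → ¬ (ιₙ q ∣ b) → ιₙ (q ℕ.^ m) * a ≡ ιₙ (q ℕ.^ n) * b → m ≡ n
  exponents-unique q m n {a} {b} q∤a q∤b e = compare (ℕ.<-cmp m n)
    where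
    lemma : ∀ m n a b → m < n → ιₙ (q ℕ.^ m) * a ≡ ιₙ (q ℕ.^ n) * b → ιₙ q ∣ a
    lemma m n a b m<n e with ℕ.m≤n⇒∃[o]m+o≡n m<n
    ... | o , refl = ιₙ (q ℕ.^ o) * b , ιₙ*-cancel (q ℕ.^ m) {{ℕ.m^n≢0 q m}} (begin
      ιₙ (q ℕ.^ m) * a                                ≡⟨ e ⟩
      ιₙ (q ℕ.^ (suc m ℕ.+ o)) * b                     ≡⟨ cong (λ z → ιₙ z * b) (trans (cong (q ℕ.^_) (sym (ℕ.+-suc m o))) (ℕ.^-distribˡ-+-* q m (suc o))) ⟩
      ιₙ (q ℕ.^ m ℕ.* (q ℕ.* q ℕ.^ o)) * b             ≡⟨ cong (_* b) (trans (ιₙ-* (q ℕ.^ m) _) (cong (ιₙ (q ℕ.^ m) *_) (ιₙ-* q _))) ⟩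
      ιₙ (q ℕ.^ m) * (ιₙ q * ιₙ (q ℕ.^ o)) * b         ≡⟨ solve 4 (λ x y z b → x :* (y :* z) :* b := x :* (y :* (z :* b))) refl (ιₙ (q ℕ.^ m)) (ιₙ q) (ιₙ (q ℕ.^ o)) b ⟩
      ιₙ (q ℕ.^ m) * (ιₙ q * (ιₙ (q ℕ.^ o) * b))       ∎)
      where open ≡-Reasoning
    compare : Tri (m < n) (m ≡ n) (n < m) → m ≡ n
    compare (tri≈ _ m≡n _) = m≡n
    compare (tri< m<n _ _) = ⊥-elim (q∤a (lemma m n a b m<n e))
    compare (tri> _ _ n<m) = ⊥-elim (q∤b (lemma n m b a n<m (sym e)))

  eval : (n : ℕ) → (ℕ → ℤ) → Carrier → Carrier
  eval zero c x = 0#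
  eval (suc n) c x = ι (c 0) + x * eval n (λ i → c (suc i)) x

  -- Integer multiples of bounded size

  module IntegerMultiple (domain : IsDomain) where

    private
      -- ‖ eval n c x ‖ ≤ weight n ‖ x ‖ * k when the coefficients are bounded by k
      weight : ℕ → ℕ → ℕ
      weight zero t = 0
      weight (suc n) t = 1 ℕ.+ κ ℕ.* (t ℕ.* weight n t)

      ‖eval‖ : ∀ (n : ℕ) (c : ℕ → ℤ) k x t → (∀ i → ℤ.∣ c i ∣ ≤ k) → ‖ x ‖ ≤ t → ‖ eval n c x ‖ ≤ weight n t ℕ.* k
      ‖eval‖ zero c k x t c≤k x≤t = ℕ.≤-reflexive ‖0‖
      ‖eval‖ (suc n) c k x t c≤k x≤t = begin
        ‖ ι (c 0) + x * eval n (λ i → c (suc i)) x ‖      ≤⟨ ‖+‖ _ _ ⟩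
        ‖ ι (c 0) ‖ ℕ.+ ‖ x * eval n (λ i → c (suc i)) x ‖ ≤⟨ ℕ.+-mono-≤ (ℕ.≤-trans (ℕ.≤-reflexive (‖ι‖ (c 0))) (c≤k 0)) (ℕ.≤-trans (‖*‖ x _) (ℕ.*-monoʳ-≤ κ (ℕ.*-mono-≤ x≤t (‖eval‖ n _ k x t (λ i → c≤k (suc i)) x≤t)))) ⟩
        k ℕ.+ κ ℕ.* (t ℕ.* (w ℕ.* k))                     ≡⟨ cong (λ z → k ℕ.+ z) (trans (cong (κ ℕ.*_) (sym (ℕ.*-assoc t w k))) (sym (ℕ.*-assoc κ (t ℕ.* w) k))) ⟩
        weight (suc n) t ℕ.* k                            ∎
        where
        open ℕ.≤-Reasoning
        w = weight n t

      eval-difference : ∀ (n : ℕ) (c d : ℕ → ℤ) x → eval n c x + - eval n d x ≡ eval n (λ i → c i ℤ.- d i) x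
      eval-difference zero c d x = -‿inverseʳ 0#
      eval-difference (suc n) c d x = begin
        ι (c 0) + x * ec + - (ι (d 0) + x * ed)        ≡⟨ solve 5 (λ a b x e f → a :+ x :* e :- (b :+ x :* f) := (a :- b) :+ x :* (e :- f)) refl (ι (c 0)) (ι (d 0)) x ec ed ⟩
        (ι (c 0) + - ι (d 0)) + x * (ec + - ed)        ≡⟨ cong₂ (λ u v → u + x * v) (sym (trans (ι-+ (c 0) (ℤ.- d 0)) (cong (λ z → ι (c 0) + z) (ι-neg (d 0))))) (eval-difference n _ _ x) ⟩
        eval (suc n) (λ i → c i ℤ.- d i) x             ∎
        where
        open ≡-Reasoning
        ec = eval n (λ i → c (suc i)) x
        ed = eval n (λ i → d (suc i)) x

      -- In a domain, dividing a relation by a power of x exhibits its lowest nonzero coefficient as a multiple of x.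
      lowest : ∀ (n : ℕ) (c : ℕ → ℤ) x → x ≢ 0# → eval n c x ≡ 0# → (∃ λ i → i < n × c i ≢ + 0) → ∃ λ i → c i ≢ + 0 × x ∣ ι (c i)
      lowest (suc n) c x x≢0 e (i , i<n , ci≢0) with c 0 ℤ.≟ + 0
      ... | no c0≢0 = 0 , c0≢0 , - eval n (λ i → c (suc i)) x , (begin
        ι (c 0)                                ≡⟨ solve 3 (λ a x e → a := (a :+ x :* e) :+ x :* (:- e)) refl (ι (c 0)) x rest ⟩
        ι (c 0) + x * rest + x * - rest        ≡⟨ cong (_+ x * - rest) e ⟩
        0# + x * - rest                        ≡⟨ +-identityˡ _ ⟩
        x * - rest                             ∎)
        where
        open ≡-Reasoning
        rest = eval n (λ i → c (suc i)) x
      lowest (suc n) c x x≢0 e (zero , _ , c0≢0) | yes c0≡0 = ⊥-elim (c0≢0 c0≡0)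
      lowest (suc n) c x x≢0 e (suc i , s≤s i<n , ci≢0) | yes c0≡0
        with domain x (eval n (λ i → c (suc i)) x) (trans (sym (trans (cong (_+ x * eval n (λ i → c (suc i)) x) (trans (cong ι c0≡0) ι-0)) (+-identityˡ _))) e)
      ... | inj₁ x≡0 = ⊥-elim (x≢0 x≡0)
      ... | inj₂ e′ with lowest n (λ i → c (suc i)) x x≢0 e′ (i , i<n , ci≢0)
      ...   | j , cj≢0 , x∣cj = suc j , cj≢0 , x∣cj

      -- With k = base t + 1 and w = `weight (suc rank) t`, at most ((1 + 2w) k) ^ rank = base t · k
      -- ^ rank values compete with k ^ (rank + 1) coefficient vectors.
      base : ℕ → ℕ
      base t = (1 ℕ.+ 2 ℕ.* weight (suc rank) t) ℕ.^ rank

    multipleBound : ℕ → ℕ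
    multipleBound t = suc (base t)

    -- More polynomials of degree ≤ rank with coefficients below k than possible values, so two values agree.
    integer-multiple : ∀ x t → x ≢ 0# → ‖ x ‖ ≤ t → ∃ λ N → 0 < N × N ≤ multipleBound t × x ∣ ιₙ N
    integer-multiple x t x≢0 x≤t = finish (lowest (suc rank) difference x x≢0 relation nontrivial)
      where
      k = multipleBound t
      w = weight (suc rank) t
      bound = w ℕ.* k

      coefficients : Fin (k ℕ.^ suc rank) → ℕ → ℤ
      coefficients i j with j ℕ.<? suc rank
      ... | yes j<n = + toℕ (Fin.finToFun {k} {suc rank} i (Fin.fromℕ< j<n))
      ... | no _ = + 0

      coefficients< : ∀ i j → ∃ λ n → coefficients i j ≡ + n × n < k
      coefficients< i j with j ℕ.<? suc rank
      ... | yes j<n = _ , refl , toℕ<n (Fin.finToFun {k} {suc rank} i (Fin.fromℕ< j<n))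
      ... | no _ = 0 , refl , s≤s z≤n

      coefficients≤ : ∀ i j → ℤ.∣ coefficients i j ∣ ≤ k
      coefficients≤ i j with coefficients< i j
      ... | n , e , n<k = subst (λ z → ℤ.∣ z ∣ ≤ k) (sym e) (ℕ.<⇒≤ n<k)

      coefficients-injective : ∀ i j → (∀ r → r < suc rank → coefficients i r ≡ coefficients j r) → i ≡ j
      coefficients-injective i j h = begin
        i                                                   ≡⟨ sym (Fin.funToFin-finToFin {suc rank} {k} i) ⟩
        Fin.funToFin (Fin.finToFun {k} {suc rank} i)         ≡⟨ funToFin-cong (suc rank) _ _ pointwise ⟩
        Fin.funToFin (Fin.finToFun {k} {suc rank} j)         ≡⟨ Fin.funToFin-finToFin {suc rank} {k} j ⟩
        j                                                   ∎
        where
        open ≡-Reasoning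
        funToFin-cong : ∀ n (f g : Fin n → Fin k) → (∀ r → f r ≡ g r) → Fin.funToFin f ≡ Fin.funToFin g
        funToFin-cong zero f g h = refl
        funToFin-cong (suc n) f g h = cong₂ Fin.combine (h Fin.zero) (funToFin-cong n _ _ (λ r → h (Fin.suc r)))
        unfold : ∀ i (r : Fin (suc rank)) → coefficients i (toℕ r) ≡ + toℕ (Fin.finToFun {k} {suc rank} i r)
        unfold i r with toℕ r ℕ.<? suc rank
        ... | yes r<n = cong (λ z → + toℕ (Fin.finToFun {k} {suc rank} i z)) (Fin.fromℕ<-toℕ r r<n)
        ... | no r≮n = ⊥-elim (r≮n (toℕ<n r))
        pointwise : ∀ r → Fin.finToFun {k} {suc rank} i r ≡ Fin.finToFun {k} {suc rank} j r
        pointwise r = toℕ-injective (ℤ.+-injective (trans (sym (unfold i r)) (trans (h (toℕ r) (toℕ<n r)) (unfold j r))))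

      values : Fin (k ℕ.^ suc rank) → Fin (suc (2 ℕ.* bound) ℕ.^ rank)
      values i = code bound (eval (suc rank) (coefficients i) x)

      counting : suc (2 ℕ.* bound) ℕ.^ rank < k ℕ.^ suc rank
      counting = begin-strict
        suc (2 ℕ.* bound) ℕ.^ rank                    ≤⟨ ℕ.^-monoˡ-≤ rank bound≤ ⟩
        ((1 ℕ.+ 2 ℕ.* w) ℕ.* k) ℕ.^ rank              ≡⟨ ^-distribʳ-* rank (1 ℕ.+ 2 ℕ.* w) k ⟩
        base t ℕ.* k ℕ.^ rank                         <⟨ ℕ.*-monoˡ-< (k ℕ.^ rank) {{ℕ.m^n≢0 k rank}} (ℕ.n<1+n (base t)) ⟩
        k ℕ.^ suc rank                                ∎
        where
        open ℕ.≤-Reasoning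
        bound≤ : suc (2 ℕ.* bound) ≤ (1 ℕ.+ 2 ℕ.* w) ℕ.* k
        bound≤ = ℕ.+-mono-≤ {1} {k} (s≤s z≤n) (ℕ.≤-reflexive (sym (ℕ.*-assoc 2 w k)))

      collision = pigeonhole counting values
      i₁ = proj₁ collision
      i₂ = proj₁ (proj₂ collision)
      i₁<i₂ = proj₁ (proj₂ (proj₂ collision))
      difference : ℕ → ℤ
      difference j = coefficients i₁ j ℤ.- coefficients i₂ j

      relation : eval (suc rank) difference x ≡ 0#
      relation = trans (sym (eval-difference (suc rank) (coefficients i₁) (coefficients i₂) x))
        (trans (cong (_+ - eval (suc rank) (coefficients i₂) x) (code-injective bound _ _ (small i₁) (small i₂) (proj₂ (proj₂ (proj₂ collision))))) (-‿inverseʳ _))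
        where
        small : ∀ i → ‖ eval (suc rank) (coefficients i) x ‖ ≤ bound
        small i = ‖eval‖ (suc rank) (coefficients i) k x t (coefficients≤ i) x≤t

      nontrivial : ∃ λ j → j < suc rank × difference j ≢ + 0
      nontrivial with ℕ.anyUpTo? (λ j → ¬? (difference j ℤ.≟ + 0)) (suc rank)
      ... | yes (j , j<n , d≢0) = j , j<n , d≢0
      ... | no none = ⊥-elim (Fin.<⇒≢ i₁<i₂ (coefficients-injective i₁ i₂ equal))
        where
        equal : ∀ r → r < suc rank → coefficients i₁ r ≡ coefficients i₂ r
        equal r r<n with difference r ℤ.≟ + 0
        ... | yes d≡0 = ℤ.i-j≡0⇒i≡j (coefficients i₁ r) (coefficients i₂ r) d≡0
        ... | no d≢0 = ⊥-elim (none (r , r<n , d≢0))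

      finish : (∃ λ i → difference i ≢ + 0 × x ∣ ι (difference i)) → ∃ λ N → 0 < N × N ≤ k × x ∣ ιₙ N
      finish (i , d≢0 , x∣d) = ℤ.∣ difference i ∣ , ℕ.n≢0⇒n>0 (λ e → d≢0 (ℤ.∣i∣≡0⇒i≡0 e)) , bounded , ∣abs (difference i) x∣d
        where
        ∣abs : ∀ d → x ∣ ι d → x ∣ ιₙ ℤ.∣ d ∣
        ∣abs (+ n) h = h
        ∣abs -[1+ n ] (c , e) = - c , trans (solve 1 (λ a → a := :- (:- a)) refl (ιₙ (suc n))) (trans (cong -_ (trans (sym (ι-neg (+ suc n))) e)) (solve 2 (λ x c → :- (x :* c) := x :* (:- c)) refl x c))
        bounded : ℤ.∣ difference i ∣ ≤ k
        bounded with coefficients< i₁ i | coefficients< i₂ i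
        ... | m , e₁ , m<k | n , e₂ , n<k = subst₂≤ (ℤ.∣m⊝n∣≤m⊔n m n)
          where
          subst₂≤ : ℤ.∣ m ℤ.⊖ n ∣ ≤ m ℕ.⊔ n → ℤ.∣ difference i ∣ ≤ k
          subst₂≤ h = ℕ.≤-trans (ℕ.≤-reflexive (cong ℤ.∣_∣ (trans (cong₂ ℤ._-_ e₁ e₂) (ℤ.m-n≡m⊖n m n)))) (ℕ.≤-trans h (ℕ.⊔-lub (ℕ.<⇒≤ m<k) (ℕ.<⇒≤ n<k)))

-- Cyclotomic integers

fermat-little : ∀ {p q} → Prime (suc p) → ¬ (suc p ∣ℕ q) → ∃ λ c → q ℕ.^ p ≡ 1 ℕ.+ suc p ℕ.* c
fermat-little {p} {q} pp p∤q = positive (q ℕ.^ p) (ℕ.m^n>0 q {{q≢0}} p) divisible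
  where
  open OrderArithmetic ℤ-order
  open Ring ℤ-ring using (_^_; _∣_; module Solver; ιₙ)
  q≢0 : NonZero q
  q≢0 = ℕ.≢-nonZero (λ { refl → p∤q (suc p ℕ∣.∣0) })
  divisible : + suc p ∣ (+ (q ℕ.^ p) ℤ.- + 1)
  divisible = coprime-∣ {suc p} {q} (prime∤⇒coprime pp p∤q) (subst (+ suc p ∣_) factor (fermat pp (+ q)))
    where
    open Solver using (solve; _:*_; _:-_; _:=_; con)
    factor : (+ q) ^ suc p ℤ.- + q ≡ + q ℤ.* (+ (q ℕ.^ p) ℤ.- + 1)
    factor = trans (cong (λ z → + q ℤ.* z ℤ.- + q) (sym (ιₙ-^ q p))) (solve 2 (λ q r → q :* r :- q := q :* (r :- con (+ 1))) refl (+ q) (+ (q ℕ.^ p)))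
  positive : ∀ n → 0 < n → + suc p ∣ (+ n ℤ.- + 1) → ∃ λ c → n ≡ 1 ℕ.+ suc p ℕ.* c
  positive (suc n) _ d with ∣ι⇒∣ℕ (suc p) (+ n) d
  ... | ℕ∣.divides c e = c , cong suc (trans e (ℕ.*-comm c (suc p)))

module Evaluation (R : Order) where
  open Order R

  evaluate : ∀ {n} → Carrier → Vec ℤ n → Carrier
  evaluate x [] = 0#
  evaluate x (a ∷ as) = ι a + x * evaluate x as

module Cyclotomic
  (O : Order) (m″ : ℕ) (prime-ℓ : Prime (suc (suc m″))) (ζ : Order.Carrier O)
  (∑ζ^≡0 : Order.∑ O (suc (suc m″)) (λ i → Order._^_ O ζ i) ≡ Order.0# O)
  (degree : ℕ) (coordinates : Order.Carrier O → Vec ℤ degree)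
  (evaluate-ζ : ∀ a → Evaluation.evaluate O ζ (coordinates a) ≡ a)
  where

  ℓ : ℕ
  ℓ = suc (suc m″)

  open Order O
  open Evaluation O
  open OrderArithmetic O
  open Solver using (solve; _:+_; _:-_; _:*_; :-_; _:=_; con)

  ∑-geometric : ∀ n x → (x + - 1#) * ∑ n (λ i → x ^ i) ≡ x ^ n + - 1#
  ∑-geometric zero x = trans (zeroʳ (x + - 1#)) (sym (-‿inverseʳ 1#))
  ∑-geometric (suc n) x = trans (distribˡ (x + - 1#) (∑ n (λ i → x ^ i)) (x ^ n)) (trans (cong (_+ (x + - 1#) * x ^ n) (∑-geometric n x))
    (solve 2 (λ x p → (p :- con (+ 1)) :+ (x :- con (+ 1)) :* p := x :* p :- con (+ 1)) refl x (x ^ n)))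

  ζ^ℓ≡1 : ζ ^ ℓ ≡ 1#
  ζ^ℓ≡1 = x-y≡0⇒x≡y (trans (sym (∑-geometric ℓ ζ)) (trans (cong ((ζ + - 1#) *_) ∑ζ^≡0) (zeroʳ (ζ + - 1#))))

  -- The value of the polynomial at 1, hence an integer representing the residue modulo π = ζ - 1.
  coefficientSum : ∀ {n} → Vec ℤ n → ℤ
  coefficientSum [] = + 0
  coefficientSum (a ∷ as) = a ℤ.+ coefficientSum as

  evaluate-mod : ∀ {n x y m} (as : Vec ℤ n) → x ≡ y [mod m ] → evaluate x as ≡ evaluate y as [mod m ]
  evaluate-mod [] h = mod-reflexive refl
  evaluate-mod (a ∷ as) h = mod-+ (mod-reflexive refl) (mod-* h (evaluate-mod as h))

  evaluate-1 : ∀ {n} (as : Vec ℤ n) → evaluate 1# as ≡ ι (coefficientSum as)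
  evaluate-1 [] = sym ι-0
  evaluate-1 (a ∷ as) = trans (cong (λ z → ι a + z) (trans (*-identityˡ (evaluate 1# as)) (evaluate-1 as))) (sym (ι-+ a (coefficientSum as)))

  π : Carrier
  π = ζ + - 1#

  ζ≡1 : ζ ≡ 1# [mod π ]
  ζ≡1 = ∣-refl π

  reduce-π : ∀ a → a ≡ ι (coefficientSum (coordinates a)) [mod π ]
  reduce-π a = mod-trans (mod-reflexive (sym (evaluate-ζ a))) (mod-trans (evaluate-mod (coordinates a) ζ≡1) (mod-reflexive (evaluate-1 (coordinates a))))

  -- Modulo π every power of ζ is 1, so the vanishing sum of the ℓ powers is congruent to ℓ.
  π∣ℓ : π ∣ ιₙ ℓ
  π∣ℓ = ≡0⇒∣ (mod-trans (mod-sym (sum ℓ)) (mod-reflexive ∑ζ^≡0))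
    where
    sum : ∀ n → ∑ n (λ i → ζ ^ i) ≡ ιₙ n [mod π ]
    sum zero = mod-reflexive (sym ι-0)
    sum (suc n) = mod-trans (mod-+ (sum n) (mod-trans (mod-^ n ζ≡1) (mod-reflexive (1^ n)))) (mod-reflexive (trans (+-comm (ιₙ n) 1#) (sym (ιₙ-suc n))))

  -- By `freshman`, (ζ - 1) ^ ℓ ≡ ζ ^ ℓ - 1 = 0 modulo ℓ; Fermat for -1 again spares the parity of
  -- ℓ.
  ℓ∣π^ℓ : ιₙ ℓ ∣ π ^ ℓ
  ℓ∣π^ℓ = ≡0⇒∣ (mod-trans (freshman prime-ℓ ζ (- 1#)) (mod-trans (mod-+ (mod-reflexive ζ^ℓ≡1) minus-one) (mod-reflexive (-‿inverseʳ 1#))))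
    where
    minus-one : (- 1#) ^ ℓ ≡ - 1# [mod ιₙ ℓ ]
    minus-one = subst (λ z → z ^ ℓ ≡ z [mod ιₙ ℓ ]) (trans (ι-neg (+ 1)) (cong -_ ι-1)) (fermat prime-ℓ (ℤ.- + 1))

  -- If π divides n, then ℓ divides π ^ ℓ and hence n ^ ℓ, which is n modulo ℓ by Fermat.
  π∣ι⇒ℓ∣ : ∀ n → π ∣ ι n → ℓ ∣ℕ ℤ.∣ n ∣
  π∣ι⇒ℓ∣ n (c , e) = ∣ι⇒∣ℕ ℓ n (mod⇒∣ (fermat prime-ℓ n) (subst (ιₙ ℓ ∣_) (trans (sym (^-distrib-* π c ℓ)) (cong (_^ ℓ) (sym e))) (∣-*ʳ {ιₙ ℓ} {π ^ ℓ} (c ^ ℓ) ℓ∣π^ℓ)))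

  ℓ∣⇒π∣ : ∀ a → ℓ ∣ℕ ℤ.∣ coefficientSum (coordinates a) ∣ → π ∣ a
  ℓ∣⇒π∣ a h = mod⇒∣ (mod-sym (reduce-π a)) (∣-trans {π} {ιₙ ℓ} π∣ℓ (∣ℕ⇒∣ι ℓ (coefficientSum (coordinates a)) h))

  -- `coefficientSum` identifies O / π with the field of ℓ elements, so Euclid's lemma for ℓ carries
  -- over.
  π-prime : ∀ a b → π ∣ a * b → π ∣ a ⊎ π ∣ b
  π-prime a b h = [ (λ p → inj₁ (ℓ∣⇒π∣ a p)) , (λ p → inj₂ (ℓ∣⇒π∣ b p)) ]′
    (euclidsLemma _ _ prime-ℓ (subst (ℓ ∣ℕ_) (ℤ.abs-* (coefficientSum (coordinates a)) (coefficientSum (coordinates b))) (π∣ι⇒ℓ∣ _ (mod⇒∣ product h))))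
    where
    product : a * b ≡ ι (coefficientSum (coordinates a) ℤ.* coefficientSum (coordinates b)) [mod π ]
    product = mod-trans (mod-* (reduce-π a) (reduce-π b)) (mod-reflexive (sym (ι-* (coefficientSum (coordinates a)) (coefficientSum (coordinates b)))))

  π-cancel : ∀ a → π * a ≡ 0# → a ≡ 0#
  π-cancel a e = [ (λ ()) , (λ p → p) ]′ (ι*≡0 (+ ℓ) a (annihilated π∣ℓ))
    where
    open ≡-Reasoning
    annihilated : π ∣ ιₙ ℓ → ιₙ ℓ * a ≡ 0#
    annihilated (c , eq) = begin
      ιₙ ℓ * a        ≡⟨ cong (_* a) eq ⟩
      π * c * a       ≡⟨ solve 3 (λ p c a → p :* c :* a := c :* (p :* a)) refl π c a ⟩
      c * (π * a)     ≡⟨ cong (c *_) e ⟩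
      c * 0#          ≡⟨ zeroʳ c ⟩
      0#              ∎

  -- π ^ ℓ is divisible by ℓ.
  π-separated : ∀ a → π ^ (ℓ ℕ.* ‖ a ‖) ∣ a → a ≡ 0#
  π-separated a h = small-multiple (ℓ ℕ.^ ‖ a ‖) (∣-trans {ιₙ (ℓ ℕ.^ ‖ a ‖)} {π ^ (ℓ ℕ.* ‖ a ‖)} (powers ‖ a ‖) h) (n<m^n ℓ ‖ a ‖ (s≤s (s≤s z≤n)))
    where
    powers : ∀ n → ιₙ (ℓ ℕ.^ n) ∣ π ^ (ℓ ℕ.* n)
    powers n = c ^ n , trans (sym (^-assocʳ π ℓ n)) (trans (cong (_^ n) (proj₂ ℓ∣π^ℓ)) (trans (^-distrib-* (ιₙ ℓ) c n) (cong (_* c ^ n) (sym (ιₙ-^ ℓ n)))))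
      where
      c = proj₁ ℓ∣π^ℓ

  π∣? : ∀ c → Dec (π ∣ c)
  π∣? c = decide (ℓ ℕ∣.∣? ℤ.∣ coefficientSum (coordinates c) ∣)
    where
    decide : Dec (ℓ ∣ℕ ℤ.∣ coefficientSum (coordinates c) ∣) → Dec (π ∣ c)
    decide (yes p) = yes (ℓ∣⇒π∣ c p)
    decide (no ¬p) = no (λ π∣c → ¬p (π∣ι⇒ℓ∣ (coefficientSum (coordinates c)) (mod⇒∣ (reduce-π c) π∣c)))

  reassociate : ∀ n d → π ^ n * (π * d) ≡ π ^ suc n * d
  reassociate n d = solve 3 (λ x p d → x :* (p :* d) := p :* x :* d) refl (π ^ n) π d

  StripsTo : Carrier → Set
  StripsTo b = ∃₂ λ k b′ → b ≡ π ^ k * b′ × ¬ (π ∣ b′)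

  strip-π : ∀ n b → StripsTo b ⊎ (π ^ n ∣ b)
  strip-π zero b = inj₂ (b , sym (*-identityˡ b))
  strip-π (suc n) b = [ inj₁ , (λ { (c , e) → step c e (π∣? c) }) ]′ (strip-π n b)
    where
    step : ∀ c → b ≡ π ^ n * c → Dec (π ∣ c) → StripsTo b ⊎ (π ^ suc n ∣ b)
    step c e (no π∤c) = inj₁ (n , c , e , π∤c)
    step c e (yes (d , e′)) = inj₂ (d , trans e (trans (cong (π ^ n *_) e′) (reassociate n d)))

  π^-cancel : ∀ k a → π ^ k * a ≡ 0# → a ≡ 0#
  π^-cancel zero a e = trans (sym (*-identityˡ a)) e
  π^-cancel (suc k) a e = π^-cancel k a (π-cancel (π ^ k * a) (trans (sym (*-assoc π (π ^ k) a)) e))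

  -- Irreducibility of the cyclotomic polynomial is bypassed: π is a prime element and no zero
  -- divisor, and only 0 is divisible by all its powers. If a b = 0 and b is nonzero, strip all
  -- factors π from b; the rest b′ is not divisible by π. So π can be split off from a again and
  -- again while the cofactor still annihilates b′, and a = 0.
  domain : IsDomain
  domain a b ab≡0 = [ stripped , (λ h → inj₂ (π-separated b h)) ]′ (strip-π (ℓ ℕ.* ‖ b ‖) b)
    where
    stripped : StripsTo b → a ≡ 0# ⊎ b ≡ 0#
    stripped (k , b′ , e , π∤b′) = inj₁ (π-separated a (proj₁ quotient , proj₁ (proj₂ quotient)))
      where
      Quotient : ℕ → Set
      Quotient n = ∃ λ c → a ≡ π ^ n * c × c * b′ ≡ 0#
      divide : ∀ n → Quotient n
      next : ∀ n → Quotient n → Quotient (suc n)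
      divide zero = a , sym (*-identityˡ a) , π^-cancel k (a * b′) (trans (solve 3 (λ x a b → x :* (a :* b) := a :* (x :* b)) refl (π ^ k) a b′) (trans (cong (a *_) (sym e)) ab≡0))
      divide (suc n) = next n (divide n)
      next n (c , e₁ , e₂) = [ factor , (λ π∣b′ → ⊥-elim (π∤b′ π∣b′)) ]′ (π-prime c b′ (0# , trans e₂ (sym (zeroʳ π))))
        where
        factor : π ∣ c → Quotient (suc n)
        factor (d , e₃) = d , trans e₁ (trans (cong (π ^ n *_) e₃) (reassociate n d)) ,
          π-cancel (d * b′) (trans (sym (*-assoc π d b′)) (trans (cong (_* b′) (sym e₃)) e₂))
      quotient = divide (ℓ ℕ.* ‖ a ‖)

  open Domain domain

  -- The product of ζ ^ j - 1 and the sum is zero. If ζ ^ j were 1, inverting j modulo ℓ would give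
  -- ζ = 1, and `∑ζ^≡0` would say that ℓ vanishes.
  ∑ζ^[ij]≡0 : ∀ j → 0 < j → j < ℓ → ∑ ℓ (λ i → ζ ^ (i ℕ.* j)) ≡ 0#
  ∑ζ^[ij]≡0 j 0<j j<ℓ = [ (λ p → ⊥-elim (ζ^j≢1 (x-y≡0⇒x≡y p))) , (λ p → trans (∑-cong ℓ (λ i _ → trans (cong (ζ ^_) (ℕ.*-comm i j)) (sym (^-assocʳ ζ j i)))) p) ]′
    (domain (ζ ^ j + - 1#) (∑ ℓ (λ i → (ζ ^ j) ^ i)) (trans (∑-geometric ℓ (ζ ^ j)) (trans (cong (_+ - 1#) [ζ^j]^ℓ≡1) (-‿inverseʳ 1#))))
    where
    [ζ^j]^ℓ≡1 : (ζ ^ j) ^ ℓ ≡ 1#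
    [ζ^j]^ℓ≡1 = trans (^-assocʳ ζ j ℓ) (trans (cong (ζ ^_) (ℕ.*-comm j ℓ)) (trans (sym (^-assocʳ ζ ℓ j)) (trans (cong (_^ j) ζ^ℓ≡1) (1^ j))))
    ζ^j≢1 : ζ ^ j ≢ 1#
    ζ^j≢1 h = [ (λ ()) , 1≢0 ]′ (ι*≡0 (+ ℓ) 1# (trans (sym (∑-const ℓ 1#)) (trans (∑-cong ℓ (λ i _ → sym (trans (cong (_^ i) ζ≡1#) (1^ i)))) ∑ζ^≡0)))
      where
      x = proj₁ (inverse-mod {j} {ℓ} (Coprimality.sym (prime∤⇒coprime prime-ℓ (λ ℓ∣j → ℕ.<⇒≱ j<ℓ (ℕ∣.∣⇒≤ {{ℕ.>-nonZero 0<j}} ℓ∣j)))))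
      jx≡1 : (j ℕ.* x) ℕ.% ℓ ≡ 1
      jx≡1 = proj₂ (inverse-mod {j} {ℓ} (Coprimality.sym (prime∤⇒coprime prime-ℓ (λ ℓ∣j → ℕ.<⇒≱ j<ℓ (ℕ∣.∣⇒≤ {{ℕ.>-nonZero 0<j}} ℓ∣j)))))
      ζ≡1# : ζ ≡ 1#
      ζ≡1# = begin
        ζ                                              ≡⟨ sym (*-identityʳ ζ) ⟩
        ζ ^ 1                                          ≡⟨ sym (*-identityʳ (ζ ^ 1)) ⟩
        ζ ^ 1 * 1#                                     ≡⟨ cong (ζ ^ 1 *_) (sym (trans (cong (ζ ^_) (ℕ.*-comm (j ℕ.* x ℕ./ ℓ) ℓ)) (trans (sym (^-assocʳ ζ ℓ (j ℕ.* x ℕ./ ℓ))) (trans (cong (_^ (j ℕ.* x ℕ./ ℓ)) ζ^ℓ≡1) (1^ (j ℕ.* x ℕ./ ℓ)))))) ⟩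
        ζ ^ 1 * ζ ^ (j ℕ.* x ℕ./ ℓ ℕ.* ℓ)              ≡⟨ sym (^-homo-* ζ 1 (j ℕ.* x ℕ./ ℓ ℕ.* ℓ)) ⟩
        ζ ^ (1 ℕ.+ j ℕ.* x ℕ./ ℓ ℕ.* ℓ)                ≡⟨ cong (λ z → ζ ^ (z ℕ.+ j ℕ.* x ℕ./ ℓ ℕ.* ℓ)) (sym jx≡1) ⟩
        ζ ^ ((j ℕ.* x) ℕ.% ℓ ℕ.+ j ℕ.* x ℕ./ ℓ ℕ.* ℓ)  ≡⟨ cong (ζ ^_) (sym (m≡m%n+[m/n]*n (j ℕ.* x) ℓ)) ⟩
        ζ ^ (j ℕ.* x)                                  ≡⟨ sym (^-assocʳ ζ j x) ⟩
        (ζ ^ j) ^ x                                    ≡⟨ trans (cong (_^ x) h) (1^ x) ⟩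
        1#                                             ∎
        where open ≡-Reasoning

  -- Cyclotomic integers modulo a prime different from ℓ

  module _ {q : ℕ} (prime-q : Prime q) (q≢ℓ : q ≢ ℓ) where

    private
      frobenius : ∀ {n} x (as : Vec ℤ n) → evaluate x as ^ q ≡ evaluate (x ^ q) as [mod ιₙ q ]
      frobenius x [] = mod-reflexive (zero-power q (ℕ.<-trans (s≤s z≤n) (prime⇒1< prime-q)))
        where
        zero-power : ∀ n → 0 < n → 0# ^ n ≡ 0#
        zero-power (suc n) _ = 0^suc n
      frobenius x (a ∷ as) = mod-trans (freshman prime-q (ι a) (x * evaluate x as))
        (mod-+ (fermat prime-q a) (mod-trans (mod-reflexive (^-distrib-* x (evaluate x as) q)) (mod-* (mod-reflexive refl) (frobenius x as))))

      frobenius^ : ∀ k a → a ^ (q ℕ.^ k) ≡ evaluate (ζ ^ (q ℕ.^ k)) (coordinates a) [mod ιₙ q ]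
      frobenius^ zero a = mod-reflexive (trans (*-identityʳ a) (trans (sym (evaluate-ζ a)) (cong (λ z → evaluate z (coordinates a)) (sym (*-identityʳ ζ)))))
      frobenius^ (suc k) a = mod-trans (mod-reflexive (split a)) (mod-trans (mod-^ q (frobenius^ k a)) (mod-trans (frobenius (ζ ^ (q ℕ.^ k)) (coordinates a)) (mod-reflexive (cong (λ z → evaluate z (coordinates a)) (sym (split ζ))))))
        where
        split : ∀ x → x ^ (q ℕ.^ suc k) ≡ (x ^ (q ℕ.^ k)) ^ q
        split x = trans (cong (x ^_) (ℕ.*-comm q (q ℕ.^ k))) (sym (^-assocʳ x (q ℕ.^ k) q))

      ℓ∤q : ¬ (ℓ ∣ℕ q)
      ℓ∤q ℓ∣q with prime⇒irreducible prime-q ℓ∣q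
      ... | inj₁ ()
      ... | inj₂ ℓ≡q = q≢ℓ (sym ℓ≡q)

      -- The exponent ℓ - 1 makes Q ≡ 1 modulo ℓ by Fermat's little theorem, so the corresponding
      -- iterate of the Frobenius map fixes ζ and with it all of O / q.
      Q : ℕ
      Q = q ℕ.^ suc m″

      ζ^Q≡ζ : ζ ^ Q ≡ ζ
      ζ^Q≡ζ = from-little (fermat-little {suc m″} {q} prime-ℓ ℓ∤q)
        where
        from-little : (∃ λ c → Q ≡ 1 ℕ.+ ℓ ℕ.* c) → ζ ^ Q ≡ ζ
        from-little (c , e) = trans (cong (ζ ^_) e) (trans (cong (ζ *_) (trans (sym (^-assocʳ ζ ℓ c)) (trans (cong (_^ c) ζ^ℓ≡1) (1^ c)))) (*-identityʳ ζ))

      ζ^Q^n≡ζ : ∀ n → ζ ^ (Q ℕ.^ n) ≡ ζ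
      ζ^Q^n≡ζ zero = *-identityʳ ζ
      ζ^Q^n≡ζ (suc n) = trans (sym (^-assocʳ ζ Q (Q ℕ.^ n))) (trans (cong (_^ (Q ℕ.^ n)) ζ^Q≡ζ) (ζ^Q^n≡ζ n))

    -- The Frobenius map has finite order on O / q, so O / q is reduced.
    reduced : ∀ n a → ιₙ q ∣ a ^ n → ιₙ q ∣ a
    reduced n a h = mod⇒∣ identity (∣-power (Q ℕ.^ n) (ℕ.<⇒≤ (n<m^n Q n (ℕ.<-≤-trans (prime⇒1< prime-q) (ℕ.m≤m*n q (q ℕ.^ m″) {{ℕ.m^n≢0 q m″ {{prime⇒nonZero prime-q}}}})))))
      where
      identity : a ^ (Q ℕ.^ n) ≡ a [mod ιₙ q ]
      identity = mod-trans (mod-reflexive (cong (a ^_) (ℕ.^-*-assoc q (suc m″) n))) (mod-trans (frobenius^ (suc m″ ℕ.* n) a)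
        (mod-reflexive (trans (cong (λ z → evaluate z (coordinates a)) (trans (cong (ζ ^_) (sym (ℕ.^-*-assoc q (suc m″) n))) (ζ^Q^n≡ζ n))) (evaluate-ζ a))))
      ∣-power : ∀ N → n ≤ N → ιₙ q ∣ a ^ N
      ∣-power N n≤N with ℕ.m≤n⇒∃[o]m+o≡n n≤N
      ... | o , refl = subst (ιₙ q ∣_) (sym (^-homo-* a n o)) (∣-*ʳ {ιₙ q} {a ^ n} (a ^ o) h)

    -- An identity w ^ ℓ c₁ = t ^ ℓ c₂ forces the q-adic valuations of c₁ and c₂ to agree modulo ℓ.
    valuations-agree : ∀ w t v₁ v₂ u₁ u₂ → w ≢ 0# → t ≢ 0# → ¬ (q ∣ℕ ℤ.∣ u₁ ∣) → ¬ (q ∣ℕ ℤ.∣ u₂ ∣) →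
      w ^ ℓ * ι (+ (q ℕ.^ v₁) ℤ.* u₁) ≡ t ^ ℓ * ι (+ (q ℕ.^ v₂) ℤ.* u₂) → ∃₂ λ i j → i ℕ.* ℓ ℕ.+ v₁ ≡ j ℕ.* ℓ ℕ.+ v₂
    valuations-agree w t v₁ v₂ u₁ u₂ w≢0 t≢0 q∤u₁ q∤u₂ e = compare (content q (prime⇒1< prime-q) w w≢0) (content q (prime⇒1< prime-q) t t≢0)
      where
      unit : ∀ a u → ¬ (ιₙ q ∣ a) → ¬ (q ∣ℕ ℤ.∣ u ∣) → ¬ (ιₙ q ∣ a ^ ℓ * ι u)
      unit a u q∤a q∤u h = q∤a (reduced ℓ a (coprime-∣ {q} {ℤ.∣ u ∣} (prime∤⇒coprime prime-q q∤u) (absolute u (subst (ιₙ q ∣_) (*-comm (a ^ ℓ) (ι u)) h))))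
        where
        absolute : ∀ u → ιₙ q ∣ ι u * a ^ ℓ → ιₙ q ∣ ιₙ ℤ.∣ u ∣ * a ^ ℓ
        absolute (+ n) h = h
        absolute -[1+ n ] (c , e) = - c , (begin
          ιₙ (suc n) * a ^ ℓ          ≡⟨ solve 2 (λ n a → n :* a := :- ((:- n) :* a)) refl (ιₙ (suc n)) (a ^ ℓ) ⟩
          - (- ιₙ (suc n) * a ^ ℓ)    ≡⟨ cong (λ z → - (z * a ^ ℓ)) (sym (ι-neg (+ suc n))) ⟩
          - (ι -[1+ n ] * a ^ ℓ)      ≡⟨ cong -_ e ⟩
          - (ιₙ q * c)                ≡⟨ solve 2 (λ q c → :- (q :* c) := q :* (:- c)) refl (ιₙ q) c ⟩
          ιₙ q * - c                  ∎)
          where open ≡-Reasoning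
      collect : ∀ i a v u → (ιₙ (q ℕ.^ i) * a) ^ ℓ * ι (+ (q ℕ.^ v) ℤ.* u) ≡ ιₙ (q ℕ.^ (i ℕ.* ℓ ℕ.+ v)) * (a ^ ℓ * ι u)
      collect i a v u = begin
        (ιₙ (q ℕ.^ i) * a) ^ ℓ * ι (+ (q ℕ.^ v) ℤ.* u)           ≡⟨ cong₂ _*_ (^-distrib-* (ιₙ (q ℕ.^ i)) a ℓ) (ι-* (+ (q ℕ.^ v)) u) ⟩
        ιₙ (q ℕ.^ i) ^ ℓ * a ^ ℓ * (ιₙ (q ℕ.^ v) * ι u)          ≡⟨ solve 4 (λ x a y u → x :* a :* (y :* u) := x :* y :* (a :* u)) refl (ιₙ (q ℕ.^ i) ^ ℓ) (a ^ ℓ) (ιₙ (q ℕ.^ v)) (ι u) ⟩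
        ιₙ (q ℕ.^ i) ^ ℓ * ιₙ (q ℕ.^ v) * (a ^ ℓ * ι u)          ≡⟨ cong (λ z → z * ιₙ (q ℕ.^ v) * (a ^ ℓ * ι u)) (trans (sym (ιₙ-^ (q ℕ.^ i) ℓ)) (cong ιₙ (ℕ.^-*-assoc q i ℓ))) ⟩
        ιₙ (q ℕ.^ (i ℕ.* ℓ)) * ιₙ (q ℕ.^ v) * (a ^ ℓ * ι u)      ≡⟨ cong (_* (a ^ ℓ * ι u)) (trans (sym (ιₙ-* (q ℕ.^ (i ℕ.* ℓ)) (q ℕ.^ v))) (cong ιₙ (sym (ℕ.^-distribˡ-+-* q (i ℕ.* ℓ) v)))) ⟩
        ιₙ (q ℕ.^ (i ℕ.* ℓ ℕ.+ v)) * (a ^ ℓ * ι u)               ∎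
        where open ≡-Reasoning
      compare : (∃₂ λ i w′ → w ≡ ιₙ (q ℕ.^ i) * w′ × ¬ (ιₙ q ∣ w′)) → (∃₂ λ j t′ → t ≡ ιₙ (q ℕ.^ j) * t′ × ¬ (ιₙ q ∣ t′)) → ∃₂ λ i j → i ℕ.* ℓ ℕ.+ v₁ ≡ j ℕ.* ℓ ℕ.+ v₂
      compare (i , w′ , e₁ , q∤w′) (j , t′ , e₂ , q∤t′) =
        i , j , exponents-unique q {{prime⇒nonZero prime-q}} (i ℕ.* ℓ ℕ.+ v₁) (j ℕ.* ℓ ℕ.+ v₂) (unit w′ u₁ q∤w′ q∤u₁) (unit t′ u₂ q∤t′ q∤u₂)
          (trans (sym (collect i w′ v₁ u₁)) (trans (cong (λ z → z ^ ℓ * ι (+ (q ℕ.^ v₁) ℤ.* u₁)) (sym e₁)) (trans e (trans (cong (λ z → z ^ ℓ * ι (+ (q ℕ.^ v₂) ℤ.* u₂)) e₂) (collect j t′ v₂ u₂)))))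

-- ℤ[ζ] in the basis 1, ζ, ..., ζ ^ (ℓ - 2).
module CyclotomicIntegers (m″ : ℕ) where

  private
    m : ℕ
    m = suc m″

    -- The relation y ^ (ℓ - 1) = -1 - y - ... - y ^ (ℓ - 2), that is, the cyclotomic polynomial.
    minusOnes : Vec ℤ m
    minusOnes = replicate m (ℤ.- + 1)

  open Extension ℤ-order m″ minusOnes using (extension; horner; 𝟏; y·; ⊗-identityʳ)
  open Generator ℤ-order m″ minusOnes using (𝐲; 𝐲⊗; 𝐲^m≡f; ∑-𝐲^)

  O : Order
  O = extension

  open Order O
  open Evaluation O

  ζ : Carrier
  ζ = 𝐲

  ∑ζ^≡0 : ∑ (suc m) (λ i → ζ ^ i) ≡ 0#
  ∑ζ^≡0 = trans (cong₂ _+_ (trans (sym (∑-𝐲^ (m))) (⊗-identityʳ (replicate (m) (+ 1)))) 𝐲^m≡f) (cancel (m))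
    where
    cancel : ∀ n → zipWith ℤ._+_ (replicate n (+ 1)) (replicate n (ℤ.- + 1)) ≡ replicate n (+ 0)
    cancel zero = refl
    cancel (suc n) = cong (+ 0 ∷_) (cancel n)

  evaluate-ζ : ∀ a → evaluate ζ a ≡ a
  evaluate-ζ a = trans (evaluate≡horner a) (⊗-identityʳ a)
    where
    scale : ∀ {n} r → _≡_ {A = Vec ℤ (suc n)} (r ℤ.* + 1 ∷ map (r ℤ.*_) (replicate n (+ 0))) (r ∷ replicate n (+ 0))
    scale {n} r = cong₂ _∷_ (ℤ.*-identityʳ r) (zeros n)
      where
      zeros : ∀ n → map (r ℤ.*_) (replicate n (+ 0)) ≡ replicate n (+ 0)
      zeros zero = refl
      zeros (suc n) = cong₂ _∷_ (ℤ.*-zeroʳ r) (zeros n)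
    evaluate≡horner : ∀ {n} (as : Vec ℤ n) → evaluate ζ as ≡ horner as 𝟏
    evaluate≡horner [] = refl
    evaluate≡horner (a ∷ as) = cong₂ _+_ (sym (scale a)) (trans (𝐲⊗ (evaluate ζ as)) (cong y· (evaluate≡horner as)))

-- Elements close to an integer

module ConeArithmetic (R : Order) (Q : ℕ) where
  open Order R
  open OrderArithmetic R
  open Solver using (solve; _:+_; _:-_; _:*_; :-_; _:=_; con)

  -- An element close to the positive integer a, and congruent to 1 modulo Q. Multiplication by it behaves like
  -- multiplication by a: in particular it has about a ^ rank residue classes.
  record Cone : Set where
    field
      a : ℕ
      w x : Carrier
      a>0 : 0 < a
      4κw≤a : 4 ℕ.* (κ ℕ.* ‖ w ‖) ≤ a
      w≤a : ‖ w ‖ ≤ a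
    element : Carrier
    element = ιₙ a + w
    field
      ≡1 : element ≡ 1# + ιₙ Q * x

  open Cone

  -- From a ε = γ - w ε and ‖w ε‖ ≤ a ‖ε‖ / 4, three quarters of a ‖ε‖ are at most ‖γ‖; the factor 2
  -- is a weakening of 4 / 3.
  quotient-bound : ∀ (c : Cone) {ε γ} → element c * ε ≡ γ → a c ℕ.* ‖ ε ‖ ≤ 2 ℕ.* ‖ γ ‖
  quotient-bound c {ε} {γ} e = ℕ.*-cancelˡ-≤ 2 (begin
    2 ℕ.* X                      ≤⟨ ℕ.*-monoˡ-≤ X (ℕ.n≤1+n 2) ⟩
    3 ℕ.* X                      ≤⟨ ℕ.+-cancelʳ-≤ X (3 ℕ.* X) (4 ℕ.* G) three ⟩
    4 ℕ.* G                      ≡⟨ ℕ.*-assoc 2 2 G ⟩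
    2 ℕ.* (2 ℕ.* G)              ∎)
    where
    open ℕ.≤-Reasoning
    X = a c ℕ.* ‖ ε ‖
    G = ‖ γ ‖
    Z = κ ℕ.* (‖ w c ‖ ℕ.* ‖ ε ‖)
    X≤ : X ≤ G ℕ.+ Z
    X≤ = begin
      X                                ≡⟨ sym (‖ι*‖ (+ a c) ε) ⟩
      ‖ ιₙ (a c) * ε ‖                 ≡⟨ cong ‖_‖ (trans (solve 3 (λ a w e → a :* e := (a :+ w) :* e :- w :* e) refl (ιₙ (a c)) (w c) ε) (cong (_+ - (w c * ε)) e)) ⟩
      ‖ γ + - (w c * ε) ‖              ≤⟨ ‖-‖≤ γ (w c * ε) ⟩
      G ℕ.+ ‖ w c * ε ‖                ≤⟨ ℕ.+-monoʳ-≤ G (‖*‖ (w c) ε) ⟩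
      G ℕ.+ Z                          ∎
    4Z≤X : 4 ℕ.* Z ≤ X
    4Z≤X = begin
      4 ℕ.* (κ ℕ.* (‖ w c ‖ ℕ.* ‖ ε ‖))   ≡⟨ +-*-Solver.solve 3 (λ k w e → +-*-Solver.con 4 +-*-Solver.:* (k +-*-Solver.:* (w +-*-Solver.:* e)) +-*-Solver.:= (+-*-Solver.con 4 +-*-Solver.:* (k +-*-Solver.:* w)) +-*-Solver.:* e) refl κ ‖ w c ‖ ‖ ε ‖ ⟩
      4 ℕ.* (κ ℕ.* ‖ w c ‖) ℕ.* ‖ ε ‖     ≤⟨ ℕ.*-monoˡ-≤ ‖ ε ‖ (4κw≤a c) ⟩
      X                                  ∎
    three : 3 ℕ.* X ℕ.+ X ≤ 4 ℕ.* G ℕ.+ X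
    three = begin
      3 ℕ.* X ℕ.+ X              ≡⟨ ℕ.+-comm (3 ℕ.* X) X ⟩
      4 ℕ.* X                    ≤⟨ ℕ.*-monoʳ-≤ 4 X≤ ⟩
      4 ℕ.* (G ℕ.+ Z)            ≡⟨ ℕ.*-distribˡ-+ 4 G Z ⟩
      4 ℕ.* G ℕ.+ 4 ℕ.* Z        ≤⟨ ℕ.+-monoʳ-≤ (4 ℕ.* G) 4Z≤X ⟩
      4 ℕ.* G ℕ.+ X              ∎

  -- Division by the integer `a` gives γ = a q + r. Modulo a + w this is r - w q, which is shorter
  -- than γ as long as ‖γ‖ > 2a, because κ ‖w‖ is at most a quarter of a.
  reduce : ∀ (c : Cone) γ → ∃ λ ρ → ‖ ρ ‖ ≤ 2 ℕ.* a c × element c ∣ (γ + - ρ)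
  reduce c γ = go γ (<-wellFounded ‖ γ ‖)
    where
    Reduced : Carrier → Set
    Reduced γ = ∃ λ ρ → ‖ ρ ‖ ≤ 2 ℕ.* a c × element c ∣ (γ + - ρ)
    go : ∀ γ → Acc _<_ ‖ γ ‖ → Reduced γ
    step : ∀ γ → Acc _<_ ‖ γ ‖ → 2 ℕ.* a c < ‖ γ ‖ → (∃₂ λ q r → γ ≡ ιₙ (a c) * q + r × ‖ r ‖ < a c × a c ℕ.* ‖ q ‖ ≤ ‖ γ ‖ ℕ.+ a c) → Reduced γ
    go γ rec = decide (‖ γ ‖ ℕ.≤? 2 ℕ.* a c)
      where
      decide : Dec (‖ γ ‖ ≤ 2 ℕ.* a c) → Reduced γ
      decide (yes p) = γ , p , (0# , trans (-‿inverseʳ γ) (sym (zeroʳ (element c))))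
      decide (no p) = step γ rec (ℕ.≰⇒> p) (divMod (a c) {{ℕ.>-nonZero (a>0 c)}} γ)
    step γ (acc rec) large (q , r , e , r<a , aq≤) = assemble (go γ′ (rec smaller))
      where
      open +-*-Solver using () renaming (solve to solveℕ; _:+_ to _⊕_; _:*_ to _⊗_; _:=_ to _⊜_; con to conℕ)
      A = a c
      G = ‖ γ ‖
      γ′ = r + - (w c * q)
      Z = κ ℕ.* (‖ w c ‖ ℕ.* ‖ q ‖)
      4Z≤ : 4 ℕ.* Z ≤ G ℕ.+ A
      4Z≤ = begin
        4 ℕ.* (κ ℕ.* (‖ w c ‖ ℕ.* ‖ q ‖))   ≡⟨ solveℕ 3 (λ k w e → conℕ 4 ⊗ (k ⊗ (w ⊗ e)) ⊜ (conℕ 4 ⊗ (k ⊗ w)) ⊗ e) refl κ ‖ w c ‖ ‖ q ‖ ⟩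
        4 ℕ.* (κ ℕ.* ‖ w c ‖) ℕ.* ‖ q ‖     ≤⟨ ℕ.*-monoˡ-≤ ‖ q ‖ (4κw≤a c) ⟩
        A ℕ.* ‖ q ‖                        ≤⟨ aq≤ ⟩
        G ℕ.+ A                            ∎
        where open ℕ.≤-Reasoning
      smaller : ‖ γ′ ‖ < G
      smaller = ℕ.*-cancelˡ-< 8 ‖ γ′ ‖ G (begin-strict
        8 ℕ.* ‖ γ′ ‖                          ≤⟨ ℕ.*-monoʳ-≤ 8 (ℕ.≤-trans (‖-‖≤ r (w c * q)) (ℕ.+-mono-≤ (ℕ.<⇒≤ r<a) (‖*‖ (w c) q))) ⟩
        8 ℕ.* (A ℕ.+ Z)                       ≡⟨ solveℕ 2 (λ a z → conℕ 8 ⊗ (a ⊕ z) ⊜ conℕ 8 ⊗ a ⊕ conℕ 2 ⊗ (conℕ 4 ⊗ z)) refl A Z ⟩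
        8 ℕ.* A ℕ.+ 2 ℕ.* (4 ℕ.* Z)           ≤⟨ ℕ.+-monoʳ-≤ (8 ℕ.* A) (ℕ.*-monoʳ-≤ 2 4Z≤) ⟩
        8 ℕ.* A ℕ.+ 2 ℕ.* (G ℕ.+ A)           ≡⟨ solveℕ 2 (λ a g → conℕ 8 ⊗ a ⊕ conℕ 2 ⊗ (g ⊕ a) ⊜ conℕ 5 ⊗ (conℕ 2 ⊗ a) ⊕ conℕ 2 ⊗ g) refl A G ⟩
        5 ℕ.* (2 ℕ.* A) ℕ.+ 2 ℕ.* G           <⟨ ℕ.+-monoˡ-< (2 ℕ.* G) (ℕ.*-monoʳ-< 5 large) ⟩
        5 ℕ.* G ℕ.+ 2 ℕ.* G                   ≡⟨ sym (ℕ.*-distribʳ-+ G 5 2) ⟩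
        7 ℕ.* G                               ≤⟨ ℕ.*-monoˡ-≤ G (ℕ.n≤1+n 7) ⟩
        8 ℕ.* G                               ∎)
        where open ℕ.≤-Reasoning
      assemble : Reduced γ′ → Reduced γ
      assemble (ρ , ρ≤ , (d , e′)) = ρ , ρ≤ , (q + d , (begin
        γ + - ρ                                        ≡⟨ cong (_+ - ρ) e ⟩
        ιₙ A * q + r + - ρ                             ≡⟨ solve 5 (λ a w q r p → a :* q :+ r :- p := (a :+ w) :* q :+ (r :- w :* q :- p)) refl (ιₙ A) (w c) q r ρ ⟩
        element c * q + (γ′ + - ρ)                     ≡⟨ cong (λ z → element c * q + z) e′ ⟩
        element c * q + element c * d                  ≡⟨ sym (distribˡ (element c) q d) ⟩
        element c * (q + d)                            ∎))
        where open ≡-Reasoning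

  -- Congruent elements may receive different codes, but equal codes mean equal remainders; so (4a +
  -- 1) ^ rank bounds the number of residue classes.
  residue : ∀ (c : Cone) → Carrier → Fin (suc (2 ℕ.* (2 ℕ.* a c)) ℕ.^ rank)
  residue c γ = code (2 ℕ.* a c) (proj₁ (reduce c γ))

  residue-∣ : ∀ (c : Cone) γ δ → residue c γ ≡ residue c δ → element c ∣ (γ + - δ)
  residue-∣ c γ δ e = subst (element c ∣_) identity (∣-+ {element c} (proj₂ (proj₂ (reduce c γ))) (mod-sym (proj₂ (proj₂ (reduce c δ)))))
    where
    same : proj₁ (reduce c γ) ≡ proj₁ (reduce c δ)
    same = code-injective (2 ℕ.* a c) (proj₁ (reduce c γ)) (proj₁ (reduce c δ)) (proj₁ (proj₂ (reduce c γ))) (proj₁ (proj₂ (reduce c δ))) e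
    identity : (γ + - proj₁ (reduce c γ)) + (proj₁ (reduce c δ) + - δ) ≡ γ + - δ
    identity = trans (cong (λ z → (γ + - z) + (proj₁ (reduce c δ) + - δ)) same) (solve 3 (λ g r d → (g :- r) :+ (r :- d) := g :- d) refl γ (proj₁ (reduce c δ)) δ)

  -- One more integer than there are codes: two of them collide, and their difference is the
  -- multiple.
  multipleOf : ∀ (c : Cone) → ∃ λ m → 0 < m × m ≤ suc (2 ℕ.* (2 ℕ.* a c)) ℕ.^ rank × element c ∣ ιₙ m
  multipleOf c = finish (pigeonhole (ℕ.n<1+n (suc (2 ℕ.* (2 ℕ.* a c)) ℕ.^ rank)) (λ i → residue c (ιₙ (toℕ i))))
    where
    finish : (∃₂ λ i j → i Fin.< j × residue c (ιₙ (toℕ i)) ≡ residue c (ιₙ (toℕ j))) → ∃ λ m → 0 < m × m ≤ suc (2 ℕ.* (2 ℕ.* a c)) ℕ.^ rank × element c ∣ ιₙ m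
    finish (i , j , i<j , e) = toℕ j ℕ.∸ toℕ i , ℕ.m<n⇒0<n∸m i<j , ℕ.≤-trans (ℕ.m∸n≤m (toℕ j) (toℕ i)) (ℕ.≤-pred (toℕ<n j)) ,
      subst (element c ∣_) difference (mod-sym (residue-∣ c (ιₙ (toℕ i)) (ιₙ (toℕ j)) e))
      where
      difference : ιₙ (toℕ j) + - ιₙ (toℕ i) ≡ ιₙ (toℕ j ℕ.∸ toℕ i)
      difference = trans (cong (λ z → ιₙ z + - ιₙ (toℕ i)) (sym (ℕ.m∸n+n≡m (ℕ.<⇒≤ i<j)))) (trans (cong (_+ - ιₙ (toℕ i)) (ιₙ-+ (toℕ j ℕ.∸ toℕ i) (toℕ i)))
        (solve 2 (λ d i → (d :+ i) :- i := d) refl (ιₙ (toℕ j ℕ.∸ toℕ i)) (ιₙ (toℕ i))))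

  -- Since the element is a unit modulo every divisor of Q, common factors with Q can be cancelled from m.
  coprime-multiple : ∀ (c : Cone) m → 0 < m → element c ∣ ιₙ m → ∃ λ n → 0 < n × n ≤ m × Coprime n Q × element c ∣ ιₙ n
  coprime-multiple c m 0<m h = go m (<-wellFounded m) 0<m h
    where
    α = element c
    Result : ℕ → Set
    Result m = ∃ λ n → 0 < n × n ≤ m × Coprime n Q × α ∣ ιₙ n
    go : ∀ m → Acc _<_ m → 0 < m → α ∣ ιₙ m → Result m
    go m (acc rec) 0<m (γ , e) = decide (coprime? m Q)
      where
      decide : Dec (Coprime m Q) → Result m
      decide (yes p) = m , 0<m , ℕ.≤-refl , p , (γ , e)
      decide (no ¬p) = cancel (gcd[m,n]∣m m Q) (gcd[m,n]∣n m Q)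
        where
        g = gcd m Q
        instance
          m≢0 : NonZero m
          m≢0 = ℕ.>-nonZero 0<m
        g≢0 : NonZero g
        g≢0 = ℕ.≢-nonZero (λ g≡0 → ℕ.<⇒≢ 0<m (sym (ℕ∣.0∣⇒≡0 (subst (_∣ℕ m) g≡0 (gcd[m,n]∣m m Q)))))
        cancel : g ∣ℕ m → g ∣ℕ Q → Result m
        cancel (ℕ∣.divides m′ e₁) (ℕ∣.divides k e₂) = weaken (go m′ (rec m′<m) 0<m′ (γ′ , sym divided))
          where
          open ≡-Reasoning
          m′≢0 : NonZero m′
          m′≢0 = ℕ.≢-nonZero (λ { refl → ℕ.<⇒≢ 0<m (sym e₁) })
          0<m′ : 0 < m′
          0<m′ = ℕ.>-nonZero⁻¹ m′ {{m′≢0}}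
          1<g : 1 < g
          1<g = ℕ.≤∧≢⇒< (ℕ.>-nonZero⁻¹ g {{g≢0}}) (λ 1≡g → ¬p (Coprimality.gcd≡1⇒coprime (sym 1≡g)))
          m′<m : m′ < m
          m′<m = ℕ.<-≤-trans (ℕ.m<m*n m′ g {{m′≢0}} 1<g) (ℕ.≤-reflexive (sym e₁))
          -- From (1 + Q x) γ = m follows γ = m - Q x γ, where g divides both m and Q. Hence g
          -- divides γ and can be cancelled from the relation.
          γ′ = ιₙ m′ + - (ιₙ k * x c * γ)
          γ≡ : γ ≡ ιₙ g * γ′
          γ≡ = begin
            γ                                              ≡⟨ solve 2 (λ y γ → γ := (con (+ 1) :+ y) :* γ :- y :* γ) refl (ιₙ Q * x c) γ ⟩
            (1# + ιₙ Q * x c) * γ + - (ιₙ Q * x c * γ)     ≡⟨ cong₂ (λ u v → u + - (v * x c * γ)) (trans (cong (_* γ) (sym (≡1 c))) (sym e)) (trans (cong ιₙ e₂) (ιₙ-* k g)) ⟩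
            ιₙ m + - (ιₙ k * ιₙ g * x c * γ)               ≡⟨ cong (_+ - (ιₙ k * ιₙ g * x c * γ)) (trans (cong ιₙ e₁) (ιₙ-* m′ g)) ⟩
            ιₙ m′ * ιₙ g + - (ιₙ k * ιₙ g * x c * γ)       ≡⟨ solve 5 (λ m g k x γ → m :* g :- k :* g :* x :* γ := g :* (m :- k :* x :* γ)) refl (ιₙ m′) (ιₙ g) (ιₙ k) (x c) γ ⟩
            ιₙ g * γ′                                      ∎
          divided : α * γ′ ≡ ιₙ m′
          divided = ιₙ*-cancel g {{g≢0}} (begin
            ιₙ g * (α * γ′)     ≡⟨ solve 3 (λ g a y → g :* (a :* y) := a :* (g :* y)) refl (ιₙ g) α γ′ ⟩
            α * (ιₙ g * γ′)     ≡⟨ cong (α *_) (sym γ≡) ⟩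
            α * γ               ≡⟨ trans (sym e) (trans (cong ιₙ (trans e₁ (ℕ.*-comm m′ g))) (ιₙ-* g m′)) ⟩
            ιₙ g * ιₙ m′        ∎)
          weaken : Result m′ → Result m
          weaken (n , 0<n , n≤ , rest) = n , 0<n , ℕ.≤-trans n≤ (ℕ.<⇒≤ m′<m) , rest

  -- Associated cone elements are equal: their ratio is small and congruent to 1 modulo Q.
  associates-equal : 5 < Q → ∀ (c d : Cone) → element c ∣ element d → element d ∣ element c → element c ≡ element d
  associates-equal 5<Q c d c∣d d∣c = [ (λ ac≤ad → sym (one-sided d c ac≤ad d∣c)) , (λ ad≤ac → one-sided c d ad≤ac c∣d) ]′ (ℕ.≤-total (a c) (a d))
    where
    one-sided : ∀ (c d : Cone) → a d ≤ a c → element c ∣ element d → element c ≡ element d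
    one-sided c d ad≤ac (ε , e) = trans (sym (*-identityʳ (element c))) (trans (cong (element c *_) (sym ε≡1)) (sym e))
      where
      instance
        a≢0 : NonZero (a c)
        a≢0 = ℕ.>-nonZero (a>0 c)
      -- The quotient bound contributes 2, and ‖a + w‖ ≤ 2a another 2. With the norm 1 of the unit
      -- element this makes ‖ε - 1‖ ≤ 5, whence the requirement 5 < Q.
      ‖ε‖≤4 : ‖ ε ‖ ≤ 4
      ‖ε‖≤4 = ℕ.*-cancelˡ-≤ (a c) (begin
        a c ℕ.* ‖ ε ‖                         ≤⟨ quotient-bound c (sym e) ⟩
        2 ℕ.* ‖ element d ‖                   ≤⟨ ℕ.*-monoʳ-≤ 2 (ℕ.≤-trans (‖+‖ (ιₙ (a d)) (w d)) (ℕ.+-mono-≤ (ℕ.≤-reflexive (‖ι‖ (+ a d))) (w≤a d))) ⟩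
        2 ℕ.* (a d ℕ.+ a d)                   ≤⟨ ℕ.*-monoʳ-≤ 2 (ℕ.+-mono-≤ ad≤ac ad≤ac) ⟩
        2 ℕ.* (a c ℕ.+ a c)                   ≡⟨ +-*-Solver.solve 1 (λ a → +-*-Solver.con 2 +-*-Solver.:* (a +-*-Solver.:+ a) +-*-Solver.:= a +-*-Solver.:* +-*-Solver.con 4) refl (a c) ⟩
        a c ℕ.* 4                             ∎)
        where open ℕ.≤-Reasoning
      Q∣ε-1 : ιₙ Q ∣ (ε + - 1#)
      Q∣ε-1 = x d + - (x c * ε) , (begin
        ε + - 1#                                                  ≡⟨ solve 3 (λ q x e → e :- con (+ 1) := (con (+ 1) :+ q :* x) :* e :- con (+ 1) :- q :* x :* e) refl (ιₙ Q) (x c) ε ⟩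
        (1# + ιₙ Q * x c) * ε + - 1# + - (ιₙ Q * x c * ε)         ≡⟨ cong (λ z → z + - 1# + - (ιₙ Q * x c * ε)) (trans (cong (_* ε) (sym (≡1 c))) (trans (sym e) (≡1 d))) ⟩
        1# + ιₙ Q * x d + - 1# + - (ιₙ Q * x c * ε)               ≡⟨ solve 4 (λ q x y e → con (+ 1) :+ q :* x :- con (+ 1) :- q :* y :* e := q :* (x :- y :* e)) refl (ιₙ Q) (x d) (x c) ε ⟩
        ιₙ Q * (x d + - (x c * ε))                                ∎)
        where open ≡-Reasoning
      ε≡1 : ε ≡ 1#
      ε≡1 = x-y≡0⇒x≡y (small-multiple Q Q∣ε-1 (ℕ.≤-<-trans (ℕ.≤-trans (‖-‖≤ ε 1#) (ℕ.+-mono-≤ ‖ε‖≤4 (ℕ.≤-reflexive ‖1‖))) 5<Q))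

-- Common multiples that stay coprime to Q

coprimeProduct : ℕ → ℕ → ℕ
coprimeProduct Q zero = 1
coprimeProduct Q (suc n) with coprime? (suc n) Q
... | yes _ = suc n ℕ.* coprimeProduct Q n
... | no _ = coprimeProduct Q n

coprime-* : ∀ {m n k} → Coprime m k → Coprime n k → Coprime (m ℕ.* n) k
coprime-* {m} {n} cm cn {d} (d∣mn , d∣k) = cn (Coprimality.coprime-divisor (λ { (i∣d , i∣m) → cm (i∣m , ℕ∣.∣-trans i∣d d∣k) }) d∣mn , d∣k)

coprimeProduct-coprime : ∀ Q n → Coprime (coprimeProduct Q n) Q
coprimeProduct-coprime Q zero = Coprimality.1-coprimeTo Q
coprimeProduct-coprime Q (suc n) with coprime? (suc n) Q
... | yes p = coprime-* {suc n} {coprimeProduct Q n} p (coprimeProduct-coprime Q n)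
... | no _ = coprimeProduct-coprime Q n

∣coprimeProduct : ∀ Q n m → 0 < m → m ≤ n → Coprime m Q → m ∣ℕ coprimeProduct Q n
∣coprimeProduct Q zero (suc m) _ () _
∣coprimeProduct Q (suc n) m 0<m m≤n c with coprime? (suc n) Q | ℕ.m≤n⇒m<n∨m≡n m≤n
... | yes _ | inj₁ (s≤s m≤n′) = ℕ∣.∣n⇒∣m*n (suc n) (∣coprimeProduct Q n m 0<m m≤n′ c)
... | yes _ | inj₂ refl = ℕ∣.m∣m*n (coprimeProduct Q n)
... | no _ | inj₁ (s≤s m≤n′) = ∣coprimeProduct Q n m 0<m m≤n′ c
... | no ¬p | inj₂ refl = ⊥-elim (¬p c)

-- The counting argument

open +-*-Solver using () renaming (solve to solveℕ; _:+_ to _⟨+⟩_; _:*_ to _⟨*⟩_; _:=_ to _⟨=⟩_; con to numeral)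

module Counting
  (R : Order) (m″ : ℕ) (prime-ℓ : Prime (suc (suc m″)))
  (ζ : Order.Carrier R) (ζ^ℓ≡1 : Order._^_ R ζ (suc (suc m″)) ≡ Order.1# R)
  (∑ζ≡0 : ∀ j → 0 < j → j < suc (suc m″) → Order.∑ R (suc (suc m″)) (λ i → Order._^_ R ζ (i ℕ.* j)) ≡ Order.0# R)
  (domain : Order.IsDomain R)
  (b : Order.Carrier R)
  (no-root : ∀ u t → Order._^_ R u (suc (suc m″)) ≡ Order._*_ R (Order._^_ R t (suc (suc m″))) b → t ≡ Order.0# R)
  where

  open Order R
  open OrderArithmetic R
  open IntegerMultiple domain
  open RootExtension R (suc m″) prime-ℓ ζ ζ^ℓ≡1 ∑ζ≡0 domain b
  open Solver using (solve; _:+_; _:-_; _:*_; :-_; _:=_; con)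

  private
    module Sₒ = Order extension

  -- A rank of 0 would let `code` identify 0 and 1.
  rank>0 : 0 < rank
  rank>0 = ℕ.n≢0⇒n>0 (λ rank≡0 → 1≢0 (code-injective 1 1# 0# (ℕ.≤-reflexive ‖1‖) (ℕ.≤-trans (ℕ.≤-reflexive ‖0‖′) z≤n) (unique (cong (3 ℕ.^_) rank≡0) (code 1 1#) (code 1 0#))))
    where
    ‖0‖′ : ‖ 0# ‖ ≡ 0
    ‖0‖′ = Characteristic0.‖0‖ R
    unique : ∀ {n} → n ≡ 1 → (i j : Fin n) → i ≡ j
    unique refl Fin.zero Fin.zero = refl

  -- A ring homomorphism modulo M as soon as x ^ ℓ = b modulo M.
  evalAt : ∀ {n} → Carrier → Vec Carrier n → Carrier
  evalAt x [] = 0#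
  evalAt x (a ∷ as) = a + x * evalAt x as

  evalAt-⊕ : ∀ {n} x (u v : Vec Carrier n) → evalAt x (u ⊕ v) ≡ evalAt x u + evalAt x v
  evalAt-⊕ x [] [] = sym (+-identityˡ 0#)
  evalAt-⊕ x (a ∷ u) (c ∷ v) = trans (cong (λ z → a + c + x * z) (evalAt-⊕ x u v))
    (solve 5 (λ a c x u v → a :+ c :+ x :* (u :+ v) := (a :+ x :* u) :+ (c :+ x :* v)) refl a c x (evalAt x u) (evalAt x v))

  evalAt-∙ : ∀ {n} x r (v : Vec Carrier n) → evalAt x (r ∙ v) ≡ r * evalAt x v
  evalAt-∙ x r [] = sym (zeroʳ r)
  evalAt-∙ x r (a ∷ v) = trans (cong (λ z → r * a + x * z) (evalAt-∙ x r v)) (solve 4 (λ r a x v → r :* a :+ x :* (r :* v) := r :* (a :+ x :* v)) refl r a x (evalAt x v))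

  evalAt-const : ∀ x r → evalAt x (const r) ≡ r
  evalAt-const x r = trans (cong (λ z → r + x * z) (zeros m′)) (solve 2 (λ r x → r :+ x :* con (+ 0) := r) refl r x)
    where
    m′ = suc m″
    zeros : ∀ n → evalAt x (replicate n 0#) ≡ 0#
    zeros zero = refl
    zeros (suc n) = trans (cong (λ z → 0# + x * z) (zeros n)) (solve 1 (λ x → con (+ 0) :+ x :* con (+ 0) := con (+ 0)) refl x)

  evalAt-shift : ∀ {n} x a (v : Vec Carrier n) → evalAt x (a ∷ v) ≡ evalAt x (shift a v) + x ^ n * carry a v
  evalAt-shift x a [] = solve 2 (λ a x → a :+ x :* con (+ 0) := con (+ 0) :+ con (+ 1) :* a) refl a x
  evalAt-shift {suc n} x a (c ∷ v) = trans (cong (λ z → a + x * z) (evalAt-shift x c v))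
    (solve 5 (λ a x e p y → a :+ x :* (e :+ p :* y) := a :+ x :* e :+ x :* p :* y) refl a x (evalAt x (shift c v)) (x ^ n) (carry c v))

  module _ {M x : Carrier} (x^ℓ≡b : x ^ ℓ ≡ b [mod M ]) where

    evalAt-y· : ∀ v → evalAt x (y· v) ≡ x * evalAt x v [mod M ]
    evalAt-y· (a ∷ v) = mod-trans (mod-reflexive (cong (evalAt x) (y·-∷ a v))) (mod-sym (mod-trans
      (mod-reflexive (trans (cong (x *_) (evalAt-shift x a v)) (solve 4 (λ x e p y → x :* (e :+ p :* y) := y :* (x :* p) :+ x :* e) refl x (evalAt x (shift a v)) (x ^ suc m″) (carry a v))))
      (mod-+ (mod-* (mod-reflexive refl) x^ℓ≡b) (mod-reflexive refl))))

    evalAt-⊗ : ∀ {n} (as : Vec Carrier n) v → evalAt x (horner as v) ≡ evalAt x as * evalAt x v [mod M ]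
    evalAt-⊗ [] v = mod-reflexive (trans (trans (cong (evalAt x) (sym (0∙ v))) (evalAt-∙ x 0# v)) refl)
    evalAt-⊗ (a ∷ as) v = mod-trans (mod-reflexive (trans (evalAt-⊕ x (a ∙ v) (y· (horner as v))) (cong (_+ evalAt x (y· (horner as v))) (evalAt-∙ x a v))))
      (mod-trans (mod-+ (mod-reflexive refl) (mod-trans (evalAt-y· (horner as v)) (mod-* (mod-reflexive refl) (evalAt-⊗ as v))))
        (mod-reflexive (solve 4 (λ a v x e → a :* v :+ x :* (e :* v) := (a :+ x :* e) :* v) refl a (evalAt x v) x (evalAt x as))))

    evalAt-∏ : ∀ n f → evalAt x (S.∏ n f) ≡ ∏ n (λ i → evalAt x (f i)) [mod M ]
    evalAt-∏ zero f = mod-reflexive (evalAt-const x 1#)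
    evalAt-∏ (suc n) f = mod-trans (evalAt-⊗ (S.∏ n f) (f n)) (mod-* (evalAt-∏ n f) (mod-reflexive refl))

  twistBound : ℕ → ℕ
  twistBound i = suc (κ ℕ.* ‖ ζ ^ i ‖) ℕ.^ ℓ

  norm-twist : ∀ {n} g (v : Vec Carrier n) → norm (twist g v) ≤ suc (κ ℕ.* ‖ g ‖) ℕ.^ n ℕ.* norm v
  norm-twist g [] = z≤n
  norm-twist {suc n} g (x ∷ v) = ℕ.⊔-lub
    (ℕ.≤-trans (ℕ.m≤m⊔n ‖ x ‖ (norm v)) (ℕ.m≤n*m N (c ℕ.^ suc n) {{ℕ.m^n≢0 c (suc n)}}))
    (begin
      norm (g ∙ twist g v)                       ≤⟨ norm-∙ g (twist g v) ⟩
      κ ℕ.* (‖ g ‖ ℕ.* norm (twist g v))         ≡⟨ sym (ℕ.*-assoc κ ‖ g ‖ _) ⟩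
      κ ℕ.* ‖ g ‖ ℕ.* norm (twist g v)           ≤⟨ ℕ.*-mono-≤ (ℕ.n≤1+n (κ ℕ.* ‖ g ‖)) (ℕ.≤-trans (norm-twist g v) (ℕ.*-monoʳ-≤ (c ℕ.^ n) (ℕ.m≤n⊔m ‖ x ‖ (norm v)))) ⟩
      c ℕ.* (c ℕ.^ n ℕ.* N)                      ≡⟨ sym (ℕ.*-assoc c (c ℕ.^ n) N) ⟩
      c ℕ.^ suc n ℕ.* N                          ∎)
    where
    open ℕ.≤-Reasoning
    c = suc (κ ℕ.* ‖ g ‖)
    N = ‖ x ‖ ⊔ norm v

  productBound : ℕ → ℕ
  productBound zero = 1
  productBound (suc n) = Sₒ.κ ℕ.* (productBound n ℕ.* twistBound n)

  norm-∏σ : ∀ n β → norm (S.∏ n (λ i → σ i β)) ≤ productBound n ℕ.* norm β ℕ.^ n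
  norm-∏σ zero β = ℕ.≤-reflexive (trans Sₒ.‖1‖ refl)
  norm-∏σ (suc n) β = begin
    norm (S.∏ n (λ i → σ i β) ⊗ σ n β)                                     ≤⟨ Sₒ.‖*‖ (S.∏ n (λ i → σ i β)) (σ n β) ⟩
    Sₒ.κ ℕ.* (norm (S.∏ n (λ i → σ i β)) ℕ.* norm (σ n β))                 ≤⟨ ℕ.*-monoʳ-≤ Sₒ.κ (ℕ.*-mono-≤ (norm-∏σ n β) (norm-twist (ζ ^ n) β)) ⟩
    Sₒ.κ ℕ.* (productBound n ℕ.* norm β ℕ.^ n ℕ.* (twistBound n ℕ.* norm β))  ≡⟨ solveℕ 5 (λ k p x t y → k ⟨*⟩ (p ⟨*⟩ x ⟨*⟩ (t ⟨*⟩ y)) ⟨=⟩ k ⟨*⟩ (p ⟨*⟩ t) ⟨*⟩ (y ⟨*⟩ x)) refl Sₒ.κ (productBound n) (norm β ℕ.^ n) (twistBound n) (norm β) ⟩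
    productBound (suc n) ℕ.* norm β ℕ.^ suc n                              ∎
    where open ℕ.≤-Reasoning

  ν₀ : V → Carrier
  ν₀ β = head (ν β)

  -- The norm is a form of degree ℓ in the coordinates, and `norm β` enters through one conjugate at
  -- a time.
  ‖ν₀‖ : ∀ β → ‖ ν₀ β ‖ ≤ productBound ℓ ℕ.* norm β ℕ.^ ℓ
  ‖ν₀‖ β = ℕ.≤-trans (head≤ (ν β)) (norm-∏σ ℓ β)
    where
    head≤ : ∀ (v : V) → ‖ head v ‖ ≤ norm v
    head≤ (x ∷ v) = ℕ.m≤m⊔n ‖ x ‖ (norm v)

  -- `h` measures the distance of the boxes from the origin in units of their side: h ≥ 4κ makes `w`
  -- small against `a`, and h > 3 keeps dyadic levels apart. `c₁` makes a box of side K in the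
  -- extension larger than the number of pairs of residues. `cτ` bounds the quotient of a norm
  -- `ν₀ β` by α α′; such a quotient divides a positive integer up to `multipleBound cτ`, and `q` is
  -- divisible by all of these. J is the number of levels; it exceeds the ratio between the number
  -- of candidates β and the number of pairs on one level.
  module Parameters
    (h c₁ : ℕ) (3<h : 3 < h) (4κ≤h : 4 ℕ.* κ ≤ h) (81h²<c₁ : 81 ℕ.* (h ℕ.* h) < c₁)
    (cτ : ℕ) (cτ≥ : 4 ℕ.* (productBound ℓ ℕ.* (2 ℕ.^ ℓ ℕ.* c₁ ℕ.^ ℓ)) ≤ cτ)
    (q g : ℕ) (5<q : 5 < q) (small∣q : ∀ N → 0 < N → N ≤ multipleBound cτ → N ∣ℕ q)
    (Q : ℕ) (Q≡ : Q ≡ q ℕ.^ ℓ)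
    (J : ℕ) (J≡ : J ≡ g ℕ.* ℓ) (J> : (5 ℕ.^ ℓ ℕ.* c₁ ℕ.^ ℓ ℕ.* (Q ℕ.* Q)) ℕ.^ rank < J)
    where

    -- Both scales carry a factor Q, so K ^ ℓ has to be a constant times Q ² 2 ^ J; this is why Q
    -- and 2 ^ J are chosen as ℓ-th powers.
    K : ℕ
    K = c₁ ℕ.* (q ℕ.* q) ℕ.* 2 ℕ.^ g

    K^ℓ : K ℕ.^ ℓ ≡ c₁ ℕ.^ ℓ ℕ.* (Q ℕ.* Q) ℕ.* 2 ℕ.^ J
    K^ℓ = begin
      K ℕ.^ ℓ                                            ≡⟨ ^-distribʳ-* ℓ (c₁ ℕ.* (q ℕ.* q)) (2 ℕ.^ g) ⟩
      (c₁ ℕ.* (q ℕ.* q)) ℕ.^ ℓ ℕ.* (2 ℕ.^ g) ℕ.^ ℓ       ≡⟨ cong₂ ℕ._*_ (trans (^-distribʳ-* ℓ c₁ (q ℕ.* q)) (cong (c₁ ℕ.^ ℓ ℕ.*_) (trans (^-distribʳ-* ℓ q q) (cong₂ ℕ._*_ (sym Q≡) (sym Q≡))))) (trans (ℕ.^-*-assoc 2 g ℓ) (cong (2 ℕ.^_) (sym J≡))) ⟩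
      c₁ ℕ.^ ℓ ℕ.* (Q ℕ.* Q) ℕ.* 2 ℕ.^ J                 ∎
      where open ≡-Reasoning

    q∣Q : q ∣ℕ Q
    q∣Q = subst (q ∣ℕ_) (sym Q≡) (ℕ∣.m∣m*n (q ℕ.^ suc m″))

    5<Q : 5 < Q
    5<Q = ℕ.<-≤-trans 5<q (ℕ.≤-trans (ℕ.m≤m*n q (q ℕ.^ suc m″) {{ℕ.m^n≢0 q (suc m″) {{q≢0}}}}) (ℕ.≤-reflexive (sym Q≡)))
      where
      q≢0 : NonZero q
      q≢0 = ℕ.>-nonZero (ℕ.<-trans (s≤s z≤n) 5<q)

    0<Q : 0 < Q
    0<Q = ℕ.<-trans (s≤s z≤n) 5<Q

    instance
      Q≢0 : NonZero Q
      Q≢0 = ℕ.>-nonZero 0<Q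

    0<h : 0 < h
    0<h = ℕ.<-trans (s≤s z≤n) 3<h

    open ConeArithmetic R Q
    open Cone

    scale : ℕ → ℕ
    scale j = Q ℕ.* (h ℕ.* 2 ℕ.^ j)

    0<scale : ∀ j → 0 < scale j
    0<scale j = ℕ.*-mono-≤ 0<Q (ℕ.*-mono-≤ 0<h (ℕ.m^n>0 2 j))

    -- A box of side 2 ^ j is translated by h · 2 ^ j, scaled by Q and shifted by 1, so that the
    -- element is 1 modulo Q.
    cone : ∀ j → Fin ((2 ℕ.^ j) ℕ.^ rank) → Cone
    cone j v = record
      { a = suc (scale j)
      ; w = ιₙ Q * box (2 ℕ.^ j) v
      ; x = ιₙ (h ℕ.* 2 ℕ.^ j) + box (2 ℕ.^ j) v
      ; a>0 = s≤s z≤n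
      ; 4κw≤a = begin
          4 ℕ.* (κ ℕ.* ‖ ιₙ Q * box (2 ℕ.^ j) v ‖)     ≤⟨ ℕ.*-monoʳ-≤ 4 (ℕ.*-monoʳ-≤ κ ‖w‖≤) ⟩
          4 ℕ.* (κ ℕ.* (Q ℕ.* 2 ℕ.^ j))               ≡⟨ solveℕ 3 (λ k q p → numeral 4 ⟨*⟩ (k ⟨*⟩ (q ⟨*⟩ p)) ⟨=⟩ numeral 4 ⟨*⟩ k ⟨*⟩ (q ⟨*⟩ p)) refl κ Q (2 ℕ.^ j) ⟩
          4 ℕ.* κ ℕ.* (Q ℕ.* 2 ℕ.^ j)                 ≤⟨ ℕ.*-monoˡ-≤ (Q ℕ.* 2 ℕ.^ j) 4κ≤h ⟩
          h ℕ.* (Q ℕ.* 2 ℕ.^ j)                       ≡⟨ solveℕ 3 (λ k q p → k ⟨*⟩ (q ⟨*⟩ p) ⟨=⟩ q ⟨*⟩ (k ⟨*⟩ p)) refl h Q (2 ℕ.^ j) ⟩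
          scale j                                     ≤⟨ ℕ.n≤1+n (scale j) ⟩
          suc (scale j)                               ∎
      ; w≤a = ℕ.≤-trans ‖w‖≤ (ℕ.≤-trans (ℕ.*-monoʳ-≤ Q (ℕ.m≤n*m (2 ℕ.^ j) h {{ℕ.>-nonZero 0<h}})) (ℕ.n≤1+n (scale j)))
      ; ≡1 = trans (cong (_+ ιₙ Q * box (2 ℕ.^ j) v) (trans (ιₙ-suc (scale j)) (cong (λ z → 1# + z) (ιₙ-* Q (h ℕ.* 2 ℕ.^ j)))))
          (solve 3 (λ q p v → con (+ 1) :+ q :* p :+ q :* v := con (+ 1) :+ q :* (p :+ v)) refl (ιₙ Q) (ιₙ (h ℕ.* 2 ℕ.^ j)) (box (2 ℕ.^ j) v))
      }
      where
      open ℕ.≤-Reasoning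
      ‖w‖≤ : ‖ ιₙ Q * box (2 ℕ.^ j) v ‖ ≤ Q ℕ.* 2 ℕ.^ j
      ‖w‖≤ = ℕ.≤-trans (ℕ.≤-reflexive (‖ι*‖ (+ Q) (box (2 ℕ.^ j) v))) (ℕ.*-monoʳ-≤ Q (‖box‖ (2 ℕ.^ j) v))

    x-injective : ∀ (c d : Cone) → element c ≡ element d → x c ≡ x d
    x-injective c d e = ιₙ*-cancel Q (begin
      ιₙ Q * x c                  ≡⟨ solve 2 (λ q x → q :* x := con (+ 1) :+ q :* x :- con (+ 1)) refl (ιₙ Q) (x c) ⟩
      1# + ιₙ Q * x c + - 1#      ≡⟨ cong (_+ - 1#) (trans (sym (≡1 c)) (trans e (≡1 d))) ⟩
      1# + ιₙ Q * x d + - 1#      ≡⟨ solve 2 (λ q x → con (+ 1) :+ q :* x :- con (+ 1) := q :* x) refl (ιₙ Q) (x d) ⟩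
      ιₙ Q * x d                  ∎)
      where open ≡-Reasoning

    -- The cofactors `x` of level j lie within 2 ^ j of h · 2 ^ j, and for h > 3 these balls are
    -- disjoint for different j.
    level-injective : ∀ j j′ v v′ → element (cone j v) ≡ element (cone j′ v′) → j ≡ j′
    level-injective j j′ v v′ e = compare (ℕ.<-cmp j j′)
      where
      separated : ∀ j j′ v v′ → element (cone j v) ≡ element (cone j′ v′) → j < j′ → ⊥
      separated j j′ v v′ e j<j′ = contradiction (ℕ.m≤n⇒∃[o]m+o≡n j<j′)
        where
        bound : h ℕ.* 2 ℕ.^ j′ ≤ h ℕ.* 2 ℕ.^ j ℕ.+ 2 ℕ.^ j ℕ.+ 2 ℕ.^ j′
        bound = begin
          h ℕ.* 2 ℕ.^ j′                                                  ≡⟨ sym (‖ι‖ (+ (h ℕ.* 2 ℕ.^ j′))) ⟩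
          ‖ ιₙ (h ℕ.* 2 ℕ.^ j′) ‖                                         ≡⟨ cong ‖_‖ (trans (solve 2 (λ p v → p := p :+ v :- v) refl (ιₙ (h ℕ.* 2 ℕ.^ j′)) (box (2 ℕ.^ j′) v′)) (cong (_+ - box (2 ℕ.^ j′) v′) (sym (x-injective (cone j v) (cone j′ v′) e)))) ⟩
          ‖ ιₙ (h ℕ.* 2 ℕ.^ j) + box (2 ℕ.^ j) v + - box (2 ℕ.^ j′) v′ ‖  ≤⟨ ‖-‖≤ (ιₙ (h ℕ.* 2 ℕ.^ j) + box (2 ℕ.^ j) v) (box (2 ℕ.^ j′) v′) ⟩
          ‖ ιₙ (h ℕ.* 2 ℕ.^ j) + box (2 ℕ.^ j) v ‖ ℕ.+ ‖ box (2 ℕ.^ j′) v′ ‖  ≤⟨ ℕ.+-mono-≤ (ℕ.≤-trans (‖+‖ (ιₙ (h ℕ.* 2 ℕ.^ j)) (box (2 ℕ.^ j) v)) (ℕ.+-mono-≤ (ℕ.≤-reflexive (‖ι‖ (+ (h ℕ.* 2 ℕ.^ j)))) (‖box‖ (2 ℕ.^ j) v))) (‖box‖ (2 ℕ.^ j′) v′) ⟩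
          h ℕ.* 2 ℕ.^ j ℕ.+ 2 ℕ.^ j ℕ.+ 2 ℕ.^ j′                          ∎
          where open ℕ.≤-Reasoning
        contradiction : (∃ λ o → suc j ℕ.+ o ≡ j′) → ⊥
        contradiction (o , refl) = ℕ.<⇒≱ 3<h (ℕ.+-cancelˡ-≤ h h 3 (ℕ.*-cancelʳ-≤ (h ℕ.+ h) (h ℕ.+ 3) (2 ℕ.^ (j ℕ.+ o)) {{ℕ.m^n≢0 2 (j ℕ.+ o)}} (begin
          (h ℕ.+ h) ℕ.* P                              ≡⟨ solveℕ 2 (λ h p → (h ⟨+⟩ h) ⟨*⟩ p ⟨=⟩ h ⟨*⟩ (p ⟨+⟩ (p ⟨+⟩ numeral 0))) refl h P ⟩
          h ℕ.* 2 ℕ.^ (suc j ℕ.+ o)                    ≤⟨ bound ⟩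
          h ℕ.* 2 ℕ.^ j ℕ.+ 2 ℕ.^ j ℕ.+ 2 ℕ.^ (suc j ℕ.+ o)  ≤⟨ ℕ.+-monoˡ-≤ (2 ℕ.^ (suc j ℕ.+ o)) (ℕ.+-mono-≤ (ℕ.*-monoʳ-≤ h 2^j≤P) 2^j≤P) ⟩
          h ℕ.* P ℕ.+ P ℕ.+ 2 ℕ.* P                    ≡⟨ solveℕ 2 (λ h p → h ⟨*⟩ p ⟨+⟩ p ⟨+⟩ numeral 2 ⟨*⟩ p ⟨=⟩ (h ⟨+⟩ numeral 3) ⟨*⟩ p) refl h P ⟩
          (h ℕ.+ 3) ℕ.* P                              ∎)))
          where
          open ℕ.≤-Reasoning
          P = 2 ℕ.^ (j ℕ.+ o)
          2^j≤P : 2 ℕ.^ j ≤ P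
          2^j≤P = ℕ.^-monoʳ-≤ 2 (ℕ.m≤m+n j o)
      compare : Tri (j < j′) (j ≡ j′) (j′ < j) → j ≡ j′
      compare (tri≈ _ j≡j′ _) = j≡j′
      compare (tri< j<j′ _ _) = ⊥-elim (separated j j′ v v′ e j<j′)
      compare (tri> _ _ j′<j) = ⊥-elim (separated j′ j v′ v (sym e) j′<j)

    cone-injective : ∀ j v v′ → element (cone j v) ≡ element (cone j v′) → v ≡ v′
    cone-injective j v v′ e = box-injective (2 ℕ.^ j) v v′ (begin
      box (2 ℕ.^ j) v             ≡⟨ solve 2 (λ p v → v := p :+ v :- p) refl p (box (2 ℕ.^ j) v) ⟩
      p + box (2 ℕ.^ j) v + - p   ≡⟨ cong (_+ - p) (x-injective (cone j v) (cone j v′) e) ⟩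
      p + box (2 ℕ.^ j) v′ + - p  ≡⟨ solve 2 (λ p v → p :+ v :- p := v) refl p (box (2 ℕ.^ j) v′) ⟩
      box (2 ℕ.^ j) v′            ∎)
      where
      open ≡-Reasoning
      p = ιₙ (h ℕ.* 2 ℕ.^ j)

    residues : Cone → ℕ
    residues c = suc (2 ℕ.* (2 ℕ.* a c))

    residues≤ : ∀ j v → residues (cone j v) ≤ 9 ℕ.* scale j
    residues≤ j v = begin
      suc (2 ℕ.* (2 ℕ.* suc (scale j)))    ≡⟨ solveℕ 1 (λ s → numeral 1 ⟨+⟩ numeral 2 ⟨*⟩ (numeral 2 ⟨*⟩ (numeral 1 ⟨+⟩ s)) ⟨=⟩ numeral 5 ⟨*⟩ numeral 1 ⟨+⟩ numeral 4 ⟨*⟩ s) refl (scale j) ⟩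
      5 ℕ.* 1 ℕ.+ 4 ℕ.* scale j            ≤⟨ ℕ.+-monoˡ-≤ (4 ℕ.* scale j) (ℕ.*-monoʳ-≤ 5 (0<scale j)) ⟩
      5 ℕ.* scale j ℕ.+ 4 ℕ.* scale j      ≡⟨ sym (ℕ.*-distribʳ-+ (scale j) 5 4) ⟩
      9 ℕ.* scale j                        ∎
      where open ℕ.≤-Reasoning

    -- Each cone contributes at most 9 times its scale, whence the constant 81 h ² below `c₁`.
    residues*residues< : ∀ j j′ v v′ → j ℕ.+ j′ ≡ J → residues (cone j v) ℕ.* residues (cone j′ v′) < K ℕ.^ ℓ
    residues*residues< j j′ v v′ j+j′≡J = begin-strict
      residues (cone j v) ℕ.* residues (cone j′ v′)         ≤⟨ ℕ.*-mono-≤ (residues≤ j v) (residues≤ j′ v′) ⟩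
      9 ℕ.* scale j ℕ.* (9 ℕ.* scale j′)                    ≡⟨ solveℕ 4 (λ q h x y → numeral 9 ⟨*⟩ (q ⟨*⟩ (h ⟨*⟩ x)) ⟨*⟩ (numeral 9 ⟨*⟩ (q ⟨*⟩ (h ⟨*⟩ y))) ⟨=⟩ numeral 81 ⟨*⟩ (h ⟨*⟩ h) ⟨*⟩ ((q ⟨*⟩ q) ⟨*⟩ (x ⟨*⟩ y))) refl Q h (2 ℕ.^ j) (2 ℕ.^ j′) ⟩
      81 ℕ.* (h ℕ.* h) ℕ.* (Q ℕ.* Q ℕ.* (2 ℕ.^ j ℕ.* 2 ℕ.^ j′))  ≡⟨ cong (λ z → 81 ℕ.* (h ℕ.* h) ℕ.* (Q ℕ.* Q ℕ.* z)) (trans (sym (ℕ.^-distribˡ-+-* 2 j j′)) (cong (2 ℕ.^_) j+j′≡J)) ⟩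
      81 ℕ.* (h ℕ.* h) ℕ.* (Q ℕ.* Q ℕ.* 2 ℕ.^ J)            <⟨ ℕ.*-monoˡ-< (Q ℕ.* Q ℕ.* 2 ℕ.^ J) {{nonzero}} 81h²<c₁ ⟩
      c₁ ℕ.* (Q ℕ.* Q ℕ.* 2 ℕ.^ J)                          ≤⟨ ℕ.*-monoˡ-≤ (Q ℕ.* Q ℕ.* 2 ℕ.^ J) (ℕ.m≤m*n c₁ (c₁ ℕ.^ suc m″) {{ℕ.m^n≢0 c₁ (suc m″) {{c₁≢0}}}}) ⟩
      c₁ ℕ.^ ℓ ℕ.* (Q ℕ.* Q ℕ.* 2 ℕ.^ J)                    ≡⟨ trans (sym (ℕ.*-assoc (c₁ ℕ.^ ℓ) (Q ℕ.* Q) (2 ℕ.^ J))) (sym K^ℓ) ⟩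
      K ℕ.^ ℓ                                               ∎
      where
      open ℕ.≤-Reasoning
      c₁≢0 : NonZero c₁
      c₁≢0 = ℕ.>-nonZero (ℕ.≤-<-trans z≤n 81h²<c₁)
      nonzero : NonZero (Q ℕ.* Q ℕ.* 2 ℕ.^ J)
      nonzero = ℕ.>-nonZero (ℕ.*-mono-≤ (ℕ.*-mono-≤ 0<Q 0<Q) (ℕ.m^n>0 2 J))

    maxResidues : ℕ
    maxResidues = (9 ℕ.* scale J) ℕ.^ rank

    -- A multiple of all cone elements up to level J: each divides a positive integer of size at
    -- most `maxResidues` that is coprime to Q, and all these integers divide `W₀`.
    W₀ : ℕ
    W₀ = coprimeProduct Q maxResidues

    element∣W₀ : ∀ j v → j ≤ J → element (cone j v) ∣ ιₙ W₀
    element∣W₀ j v j≤J = fromMultiple (multipleOf (cone j v))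
      where
      fromMultiple : (∃ λ m → 0 < m × m ≤ residues (cone j v) ℕ.^ rank × element (cone j v) ∣ ιₙ m) → element (cone j v) ∣ ιₙ W₀
      fromMultiple (m , 0<m , m≤ , d) = fromCoprime (coprime-multiple (cone j v) m 0<m d)
        where
        fromCoprime : (∃ λ n → 0 < n × n ≤ m × Coprime n Q × element (cone j v) ∣ ιₙ n) → element (cone j v) ∣ ιₙ W₀
        fromCoprime (n , 0<n , n≤m , c , d) = ∣-trans {element (cone j v)} {ιₙ n} d (∣ℕ⇒∣ι n (+ W₀) (∣coprimeProduct Q maxResidues n 0<n
          (ℕ.≤-trans n≤m (ℕ.≤-trans m≤ (ℕ.^-monoˡ-≤ rank (ℕ.≤-trans (residues≤ j v) (ℕ.*-monoʳ-≤ 9 (ℕ.*-monoʳ-≤ Q (ℕ.*-monoʳ-≤ h (ℕ.^-monoʳ-≤ 2 j≤J)))))))) c))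

    -- When a norm, known modulo W, is divided by α α′, one factor `W₀` cancels α and one cancels
    -- α′; the third leaves a congruence modulo `W₀` for the quotient.
    W : ℕ
    W = W₀ ℕ.* (W₀ ℕ.* W₀)

    W-coprime : Coprime W Q
    W-coprime = coprime-* {W₀} {W₀ ℕ.* W₀} c (coprime-* {W₀} {W₀} c c)
      where
      c = coprimeProduct-coprime Q maxResidues

    -- The count under the assumption of a root modulo W

    module Contradiction (y₀ : Carrier) (y₀^ℓ≡b : y₀ ^ ℓ ≡ b [mod ιₙ W ]) where

      -- Substitution of ζ ^ i y₀ for y. Modulo W these are ring homomorphisms, and their product is
      -- the norm (`ν₀≡∏φ`).
      φ : ℕ → V → Carrier
      φ i β = evalAt y₀ (σ i β)

      φ-difference : ∀ i u v → φ i (u ⊕ ⊖ v) ≡ φ i u + - φ i v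
      φ-difference i u v = trans (cong (evalAt y₀) (trans (cong (twist (ζ ^ i)) (cong (u ⊕_) minus)) (trans (twist-⊕ (ζ ^ i) u _) (cong (σ i u ⊕_) (twist-∙ (ζ ^ i) (- 1#) v)))))
        (trans (evalAt-⊕ y₀ (σ i u) _) (trans (cong (λ z → φ i u + z) (evalAt-∙ y₀ (- 1#) (σ i v))) (cong (λ z → φ i u + z) (solve 1 (λ x → (:- con (+ 1)) :* x := :- x) refl (φ i v)))))
        where
        minus : ⊖ v ≡ (- 1#) ∙ v
        minus = go v
          where
          go : ∀ {n} (v : Vec Carrier n) → ⊖ v ≡ (- 1#) ∙ v
          go [] = refl
          go (x ∷ v) = cong₂ _∷_ (solve 1 (λ x → :- x := (:- con (+ 1)) :* x) refl x) (go v)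

      record Witness (c d : Cone) : Set where
        field
          β : V
          β≢𝟎 : β ≢ 𝟎
          ‖β‖≤ : norm β ≤ 2 ℕ.* K
          divides₀ : element c ∣ φ 0 β
          divides₁ : element d ∣ φ 1 β
      open Witness

      -- There are K ^ (ℓ rank) elements in the box but fewer pairs of residues, so two elements
      -- share both residues; β is their difference, which explains the bound 2K.
      witness : ∀ j j′ v v′ → j ℕ.+ j′ ≡ J → Witness (cone j v) (cone j′ v′)
      witness j j′ v v′ j+j′≡J = finish (pigeonhole counting values)
        where
        c = cone j v
        d = cone j′ v′
        values : Fin (K ℕ.^ Sₒ.rank) → Fin (residues c ℕ.^ rank ℕ.* residues d ℕ.^ rank)
        values i = combine (residue c (φ 0 (Sₒ.box K i))) (residue d (φ 1 (Sₒ.box K i)))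
        counting : residues c ℕ.^ rank ℕ.* residues d ℕ.^ rank < K ℕ.^ Sₒ.rank
        counting = begin-strict
          residues c ℕ.^ rank ℕ.* residues d ℕ.^ rank   ≡⟨ sym (^-distribʳ-* rank (residues c) (residues d)) ⟩
          (residues c ℕ.* residues d) ℕ.^ rank          <⟨ ℕ.^-monoˡ-< rank {{ℕ.>-nonZero rank>0}} (residues*residues< j j′ v v′ j+j′≡J) ⟩
          (K ℕ.^ ℓ) ℕ.^ rank                            ≡⟨ ℕ.^-*-assoc K ℓ rank ⟩
          K ℕ.^ (ℓ ℕ.* rank)                            ∎
          where open ℕ.≤-Reasoning
        Collision : Set
        Collision = ∃₂ λ i i′ → i Fin.< i′ × values i ≡ values i′
        finish : Collision → Witness c d
        finish (i , i′ , i<i′ , e) = record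
          { β = β₁ ⊕ ⊖ β₂
          ; β≢𝟎 = λ β≡𝟎 → Fin.<⇒≢ i<i′ (Sₒ.box-injective K i i′ (S.x-y≡0⇒x≡y β≡𝟎))
          ; ‖β‖≤ = ℕ.≤-trans (OrderArithmetic.‖-‖≤ extension β₁ β₂) (ℕ.≤-trans (ℕ.+-mono-≤ (Sₒ.‖box‖ K i) (Sₒ.‖box‖ K i′)) (ℕ.≤-reflexive (cong (λ z → K ℕ.+ z) (sym (ℕ.+-identityʳ K)))))
          ; divides₀ = subst (element c ∣_) (sym (φ-difference 0 β₁ β₂)) (residue-∣ c (φ 0 β₁) (φ 0 β₂) (proj₁ equal))
          ; divides₁ = subst (element d ∣_) (sym (φ-difference 1 β₁ β₂)) (residue-∣ d (φ 1 β₁) (φ 1 β₂) (proj₂ equal))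
          }
          where
          β₁ = Sₒ.box K i
          β₂ = Sₒ.box K i′
          equal = combine-injective (residue c (φ 0 β₁)) (residue d (φ 1 β₁)) (residue c (φ 0 β₂)) (residue d (φ 1 β₂)) e

      ν₀≡∏φ : ∀ β → ν₀ β ≡ ∏ ℓ (λ i → φ i β) [mod ιₙ W ]
      ν₀≡∏φ β = mod-trans (mod-reflexive (trans (sym (evalAt-const y₀ (ν₀ β))) (cong (evalAt y₀) (sym (ν≡const β))))) (evalAt-∏ y₀^ℓ≡b ℓ (λ i → σ i β))

      ν₀≢0 : ∀ β → β ≢ 𝟎 → ν₀ β ≢ 0#
      ν₀≢0 β β≢𝟎 e = ν≢𝟎 no-root β β≢𝟎 (trans (ν≡const β) (cong const e))

      -- A multiple N of τ is bounded in terms of `cτ`, so N divides q, and q divides Q, to which W₀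
      -- is coprime.
      ι-unit : ∀ {τ} → τ ≢ 0# → ‖ τ ‖ ≤ cτ → ∃ λ s → τ * s ≡ 1# [mod ιₙ W₀ ]
      ι-unit {τ} τ≢0 τ≤ = fromMultiple (integer-multiple τ cτ τ≢0 τ≤)
        where
        fromMultiple : (∃ λ N → 0 < N × N ≤ multipleBound cτ × τ ∣ ιₙ N) → ∃ λ s → τ * s ≡ 1# [mod ιₙ W₀ ]
        fromMultiple (N , 0<N , N≤ , (τ′ , e)) = fromBézout (bézout {W₀} {N} (λ { (d∣W₀ , d∣N) → coprimeProduct-coprime Q maxResidues (d∣W₀ , ℕ∣.∣-trans d∣N (ℕ∣.∣-trans (small∣q N 0<N N≤) q∣Q)) }))
          where
          fromBézout : (∃₂ λ s t → ι s * ιₙ W₀ + ι t * ιₙ N ≡ 1#) → ∃ λ s → τ * s ≡ 1# [mod ιₙ W₀ ]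
          fromBézout (s , t , st) = ι t * τ′ , (- ι s , (begin
            τ * (ι t * τ′) + - 1#                                  ≡⟨ solve 3 (λ τ t τ′ → τ :* (t :* τ′) :- con (+ 1) := t :* (τ :* τ′) :- con (+ 1)) refl τ (ι t) τ′ ⟩
            ι t * (τ * τ′) + - 1#                                  ≡⟨ cong₂ (λ z o → ι t * z + - o) (sym e) (sym st) ⟩
            ι t * ιₙ N + - (ι s * ιₙ W₀ + ι t * ιₙ N)              ≡⟨ solve 4 (λ t n s w → t :* n :- (s :* w :+ t :* n) := w :* (:- s)) refl (ι t) (ιₙ N) (ι s) (ιₙ W₀) ⟩
            ιₙ W₀ * - ι s                                          ∎))
            where open ≡-Reasoning

      -- φ 0 β and φ 1 β equal the given cone elements up to units modulo W₀, because the quotient of ν β by the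
      -- two elements is too small to have a common factor with W₀.
      record Factorised (c d : Cone) (β : V) : Set where
        field
          u₀ u₁ : Carrier
          φ₀ : φ 0 β * u₀ ≡ element c [mod ιₙ W₀ ]
          φ₁ : φ 1 β * u₁ ≡ element d [mod ιₙ W₀ ]

      factorised : ∀ {c d : Cone} (ω : Witness c d) → Q ℕ.* Q ℕ.* 2 ℕ.^ J ≤ a c ℕ.* a d → element c ∣ ιₙ W₀ → element d ∣ ιₙ W₀ → Factorised c d (β ω)
      factorised {c} {d} ω large (c′ , ec) (d′ , ed) = assemble (divides₀ ω) (divides₁ ω) (ν₀≡∏φ (β ω))
        where
        r = ν₀ (β ω)
        ρ = ∏ m″ (λ i → φ (suc (suc i)) (β ω))
        assemble : element c ∣ φ 0 (β ω) → element d ∣ φ 1 (β ω) → r ≡ ∏ ℓ (λ i → φ i (β ω)) [mod ιₙ W ] → Factorised c d (β ω)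
        assemble (γ₀ , e₀) (γ₁ , e₁) (z , ez) = fromUnit (ι-unit τ≢0 ‖τ‖≤)
          where
          -- The norm of β divided by α α′; the error term keeps the factor `W₀`.
          τ = γ₀ * γ₁ * ρ + c′ * d′ * ιₙ W₀ * z
          r≡ : r ≡ element c * (element d * τ)
          r≡ = begin
            r
              ≡⟨ solve 2 (λ r p → r := p :+ (r :- p)) refl r (∏ ℓ (λ i → φ i (β ω))) ⟩
            ∏ ℓ (λ i → φ i (β ω)) + (r + - ∏ ℓ (λ i → φ i (β ω)))
              ≡⟨ cong₂ _+_ (trans (∏-shift (suc m″) (λ i → φ i (β ω))) (cong (φ 0 (β ω) *_) (∏-shift m″ (λ i → φ (suc i) (β ω))))) ez ⟩
            φ 0 (β ω) * (φ 1 (β ω) * ρ) + ιₙ W * z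
              ≡⟨ cong₂ _+_ (cong₂ (λ u v → u * (v * ρ)) e₀ e₁) (cong (_* z) (trans (ιₙ-* W₀ (W₀ ℕ.* W₀)) (cong₂ _*_ ec (trans (ιₙ-* W₀ W₀) (cong (_* ιₙ W₀) ed))))) ⟩
            element c * γ₀ * (element d * γ₁ * ρ) + element c * c′ * (element d * d′ * ιₙ W₀) * z
              ≡⟨ solve 9 (λ c d x y p s t w z → c :* x :* (d :* y :* p) :+ c :* s :* (d :* t :* w) :* z := c :* (d :* (x :* y :* p :+ s :* t :* w :* z))) refl (element c) (element d) γ₀ γ₁ ρ c′ d′ (ιₙ W₀) z ⟩
            element c * (element d * τ) ∎
            where open ≡-Reasoning
          τ≢0 : τ ≢ 0#
          τ≢0 e = ν₀≢0 (β ω) (β≢𝟎 ω) (trans r≡ (trans (cong (λ z → element c * (element d * z)) e) (trans (cong (element c *_) (zeroʳ (element d))) (zeroʳ (element c)))))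
          -- Dividing by α and by α′ costs a factor 2 each, and (2K) ^ ℓ contributes (2 c₁) ^ ℓ Q ²
          -- 2 ^ J, whose last two factors are made up for by a a′.
          ‖τ‖≤ : ‖ τ ‖ ≤ cτ
          ‖τ‖≤ = ℕ.*-cancelˡ-≤ (Q ℕ.* Q ℕ.* 2 ℕ.^ J) {{ℕ.>-nonZero (ℕ.*-mono-≤ (ℕ.*-mono-≤ 0<Q 0<Q) (ℕ.m^n>0 2 J))}} (begin
            X ℕ.* ‖ τ ‖                                          ≤⟨ ℕ.*-monoˡ-≤ ‖ τ ‖ large ⟩
            a c ℕ.* a d ℕ.* ‖ τ ‖                                ≡⟨ ℕ.*-assoc (a c) (a d) ‖ τ ‖ ⟩
            a c ℕ.* (a d ℕ.* ‖ τ ‖)                              ≤⟨ ℕ.*-monoʳ-≤ (a c) (quotient-bound d {τ} refl) ⟩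
            a c ℕ.* (2 ℕ.* ‖ element d * τ ‖)                    ≡⟨ solveℕ 2 (λ a n → a ⟨*⟩ (numeral 2 ⟨*⟩ n) ⟨=⟩ numeral 2 ⟨*⟩ (a ⟨*⟩ n)) refl (a c) ‖ element d * τ ‖ ⟩
            2 ℕ.* (a c ℕ.* ‖ element d * τ ‖)                    ≤⟨ ℕ.*-monoʳ-≤ 2 (quotient-bound c (sym r≡)) ⟩
            2 ℕ.* (2 ℕ.* ‖ r ‖)                                  ≤⟨ ℕ.*-monoʳ-≤ 2 (ℕ.*-monoʳ-≤ 2 (ℕ.≤-trans (‖ν₀‖ (β ω)) (ℕ.*-monoʳ-≤ (productBound ℓ) (ℕ.^-monoˡ-≤ ℓ (‖β‖≤ ω))))) ⟩
            2 ℕ.* (2 ℕ.* (productBound ℓ ℕ.* (2 ℕ.* K) ℕ.^ ℓ))   ≡⟨ cong (λ z → 2 ℕ.* (2 ℕ.* (productBound ℓ ℕ.* z))) (trans (^-distribʳ-* ℓ 2 K) (cong (2 ℕ.^ ℓ ℕ.*_) K^ℓ)) ⟩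
            2 ℕ.* (2 ℕ.* (productBound ℓ ℕ.* (2 ℕ.^ ℓ ℕ.* (c₁ ℕ.^ ℓ ℕ.* (Q ℕ.* Q) ℕ.* 2 ℕ.^ J))))  ≡⟨ solveℕ 5 (λ p t c q j → numeral 2 ⟨*⟩ (numeral 2 ⟨*⟩ (p ⟨*⟩ (t ⟨*⟩ (c ⟨*⟩ q ⟨*⟩ j)))) ⟨=⟩ q ⟨*⟩ j ⟨*⟩ (numeral 4 ⟨*⟩ (p ⟨*⟩ (t ⟨*⟩ c)))) refl (productBound ℓ) (2 ℕ.^ ℓ) (c₁ ℕ.^ ℓ) (Q ℕ.* Q) (2 ℕ.^ J) ⟩
            X ℕ.* (4 ℕ.* (productBound ℓ ℕ.* (2 ℕ.^ ℓ ℕ.* c₁ ℕ.^ ℓ)))  ≤⟨ ℕ.*-monoʳ-≤ X cτ≥ ⟩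
            X ℕ.* cτ                                             ∎)
            where
            open ℕ.≤-Reasoning
            X = Q ℕ.* Q ℕ.* 2 ℕ.^ J
          τ≡ : τ ≡ γ₀ * γ₁ * ρ [mod ιₙ W₀ ]
          τ≡ = c′ * d′ * z , solve 4 (λ p s w z → p :+ s :* w :* z :- p := w :* (s :* z)) refl (γ₀ * γ₁ * ρ) (c′ * d′) (ιₙ W₀) z
          fromUnit : (∃ λ s → τ * s ≡ 1# [mod ιₙ W₀ ]) → Factorised c d (β ω)
          fromUnit (s , e) = record
            -- Since φ 0 β = α γ₀, the product with `u₀` is α γ₀ γ₁ ρ s ≡ α τ s ≡ α.
            { u₀ = γ₁ * ρ * s
            ; u₁ = γ₀ * ρ * s
            ; φ₀ = mod-trans (mod-reflexive (trans (cong (_* (γ₁ * ρ * s)) e₀) (solve 5 (λ c x y p s → c :* x :* (y :* p :* s) := c :* (x :* y :* p :* s)) refl (element c) γ₀ γ₁ ρ s))) (times (element c))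
            ; φ₁ = mod-trans (mod-reflexive (trans (cong (_* (γ₀ * ρ * s)) e₁) (solve 5 (λ c x y p s → c :* y :* (x :* p :* s) := c :* (x :* y :* p :* s)) refl (element d) γ₀ γ₁ ρ s))) (times (element d))
            }
            where
            times : ∀ α → α * (γ₀ * γ₁ * ρ * s) ≡ α [mod ιₙ W₀ ]
            times α = mod-trans (mod-* (mod-reflexive {α} refl) (mod-trans (mod-* (mod-sym τ≡) (mod-reflexive {s} refl)) e)) (mod-reflexive (*-identityʳ α))

      level≥ : ∀ j j′ v v′ → j ℕ.+ j′ ≡ J → Q ℕ.* Q ℕ.* 2 ℕ.^ J ≤ a (cone j v) ℕ.* a (cone j′ v′)
      level≥ j j′ v v′ refl = begin
        Q ℕ.* Q ℕ.* 2 ℕ.^ (j ℕ.+ j′)                   ≡⟨ cong (Q ℕ.* Q ℕ.*_) (ℕ.^-distribˡ-+-* 2 j j′) ⟩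
        Q ℕ.* Q ℕ.* (2 ℕ.^ j ℕ.* 2 ℕ.^ j′)             ≡⟨ ℕ.[m*n]*[o*p]≡[m*o]*[n*p] Q Q (2 ℕ.^ j) (2 ℕ.^ j′) ⟩
        Q ℕ.* 2 ℕ.^ j ℕ.* (Q ℕ.* 2 ℕ.^ j′)             ≤⟨ ℕ.*-mono-≤ (one j) (one j′) ⟩
        suc (scale j) ℕ.* suc (scale j′)               ∎
        where
        open ℕ.≤-Reasoning
        one : ∀ j → Q ℕ.* 2 ℕ.^ j ≤ suc (scale j)
        one j = ℕ.≤-trans (ℕ.*-monoʳ-≤ Q (ℕ.m≤n*m (2 ℕ.^ j) h {{ℕ.>-nonZero 0<h}})) (ℕ.n≤1+n (scale j))

      -- α is a multiple of φ 0 β modulo `W₀`, and α′ divides both φ 0 β and `W₀`; so α′ divides α.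
      -- The same holds for the second components with φ 1.
      determined : ∀ {c d c′ d′ : Cone} (ω : Witness c d) (ω′ : Witness c′ d′) → β ω ≡ β ω′ →
        Factorised c d (β ω) → element c′ ∣ ιₙ W₀ → element d′ ∣ ιₙ W₀ → element c′ ∣ element c × element d′ ∣ element d
      determined {c} {d} {c′} {d′} ω ω′ β≡ F c′∣W₀ d′∣W₀ =
        transfer (Factorised.φ₀ F) c′∣W₀ (subst (λ z → element c′ ∣ φ 0 z) (sym β≡) (divides₀ ω′)) ,
        transfer (Factorised.φ₁ F) d′∣W₀ (subst (λ z → element d′ ∣ φ 1 z) (sym β≡) (divides₁ ω′))
        where
        transfer : ∀ {α α′ p u} → p * u ≡ α [mod ιₙ W₀ ] → α′ ∣ ιₙ W₀ → α′ ∣ p → α′ ∣ α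
        transfer {α} {α′} {p} {u} e α′∣W₀ α′∣p = mod⇒∣ (mod-∣ α′∣W₀ e) (∣-*ʳ {α′} {p} u α′∣p)

      private
        block : ∀ j → j ≤ J → (2 ℕ.^ J) ℕ.^ rank ≡ (2 ℕ.^ j) ℕ.^ rank ℕ.* (2 ℕ.^ (J ℕ.∸ j)) ℕ.^ rank
        block j j≤J = trans (cong (ℕ._^ rank) (trans (cong (2 ℕ.^_) (sym (ℕ.m+[n∸m]≡n j≤J))) (ℕ.^-distribˡ-+-* 2 j (J ℕ.∸ j)))) (^-distribʳ-* rank (2 ℕ.^ j) (2 ℕ.^ (J ℕ.∸ j)))

        subst-injective : ∀ {m n} (e : m ≡ n) {i j : Fin m} → subst Fin e i ≡ subst Fin e j → i ≡ j
        subst-injective refl h = h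

      -- A level j below J, and a number that encodes one position in a box of side 2 ^ j and one in
      -- a box of side 2 ^ (J - j). Every level has the same number (2 ^ J) ^ rank of pairs, and the
      -- J levels supply the logarithm.
      Index : Set
      Index = Fin J × Fin ((2 ℕ.^ J) ℕ.^ rank)

      level : Index → ℕ
      level (j , _) = toℕ j

      level≤ : ∀ i → level i ≤ J
      level≤ (j , _) = ℕ.<⇒≤ (toℕ<n j)

      split : ∀ (i : Index) → Fin ((2 ℕ.^ level i) ℕ.^ rank) × Fin ((2 ℕ.^ (J ℕ.∸ level i)) ℕ.^ rank)
      split i = remQuot ((2 ℕ.^ (J ℕ.∸ level i)) ℕ.^ rank) (subst Fin (block (level i) (level≤ i)) (proj₂ i))

      cone₀ cone₁ : Index → Cone
      cone₀ i = cone (level i) (proj₁ (split i))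
      cone₁ i = cone (J ℕ.∸ level i) (proj₂ (split i))

      index-injective : ∀ i i′ → element (cone₀ i) ≡ element (cone₀ i′) → element (cone₁ i) ≡ element (cone₁ i′) → i ≡ i′
      index-injective i@(j , r) i′@(j′ , r′) e₀ e₁ = same-level (toℕ-injective (level-injective (toℕ j) (toℕ j′) (proj₁ (split i)) (proj₁ (split i′)) e₀)) e₀ e₁
        where
        same-level : j ≡ j′ → element (cone₀ i) ≡ element (cone₀ i′) → element (cone₁ i) ≡ element (cone₁ i′) → i ≡ i′
        same-level refl e₀ e₁ = cong (j ,_) (subst-injective (block (toℕ j) (level≤ i)) (begin
          s                                                                 ≡⟨ sym (combine-remQuot {A} B s) ⟩
          combine (proj₁ (split i)) (proj₂ (split i))                       ≡⟨ cong₂ combine (cone-injective (toℕ j) (proj₁ (split i)) (proj₁ (split i′)) e₀) (cone-injective (J ℕ.∸ toℕ j) (proj₂ (split i)) (proj₂ (split i′)) e₁) ⟩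
          combine (proj₁ (split i′)) (proj₂ (split i′))                     ≡⟨ combine-remQuot {A} B s′ ⟩
          s′                                                                ∎))
          where
          open ≡-Reasoning
          A = (2 ℕ.^ toℕ j) ℕ.^ rank
          B = (2 ℕ.^ (J ℕ.∸ toℕ j)) ℕ.^ rank
          s = subst Fin (block (toℕ j) (level≤ i)) r
          s′ = subst Fin (block (toℕ j) (level≤ i′)) r′

      ω : ∀ i → Witness (cone₀ i) (cone₁ i)
      ω i = witness (level i) (J ℕ.∸ level i) (proj₁ (split i)) (proj₂ (split i)) (ℕ.m+[n∸m]≡n (level≤ i))

      β-injective : ∀ i i′ → β (ω i) ≡ β (ω i′) → i ≡ i′
      β-injective i i′ β≡ = index-injective i i′
        (associates-equal 5<Q (cone₀ i) (cone₀ i′) (proj₁ (one i′ i (sym β≡))) (proj₁ (one i i′ β≡)))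
        (associates-equal 5<Q (cone₁ i) (cone₁ i′) (proj₂ (one i′ i (sym β≡))) (proj₂ (one i i′ β≡)))
        where
        ∣W₀ : ∀ i → element (cone₀ i) ∣ ιₙ W₀ × element (cone₁ i) ∣ ιₙ W₀
        ∣W₀ i = element∣W₀ (level i) (proj₁ (split i)) (level≤ i) , element∣W₀ (J ℕ.∸ level i) (proj₂ (split i)) (ℕ.m∸n≤m J (level i))
        one : ∀ i i′ → β (ω i) ≡ β (ω i′) → element (cone₀ i′) ∣ element (cone₀ i) × element (cone₁ i′) ∣ element (cone₁ i)
        one i i′ e = determined (ω i) (ω i′) e (factorised (ω i) (level≥ (level i) (J ℕ.∸ level i) (proj₁ (split i)) (proj₂ (split i)) (ℕ.m+[n∸m]≡n (level≤ i))) (proj₁ (∣W₀ i)) (proj₂ (∣W₀ i))) (proj₁ (∣W₀ i′)) (proj₂ (∣W₀ i′))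

      -- The elements of norm at most 2K number at most (4K + 1) ^ (ℓ rank), which is below (2 ^ J)
      -- ^ rank times a factor that does not involve J and lies below J; but there are J (2 ^ J) ^
      -- rank pairs.
      contradiction : ⊥
      contradiction = finish (pigeonhole counting (λ i → Sₒ.code (2 ℕ.* K) (β (ω (index i)))))
        where
        N = (2 ℕ.^ J) ℕ.^ rank
        index : Fin (J ℕ.* N) → Index
        index = remQuot N
        counting : suc (2 ℕ.* (2 ℕ.* K)) ℕ.^ Sₒ.rank < J ℕ.* N
        counting = begin-strict
          suc (2 ℕ.* (2 ℕ.* K)) ℕ.^ (ℓ ℕ.* rank)                    ≤⟨ ℕ.^-monoˡ-≤ (ℓ ℕ.* rank) 1+4K≤5K ⟩
          (5 ℕ.* K) ℕ.^ (ℓ ℕ.* rank)                                ≡⟨ sym (ℕ.^-*-assoc (5 ℕ.* K) ℓ rank) ⟩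
          ((5 ℕ.* K) ℕ.^ ℓ) ℕ.^ rank                                ≡⟨ cong (ℕ._^ rank) (trans (^-distribʳ-* ℓ 5 K) (trans (cong (5 ℕ.^ ℓ ℕ.*_) K^ℓ) (solveℕ 4 (λ f c q j → f ⟨*⟩ (c ⟨*⟩ q ⟨*⟩ j) ⟨=⟩ f ⟨*⟩ c ⟨*⟩ q ⟨*⟩ j) refl (5 ℕ.^ ℓ) (c₁ ℕ.^ ℓ) (Q ℕ.* Q) (2 ℕ.^ J)))) ⟩
          (5 ℕ.^ ℓ ℕ.* c₁ ℕ.^ ℓ ℕ.* (Q ℕ.* Q) ℕ.* 2 ℕ.^ J) ℕ.^ rank  ≡⟨ ^-distribʳ-* rank (5 ℕ.^ ℓ ℕ.* c₁ ℕ.^ ℓ ℕ.* (Q ℕ.* Q)) (2 ℕ.^ J) ⟩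
          (5 ℕ.^ ℓ ℕ.* c₁ ℕ.^ ℓ ℕ.* (Q ℕ.* Q)) ℕ.^ rank ℕ.* N       <⟨ ℕ.*-monoˡ-< N {{ℕ.m^n≢0 (2 ℕ.^ J) rank {{ℕ.m^n≢0 2 J}}}} J> ⟩
          J ℕ.* N                                                   ∎
          where
          open ℕ.≤-Reasoning
          0<K : 0 < K
          0<K = ℕ.*-mono-≤ (ℕ.*-mono-≤ (ℕ.≤-<-trans z≤n 81h²<c₁) (ℕ.*-mono-≤ (ℕ.<-trans (s≤s z≤n) 5<q) (ℕ.<-trans (s≤s z≤n) 5<q))) (ℕ.m^n>0 2 g)
          1+4K≤5K : suc (2 ℕ.* (2 ℕ.* K)) ≤ 5 ℕ.* K
          1+4K≤5K = ℕ.≤-trans (ℕ.+-mono-≤ 0<K (ℕ.≤-reflexive (sym (ℕ.*-assoc 2 2 K)))) ℕ.≤-refl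
        finish : (∃₂ λ i i′ → i Fin.< i′ × Sₒ.code (2 ℕ.* K) (β (ω (index i))) ≡ Sₒ.code (2 ℕ.* K) (β (ω (index i′)))) → ⊥
        finish (i , i′ , i<i′ , e) = Fin.<⇒≢ i<i′ (trans (sym (combine-remQuot {J} N i)) (trans (cong (λ z → combine (proj₁ z) (proj₂ z)) equal) (combine-remQuot {J} N i′)))
          where
          equal : index i ≡ index i′
          equal = β-injective (index i) (index i′) (Sₒ.code-injective (2 ℕ.* K) (β (ω (index i))) (β (ω (index i′))) (‖β‖≤ (ω (index i))) (‖β‖≤ (ω (index i′))) e)

  non-power-modulus : ∀ D → 0 < D → ∃ λ W → Coprime W D × (∀ y₀ → ¬ (y₀ ^ ℓ ≡ b [mod ιₙ W ]))
  non-power-modulus D 0<D = P.W , (λ { (d∣W , d∣D) → P.W-coprime (d∣W , ℕ∣.∣-trans d∣D (ℕ∣.∣-trans D∣q P.q∣Q)) }) , P.Contradiction.contradiction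
    where
    -- The order of the choices matters: `h`, `c₁` and `cτ` depend on the extension alone, `q` on
    -- these and on D, and the number (E + 1) ℓ of levels comes last, since it has to exceed `E`,
    -- which involves Q. In `q`, the factor D makes W coprime to D, 6 ensures 5 < q, and the
    -- factorial takes care of all small integers.
    h c₁ cτ q Q E : ℕ
    h = 4 ℕ.+ 4 ℕ.* κ
    c₁ = suc (81 ℕ.* (h ℕ.* h))
    cτ = 4 ℕ.* (productBound ℓ ℕ.* (2 ℕ.^ ℓ ℕ.* c₁ ℕ.^ ℓ))
    q = D ℕ.* (6 ℕ.* multipleBound cτ !)
    Q = q ℕ.^ ℓ
    E = (5 ℕ.^ ℓ ℕ.* c₁ ℕ.^ ℓ ℕ.* (Q ℕ.* Q)) ℕ.^ rank
    D∣q : D ∣ℕ q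
    D∣q = ℕ∣.m∣m*n (6 ℕ.* multipleBound cτ !)
    5<q : 5 < q
    5<q = ℕ.*-mono-≤ 0<D (ℕ.*-mono-≤ {6} {6} ℕ.≤-refl (ℕ.>-nonZero⁻¹ _ {{(multipleBound cτ) ℕ.!≢0}}))
    small∣q : ∀ N → 0 < N → N ≤ multipleBound cτ → N ∣ℕ q
    small∣q (suc N) _ N≤ = ℕ∣.∣-trans (ℕ∣.∣-trans (ℕ∣.m∣m*n (N !)) (ℕ∣.m≤n⇒m!∣n! N≤)) (ℕ∣.∣n⇒∣m*n D (ℕ∣.∣n⇒∣m*n 6 ℕ∣.∣-refl))
    module P = Parameters h c₁ (ℕ.m≤m+n 4 (4 ℕ.* κ)) (ℕ.m≤n+m (4 ℕ.* κ) 4) (ℕ.n<1+n (81 ℕ.* (h ℕ.* h))) cτ ℕ.≤-refl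
      q (suc E) 5<q small∣q Q refl (suc E ℕ.* ℓ) refl (ℕ.m≤m*n (suc E) ℓ)

-- Roots modulo composite numbers

module Roots (R : Ring) where
  open Ring R
  open Congruences R
  open Solver using (solve; _:+_; _:-_; _:*_; :-_; _:=_; con)

  linear-expansion : ∀ n y e → ∃ λ k → (y + e) ^ suc n ≡ y ^ suc n + ιₙ (suc n) * (y ^ n * e) + e * e * k
  linear-expansion zero y e = 0# , trans (solve 2 (λ y e → (y :+ e) :* con (+ 1) := y :* con (+ 1) :+ con (+ 1) :* (con (+ 1) :* e) :+ e :* e :* con (+ 0)) refl y e)
    (cong (λ z → y * 1# + z * (1# * e) + e * e * 0#) (sym ι-1))
  linear-expansion (suc n) y e = step (linear-expansion n y e)
    where
    open ≡-Reasoning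
    N = ιₙ (suc n)
    p = y ^ n
    step : (∃ λ k → (y + e) ^ suc n ≡ y ^ suc n + N * (p * e) + e * e * k) → ∃ λ k → (y + e) ^ suc (suc n) ≡ y ^ suc (suc n) + ιₙ (suc (suc n)) * (y ^ suc n * e) + e * e * k
    step (k , eq) = y * k + N * p + e * k , (begin
      (y + e) * (y + e) ^ suc n                                ≡⟨ cong ((y + e) *_) eq ⟩
      (y + e) * (y * p + N * (p * e) + e * e * k)              ≡⟨ solve 5 (λ y e p n k → (y :+ e) :* (y :* p :+ n :* (p :* e) :+ e :* e :* k) := y :* (y :* p) :+ (con (+ 1) :+ n) :* (y :* p :* e) :+ e :* e :* (y :* k :+ n :* p :+ e :* k)) refl y e p N k ⟩
      y * (y * p) + (1# + N) * (y * p * e) + e * e * (y * k + N * p + e * k)  ≡⟨ cong (λ z → y * (y * p) + z * (y * p * e) + e * e * (y * k + N * p + e * k)) (sym (ιₙ-suc (suc n))) ⟩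
      y ^ suc (suc n) + ιₙ (suc (suc n)) * (y ^ suc n * e) + e * e * (y * k + N * p + e * k) ∎)

  module _ (m′ : ℕ) (b : Carrier) where

    private
      ℓ : ℕ
      ℓ = suc m′

    Root : ℕ → Set
    Root m = ∃ λ y → y ^ ℓ ≡ b [mod ιₙ m ]

    Unit : ℕ → Set
    Unit m = ∃ λ g → ιₙ ℓ * b * g ≡ 1# [mod ιₙ m ]

    hensel : ∀ m → Unit m → Root m → Root (m ℕ.* m)
    hensel m (g , (s , es)) (y , (z , ez)) = lift (linear-expansion m′ y e)
      where
      M = ιₙ m
      -- The Newton step: y ^ ℓ - b is M z, and because of y ^ ℓ ≡ b the derivative ℓ y ^ (ℓ - 1)
      -- has the inverse y g modulo m.
      e = - (M * z * y * g)
      lift : (∃ λ k → (y + e) ^ ℓ ≡ y ^ ℓ + ιₙ ℓ * (y ^ m′ * e) + e * e * k) → Root (m ℕ.* m)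
      lift (k , ek) = y + e , (- (z * s) + - (z * (ιₙ ℓ * g * z)) + z * z * y * y * g * g * k , (begin
        (y + e) ^ ℓ + - b
          ≡⟨ cong (_+ - b) ek ⟩
        y * y ^ m′ + ιₙ ℓ * (y ^ m′ * e) + e * e * k + - b
          ≡⟨ solve 8 (λ y p l m z g k b → y :* p :+ l :* (p :* (:- (m :* z :* y :* g))) :+ (:- (m :* z :* y :* g)) :* (:- (m :* z :* y :* g)) :* k :- b
               := (y :* p :- b) :- m :* z :* (l :* b :* g) :- m :* z :* l :* g :* (y :* p :- b) :+ m :* m :* (z :* z :* y :* y :* g :* g :* k)) refl y (y ^ m′) (ιₙ ℓ) M z g k b ⟩
        (y ^ ℓ + - b) + - (M * z * (ιₙ ℓ * b * g)) + - (M * z * ιₙ ℓ * g * (y ^ ℓ + - b)) + M * M * (z * z * y * y * g * g * k)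
          ≡⟨ cong₂ (λ u v → u + - (M * z * v) + - (M * z * ιₙ ℓ * g * u) + M * M * (z * z * y * y * g * g * k)) ez unit ⟩
        M * z + - (M * z * (1# + M * s)) + - (M * z * ιₙ ℓ * g * (M * z)) + M * M * (z * z * y * y * g * g * k)
          ≡⟨ solve 7 (λ m z s l g y k → m :* z :- m :* z :* (con (+ 1) :+ m :* s) :- m :* z :* l :* g :* (m :* z) :+ m :* m :* (z :* z :* y :* y :* g :* g :* k)
               := m :* m :* ((:- (z :* s)) :- z :* (l :* g :* z) :+ z :* z :* y :* y :* g :* g :* k)) refl M z s (ιₙ ℓ) g y k ⟩
        M * M * (- (z * s) + - (z * (ιₙ ℓ * g * z)) + z * z * y * y * g * g * k)
          ≡⟨ cong (_* (- (z * s) + - (z * (ιₙ ℓ * g * z)) + z * z * y * y * g * g * k)) (sym (ιₙ-* m m)) ⟩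
        ιₙ (m ℕ.* m) * (- (z * s) + - (z * (ιₙ ℓ * g * z)) + z * z * y * y * g * g * k) ∎))
        where
        open ≡-Reasoning
        unit : ιₙ ℓ * b * g ≡ 1# + M * s
        unit = trans (solve 1 (λ x → x := con (+ 1) :+ (x :- con (+ 1))) refl (ιₙ ℓ * b * g)) (cong (λ z → 1# + z) es)

    crt : ∀ {m n} → Coprime m n → Root m → Root n → Root (m ℕ.* n)
    crt {m} {n} c (y , (z , ez)) (y′ , (z′ , ez′)) = assemble (bézout c)
      where
      assemble : (∃₂ λ s t → ι s * ιₙ m + ι t * ιₙ n ≡ 1#) → Root (m ℕ.* n)
      assemble (s , t , st) = Y , both (mod-trans (mod-^ ℓ (congruent y y′ (ι s) (ι t) (ιₙ m) (ιₙ n) st)) (z , ez))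
        (mod-trans (mod-^ ℓ (mod-trans (mod-reflexive (+-comm (y * (ι t * ιₙ n)) (y′ * (ι s * ιₙ m)))) (congruent y′ y (ι t) (ι s) (ιₙ n) (ιₙ m) (trans (+-comm (ι t * ιₙ n) (ι s * ιₙ m)) st)))) (z′ , ez′))
        where
        Y = y * (ι t * ιₙ n) + y′ * (ι s * ιₙ m)
        congruent : ∀ y y′ s t m n → s * m + t * n ≡ 1# → y * (t * n) + y′ * (s * m) ≡ y [mod m ]
        congruent y y′ s t m n st = (y′ * s + - (y * s)) , (begin
          y * (t * n) + y′ * (s * m) + - y                      ≡⟨ solve 6 (λ y y′ s t m n → y :* (t :* n) :+ y′ :* (s :* m) :- y := m :* (y′ :* s :- y :* s) :+ y :* (s :* m :+ t :* n :- con (+ 1))) refl y y′ s t m n ⟩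
          m * (y′ * s + - (y * s)) + y * (s * m + t * n + - 1#) ≡⟨ cong (λ z → m * (y′ * s + - (y * s)) + y * (z + - 1#)) st ⟩
          m * (y′ * s + - (y * s)) + y * (1# + - 1#)            ≡⟨ solve 2 (λ m y → m :+ y :* (con (+ 1) :- con (+ 1)) := m) refl (m * (y′ * s + - (y * s))) y ⟩
          m * (y′ * s + - (y * s))                              ∎)
          where open ≡-Reasoning
        both : ∀ {u v} → u ≡ v [mod ιₙ m ] → u ≡ v [mod ιₙ n ] → u ≡ v [mod ιₙ (m ℕ.* n) ]
        both {u} {v} (x , ex) (x′ , ex′) = ι s * x′ + ι t * x , (begin
          u + - v                                                ≡⟨ sym (*-identityˡ _) ⟩
          1# * (u + - v)                                         ≡⟨ cong (_* (u + - v)) (sym st) ⟩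
          (ι s * ιₙ m + ι t * ιₙ n) * (u + - v)                  ≡⟨ distribʳ (u + - v) (ι s * ιₙ m) (ι t * ιₙ n) ⟩
          ι s * ιₙ m * (u + - v) + ι t * ιₙ n * (u + - v)        ≡⟨ cong₂ (λ p q → ι s * ιₙ m * p + ι t * ιₙ n * q) ex′ ex ⟩
          ι s * ιₙ m * (ιₙ n * x′) + ι t * ιₙ n * (ιₙ m * x)     ≡⟨ solve 6 (λ s t m n x x′ → s :* m :* (n :* x′) :+ t :* n :* (m :* x) := m :* n :* (s :* x′ :+ t :* x)) refl (ι s) (ι t) (ιₙ m) (ιₙ n) x x′ ⟩
          ιₙ m * ιₙ n * (ι s * x′ + ι t * x)                     ≡⟨ cong (_* (ι s * x′ + ι t * x)) (sym (ιₙ-* m n)) ⟩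
          ιₙ (m ℕ.* n) * (ι s * x′ + ι t * x)                    ∎)
          where open ≡-Reasoning

    weaken : ∀ {m n} → m ∣ℕ n → Root n → Root m
    weaken {m} (ℕ∣.divides k refl) (y , e) = y , mod-∣ (ιₙ-∣ (k , ℕ.*-comm k m)) e

    -- A repeated prime is absorbed by Hensel lifting: if p divides the product P of the remaining
    -- factors, then p P divides P · P. Otherwise p and P are coprime and the Chinese remainder
    -- theorem applies.
    root-mod-product : ∀ ps → All Prime ps → (∀ p → Prime p → p ∣ℕ productℕ ps → Root p) → Unit (productℕ ps) → Root (productℕ ps)
    root-mod-product [] [] roots unit = 1# , (1# ^ ℓ + - b , sym (trans (cong (_* (1# ^ ℓ + - b)) ι-1) (*-identityˡ _)))
    root-mod-product (p ∷ ps) (prime-p ∷ primes) roots (g , e) = extend (p ℕ∣.∣? productℕ ps)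
      where
      rest : Unit (productℕ ps)
      rest = g , mod-∣ (ιₙ-∣ (p , ℕ.*-comm p (productℕ ps))) e
      induction : Root (productℕ ps)
      induction = root-mod-product ps primes (λ q prime-q q∣ → roots q prime-q (ℕ∣.∣n⇒∣m*n p q∣)) rest
      extend : Dec (p ∣ℕ productℕ ps) → Root (p ℕ.* productℕ ps)
      extend (yes p∣) = weaken (ℕ∣.*-monoˡ-∣ (productℕ ps) p∣) (hensel (productℕ ps) rest induction)
      extend (no p∤) = crt (prime∤⇒coprime prime-p p∤) (roots p prime-p (ℕ∣.m∣m*n (productℕ ps))) induction

    root-mod : ∀ W → .{{NonZero W}} → (∀ p → Prime p → p ∣ℕ W → Root p) → Unit W → Root W
    root-mod W roots unit = subst Root (sym W≡) (root-mod-product factors factorsPrime (λ p prime-p p∣ → roots p prime-p (subst (p ∣ℕ_) (sym W≡) p∣)) (subst Unit W≡ unit))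
      where
      open PrimeFactorisation (factorise W) renaming (isFactorisation to W≡)

    -- If c / d = (x / d) ^ ℓ, then f / g = (c / d) ^ n makes f g ^ (ℓ - 1) the ℓ-th power of g (x / d) ^ n.
    root-from-power : ∀ {M c d d′ f g x} n → x ^ ℓ ≡ c * d ^ m′ → d * d′ ≡ 1# [mod M ] → c ^ n * g ≡ f * d ^ n [mod M ] → (g * (x * d′) ^ n) ^ ℓ ≡ f * g ^ m′ [mod M ]
    root-from-power {M} {c} {d} {d′} {f} {g} {x} n ex dd′ e = mod-trans (mod-reflexive expand) (mod-trans (mod-* (mod-reflexive {g ^ m′} refl) collapse) (mod-reflexive (*-comm (g ^ m′) f)))
      where
      open ≡-Reasoning
      expand : (g * (x * d′) ^ n) ^ ℓ ≡ g ^ m′ * (g * ((c * d′) * (d * d′) ^ m′) ^ n)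
      expand = begin
        (g * (x * d′) ^ n) ^ ℓ                          ≡⟨ ^-distrib-* g ((x * d′) ^ n) ℓ ⟩
        g ^ ℓ * ((x * d′) ^ n) ^ ℓ                      ≡⟨ cong (g ^ ℓ *_) (trans (^-assocʳ (x * d′) n ℓ) (trans (cong ((x * d′) ^_) (ℕ.*-comm n ℓ)) (sym (^-assocʳ (x * d′) ℓ n)))) ⟩
        g ^ ℓ * ((x * d′) ^ ℓ) ^ n                      ≡⟨ cong (λ z → g ^ ℓ * z ^ n) (trans (^-distrib-* x d′ ℓ) (trans (cong (_* d′ ^ ℓ) ex) (solve 4 (λ c p d q → c :* p :* (d :* q) := c :* d :* (p :* q)) refl c (d ^ m′) d′ (d′ ^ m′)))) ⟩
        g ^ ℓ * (c * d′ * (d ^ m′ * d′ ^ m′)) ^ n       ≡⟨ cong (λ z → g ^ ℓ * (c * d′ * z) ^ n) (sym (^-distrib-* d d′ m′)) ⟩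
        g ^ ℓ * (c * d′ * (d * d′) ^ m′) ^ n            ≡⟨ solve 3 (λ g p q → g :* p :* q := p :* (g :* q)) refl g (g ^ m′) ((c * d′ * (d * d′) ^ m′) ^ n) ⟩
        g ^ m′ * (g * (c * d′ * (d * d′) ^ m′) ^ n)     ∎
      one : ∀ k → (d * d′) ^ k ≡ 1# [mod M ]
      one k = mod-trans (mod-^ k dd′) (mod-reflexive (1^ k))
      collapse : g * (c * d′ * (d * d′) ^ m′) ^ n ≡ f [mod M ]
      collapse = mod-trans (mod-* (mod-reflexive {g} refl) (mod-^ n (mod-trans (mod-* (mod-reflexive {c * d′} refl) (one m′)) (mod-reflexive (*-identityʳ (c * d′))))))
        (mod-trans (mod-reflexive (trans (cong (g *_) (^-distrib-* c d′ n)) (solve 3 (λ g c d → g :* (c :* d) := c :* g :* d) refl g (c ^ n) (d′ ^ n))))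
        (mod-trans (mod-* e (mod-reflexive {d′ ^ n} refl))
        (mod-trans (mod-reflexive (trans (*-assoc f (d ^ n) (d′ ^ n)) (cong (f *_) (sym (^-distrib-* d d′ n)))))
        (mod-trans (mod-* (mod-reflexive {f} refl) (one n)) (mod-reflexive (*-identityʳ f))))))

-- The Kummer tower

-- C becomes an ℓ-th power in A, whereas B is not an ℓ-th power modulo W for suitable W coprime to any given D.
NonPowerModuli : Ring → ℕ → ℤ → ℤ → Set
NonPowerModuli A ℓ C B = (∃ λ x → x ^ ℓ ≡ ι C) × (∀ D → 0 < D → ∃ λ W → Coprime W D × (∀ y → ¬ (y ^ ℓ ≡ ι B [mod ιₙ W ])))
  where
  open Ring A
  open Congruences A

module KummerTower
  (O : Order) (m″ : ℕ) (prime-ℓ : Prime (suc (suc m″)))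
  (ζ : Order.Carrier O) (ζ^ℓ≡1 : Order._^_ O ζ (suc (suc m″)) ≡ Order.1# O)
  (∑ζ≡0 : ∀ j → 0 < j → j < suc (suc m″) → Order.∑ O (suc (suc m″)) (λ i → Order._^_ O ζ (i ℕ.* j)) ≡ Order.0# O)
  (domain : Order.IsDomain O)
  (C B : ℤ) (B≢0 : B ≢ + 0)
  (no-C-root : ∀ u t → Order._^_ O u (suc (suc m″)) ≡ Order._*_ O (Order._^_ O t (suc (suc m″))) (Order.ι O C) → t ≡ Order.0# O)
  (no-BC-root : ∀ j u t → Order._^_ O u (suc (suc m″)) ≡ Order._*_ O (Order._^_ O t (suc (suc m″))) (Order._*_ O (Order.ι O B) (Order._^_ O (Order.ι O C) j)) → t ≡ Order.0# O)
  where

  private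
    module O = Order O
    module X = RootExtension O (suc m″) prime-ℓ ζ ζ^ℓ≡1 ∑ζ≡0 domain (O.ι C)

    R : Order
    R = X.extension

    R-domain : Order.IsDomain R
    R-domain = X.extension-domain no-C-root

  open Order R
  open OrderArithmetic R
  open IntegerMultiple R-domain

  private
    const-^ : ∀ a n → X.const (a O.^ n) ≡ X.const a ^ n
    const-^ a zero = refl
    const-^ a (suc n) = trans (X.const-* a (a O.^ n)) (cong (X.const a *_) (const-^ a n))

    const-∑ : ∀ n f → X.const (O.∑ n f) ≡ ∑ n (λ i → X.const (f i))
    const-∑ zero f = refl
    const-∑ (suc n) f = trans (X.const-+ (O.∑ n f) (f n)) (cong (_+ X.const (f n)) (const-∑ n f))

    const-injective : ∀ {a c} → X.const a ≡ X.const c → a ≡ c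
    const-injective e = cong head e

    ℓ : ℕ
    ℓ = suc (suc m″)

    ξ : Carrier
    ξ = X.const ζ

    ξ^ℓ≡1 : ξ ^ ℓ ≡ 1#
    ξ^ℓ≡1 = trans (sym (const-^ ζ ℓ)) (cong X.const ζ^ℓ≡1)

    ∑ξ≡0 : ∀ j → 0 < j → j < ℓ → ∑ ℓ (λ i → ξ ^ (i ℕ.* j)) ≡ 0#
    ∑ξ≡0 j 0<j j<ℓ = trans (∑-cong ℓ (λ i _ → sym (const-^ ζ (i ℕ.* j)))) (trans (sym (const-∑ ℓ (λ i → ζ O.^ (i ℕ.* j)))) (cong X.const (∑ζ≡0 j 0<j j<ℓ)))

    module Y = RootExtension R (suc m″) prime-ℓ ξ ξ^ℓ≡1 ∑ξ≡0 R-domain (ι B)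

    x : Carrier
    x = X.𝐲

    x^ℓ≡C : x ^ ℓ ≡ ι C
    x^ℓ≡C = X.𝐲^m≡f


    σx≡ξx : X.σ 1 x ≡ ξ * x
    σx≡ξx = trans (X.twist-y· (ζ O.^ 1) (trans (O.^-assocʳ ζ 1 ℓ) (trans (cong (ζ O.^_) (ℕ.*-identityˡ ℓ)) ζ^ℓ≡1)) X.𝟏)
      (trans (cong₂ (λ z v → z X.∙ X.y· v) (O.*-identityʳ ζ) (X.twist-const (ζ O.^ 1) O.1#)) (sym (X.const-⊗ ζ x)))

    σ-^ : ∀ u n → X.σ 1 (u ^ n) ≡ X.σ 1 u ^ n
    σ-^ u zero = X.twist-const (ζ O.^ 1) O.1#
    σ-^ u (suc n) = trans (X.σ-⊗ 1 u (u ^ n)) (cong (X.σ 1 u *_) (σ-^ u n))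

    σ-const : ∀ a → X.σ 1 (X.const a) ≡ X.const a
    σ-const = X.twist-const (ζ O.^ 1)

    -- Kummer theory: an ℓ-th root u of an element of O satisfies σ u = ζ ^ (-j) u for some j, so u x ^ j lies in O.
    kummer : ∀ u a → u ^ ℓ ≡ X.const a → u ≢ 0# → ∃₂ λ j w → u * x ^ j ≡ X.const w
    kummer u a e u≢0 = finish (Y.equal-powers (X.σ 1 u) u u≢0 (trans (sym (σ-^ u ℓ)) (trans (cong (X.σ 1) e) (trans (σ-const a) (sym e)))))
      where
      finish : (∃ λ j → ξ ^ j * X.σ 1 u ≡ u) → ∃₂ λ j w → u * x ^ j ≡ X.const w
      finish (j , ej) = j , head (u * x ^ j) , X.fixed⇒const (u * x ^ j) (begin
        X.σ 1 (u * x ^ j)                ≡⟨ trans (X.σ-⊗ 1 u (x ^ j)) (cong (X.σ 1 u *_) (trans (σ-^ x j) (trans (cong (_^ j) σx≡ξx) (^-distrib-* ξ x j)))) ⟩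
        X.σ 1 u * (ξ ^ j * x ^ j)        ≡⟨ trans (sym (*-assoc (X.σ 1 u) (ξ ^ j) (x ^ j))) (cong (_* x ^ j) (*-comm (X.σ 1 u) (ξ ^ j))) ⟩
        ξ ^ j * X.σ 1 u * x ^ j          ≡⟨ cong (_* x ^ j) ej ⟩
        u * x ^ j                        ∎)
        where open ≡-Reasoning

    -- As N is an integer, N ^ ℓ B comes from O and `kummer` applies: u x ^ j = w lies in O, and w ^
    -- ℓ = N ^ ℓ B C ^ j contradicts `no-BC-root`.
    no-integral-root : ∀ u N → N ≢ + 0 → u ^ ℓ ≢ ι N ^ ℓ * ι B
    no-integral-root u N N≢0 e = finish (kummer u (O.ι N O.^ ℓ O.* O.ι B) (trans e (sym const-e)) u≢0)
      where
      const-e : X.const (O.ι N O.^ ℓ O.* O.ι B) ≡ ι N ^ ℓ * ι B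
      const-e = trans (X.const-* (O.ι N O.^ ℓ) (O.ι B)) (cong (_* ι B) (const-^ (O.ι N) ℓ))
      ιN≢0 : O.ι N ≢ O.0#
      ιN≢0 h = N≢0 (ι-injective N h)
        where
        ι-injective : ∀ n → O.ι n ≡ O.0# → n ≡ + 0
        ι-injective n h = ℤ.∣i∣≡0⇒i≡0 (trans (sym (OrderArithmetic.‖ι‖ O n)) (trans (cong O.‖_‖ h) (OrderArithmetic.‖0‖ O)))
      ιB≢0 : O.ι B ≢ O.0#
      ιB≢0 h = B≢0 (ℤ.∣i∣≡0⇒i≡0 (trans (sym (OrderArithmetic.‖ι‖ O B)) (trans (cong O.‖_‖ h) (OrderArithmetic.‖0‖ O))))
      u≢0 : u ≢ 0#
      u≢0 u≡0 = O.Domain.*-≢0 domain (O.Domain.^-≢0 domain ℓ ιN≢0 (OrderArithmetic.1≢0 O)) ιB≢0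
        (const-injective (trans const-e (trans (sym e) (trans (cong (_^ ℓ) u≡0) (0^suc (suc m″))))))
      finish : (∃₂ λ j w → u * x ^ j ≡ X.const w) → ⊥
      finish (j , w , ew) = ιN≢0 (no-BC-root j w (O.ι N) (const-injective (begin
        X.const (w O.^ ℓ)                              ≡⟨ const-^ w ℓ ⟩
        X.const w ^ ℓ                                  ≡⟨ cong (_^ ℓ) (sym ew) ⟩
        (u * x ^ j) ^ ℓ                                ≡⟨ ^-distrib-* u (x ^ j) ℓ ⟩
        u ^ ℓ * (x ^ j) ^ ℓ                            ≡⟨ cong₂ _*_ e (trans (^-assocʳ x j ℓ) (trans (cong (x ^_) (ℕ.*-comm j ℓ)) (trans (sym (^-assocʳ x ℓ j)) (cong (_^ j) x^ℓ≡C)))) ⟩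
        ι N ^ ℓ * ι B * ι C ^ j                        ≡⟨ *-assoc (ι N ^ ℓ) (ι B) (ι C ^ j) ⟩
        ι N ^ ℓ * (ι B * ι C ^ j)                      ≡⟨ cong₂ _*_ (sym (const-^ (O.ι N) ℓ)) (trans (cong (ι B *_) (sym (const-^ (O.ι C) j))) (sym (X.const-* (O.ι B) (O.ι C O.^ j)))) ⟩
        X.const (O.ι N O.^ ℓ) * X.const (O.ι B O.* O.ι C O.^ j)  ≡⟨ sym (X.const-* (O.ι N O.^ ℓ) (O.ι B O.* O.ι C O.^ j)) ⟩
        X.const (O.ι N O.^ ℓ O.* (O.ι B O.* O.ι C O.^ j))  ∎)))
        where open ≡-Reasoning

    -- `kummer` wants the ℓ-th power in O, so t is traded for an integer: both sides are multiplied
    -- by s ^ ℓ, where t s = N.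
    no-root : ∀ u t → u ^ ℓ ≡ t ^ ℓ * ι B → t ≡ 0#
    no-root u t e = decide (t ≟ 0#)
      where
      decide : Dec (t ≡ 0#) → t ≡ 0#
      decide (yes p) = p
      decide (no t≢0) = ⊥-elim (clear (integer-multiple t ‖ t ‖ t≢0 ℕ.≤-refl))
        where
        clear : (∃ λ N → 0 < N × N ≤ multipleBound ‖ t ‖ × t ∣ ιₙ N) → ⊥
        clear (N , 0<N , _ , (s , es)) = no-integral-root (u * s) (+ N) (λ { refl → ℕ.<-irrefl refl 0<N }) (begin
          (u * s) ^ ℓ               ≡⟨ ^-distrib-* u s ℓ ⟩
          u ^ ℓ * s ^ ℓ             ≡⟨ cong (_* s ^ ℓ) e ⟩
          t ^ ℓ * ι B * s ^ ℓ       ≡⟨ trans (*-assoc (t ^ ℓ) (ι B) (s ^ ℓ)) (trans (cong (t ^ ℓ *_) (*-comm (ι B) (s ^ ℓ))) (sym (*-assoc (t ^ ℓ) (s ^ ℓ) (ι B)))) ⟩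
          t ^ ℓ * s ^ ℓ * ι B       ≡⟨ cong (_* ι B) (trans (sym (^-distrib-* t s ℓ)) (cong (_^ ℓ) (sym es))) ⟩
          ιₙ N ^ ℓ * ι B            ∎)
          where open ≡-Reasoning

    module Z = Counting R m″ prime-ℓ ξ ξ^ℓ≡1 ∑ξ≡0 R-domain (ι B) no-root

  kummer-tower : Σ Ring λ A → NonPowerModuli A (suc (suc m″)) C B
  kummer-tower = ring , (x , x^ℓ≡C) , Z.non-power-modulus

-- Valuations and the choice of ℓ

open Ring ℤ-ring using () renaming (_^_ to _^ᶻ_)

ι-^ : ∀ (A : Ring) a n → Ring.ι A (a ^ᶻ n) ≡ Ring._^_ A (Ring.ι A a) n
ι-^ A a zero = Ring.ι-1 A
ι-^ A a (suc n) = trans (Ring.ι-* A a (a ^ᶻ n)) (cong (Ring._*_ A (Ring.ι A a)) (ι-^ A a n))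

prime-divisor : ∀ n → 1 < n → ∃ λ p → Prime p × p ∣ℕ n
prime-divisor n@(suc _) 1<n = first (factorise n)
  where
  first : PrimeFactorisation n → ∃ λ p → Prime p × p ∣ℕ n
  first record { factors = [] ; isFactorisation = e } = ⊥-elim (ℕ.<⇒≢ 1<n (sym e))
  first record { factors = p ∷ ps ; isFactorisation = e ; factorsPrime = prime-p ∷ _ } = p , prime-p , subst (p ∣ℕ_) (sym e) (ℕ∣.m∣m*n _)

-- Euclid's argument with n ! + 1.
prime-above : ∀ n → ∃ λ p → Prime p × n < p
prime-above n = larger (prime-divisor (suc (n !)) (s≤s (ℕ.>-nonZero⁻¹ (n !) {{n ℕ.!≢0}})))
  where
  larger : (∃ λ p → Prime p × p ∣ℕ suc (n !)) → ∃ λ p → Prime p × n < p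
  larger (p , prime-p , p∣) = p , prime-p , ℕ.≰⇒> (λ p≤n → prime∤1 prime-p (ℕ∣.∣m+n∣m⇒∣n (subst (p ∣ℕ_) (ℕ.+-comm 1 (n !)) p∣) (p∣n! p≤n)))
    where
    p∣n! : p ≤ n → p ∣ℕ n !
    p∣n! p≤n = ℕ∣.∣-trans (self p (prime⇒nonZero prime-p)) (ℕ∣.m≤n⇒m!∣n! p≤n)
      where
      self : ∀ p → NonZero p → p ∣ℕ p !
      self (suc p) _ = ℕ∣.m∣m*n (p !)

Valuation : ℕ → ℤ → ℕ → Set
Valuation q c v = ∃ λ u → c ≡ + (q ℕ.^ v) ℤ.* u × ¬ (q ∣ℕ ℤ.∣ u ∣)

module _ {q : ℕ} (prime-q : Prime q) where

  private
    module A = OrderArithmetic ℤ-order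

    instance
      q≢0 : NonZero q
      q≢0 = prime⇒nonZero prime-q

  valuation : ∀ c → c ≢ + 0 → ∃ λ v → Valuation q c v
  valuation c c≢0 = convert (A.content q (prime⇒1< prime-q) c c≢0)
    where
    convert : (∃₂ λ i u → c ≡ + (q ℕ.^ i) ℤ.* u × ¬ (Ring._∣_ ℤ-ring (+ q) u)) → ∃ λ v → Valuation q c v
    convert (i , u , e , q∤u) = i , u , e , (λ q∣u → q∤u (A.∣ℕ⇒∣ι q u q∣u))

  valuation-unique : ∀ {c v w} → Valuation q c v → Valuation q c w → v ≡ w
  valuation-unique {c} {v} {w} (u , e , q∤u) (u′ , e′ , q∤u′) =
    A.exponents-unique q v w (λ d → q∤u (A.∣ι⇒∣ℕ q u d)) (λ d → q∤u′ (A.∣ι⇒∣ℕ q u′ d)) (trans (sym e) e′)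

  valuation-* : ∀ {c d v w} → Valuation q c v → Valuation q d w → Valuation q (c ℤ.* d) (v ℕ.+ w)
  valuation-* {c} {d} {v} {w} (u , e , q∤u) (u′ , e′ , q∤u′) = u ℤ.* u′ , (begin
    c ℤ.* d                                             ≡⟨ cong₂ ℤ._*_ e e′ ⟩
    + (q ℕ.^ v) ℤ.* u ℤ.* (+ (q ℕ.^ w) ℤ.* u′)          ≡⟨ solve 4 (λ x u y w → x :* u :* (y :* w) := x :* y :* (u :* w)) refl (+ (q ℕ.^ v)) u (+ (q ℕ.^ w)) u′ ⟩
    + (q ℕ.^ v) ℤ.* + (q ℕ.^ w) ℤ.* (u ℤ.* u′)          ≡⟨ cong (ℤ._* (u ℤ.* u′)) (trans (sym (ℤ.pos-* (q ℕ.^ v) (q ℕ.^ w))) (cong +_ (sym (ℕ.^-distribˡ-+-* q v w)))) ⟩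
    + (q ℕ.^ (v ℕ.+ w)) ℤ.* (u ℤ.* u′)                  ∎) ,
    (λ q∣ → [ q∤u , q∤u′ ]′ (euclidsLemma ℤ.∣ u ∣ ℤ.∣ u′ ∣ prime-q (subst (q ∣ℕ_) (ℤ.abs-* u u′) q∣)))
    where
    open ≡-Reasoning
    open Ring.Solver ℤ-ring using (solve; _:*_; _:=_)

  valuation-^ : ∀ {c v} n → Valuation q c v → Valuation q (c ^ᶻ n) (n ℕ.* v)
  valuation-^ zero _ = + 1 , refl , prime∤1 prime-q
  valuation-^ {c} {v} (suc n) h = valuation-* {c} {c ^ᶻ n} {v} {n ℕ.* v} h (valuation-^ {c} {v} n h)

  valuation-∤ : ∀ c → ¬ (q ∣ℕ ℤ.∣ c ∣) → Valuation q c 0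
  valuation-∤ c q∤c = c , sym (ℤ.*-identityˡ c) , q∤c

  valuation⇒≢0 : ∀ {c v} → Valuation q c v → c ≢ + 0
  valuation⇒≢0 {v = v} (u , e , q∤u) c≡0 = q∤u (subst (q ∣ℕ_) (sym ∣u∣≡0) (q ℕ∣.∣0))
    where
    ∣u∣≡0 : ℤ.∣ u ∣ ≡ 0
    ∣u∣≡0 = [ (λ z → ⊥-elim (ℕ.≢-nonZero⁻¹ (q ℕ.^ v) {{ℕ.m^n≢0 q v}} z)) , (λ z → z) ]′
      (ℕ.m*n≡0⇒m≡0∨n≡0 (q ℕ.^ v) (trans (sym (ℤ.abs-* (+ (q ℕ.^ v)) u)) (cong ℤ.∣_∣ (trans (sym e) c≡0))))

  valuation-abs : ∀ {c v} → Valuation q c v → Valuation q (+ ℤ.∣ c ∣) v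
  valuation-abs {c} {v} (u , e , q∤u) = + ℤ.∣ u ∣ , trans (cong (λ z → + ℤ.∣ z ∣) e) (trans (cong +_ (ℤ.abs-* (+ (q ℕ.^ v)) u)) (ℤ.pos-* (q ℕ.^ v) ℤ.∣ u ∣)) , q∤u

-- After division by the gcd the absolute values are coprime and not both 1; a prime divisor of one
-- that exceeds 1 does not divide the other.
separating-prime : ∀ X Y → X ≢ + 0 → Y ≢ + 0 → ℤ.∣ X ∣ ≢ ℤ.∣ Y ∣ → ∃ λ q → Prime q × (∀ v w → Valuation q X v → Valuation q Y w → v ≢ w)
separating-prime X Y X≢0 Y≢0 X≢Y = split (gcd[m,n]∣m x y) (gcd[m,n]∣n x y)
  where
  x = ℤ.∣ X ∣
  y = ℤ.∣ Y ∣
  g = gcd x y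
  Result : ℤ → ℤ → Set
  Result X Y = ∃ λ q → Prime q × (∀ v w → Valuation q X v → Valuation q Y w → v ≢ w)
  one-sided : ∀ X Y g x′ y′ → ℤ.∣ X ∣ ≡ g ℕ.* x′ → ℤ.∣ Y ∣ ≡ g ℕ.* y′ → X ≢ + 0 → Y ≢ + 0 → Coprime x′ y′ → 1 < x′ → Result X Y
  one-sided X Y g x′ y′ ex ey X≢0 Y≢0 coprime 1<x′ = distinguish (prime-divisor x′ 1<x′)
    where
    nonzero : ∀ Z z → ℤ.∣ Z ∣ ≡ g ℕ.* z → Z ≢ + 0 → + g ≢ + 0 × + z ≢ + 0
    nonzero Z z e Z≢0 = (λ h → Z≢0 (ℤ.∣i∣≡0⇒i≡0 (trans e (cong (ℕ._* z) (ℤ.+-injective h))))) , (λ h → Z≢0 (ℤ.∣i∣≡0⇒i≡0 (trans e (trans (cong (g ℕ.*_) (ℤ.+-injective h)) (ℕ.*-zeroʳ g)))))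
    distinguish : (∃ λ q → Prime q × q ∣ℕ x′) → Result X Y
    distinguish (q , prime-q , q∣x′) = q , prime-q , compare (valuation prime-q (+ g) (proj₁ (nonzero X x′ ex X≢0))) (valuation prime-q (+ x′) (proj₂ (nonzero X x′ ex X≢0)))
      where
      q∤y′ : ¬ (q ∣ℕ y′)
      q∤y′ q∣y′ = prime∤1 prime-q (subst (q ∣ℕ_) (coprime (q∣x′ , q∣y′)) ℕ∣.∣-refl)
      compare : (∃ λ v → Valuation q (+ g) v) → (∃ λ v → Valuation q (+ x′) v) → ∀ v w → Valuation q X v → Valuation q Y w → v ≢ w
      compare (vg , hg) (zero , (u , e , q∤u)) v w hX hY v≡w = q∤u (subst (q ∣ℕ_) (trans (cong ℤ.∣_∣ (trans e (ℤ.*-identityˡ u))) refl) q∣x′)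
      compare (vg , hg) (suc vx , hx) v w hX hY v≡w = ℕ.m+1+n≢m vg {vx} (begin
        vg ℕ.+ suc vx    ≡⟨ valuation-unique prime-q (subst (λ z → Valuation q z (vg ℕ.+ suc vx)) (product X x′ ex) (valuation-* prime-q {+ g} {+ x′} {vg} {suc vx} hg hx)) (valuation-abs prime-q {X} {v} hX) ⟩
        v                ≡⟨ v≡w ⟩
        w                ≡⟨ valuation-unique prime-q (valuation-abs prime-q {Y} {w} hY) (subst (λ z → Valuation q z (vg ℕ.+ 0)) (product Y y′ ey) (valuation-* prime-q {+ g} {+ y′} {vg} {0} hg (valuation-∤ prime-q (+ y′) q∤y′))) ⟩
        vg ℕ.+ 0         ≡⟨ ℕ.+-identityʳ vg ⟩
        vg               ∎)
        where
        open ≡-Reasoning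
        product : ∀ Z z → ℤ.∣ Z ∣ ≡ g ℕ.* z → + g ℤ.* + z ≡ + ℤ.∣ Z ∣
        product Z z e = trans (sym (ℤ.pos-* g z)) (cong +_ (sym e))
  split : g ∣ℕ x → g ∣ℕ y → Result X Y
  split (ℕ∣.divides x′ ex) (ℕ∣.divides y′ ey) = decide x′ y′ refl refl
    where
    instance
      g≢0 : NonZero g
      g≢0 = ℕ.≢-nonZero (λ g≡0 → X≢0 (ℤ.∣i∣≡0⇒i≡0 (trans ex (trans (cong (x′ ℕ.*_) g≡0) (ℕ.*-zeroʳ x′)))))
    coprime : Coprime x′ y′
    coprime {i} (ℕ∣.divides k e , ℕ∣.divides k′ e′) = ℕ∣.∣1⇒≡1 (ℕ∣.*-cancelˡ-∣ g (subst (g ℕ.* i ∣ℕ_) (sym (ℕ.*-identityʳ g)) (gcd-greatest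
      (ℕ∣.divides k (trans ex (trans (cong (ℕ._* g) e) (trans (ℕ.*-assoc k i g) (cong (k ℕ.*_) (ℕ.*-comm i g))))))
      (ℕ∣.divides k′ (trans ey (trans (cong (ℕ._* g) e′) (trans (ℕ.*-assoc k′ i g) (cong (k′ ℕ.*_) (ℕ.*-comm i g)))))))))
    swap : Result Y X → Result X Y
    swap (q , prime-q , h) = q , prime-q , (λ v w hv hw v≡w → h w v hw hv (sym v≡w))
    ex′ = trans ex (ℕ.*-comm x′ g)
    ey′ = trans ey (ℕ.*-comm y′ g)
    decide : ∀ m n → m ≡ x′ → n ≡ y′ → Result X Y
    decide zero n e _ = ⊥-elim (X≢0 (ℤ.∣i∣≡0⇒i≡0 (trans ex (cong (ℕ._* g) (sym e)))))
    decide m zero _ e = ⊥-elim (Y≢0 (ℤ.∣i∣≡0⇒i≡0 (trans ey (cong (ℕ._* g) (sym e)))))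
    decide 1 1 e e′ = ⊥-elim (X≢Y (trans ex (trans (cong (ℕ._* g) (trans (sym e) e′)) (sym ey))))
    decide (suc (suc m)) n e _ = one-sided X Y g x′ y′ ex′ ey′ X≢0 Y≢0 coprime (subst (1 <_) e (s≤s (s≤s z≤n)))
    decide m (suc (suc n)) _ e = swap (one-sided Y X g y′ x′ ey′ ex′ Y≢0 X≢0 (Coprimality.sym coprime) (subst (1 <_) e (s≤s (s≤s z≤n))))

-- Valuations as obstructions to ℓ-th roots

module CyclotomicTower
  (O : Order) (m″ : ℕ) (prime-ℓ : Prime (suc (suc m″))) (ζ : Order.Carrier O)
  (∑ζ^≡0 : Order.∑ O (suc (suc m″)) (λ i → Order._^_ O ζ i) ≡ Order.0# O)
  (degree : ℕ) (coordinates : Order.Carrier O → Vec ℤ degree)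
  (evaluate-ζ : ∀ a → Evaluation.evaluate O ζ (coordinates a) ≡ a)
  where

  open Cyclotomic O m″ prime-ℓ ζ ∑ζ^≡0 degree coordinates evaluate-ζ
  open Order O using (Carrier; ι; 0#; 1#; ι-1; ι-*; zeroˡ; zeroʳ; *-identityʳ; _≟_; 0^suc) renaming (_*_ to _·_; _^_ to _^ₒ_)

  Obstruction : ℤ → Set
  Obstruction C = ∃₂ λ q v → Prime q × q ≢ ℓ × Valuation q C v × v % ℓ ≢ 0

  -- Otherwise the valuation of C at q would be a difference of two multiples of ℓ. Since O / q is
  -- reduced for q different from ℓ, powers of q split off from ℓ-th powers in multiples of ℓ even
  -- where q does not stay prime in O.
  no-root : ∀ C → Obstruction C → ∀ u t → u ^ₒ ℓ ≡ t ^ₒ ℓ · ι C → t ≡ 0#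
  no-root C (q , v , prime-q , q≢ℓ , hC@(c , eC , q∤c) , ℓ∤v) u t e = decide (t ≟ 0#)
    where
    open Order.Domain O domain
    decide : Dec (t ≡ 0#) → t ≡ 0#
    decide (yes p) = p
    decide (no t≢0) = ⊥-elim (conclude (valuations-agree prime-q q≢ℓ u t 0 v (+ 1) c u≢0 t≢0 (prime∤1 prime-q) q∤c
      (trans (trans (cong (u ^ₒ ℓ ·_) ι-1) (*-identityʳ (u ^ₒ ℓ))) (trans e (cong (λ z → t ^ₒ ℓ · ι z) eC)))))
      where
      u≢0 : u ≢ 0#
      u≢0 u≡0 = *-≢0 (^-≢0 ℓ t≢0 (OrderArithmetic.1≢0 O)) (λ ιC≡0 → valuation⇒≢0 prime-q {C} {v} hC (ℤ.∣i∣≡0⇒i≡0 (trans (sym (OrderArithmetic.‖ι‖ O C)) (trans (cong (Order.‖_‖ O) ιC≡0) (OrderArithmetic.‖0‖ O)))))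
        (trans (sym e) (trans (cong (_^ₒ ℓ) u≡0) (0^suc (suc m″))))
      conclude : (∃₂ λ i j → i ℕ.* ℓ ℕ.+ 0 ≡ j ℕ.* ℓ ℕ.+ v) → ⊥
      conclude (i , j , ij) = ℓ∤v (begin
        v % ℓ                      ≡⟨ sym ([m+kn]%n≡m%n v j ℓ) ⟩
        (v ℕ.+ j ℕ.* ℓ) % ℓ        ≡⟨ cong (_% ℓ) (trans (ℕ.+-comm v (j ℕ.* ℓ)) (trans (sym ij) (ℕ.+-identityʳ (i ℕ.* ℓ)))) ⟩
        (i ℕ.* ℓ) % ℓ              ≡⟨ m*n%n≡0 i ℓ ⟩
        0                          ∎)
        where open ≡-Reasoning

  cyclotomic-tower : ∀ C B → B ≢ + 0 → Obstruction C → (∀ j → Obstruction (B ℤ.* C ^ᶻ j)) → Σ Ring λ A → NonPowerModuli A ℓ C B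
  cyclotomic-tower C B B≢0 hC hB = KummerTower.kummer-tower O m″ prime-ℓ ζ ζ^ℓ≡1 ∑ζ^[ij]≡0 domain C B B≢0 (no-root C hC)
    (λ j u t e → no-root (B ℤ.* C ^ᶻ j) (hB j) u t (trans e (cong (t ^ₒ ℓ ·_) (sym (trans (ι-* B (C ^ᶻ j)) (cong (ι B ·_) (ι-^ (Order.ring O) C j)))))))

non-power-moduli : ∀ m″ (prime-ℓ : Prime (suc (suc m″))) C B → B ≢ + 0 →
  (∃₂ λ q v → Prime q × q ≢ suc (suc m″) × Valuation q C v × v % suc (suc m″) ≢ 0) →
  (∀ j → ∃₂ λ q v → Prime q × q ≢ suc (suc m″) × Valuation q (B ℤ.* C ^ᶻ j) v × v % suc (suc m″) ≢ 0) →
  Σ Ring λ A → NonPowerModuli A (suc (suc m″)) C B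
non-power-moduli m″ prime-ℓ = CyclotomicTower.cyclotomic-tower O m″ prime-ℓ ζ ∑ζ^≡0 (suc m″) (λ a → a) evaluate-ζ
  where open CyclotomicIntegers m″

module _ (c d f g : ℤ) (c≢0 : c ≢ + 0) (d≢0 : d ≢ + 0) (f≢0 : f ≢ + 0) (g≢0 : g ≢ + 0) where

  private
    *-≢0 : ∀ {a b} → a ≢ + 0 → b ≢ + 0 → a ℤ.* b ≢ + 0
    *-≢0 {a} {b} a≢0 b≢0 e = [ a≢0 , b≢0 ]′ (ℤ.i*j≡0⇒i≡0∨j≡0 a e)

    ^-≢0 : ∀ {a} n → a ≢ + 0 → a ^ᶻ n ≢ + 0
    ^-≢0 zero a≢0 ()
    ^-≢0 (suc n) a≢0 = *-≢0 a≢0 (^-≢0 n a≢0)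


  -- Exchanging a with a′ and e with e′ leads to a monomial whose quotient with the original is a
  -- power product: (f / g) ^ (a - a′) (c / d) ^ (e - e′). Independence up to sign can thus be
  -- stated with natural exponents and absolute values.
  monomial : ℕ → ℕ → ℕ → ℕ → ℤ
  monomial a a′ e e′ = f ^ᶻ a ℤ.* g ^ᶻ a′ ℤ.* (c ^ᶻ e ℤ.* d ^ᶻ e′)

  monomial≢0 : ∀ a a′ e e′ → monomial a a′ e e′ ≢ + 0
  monomial≢0 a a′ e e′ = *-≢0 (*-≢0 (^-≢0 a f≢0) (^-≢0 a′ g≢0)) (*-≢0 (^-≢0 e c≢0) (^-≢0 e′ d≢0))

  -- The valuations of c / d and f / g at two primes form a nonsingular matrix, so for large ℓ no f / g (c / d) ^ j is an ℓ-th power.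
  module _ (∣c∣≢∣d∣ : ℤ.∣ c ∣ ≢ ℤ.∣ d ∣)
           (independent : ∀ a a′ e e′ → a ≢ a′ → ℤ.∣ monomial a a′ e e′ ∣ ≢ ℤ.∣ monomial a′ a e′ e ∣) where

    private
      record Valuations (q : ℕ) : Set where
        field
          prime-q : Prime q
          vc vd vf vg : ℕ
          hc : Valuation q c vc
          hd : Valuation q d vd
          hf : Valuation q f vf
          hg : Valuation q g vg

      valuations : ∀ q → Prime q → Valuations q
      valuations q prime-q = collect (valuation prime-q c c≢0) (valuation prime-q d d≢0) (valuation prime-q f f≢0) (valuation prime-q g g≢0)
        where
        collect : (∃ λ v → Valuation q c v) → (∃ λ v → Valuation q d v) → (∃ λ v → Valuation q f v) → (∃ λ v → Valuation q g v) → Valuations q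
        collect (vc , hc) (vd , hd) (vf , hf) (vg , hg) = record { prime-q = prime-q ; vc = vc ; vd = vd ; vf = vf ; vg = vg ; hc = hc ; hd = hd ; hf = hf ; hg = hg }

      monomial-valuation : ∀ {q} (V : Valuations q) a a′ e e′ → let open Valuations V in
        Valuation q (monomial a a′ e e′) (a ℕ.* vf ℕ.+ a′ ℕ.* vg ℕ.+ (e ℕ.* vc ℕ.+ e′ ℕ.* vd))
      monomial-valuation V a a′ e e′ = valuation-* prime-q {f ^ᶻ a ℤ.* g ^ᶻ a′} {c ^ᶻ e ℤ.* d ^ᶻ e′} {a ℕ.* vf ℕ.+ a′ ℕ.* vg} {e ℕ.* vc ℕ.+ e′ ℕ.* vd}
        (valuation-* prime-q {f ^ᶻ a} {g ^ᶻ a′} {a ℕ.* vf} {a′ ℕ.* vg} (valuation-^ prime-q {f} {vf} a hf) (valuation-^ prime-q {g} {vg} a′ hg))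
        (valuation-* prime-q {c ^ᶻ e} {d ^ᶻ e′} {e ℕ.* vc} {e′ ℕ.* vd} (valuation-^ prime-q {c} {vc} e hc) (valuation-^ prime-q {d} {vd} e′ hd))
        where open Valuations V

    record Exponent : Set₁ where
      field
        m″ : ℕ
        prime-ℓ : Prime (suc (suc m″))
        ring : Ring
        moduli : NonPowerModuli ring (suc (suc m″)) (c ℤ.* d ^ᶻ suc m″) (f ℤ.* g ^ᶻ suc m″)

    private
      module _ {q₁ q₂ : ℕ} (V₁ : Valuations q₁) (V₂ : Valuations q₂) (vc≢vd : Valuations.vc V₁ ≢ Valuations.vd V₁) where
        open Valuations V₁
        open Valuations V₂ using () renaming (prime-q to prime-q₂; vc to vc₂; vd to vd₂; vf to vf₂; vg to vg₂; hc to hc₂; hd to hd₂; hf to hf₂; hg to hg₂)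

        vX vY : ℕ
        vX = vc ℕ.* vf₂ ℕ.+ vd ℕ.* vg₂ ℕ.+ (vg ℕ.* vc₂ ℕ.+ vf ℕ.* vd₂)
        vY = vd ℕ.* vf₂ ℕ.+ vc ℕ.* vg₂ ℕ.+ (vf ℕ.* vc₂ ℕ.+ vg ℕ.* vd₂)

        exponent : vX ≢ vY → ∀ m″ → Prime (suc (suc m″)) → vc ℕ.+ vd ℕ.+ (q₁ ℕ.+ q₂) ℕ.+ (vX ℕ.+ vY) < suc (suc m″) → Exponent
        exponent vX≢vY m″ prime-ℓ large = record { m″ = m″ ; prime-ℓ = prime-ℓ ; ring = proj₁ tower ; moduli = proj₂ tower }
          where
          m′ ℓ : ℕ
          m′ = suc m″
          ℓ = suc m′
          C = c ℤ.* d ^ᶻ m′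
          B = f ℤ.* g ^ᶻ m′
          below : ∀ {k} → k ≤ vc ℕ.+ vd ℕ.+ (q₁ ℕ.+ q₂) ℕ.+ (vX ℕ.+ vY) → k < ℓ
          below k≤ = ℕ.≤-<-trans k≤ large
          vc+vd≤ = ℕ.≤-trans (ℕ.m≤m+n (vc ℕ.+ vd) (q₁ ℕ.+ q₂)) (ℕ.m≤m+n (vc ℕ.+ vd ℕ.+ (q₁ ℕ.+ q₂)) (vX ℕ.+ vY))
          q₁+q₂≤ = ℕ.≤-trans (ℕ.m≤n+m (q₁ ℕ.+ q₂) (vc ℕ.+ vd)) (ℕ.m≤m+n (vc ℕ.+ vd ℕ.+ (q₁ ℕ.+ q₂)) (vX ℕ.+ vY))
          vX+vY≤ = ℕ.m≤n+m (vX ℕ.+ vY) (vc ℕ.+ vd ℕ.+ (q₁ ℕ.+ q₂))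
          vc<ℓ = below (ℕ.≤-trans (ℕ.m≤m+n vc vd) vc+vd≤)
          vd<ℓ = below (ℕ.≤-trans (ℕ.m≤n+m vd vc) vc+vd≤)
          q₁≢ℓ : q₁ ≢ ℓ
          q₁≢ℓ e = ℕ.<⇒≢ (below (ℕ.≤-trans (ℕ.m≤m+n q₁ q₂) q₁+q₂≤)) e
          q₂≢ℓ : q₂ ≢ ℓ
          q₂≢ℓ e = ℕ.<⇒≢ (below (ℕ.≤-trans (ℕ.m≤n+m q₂ q₁) q₁+q₂≤)) e
          -- The valuation of c d ^ (ℓ - 1) is vc - vd modulo ℓ, and vc and vd are different and
          -- below ℓ.
          vC≢0 : (vc ℕ.+ m′ ℕ.* vd) % ℓ ≢ 0
          vC≢0 h = vc≢vd (begin
            vc                                                ≡⟨ sym (m<n⇒m%n≡m vc<ℓ) ⟩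
            vc % ℓ                                            ≡⟨ sym ([m+kn]%n≡m%n vc vd ℓ) ⟩
            (vc ℕ.+ vd ℕ.* ℓ) % ℓ                             ≡⟨ cong (_% ℓ) (trans (cong (λ z → vc ℕ.+ z) (ℕ.*-comm vd ℓ)) (trans (cong (λ z → vc ℕ.+ z) (ℕ.+-comm vd (m′ ℕ.* vd))) (trans (sym (ℕ.+-assoc vc (m′ ℕ.* vd) vd)) (ℕ.+-comm v vd)))) ⟩
            (vd ℕ.+ v) % ℓ                                    ≡⟨ cong (λ z → (vd ℕ.+ z) % ℓ) (trans (m≡m%n+[m/n]*n v ℓ) (cong (λ z → z ℕ.+ v ℕ./ ℓ ℕ.* ℓ) h)) ⟩
            (vd ℕ.+ v ℕ./ ℓ ℕ.* ℓ) % ℓ                        ≡⟨ [m+kn]%n≡m%n vd (v ℕ./ ℓ) ℓ ⟩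
            vd % ℓ                                            ≡⟨ m<n⇒m%n≡m vd<ℓ ⟩
            vd                                                ∎)
            where
            open ≡-Reasoning
            v = vc ℕ.+ m′ ℕ.* vd
          E₁ E₂ : ℕ → ℕ
          E₁ j = vf ℕ.+ m′ ℕ.* vg ℕ.+ j ℕ.* (vc ℕ.+ m′ ℕ.* vd)
          E₂ j = vf₂ ℕ.+ m′ ℕ.* vg₂ ℕ.+ j ℕ.* (vc₂ ℕ.+ m′ ℕ.* vd₂)
          hE : ∀ {q} (V : Valuations q) j → let module v = Valuations V in Valuation q (B ℤ.* C ^ᶻ j) (v.vf ℕ.+ m′ ℕ.* v.vg ℕ.+ j ℕ.* (v.vc ℕ.+ m′ ℕ.* v.vd))
          hE V j = valuation-* v.prime-q {B} {C ^ᶻ j} {v.vf ℕ.+ m′ ℕ.* v.vg} {j ℕ.* (v.vc ℕ.+ m′ ℕ.* v.vd)}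
            (valuation-* v.prime-q {f} {g ^ᶻ m′} {v.vf} {m′ ℕ.* v.vg} v.hf (valuation-^ v.prime-q {g} {v.vg} m′ v.hg))
            (valuation-^ v.prime-q {C} {v.vc ℕ.+ m′ ℕ.* v.vd} j (valuation-* v.prime-q {c} {d ^ᶻ m′} {v.vc} {m′ ℕ.* v.vd} v.hc (valuation-^ v.prime-q {d} {v.vd} m′ v.hd)))
            where module v = Valuations V
          -- If the valuations of B C ^ j at both primes vanished modulo ℓ, eliminating j would make
          -- ℓ divide vX - vY, the determinant formed by the valuations of c / d and f / g at q₁ and
          -- q₂. It is nonzero and smaller than ℓ.
          not-both : ∀ j → E₁ j % ℓ ≡ 0 → E₂ j % ℓ ≡ 0 → ⊥
          not-both j h₁ h₂ = vX≢vY (ℤ.+-injective (ℤ.i-j≡0⇒i≡j (+ vX) (+ vY) (OrderArithmetic.small-multiple ℤ-order ℓ {+ vX ℤ.- + vY} divisible small)))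
            where
            open Ring.Solver ℤ-ring using (solve; _:+_; _:-_; _:*_; _:=_; con)
            open ≡-Reasoning
            embed : ∀ f g c d → + (f ℕ.+ m′ ℕ.* g ℕ.+ j ℕ.* (c ℕ.+ m′ ℕ.* d)) ≡ + f ℤ.+ + m′ ℤ.* + g ℤ.+ + j ℤ.* (+ c ℤ.+ + m′ ℤ.* + d)
            embed f g c d = cong₂ ℤ._+_ (cong (λ z → + f ℤ.+ z) (ℤ.pos-* m′ g)) (trans (ℤ.pos-* j (c ℕ.+ m′ ℕ.* d)) (cong (λ z → + j ℤ.* (+ c ℤ.+ z)) (ℤ.pos-* m′ d)))
            combination : ∀ f g c d → (f ℕ.+ m′ ℕ.* g ℕ.+ j ℕ.* (c ℕ.+ m′ ℕ.* d)) % ℓ ≡ 0 → ∃ λ k → (+ f ℤ.- + g) ℤ.+ + j ℤ.* (+ c ℤ.- + d) ≡ + ℓ ℤ.* k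
            combination f g c d h = + (e ℕ./ ℓ) ℤ.- (+ g ℤ.+ + j ℤ.* + d) , (begin
              (+ f ℤ.- + g) ℤ.+ + j ℤ.* (+ c ℤ.- + d)
                ≡⟨ solve 6 (λ f g c d j m → (f :- g) :+ j :* (c :- d) := (f :+ m :* g :+ j :* (c :+ m :* d)) :- (con (+ 1) :+ m) :* (g :+ j :* d)) refl (+ f) (+ g) (+ c) (+ d) (+ j) (+ m′) ⟩
              (+ f ℤ.+ + m′ ℤ.* + g ℤ.+ + j ℤ.* (+ c ℤ.+ + m′ ℤ.* + d)) ℤ.- + ℓ ℤ.* (+ g ℤ.+ + j ℤ.* + d)
                ≡⟨ cong (λ z → z ℤ.- + ℓ ℤ.* (+ g ℤ.+ + j ℤ.* + d)) (trans (sym (embed f g c d)) (trans (cong +_ (trans (m≡m%n+[m/n]*n e ℓ) (cong (λ z → z ℕ.+ e ℕ./ ℓ ℕ.* ℓ) h))) (ℤ.pos-* (e ℕ./ ℓ) ℓ))) ⟩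
              + (e ℕ./ ℓ) ℤ.* + ℓ ℤ.- + ℓ ℤ.* (+ g ℤ.+ + j ℤ.* + d)
                ≡⟨ solve 3 (λ k l x → k :* l :- l :* x := l :* (k :- x)) refl (+ (e ℕ./ ℓ)) (+ ℓ) (+ g ℤ.+ + j ℤ.* + d) ⟩
              + ℓ ℤ.* (+ (e ℕ./ ℓ) ℤ.- (+ g ℤ.+ + j ℤ.* + d)) ∎)
              where
              e = f ℕ.+ m′ ℕ.* g ℕ.+ j ℕ.* (c ℕ.+ m′ ℕ.* d)
            k₁ = proj₁ (combination vf vg vc vd h₁)
            k₂ = proj₁ (combination vf₂ vg₂ vc₂ vd₂ h₂)
            x₁ = + vc ℤ.- + vd
            x₂ = + vc₂ ℤ.- + vd₂
            products : ∀ a b c d e f g h → + (a ℕ.* b ℕ.+ c ℕ.* d ℕ.+ (e ℕ.* f ℕ.+ g ℕ.* h)) ≡ + a ℤ.* + b ℤ.+ + c ℤ.* + d ℤ.+ (+ e ℤ.* + f ℤ.+ + g ℤ.* + h)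
            products a b c d e f g h = cong₂ ℤ._+_ (cong₂ ℤ._+_ (ℤ.pos-* a b) (ℤ.pos-* c d)) (cong₂ ℤ._+_ (ℤ.pos-* e f) (ℤ.pos-* g h))
            determinant : + vX ℤ.- + vY ≡ x₁ ℤ.* ((+ vf₂ ℤ.- + vg₂) ℤ.+ + j ℤ.* x₂) ℤ.- x₂ ℤ.* ((+ vf ℤ.- + vg) ℤ.+ + j ℤ.* x₁)
            determinant = begin
              + vX ℤ.- + vY
                ≡⟨ cong₂ ℤ._-_ (products vc vf₂ vd vg₂ vg vc₂ vf vd₂) (products vd vf₂ vc vg₂ vf vc₂ vg vd₂) ⟩
              (+ vc ℤ.* + vf₂ ℤ.+ + vd ℤ.* + vg₂ ℤ.+ (+ vg ℤ.* + vc₂ ℤ.+ + vf ℤ.* + vd₂)) ℤ.- (+ vd ℤ.* + vf₂ ℤ.+ + vc ℤ.* + vg₂ ℤ.+ (+ vf ℤ.* + vc₂ ℤ.+ + vg ℤ.* + vd₂))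
                ≡⟨ solve 8 (λ c d f g c₂ d₂ f₂ g₂ → (c :* f₂ :+ d :* g₂ :+ (g :* c₂ :+ f :* d₂)) :- (d :* f₂ :+ c :* g₂ :+ (f :* c₂ :+ g :* d₂)) := (c :- d) :* (f₂ :- g₂) :- (c₂ :- d₂) :* (f :- g)) refl (+ vc) (+ vd) (+ vf) (+ vg) (+ vc₂) (+ vd₂) (+ vf₂) (+ vg₂) ⟩
              x₁ ℤ.* (+ vf₂ ℤ.- + vg₂) ℤ.- x₂ ℤ.* (+ vf ℤ.- + vg)
                ≡⟨ solve 5 (λ x y x₂ y₂ j → x :* y₂ :- x₂ :* y := x :* (y₂ :+ j :* x₂) :- x₂ :* (y :+ j :* x)) refl x₁ (+ vf ℤ.- + vg) x₂ (+ vf₂ ℤ.- + vg₂) (+ j) ⟩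
              x₁ ℤ.* ((+ vf₂ ℤ.- + vg₂) ℤ.+ + j ℤ.* x₂) ℤ.- x₂ ℤ.* ((+ vf ℤ.- + vg) ℤ.+ + j ℤ.* x₁) ∎
            divisible : Ring._∣_ ℤ-ring (+ ℓ) (+ vX ℤ.- + vY)
            divisible = x₁ ℤ.* k₂ ℤ.- x₂ ℤ.* k₁ , (begin
              + vX ℤ.- + vY                                       ≡⟨ determinant ⟩
              x₁ ℤ.* ((+ vf₂ ℤ.- + vg₂) ℤ.+ + j ℤ.* x₂) ℤ.- x₂ ℤ.* ((+ vf ℤ.- + vg) ℤ.+ + j ℤ.* x₁)  ≡⟨ cong₂ (λ a b → x₁ ℤ.* a ℤ.- x₂ ℤ.* b) (proj₂ (combination vf₂ vg₂ vc₂ vd₂ h₂)) (proj₂ (combination vf vg vc vd h₁)) ⟩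
              x₁ ℤ.* (+ ℓ ℤ.* k₂) ℤ.- x₂ ℤ.* (+ ℓ ℤ.* k₁)          ≡⟨ solve 5 (λ x a y b l → x :* (l :* a) :- y :* (l :* b) := l :* (x :* a :- y :* b)) refl x₁ k₂ x₂ k₁ (+ ℓ) ⟩
              + ℓ ℤ.* (x₁ ℤ.* k₂ ℤ.- x₂ ℤ.* k₁)                    ∎)
            small : ℤ.∣ + vX ℤ.- + vY ∣ < ℓ
            small = below (ℕ.≤-trans (ℕ.≤-trans (ℕ.≤-reflexive (cong ℤ.∣_∣ (ℤ.m-n≡m⊖n vX vY))) (ℕ.≤-trans (ℤ.∣m⊝n∣≤m⊔n vX vY) (ℕ.m⊔n≤m+n vX vY))) vX+vY≤)
          obstruction : ∀ j → ∃₂ λ q v → Prime q × q ≢ ℓ × Valuation q (B ℤ.* C ^ᶻ j) v × v % ℓ ≢ 0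
          obstruction j = decide (E₁ j % ℓ ℕ.≟ 0)
            where
            decide : Dec (E₁ j % ℓ ≡ 0) → ∃₂ λ q v → Prime q × q ≢ ℓ × Valuation q (B ℤ.* C ^ᶻ j) v × v % ℓ ≢ 0
            decide (no h) = q₁ , E₁ j , prime-q , q₁≢ℓ , hE V₁ j , h
            decide (yes h) = q₂ , E₂ j , prime-q₂ , q₂≢ℓ , hE V₂ j , not-both j h
          tower = non-power-moduli m″ prime-ℓ C B (*-≢0 f≢0 (^-≢0 m′ g≢0))
            (q₁ , vc ℕ.+ m′ ℕ.* vd , prime-q , q₁≢ℓ , valuation-* prime-q {c} {d ^ᶻ m′} {vc} {m′ ℕ.* vd} hc (valuation-^ prime-q {d} {vd} m′ hd) , vC≢0)
            obstruction

    exponent-exists : Exponent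
    exponent-exists = first (separating-prime c d c≢0 d≢0 ∣c∣≢∣d∣)
      where
      first : (∃ λ q → Prime q × (∀ v w → Valuation q c v → Valuation q d w → v ≢ w)) → Exponent
      first (q₁ , prime-q₁ , h₁) = second (separating-prime X Y (monomial≢0 vc vd vg vf) (monomial≢0 vd vc vf vg) (independent vc vd vg vf vc≢vd))
        where
        V₁ = valuations q₁ prime-q₁
        open Valuations V₁
        vc≢vd = h₁ vc vd hc hd
        -- X / Y = (f / g) ^ (vc - vd) (c / d) ^ (vg - vf) is built to have valuation 0 at q₁. At a
        -- prime q₂ where X and Y differ, its valuation is the determinant of the two valuation
        -- vectors, which is therefore nonzero.
        X = monomial vc vd vg vf
        Y = monomial vd vc vf vg
        second : (∃ λ q → Prime q × (∀ v w → Valuation q X v → Valuation q Y w → v ≢ w)) → Exponent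
        second (q₂ , prime-q₂ , h₂) = choose (prime-above (vc ℕ.+ vd ℕ.+ (q₁ ℕ.+ q₂) ℕ.+ (vX V₁ V₂ vc≢vd ℕ.+ vY V₁ V₂ vc≢vd)))
          where
          V₂ = valuations q₂ prime-q₂
          choose : (∃ λ ℓ → Prime ℓ × vc ℕ.+ vd ℕ.+ (q₁ ℕ.+ q₂) ℕ.+ (vX V₁ V₂ vc≢vd ℕ.+ vY V₁ V₂ vc≢vd) < ℓ) → Exponent
          choose (zero , _ , ())
          choose (suc zero , prime-1 , _) = ⊥-elim (prime⇒≢1 prime-1 refl)
          choose (suc (suc m″) , prime-ℓ , large) = exponent V₁ V₂ vc≢vd (h₂ _ _ (monomial-valuation V₂ vc vd vg vf) (monomial-valuation V₂ vd vc vf vg)) m″ prime-ℓ large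

-- The separating prime

open Ring ℤ-ring using () renaming (^-homo-* to ^ᶻ-homo-*)

module _ (c d f g : ℤ) where

  -- f / g is congruent to (c / d) ^ n modulo p.
  Meets : ℕ → ℕ → Set
  Meets p n = p ∣ℕ ℤ.∣ c ^ᶻ n ℤ.* g ℤ.- f ℤ.* d ^ᶻ n ∣

  NonMeeting : ℕ → Set
  NonMeeting D = ∃ λ p → Prime p × ¬ (p ∣ℕ D) × (∀ n → ¬ Meets p n)

  private
    module A = OrderArithmetic ℤ-order
    _∣ℤ_ = Ring._∣_ ℤ-ring

  fermat-unit : ∀ {p} → Prime (suc p) → ∀ a → ¬ (suc p ∣ℕ ℤ.∣ a ∣) → (+ suc p) ∣ℤ (a ^ᶻ p ℤ.- + 1)
  fermat-unit {p} prime-p a p∤a = A.∣ℕ⇒∣ι (suc p) (a ^ᶻ p ℤ.- + 1) ([ (λ h → ⊥-elim (p∤a h)) , (λ h → h) ]′ (euclidsLemma ℤ.∣ a ∣ ℤ.∣ a ^ᶻ p ℤ.- + 1 ∣ prime-p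
    (subst (suc p ∣ℕ_) (trans (cong ℤ.∣_∣ (solve 2 (λ a b → a :* b :- a := a :* (b :- con (+ 1))) refl a (a ^ᶻ p))) (ℤ.abs-* a (a ^ᶻ p ℤ.- + 1))) (A.∣ι⇒∣ℕ (suc p) (a ^ᶻ suc p ℤ.- a) (A.fermat prime-p a)))))
    where open Ring.Solver ℤ-ring using (solve; _:*_; _:-_; _:=_; con)

  -- By Fermat's little theorem n counts only modulo p - 1, so whether some exponent meets is
  -- decided by a bounded search.
  meets-below : ∀ {p} → Prime p → ¬ (p ∣ℕ ℤ.∣ c ∣) → ¬ (p ∣ℕ ℤ.∣ d ∣) → ∀ n → Meets p n → ∃ λ m → m < p × Meets p m
  meets-below {zero} prime-p _ _ n h = ⊥-elim (ℕ.≢-nonZero⁻¹ 0 {{prime⇒nonZero prime-p}} refl)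
  meets-below {suc p} prime-p p∤c p∤d n h = go n (<-wellFounded n) h
    where
    open Ring.Solver ℤ-ring using (solve; _:*_; _:-_; _:+_; :-_; _:=_; con)
    0<p : 0 < p
    0<p = ℕ.≤-pred (prime⇒1< prime-p)
    go : ∀ n → Acc _<_ n → Meets (suc p) n → ∃ λ m → m < suc p × Meets (suc p) m
    go n (acc rec) h = decide (n ℕ.<? suc p)
      where
      decide : Dec (n < suc p) → ∃ λ m → m < suc p × Meets (suc p) m
      decide (yes n<p) = n , n<p , h
      decide (no n≮p) = descend (ℕ.m≤n⇒∃[o]m+o≡n (ℕ.≤-trans (ℕ.n≤1+n p) (ℕ.≮⇒≥ n≮p)))
        where
        descend : (∃ λ o → p ℕ.+ o ≡ n) → ∃ λ m → m < suc p × Meets (suc p) m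
        descend (o , refl) = go o (rec (ℕ.m<n+m o 0<p)) (A.∣ι⇒∣ℕ (suc p) (c ^ᶻ o ℤ.* g ℤ.- f ℤ.* d ^ᶻ o) (subst ((+ suc p) ∣ℤ_) identity
          (Ring.∣-+ ℤ-ring {+ suc p} (A.∣ℕ⇒∣ι (suc p) (c ^ᶻ (p ℕ.+ o) ℤ.* g ℤ.- f ℤ.* d ^ᶻ (p ℕ.+ o)) h)
            (Ring.∣-+ ℤ-ring {+ suc p} (Ring.∣-*ʳ ℤ-ring {+ suc p} {c ^ᶻ p ℤ.- + 1} (ℤ.- (c ^ᶻ o ℤ.* g)) (fermat-unit prime-p c p∤c)) (Ring.∣-*ʳ ℤ-ring {+ suc p} {d ^ᶻ p ℤ.- + 1} (f ℤ.* d ^ᶻ o) (fermat-unit prime-p d p∤d))))))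
          where
          identity : (c ^ᶻ (p ℕ.+ o) ℤ.* g ℤ.- f ℤ.* d ^ᶻ (p ℕ.+ o)) ℤ.+ ((c ^ᶻ p ℤ.- + 1) ℤ.* (ℤ.- (c ^ᶻ o ℤ.* g)) ℤ.+ (d ^ᶻ p ℤ.- + 1) ℤ.* (f ℤ.* d ^ᶻ o)) ≡ c ^ᶻ o ℤ.* g ℤ.- f ℤ.* d ^ᶻ o
          identity = trans (cong₂ (λ u v → (u ℤ.* g ℤ.- f ℤ.* v) ℤ.+ ((c ^ᶻ p ℤ.- + 1) ℤ.* (ℤ.- (c ^ᶻ o ℤ.* g)) ℤ.+ (d ^ᶻ p ℤ.- + 1) ℤ.* (f ℤ.* d ^ᶻ o))) (^ᶻ-homo-* c p o) (^ᶻ-homo-* d p o))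
            (solve 6 (λ cp co dp dₒ f g → (cp :* co :* g :- f :* (dp :* dₒ)) :+ ((cp :- con (+ 1)) :* (:- (co :* g)) :+ (dp :- con (+ 1)) :* (f :* dₒ)) := co :* g :- f :* dₒ) refl (c ^ᶻ p) (c ^ᶻ o) (d ^ᶻ p) (d ^ᶻ o) f g)

  module _ (c≢0 : c ≢ + 0) (d≢0 : d ≢ + 0) (f≢0 : f ≢ + 0) (g≢0 : g ≢ + 0)
           (∣c∣≢∣d∣ : ℤ.∣ c ∣ ≢ ℤ.∣ d ∣)
           (independent : ∀ a a′ e e′ → a ≢ a′ → ℤ.∣ monomial c d f g c≢0 d≢0 f≢0 g≢0 a a′ e e′ ∣ ≢ ℤ.∣ monomial c d f g c≢0 d≢0 f≢0 g≢0 a′ a e′ e ∣) where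

    -- For large ℓ there is a modulus W for which f / g is not an ℓ-th power in ring, although c / d is one;
    -- so f / g cannot be a power of c / d modulo every prime divisor of W.
    non-meeting-prime : ∀ D → 0 < D → NonMeeting D
    non-meeting-prime D 0<D = fromExponent (exponent-exists c d f g c≢0 d≢0 f≢0 g≢0 ∣c∣≢∣d∣ independent)
      where
      fromExponent : Exponent c d f g c≢0 d≢0 f≢0 g≢0 ∣c∣≢∣d∣ independent → NonMeeting D
      fromExponent E = fromModuli moduli
        where
        open Exponent E using (m″; moduli) renaming (ring to R)
        open Ring R using (ι; ιₙ; 1#; _+_; _*_; -_; ι-*; ι-+; ι-neg; *-comm; *-assoc; ιₙ-*; ι-1; *-identityˡ) renaming (_^_ to _^ᵣ_; _∣_ to _∣ᵣ_)
        open Congruences R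
        open Roots R
        m′ ℓ : ℕ
        m′ = suc m″
        ℓ = suc m′
        B : ℤ
        B = f ℤ.* g ^ᶻ m′
        nonzero : ∀ {a} → a ≢ + 0 → 0 < ℤ.∣ a ∣
        nonzero a≢0 = ℕ.n≢0⇒n>0 (λ e → a≢0 (ℤ.∣i∣≡0⇒i≡0 e))
        B≢0 : B ≢ + 0
        B≢0 e = [ f≢0 , power m′ ]′ (ℤ.i*j≡0⇒i≡0∨j≡0 f e)
          where
          power : ∀ n → g ^ᶻ n ≢ + 0
          power zero ()
          power (suc n) e = [ g≢0 , power n ]′ (ℤ.i*j≡0⇒i≡0∨j≡0 g e)
        -- Besides D, the modulus has to avoid ℓ B for Hensel lifting, and c and d so that both are
        -- invertible modulo its primes.
        bad : ℕ
        bad = D ℕ.* (ℓ ℕ.* ℤ.∣ B ∣ ℕ.* (ℤ.∣ c ∣ ℕ.* ℤ.∣ d ∣))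
        0<bad : 0 < bad
        0<bad = ℕ.*-mono-≤ 0<D (ℕ.*-mono-≤ (ℕ.*-mono-≤ {1} {ℓ} (s≤s z≤n) (nonzero B≢0)) (ℕ.*-mono-≤ (nonzero c≢0) (nonzero d≢0)))
        -- Excludes W = 0, which is coprime only to 1.
        1<bad : 1 < bad
        1<bad = ℕ.*-mono-≤ {1} {D} {2} 0<D (ℕ.*-mono-≤ {2} {ℓ ℕ.* ℤ.∣ B ∣} {1} (ℕ.*-mono-≤ {2} {ℓ} {1} (s≤s (s≤s z≤n)) (nonzero B≢0)) (ℕ.*-mono-≤ (nonzero c≢0) (nonzero d≢0)))
        fromModuli : NonPowerModuli R ℓ (c ℤ.* d ^ᶻ m′) B → NonMeeting D
        fromModuli ((x , x^ℓ≡C) , modulus) = fromModulus (modulus bad 0<bad)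
          where
          fromModulus : (∃ λ W → Coprime W bad × (∀ y → ¬ (y ^ᵣ ℓ ≡ ι B [mod ιₙ W ]))) → NonMeeting D
          -- Prime divisors of W are at most W, so the search either finds one without a meeting
          -- exponent or shows that all have one; in the latter case B has an ℓ-th root modulo each
          -- of them and hence modulo W.
          fromModulus (W , coprime , no-root) = decide (ℕ.anyUpTo? good? (suc W))
            where
            Good : ℕ → Set
            Good p = Prime p × p ∣ℕ W × ¬ (∃ λ n → n < p × Meets p n)
            meets? : ∀ p n → Dec (Meets p n)
            meets? p n = p ℕ∣.∣? ℤ.∣ c ^ᶻ n ℤ.* g ℤ.- f ℤ.* d ^ᶻ n ∣
            good? : ∀ p → Dec (Good p)
            good? p = prime? p ×-dec ((p ℕ∣.∣? W) ×-dec (¬? (ℕ.anyUpTo? (meets? p) p)))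
            W≢0 : NonZero W
            W≢0 = ℕ.≢-nonZero (λ { refl → ℕ.<⇒≢ 1<bad (sym (Coprimality.0-coprimeTo-m⇒m≡1 coprime)) })
            avoids : ∀ {p k} → Prime p → p ∣ℕ W → k ∣ℕ bad → ¬ (p ∣ℕ k)
            avoids prime-p p∣W k∣bad p∣k = prime⇒≢1 prime-p (coprime (p∣W , ℕ∣.∣-trans p∣k k∣bad))
            c∣bad : ℤ.∣ c ∣ ∣ℕ bad
            c∣bad = ℕ∣.∣n⇒∣m*n D (ℕ∣.∣n⇒∣m*n (ℓ ℕ.* ℤ.∣ B ∣) (ℕ∣.m∣m*n ℤ.∣ d ∣))
            d∣bad : ℤ.∣ d ∣ ∣ℕ bad
            d∣bad = ℕ∣.∣n⇒∣m*n D (ℕ∣.∣n⇒∣m*n (ℓ ℕ.* ℤ.∣ B ∣) (ℕ∣.∣n⇒∣m*n ℤ.∣ c ∣ ℕ∣.∣-refl))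
            decide : Dec (∃ λ p → p < suc W × Good p) → NonMeeting D
            decide (yes (p , _ , prime-p , p∣W , none)) = p , prime-p , avoids prime-p p∣W (ℕ∣.m∣m*n _) ,
              (λ n h → none (meets-below prime-p (avoids prime-p p∣W c∣bad) (avoids prime-p p∣W d∣bad) n h))
            decide (no all-meet) = ⊥-elim (no-root (proj₁ root) (proj₂ root))
              where
              signed : ∀ n → ∃ λ s → ι n * s ≡ ιₙ ℤ.∣ n ∣
              signed (+ n) = 1# , Ring.*-identityʳ R (ιₙ n)
              signed -[1+ n ] = - 1# , trans (cong (_* - 1#) (ι-neg (+ suc n))) (solve 1 (λ x → (:- x) :* (:- con (+ 1)) := x) refl (ιₙ (suc n)))
                where open Ring.Solver R using (solve; _:*_; :-_; _:=_; con)
              inverse : ∀ {M} n → Coprime M ℤ.∣ n ∣ → ∃ λ u → ι n * u ≡ 1# [mod ιₙ M ]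
              inverse {M} n co = fromBézout (bézout co) (signed n)
                where
                open ≡-Reasoning
                open Ring.Solver R using (solve; _:*_; _:+_; _:-_; :-_; _:=_; con)
                fromBézout : (∃₂ λ s t → ι s * ιₙ M + ι t * ιₙ ℤ.∣ n ∣ ≡ 1#) → (∃ λ s → ι n * s ≡ ιₙ ℤ.∣ n ∣) → ∃ λ u → ι n * u ≡ 1# [mod ιₙ M ]
                fromBézout (s , t , st) (σ , eσ) = σ * ι t , (- ι s , (begin
                  ι n * (σ * ι t) + - 1#                              ≡⟨ cong₂ (λ u v → u + - v) (sym (*-assoc (ι n) σ (ι t))) (sym st) ⟩
                  ι n * σ * ι t + - (ι s * ιₙ M + ι t * ιₙ ℤ.∣ n ∣)    ≡⟨ cong (λ z → z * ι t + - (ι s * ιₙ M + ι t * ιₙ ℤ.∣ n ∣)) eσ ⟩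
                  ιₙ ℤ.∣ n ∣ * ι t + - (ι s * ιₙ M + ι t * ιₙ ℤ.∣ n ∣)  ≡⟨ solve 4 (λ n t s m → n :* t :- (s :* m :+ t :* n) := m :* (:- s)) refl (ιₙ ℤ.∣ n ∣) (ι t) (ι s) (ιₙ M) ⟩
                  ιₙ M * - ι s                                        ∎))
              ι-C : ι (c ℤ.* d ^ᶻ m′) ≡ ι c * ι d ^ᵣ m′
              ι-C = trans (ι-* c (d ^ᶻ m′)) (cong (ι c *_) (ι-^ R d m′))
              ι-B : ι B ≡ ι f * ι g ^ᵣ m′
              ι-B = trans (ι-* f (g ^ᶻ m′)) (cong (ι f *_) (ι-^ R g m′))
              unit : Unit m′ (ι B) W
              unit = fromInverse (inverse {W} (+ ℓ ℤ.* B) (λ { (i∣W , i∣ℓB) → coprime (i∣W , ℕ∣.∣-trans i∣ℓB (ℕ∣.∣-trans (ℕ∣.∣-reflexive (ℤ.abs-* (+ ℓ) B)) (ℕ∣.∣n⇒∣m*n D (ℕ∣.m∣m*n (ℤ.∣ c ∣ ℕ.* ℤ.∣ d ∣))))) }))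
                where
                fromInverse : (∃ λ u → ι (+ ℓ ℤ.* B) * u ≡ 1# [mod ιₙ W ]) → Unit m′ (ι B) W
                fromInverse (u , e) = u , mod-trans (mod-reflexive (cong (_* u) (sym (ι-* (+ ℓ) B)))) e
              roots : ∀ p → Prime p → p ∣ℕ W → Root m′ (ι B) p
              roots p prime-p p∣W = fromMeets (ℕ.anyUpTo? (meets? p) p)
                where
                fromMeets : Dec (∃ λ n → n < p × Meets p n) → Root m′ (ι B) p
                fromMeets (no h) = ⊥-elim (all-meet (p , s≤s (ℕ∣.∣⇒≤ {{W≢0}} p∣W) , prime-p , p∣W , h))
                fromMeets (yes (n , _ , h)) = fromInverse (inverse {p} d (prime∤⇒coprime prime-p (avoids prime-p p∣W d∣bad)))
                  where
                  congruent : ι c ^ᵣ n * ι g ≡ ι f * ι d ^ᵣ n [mod ιₙ p ]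
                  congruent = image (A.∣ℕ⇒∣ι p (c ^ᶻ n ℤ.* g ℤ.- f ℤ.* d ^ᶻ n) h)
                    where
                    open ≡-Reasoning
                    image : (+ p) ∣ℤ (c ^ᶻ n ℤ.* g ℤ.- f ℤ.* d ^ᶻ n) → ι c ^ᵣ n * ι g ≡ ι f * ι d ^ᵣ n [mod ιₙ p ]
                    image (k , e) = ι k , (begin
                      ι c ^ᵣ n * ι g + - (ι f * ι d ^ᵣ n)        ≡⟨ cong₂ (λ u v → u * ι g + - (ι f * v)) (sym (ι-^ R c n)) (sym (ι-^ R d n)) ⟩
                      ι (c ^ᶻ n) * ι g + - (ι f * ι (d ^ᶻ n))      ≡⟨ cong₂ (λ u v → u + - v) (sym (ι-* (c ^ᶻ n) g)) (sym (ι-* f (d ^ᶻ n))) ⟩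
                      ι (c ^ᶻ n ℤ.* g) + - ι (f ℤ.* d ^ᶻ n)        ≡⟨ trans (cong (λ z → ι (c ^ᶻ n ℤ.* g) + z) (sym (ι-neg (f ℤ.* d ^ᶻ n)))) (sym (ι-+ (c ^ᶻ n ℤ.* g) (ℤ.- (f ℤ.* d ^ᶻ n)))) ⟩
                      ι (c ^ᶻ n ℤ.* g ℤ.- f ℤ.* d ^ᶻ n)            ≡⟨ trans (cong ι e) (ι-* (+ p) k) ⟩
                      ιₙ p * ι k                                 ∎)
                  fromInverse : (∃ λ u → ι d * u ≡ 1# [mod ιₙ p ]) → Root m′ (ι B) p
                  fromInverse (d′ , dd′) = ι g * (x * d′) ^ᵣ n , mod-trans
                    (root-from-power m′ (ι B) {ιₙ p} {ι c} {ι d} {d′} {ι f} {ι g} {x} n (trans x^ℓ≡C ι-C) dd′ congruent) (mod-reflexive (sym ι-B))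
              root : Root m′ (ι B) W
              root = root-mod m′ (ι B) W {{W≢0}} roots unit

  module _ (c≢0 : c ≢ + 0) (d≢0 : d ≢ + 0) (f≢0 : f ≢ + 0) (g≢0 : g ≢ + 0)
           (independent : ∀ a a′ e e′ → a ≢ a′ → ℤ.∣ monomial c d f g c≢0 d≢0 f≢0 g≢0 a a′ e e′ ∣ ≢ ℤ.∣ monomial c d f g c≢0 d≢0 f≢0 g≢0 a′ a e′ e ∣) where

    private
      ∣f∣≢∣g∣ : ℤ.∣ f ∣ ≢ ℤ.∣ g ∣
      ∣f∣≢∣g∣ e = independent 1 0 0 0 (λ ()) (begin
        ℤ.∣ f ℤ.* + 1 ℤ.* + 1 ℤ.* + 1 ∣     ≡⟨ cong ℤ.∣_∣ (solve 1 (λ f → f :* con (+ 1) :* con (+ 1) :* con (+ 1) := f) refl f) ⟩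
        ℤ.∣ f ∣                             ≡⟨ e ⟩
        ℤ.∣ g ∣                             ≡⟨ cong ℤ.∣_∣ (solve 1 (λ g → g := con (+ 1) :* (g :* con (+ 1)) :* con (+ 1)) refl g) ⟩
        ℤ.∣ + 1 ℤ.* (g ℤ.* + 1) ℤ.* + 1 ∣   ∎)
        where
        open ≡-Reasoning
        open Ring.Solver ℤ-ring using (solve; _:*_; _:=_; con)

      -- If c / d = ±1, then f / g ≢ ±1 modulo every large prime.
      trivial-case : ℤ.∣ c ∣ ≡ ℤ.∣ d ∣ → ∀ D → 0 < D → NonMeeting D
      trivial-case ∣c∣≡∣d∣ D 0<D = fromPrime (prime-above (D ℕ.+ ℤ.∣ d ∣ ℕ.+ (ℤ.∣ f ∣ ℕ.+ ℤ.∣ g ∣)))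
        where
        fromPrime : (∃ λ p → Prime p × D ℕ.+ ℤ.∣ d ∣ ℕ.+ (ℤ.∣ f ∣ ℕ.+ ℤ.∣ g ∣) < p) → NonMeeting D
        fromPrime (p , prime-p , large) = p , prime-p , too-big D 0<D (ℕ.≤-trans (ℕ.m≤m+n D ℤ.∣ d ∣) (ℕ.m≤m+n (D ℕ.+ ℤ.∣ d ∣) (ℤ.∣ f ∣ ℕ.+ ℤ.∣ g ∣))) , none
          where
          too-big : ∀ k → 0 < k → k ≤ D ℕ.+ ℤ.∣ d ∣ ℕ.+ (ℤ.∣ f ∣ ℕ.+ ℤ.∣ g ∣) → ¬ (p ∣ℕ k)
          too-big k 0<k k≤ p∣k = ℕ.<⇒≱ (ℕ.≤-<-trans k≤ large) (ℕ∣.∣⇒≤ {{ℕ.>-nonZero 0<k}} p∣k)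
          p∤d : ¬ (p ∣ℕ ℤ.∣ d ∣)
          p∤d = too-big ℤ.∣ d ∣ (ℕ.n≢0⇒n>0 (λ e → d≢0 (ℤ.∣i∣≡0⇒i≡0 e))) (ℕ.≤-trans (ℕ.m≤n+m ℤ.∣ d ∣ D) (ℕ.m≤m+n (D ℕ.+ ℤ.∣ d ∣) (ℤ.∣ f ∣ ℕ.+ ℤ.∣ g ∣)))
          p∤d^ : ∀ n → ¬ (p ∣ℕ ℤ.∣ d ^ᶻ n ∣)
          p∤d^ zero = prime∤1 prime-p
          p∤d^ (suc n) h = [ p∤d , p∤d^ n ]′ (euclidsLemma ℤ.∣ d ∣ ℤ.∣ d ^ᶻ n ∣ prime-p (subst (p ∣ℕ_) (ℤ.abs-* d (d ^ᶻ n)) h))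
          Sign : ℤ → Set
          Sign s = s ≡ + 1 ⊎ s ≡ ℤ.- + 1
          abs-sign : ∀ a b → ℤ.∣ a ∣ ≡ ℤ.∣ b ∣ → ∃ λ s → Sign s × a ≡ s ℤ.* b
          abs-sign (+ m) (+ n) refl = + 1 , inj₁ refl , sym (ℤ.*-identityˡ (+ m))
          abs-sign (+ m) -[1+ n ] refl = ℤ.- + 1 , inj₂ refl , sym (ℤ.-1*i≡-i -[1+ n ])
          abs-sign -[1+ m ] (+ n) refl = ℤ.- + 1 , inj₂ refl , sym (ℤ.-1*i≡-i (+ n))
          abs-sign -[1+ m ] -[1+ n ] refl = + 1 , inj₁ refl , sym (ℤ.*-identityˡ -[1+ m ])
          sign-* : ∀ {s t} → Sign s → Sign t → Sign (s ℤ.* t)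
          sign-* (inj₁ refl) (inj₁ refl) = inj₁ refl
          sign-* (inj₁ refl) (inj₂ refl) = inj₂ refl
          sign-* (inj₂ refl) (inj₁ refl) = inj₂ refl
          sign-* (inj₂ refl) (inj₂ refl) = inj₁ refl
          powers : ∀ n → ∃ λ s → Sign s × c ^ᶻ n ≡ s ℤ.* d ^ᶻ n
          powers zero = + 1 , inj₁ refl , refl
          powers (suc n) = next (abs-sign c d ∣c∣≡∣d∣) (powers n)
            where
            open Ring.Solver ℤ-ring using (solve; _:*_; _:=_)
            next : (∃ λ s → Sign s × c ≡ s ℤ.* d) → (∃ λ s → Sign s × c ^ᶻ n ≡ s ℤ.* d ^ᶻ n) → ∃ λ s → Sign s × c ^ᶻ suc n ≡ s ℤ.* d ^ᶻ suc n
            next (s , hs , es) (t , ht , et) = s ℤ.* t , sign-* hs ht , trans (cong₂ ℤ._*_ es et) (solve 4 (λ s d t e → s :* d :* (t :* e) := s :* t :* (d :* e)) refl s d t (d ^ᶻ n))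
          small : ∀ s → Sign s → ¬ (p ∣ℕ ℤ.∣ s ℤ.* g ℤ.- f ∣)
          small s hs = too-big ℤ.∣ s ℤ.* g ℤ.- f ∣ (ℕ.n≢0⇒n>0 nonzero) (ℕ.≤-trans (ℤ.∣i+j∣≤∣i∣+∣j∣ (s ℤ.* g) (ℤ.- f))
            (ℕ.≤-trans (ℕ.≤-reflexive (trans (cong₂ ℕ._+_ (abs-sg s hs) (ℤ.∣-i∣≡∣i∣ f)) (ℕ.+-comm ℤ.∣ g ∣ ℤ.∣ f ∣))) (ℕ.m≤n+m (ℤ.∣ f ∣ ℕ.+ ℤ.∣ g ∣) (D ℕ.+ ℤ.∣ d ∣))))
            where
            abs-sg : ∀ s → Sign s → ℤ.∣ s ℤ.* g ∣ ≡ ℤ.∣ g ∣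
            abs-sg s (inj₁ refl) = cong ℤ.∣_∣ (ℤ.*-identityˡ g)
            abs-sg s (inj₂ refl) = trans (cong ℤ.∣_∣ (ℤ.-1*i≡-i g)) (ℤ.∣-i∣≡∣i∣ g)
            nonzero : ℤ.∣ s ℤ.* g ℤ.- f ∣ ≢ 0
            nonzero e = ∣f∣≢∣g∣ (trans (cong ℤ.∣_∣ (sym (ℤ.i-j≡0⇒i≡j (s ℤ.* g) f (ℤ.∣i∣≡0⇒i≡0 e)))) (abs-sg s hs))
          none : ∀ n → ¬ Meets p n
          none n h = fromPower (powers n)
            where
            open Ring.Solver ℤ-ring using (solve; _:*_; _:-_; _:=_)
            fromPower : (∃ λ s → Sign s × c ^ᶻ n ≡ s ℤ.* d ^ᶻ n) → ⊥
            fromPower (s , hs , e) = [ p∤d^ n , small s hs ]′ (euclidsLemma ℤ.∣ d ^ᶻ n ∣ ℤ.∣ s ℤ.* g ℤ.- f ∣ prime-p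
              (subst (p ∣ℕ_) (trans (cong ℤ.∣_∣ (trans (cong (λ z → z ℤ.* g ℤ.- f ℤ.* d ^ᶻ n) e) (solve 4 (λ s d g f → s :* d :* g :- f :* d := d :* (s :* g :- f)) refl s (d ^ᶻ n) g f))) (ℤ.abs-* (d ^ᶻ n) (s ℤ.* g ℤ.- f))) h))

    separating-prime-for : ∀ D → 0 < D → NonMeeting D
    separating-prime-for = decide (ℤ.∣ c ∣ ℕ.≟ ℤ.∣ d ∣)
      where
      decide : Dec (ℤ.∣ c ∣ ≡ ℤ.∣ d ∣) → ∀ D → 0 < D → NonMeeting D
      decide (yes e) = trivial-case e
      decide (no ∣c∣≢∣d∣) = non-meeting-prime c≢0 d≢0 f≢0 g≢0 ∣c∣≢∣d∣ independent

  -- f / g = (c / d) ^ (-m) implies f / g = (c / d) ^ (m (p - 2)) modulo p.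
  meets-inverse : ∀ {p} → Prime p → ¬ (p ∣ℕ ℤ.∣ c ∣) → ¬ (p ∣ℕ ℤ.∣ d ∣) → ∀ m → p ∣ℕ ℤ.∣ d ^ᶻ m ℤ.* g ℤ.- f ℤ.* c ^ᶻ m ∣ → ∃ λ n → Meets p n
  meets-inverse {zero} prime-p _ _ m _ = ⊥-elim (ℕ.≢-nonZero⁻¹ 0 {{prime⇒nonZero prime-p}} refl)
  meets-inverse {suc zero} prime-p _ _ m _ = ⊥-elim (prime⇒≢1 prime-p refl)
  meets-inverse {p@(suc (suc r))} prime-p p∤c p∤d m h = m ℕ.* r , A.∣ι⇒∣ℕ p X (A.coprime-∣ {p} {ℤ.∣ d ∣ ℕ.^ m} (prime∤⇒coprime prime-p (power p∤d m)) (abs-d (d ^ᶻ m) (pow-abs d m)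
      (A.coprime-∣ {p} {ℤ.∣ c ∣ ℕ.^ m} (prime∤⇒coprime prime-p (power p∤c m)) (abs-d (c ^ᶻ m) (pow-abs c m) total))))
    where
    open Ring.Solver ℤ-ring using (solve; _:*_; _:+_; _:-_; :-_; _:=_; con)
    open Ring ℤ-ring using (^-assocʳ; 1^)
    X = c ^ᶻ (m ℕ.* r) ℤ.* g ℤ.- f ℤ.* d ^ᶻ (m ℕ.* r)
    power : ∀ {a} → ¬ (p ∣ℕ a) → ∀ m → ¬ (p ∣ℕ a ℕ.^ m)
    power p∤a zero = prime∤1 prime-p
    power {a} p∤a (suc m) h = [ p∤a , power p∤a m ]′ (euclidsLemma a (a ℕ.^ m) prime-p h)
    pow-abs : ∀ a m → ℤ.∣ a ^ᶻ m ∣ ≡ ℤ.∣ a ∣ ℕ.^ m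
    pow-abs a zero = refl
    pow-abs a (suc m) = trans (ℤ.abs-* a (a ^ᶻ m)) (cong (ℤ.∣ a ∣ ℕ.*_) (pow-abs a m))
    abs-d : ∀ a {k x} → ℤ.∣ a ∣ ≡ k → (+ p) ∣ℤ (a ℤ.* x) → (+ p) ∣ℤ (+ k ℤ.* x)
    abs-d a {k} {x} e d = A.∣ℕ⇒∣ι p (+ k ℤ.* x) (subst (p ∣ℕ_) (trans (ℤ.abs-* a x) (trans (cong (ℕ._* ℤ.∣ x ∣) e) (sym (ℤ.abs-* (+ k) x)))) (A.∣ι⇒∣ℕ p (a ℤ.* x) d))
    full : ∀ a → ¬ (p ∣ℕ ℤ.∣ a ∣) → (+ p) ∣ℤ (a ^ᶻ m ℤ.* a ^ᶻ (m ℕ.* r) ℤ.- + 1)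
    full a p∤a = subst ((+ p) ∣ℤ_) (cong₂ ℤ._-_ collect (1^ m)) (A.mod-^ {a ^ᶻ suc r} {+ 1} {+ p} m (fermat-unit prime-p a p∤a))
      where
      collect : (a ^ᶻ suc r) ^ᶻ m ≡ a ^ᶻ m ℤ.* a ^ᶻ (m ℕ.* r)
      collect = trans (^-assocʳ a (suc r) m) (trans (cong (a ^ᶻ_) (trans (ℕ.*-comm (suc r) m) (ℕ.*-suc m r))) (^ᶻ-homo-* a m (m ℕ.* r)))
    total : (+ p) ∣ℤ (c ^ᶻ m ℤ.* (d ^ᶻ m ℤ.* X))
    total = subst ((+ p) ∣ℤ_) (solve 6 (λ cm cr dm dr f g → (dm :* g :- f :* cm) :+ ((cm :* cr :- con (+ 1)) :* (dm :* g) :+ (dm :* dr :- con (+ 1)) :* (:- (f :* cm))) := cm :* (dm :* (cr :* g :- f :* dr))) refl (c ^ᶻ m) (c ^ᶻ (m ℕ.* r)) (d ^ᶻ m) (d ^ᶻ (m ℕ.* r)) f g)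
      (Ring.∣-+ ℤ-ring {+ p} (A.∣ℕ⇒∣ι p (d ^ᶻ m ℤ.* g ℤ.- f ℤ.* c ^ᶻ m) h)
        (Ring.∣-+ ℤ-ring {+ p} (Ring.∣-*ʳ ℤ-ring {+ p} {c ^ᶻ m ℤ.* c ^ᶻ (m ℕ.* r) ℤ.- + 1} (d ^ᶻ m ℤ.* g) (full c p∤c))
          (Ring.∣-*ʳ ℤ-ring {+ p} {d ^ᶻ m ℤ.* d ^ᶻ (m ℕ.* r) ℤ.- + 1} (ℤ.- (f ℤ.* c ^ᶻ m)) (full d p∤d))))

-- Passage to the field of fractions

module FractionField
  (F : Ring) (domain : Ring.IsDomain F)
  (ι-injective : ∀ {m n} → Ring.ι F m ≡ Ring.ι F n → m ≡ n)
  (num : Ring.Carrier F → ℤ) (den : Ring.Carrier F → ℕ) (den≢0 : ∀ q → den q ≢ 0)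
  (num-den : ∀ q → Ring._*_ F q (Ring.ι F (+ den q)) ≡ Ring.ι F (num q))
  (inv : Ring.Carrier F → Ring.Carrier F)
  (*-inv : ∀ q → q ≢ Ring.0# F → Ring._*_ F q (inv q) ≡ Ring.1# F)
  where

  open Ring F
  open Domain domain
  open Solver using (solve; _:+_; _:-_; _:*_; :-_; _:=_; con)
  open ≡-Reasoning

  1≢0 : 1# ≢ 0#
  1≢0 e with () ← ι-injective (trans ι-1 (trans e (sym ι-0)))

  ιₙ≢0 : ∀ {n} → n ≢ 0 → ιₙ n ≢ 0#
  ιₙ≢0 n≢0 e = n≢0 (ℤ.+-injective (ι-injective (trans e (sym ι-0))))

  ^≢0 : ∀ {q} n → q ≢ 0# → q ^ n ≢ 0#
  ^≢0 n q≢0 = ^-≢0 n q≢0 1≢0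

  num≢0 : ∀ q → q ≢ 0# → num q ≢ + 0
  num≢0 q q≢0 e = *-≢0 q≢0 (ιₙ≢0 (den≢0 q)) (trans (num-den q) (trans (cong ι e) ι-0))

  infixr 8 _^ℤ_
  _^ℤ_ : Carrier → ℤ → Carrier
  q ^ℤ (+ n) = q ^ n
  q ^ℤ -[1+ n ] = inv (q ^ suc n)

  ^ℤ-cancel : ∀ {q} n → q ≢ 0# → q ^ℤ -[1+ n ] * q ^ suc n ≡ 1#
  ^ℤ-cancel {q} n q≢0 = trans (*-comm (inv (q ^ suc n)) (q ^ suc n)) (*-inv (q ^ suc n) (^≢0 (suc n) q≢0))

  ^ℤ-* : ∀ {q r s} → q * r ≡ s → q ≢ 0# → r ≢ 0# → s ≢ 0# → ∀ m → q ^ℤ m * r ^ℤ m ≡ s ^ℤ m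
  ^ℤ-* {q} {r} {s} e q≢0 r≢0 s≢0 (+ n) = trans (sym (^-distrib-* q r n)) (cong (_^ n) e)
  ^ℤ-* {q} {r} {s} e q≢0 r≢0 s≢0 -[1+ n ] = *-cancelˡ (q ^ℤ -[1+ n ] * r ^ℤ -[1+ n ]) (s ^ℤ -[1+ n ]) (^≢0 (suc n) s≢0) (begin
    s ^ suc n * (q ^ℤ -[1+ n ] * r ^ℤ -[1+ n ])            ≡⟨ cong (_* (q ^ℤ -[1+ n ] * r ^ℤ -[1+ n ])) (trans (cong (_^ suc n) (sym e)) (^-distrib-* q r (suc n))) ⟩
    q ^ suc n * r ^ suc n * (q ^ℤ -[1+ n ] * r ^ℤ -[1+ n ])  ≡⟨ solve 4 (λ a b c d → a :* b :* (c :* d) := (c :* a) :* (d :* b)) refl (q ^ suc n) (r ^ suc n) (q ^ℤ -[1+ n ]) (r ^ℤ -[1+ n ]) ⟩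
    (q ^ℤ -[1+ n ] * q ^ suc n) * (r ^ℤ -[1+ n ] * r ^ suc n)  ≡⟨ cong₂ _*_ (^ℤ-cancel n q≢0) (^ℤ-cancel n r≢0) ⟩
    1# * 1#                                                ≡⟨ *-identityˡ 1# ⟩
    1#                                                     ≡⟨ sym (*-inv (s ^ suc n) (^≢0 (suc n) s≢0)) ⟩
    s ^ suc n * s ^ℤ -[1+ n ]                              ∎)

  ^ℤ-⊖ : ∀ {q} m n → q ≢ 0# → q ^ℤ (m ℤ.⊖ n) * q ^ n ≡ q ^ m
  ^ℤ-⊖ {q} m n q≢0 = compare (ℕ.≤-total n m)
    where
    below : ∀ o → m ℕ.+ o ≡ n → q ^ℤ (ℤ.- + o) * q ^ n ≡ q ^ m
    below zero e = trans (*-identityˡ (q ^ n)) (cong (q ^_) (trans (sym e) (ℕ.+-identityʳ m)))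
    below (suc o) e = begin
      q ^ℤ -[1+ o ] * q ^ n                  ≡⟨ cong (λ z → q ^ℤ -[1+ o ] * q ^ z) (trans (sym e) (ℕ.+-comm m (suc o))) ⟩
      q ^ℤ -[1+ o ] * q ^ (suc o ℕ.+ m)      ≡⟨ cong (q ^ℤ -[1+ o ] *_) (^-homo-* q (suc o) m) ⟩
      q ^ℤ -[1+ o ] * (q ^ suc o * q ^ m)    ≡⟨ sym (*-assoc (q ^ℤ -[1+ o ]) (q ^ suc o) (q ^ m)) ⟩
      q ^ℤ -[1+ o ] * q ^ suc o * q ^ m      ≡⟨ cong (_* q ^ m) (^ℤ-cancel o q≢0) ⟩
      1# * q ^ m                             ≡⟨ *-identityˡ (q ^ m) ⟩
      q ^ m                                  ∎
    compare : n ≤ m ⊎ m ≤ n → q ^ℤ (m ℤ.⊖ n) * q ^ n ≡ q ^ m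
    compare (inj₁ n≤m) = trans (cong (λ z → q ^ℤ z * q ^ n) (ℤ.⊖-≥ n≤m)) (trans (sym (^-homo-* q (m ℕ.∸ n) n)) (cong (q ^_) (ℕ.m∸n+n≡m n≤m)))
    compare (inj₂ m≤n) = trans (cong (λ z → q ^ℤ z * q ^ n) (ℤ.⊖-≤ m≤n)) (below (n ℕ.∸ m) (ℕ.m+[n∸m]≡n m≤n))

  module Sequence (c₁ c₂ b₁ b₂ C B : Carrier) (c₁≢0 : c₁ ≢ 0#) (c₂≢0 : c₂ ≢ 0#) (b₁≢0 : b₁ ≢ 0#)
                  (C≢0 : C ≢ 0#) (B≢0 : B ≢ 0#) (Cc₂≡c₁ : C * c₂ ≡ c₁) (b₁B≡-b₂ : b₁ * B ≡ - b₂) where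

    private
      b₂≡ : b₂ ≡ - (b₁ * B)
      b₂≡ = trans (solve 1 (λ x → x := :- (:- x)) refl b₂) (cong -_ (sym b₁B≡-b₂))

    u : ℤ → Carrier
    u n = b₁ * c₁ ^ℤ n + b₂ * c₂ ^ℤ n

    zero-term : ∀ m → C ^ℤ m ≡ B → u m ≡ 0#
    zero-term m e = begin
      b₁ * c₁ ^ℤ m + b₂ * c₂ ^ℤ m                       ≡⟨ cong₂ (λ x y → b₁ * x + y * c₂ ^ℤ m) (trans (sym (^ℤ-* Cc₂≡c₁ C≢0 c₂≢0 c₁≢0 m)) (cong (_* c₂ ^ℤ m) e)) b₂≡ ⟩
      b₁ * (B * c₂ ^ℤ m) + - (b₁ * B) * c₂ ^ℤ m         ≡⟨ solve 3 (λ b B x → b :* (B :* x) :+ (:- (b :* B)) :* x := con (+ 0)) refl b₁ B (c₂ ^ℤ m) ⟩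
      0#                                                ∎

    c d f g : ℤ
    c = num C
    d = + den C
    f = num B
    g = + den B

    private
      c≢0 = num≢0 C C≢0
      f≢0 = num≢0 B B≢0
      d≢0 : d ≢ + 0
      d≢0 e = den≢0 C (ℤ.+-injective e)
      g≢0 : g ≢ + 0
      g≢0 e = den≢0 B (ℤ.+-injective e)
      mono : ℕ → ℕ → ℕ → ℕ → ℤ
      mono = monomial c d f g c≢0 d≢0 f≢0 g≢0

    open Ring ℤ-ring using () renaming (_^_ to _^ᵢ_)

    -- The last factor depends only on a + a′ and e + e′, so it cancels when the monomial is
    -- compared with the exchanged one.
    ι-mono : ∀ a a′ e e′ → ι (mono a a′ e e′) ≡ B ^ a * C ^ e * (ι g ^ (a ℕ.+ a′) * ι d ^ (e ℕ.+ e′))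
    ι-mono a a′ e e′ = begin
      ι (f ^ᵢ a ℤ.* g ^ᵢ a′ ℤ.* (c ^ᵢ e ℤ.* d ^ᵢ e′))
        ≡⟨ trans (ι-* (f ^ᵢ a ℤ.* g ^ᵢ a′) (c ^ᵢ e ℤ.* d ^ᵢ e′)) (cong₂ _*_ (trans (ι-* (f ^ᵢ a) (g ^ᵢ a′)) (cong₂ _*_ (ι-^ F f a) (ι-^ F g a′))) (trans (ι-* (c ^ᵢ e) (d ^ᵢ e′)) (cong₂ _*_ (ι-^ F c e) (ι-^ F d e′)))) ⟩
      ι f ^ a * ι g ^ a′ * (ι c ^ e * ι d ^ e′)
        ≡⟨ cong₂ (λ x y → x ^ a * ι g ^ a′ * (y ^ e * ι d ^ e′)) (sym (num-den B)) (sym (num-den C)) ⟩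
      (B * ι g) ^ a * ι g ^ a′ * ((C * ι d) ^ e * ι d ^ e′)
        ≡⟨ cong₂ (λ x y → x * ι g ^ a′ * (y * ι d ^ e′)) (^-distrib-* B (ι g) a) (^-distrib-* C (ι d) e) ⟩
      B ^ a * ι g ^ a * ι g ^ a′ * (C ^ e * ι d ^ e * ι d ^ e′)
        ≡⟨ solve 6 (λ b g g′ c d d′ → b :* g :* g′ :* (c :* d :* d′) := b :* c :* (g :* g′ :* (d :* d′))) refl (B ^ a) (ι g ^ a) (ι g ^ a′) (C ^ e) (ι d ^ e) (ι d ^ e′) ⟩
      B ^ a * C ^ e * (ι g ^ a * ι g ^ a′ * (ι d ^ e * ι d ^ e′))
        ≡⟨ cong (B ^ a * C ^ e *_) (cong₂ _*_ (sym (^-homo-* (ι g) a a′)) (sym (^-homo-* (ι d) e e′))) ⟩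
      B ^ a * C ^ e * (ι g ^ (a ℕ.+ a′) * ι d ^ (e ℕ.+ e′)) ∎

    module Independent (indep : ∀ k → k ≢ + 0 → ∀ l → B ^ℤ k * C ^ℤ l ≢ 1# × B ^ℤ k * C ^ℤ l ≢ - 1#) where

      independent : ∀ a a′ e e′ → a ≢ a′ → ℤ.∣ mono a a′ e e′ ∣ ≢ ℤ.∣ mono a′ a e′ e ∣
      independent a a′ e e′ a≢a′ equal = [ (λ h → proj₁ (indep k k≢0 l) (ratio 1# (trans (compare-powers h) (sym (*-identityˡ _))))) , (λ h → proj₂ (indep k k≢0 l) (ratio (- 1#) (trans (compare-powers⁻ h) (solve 1 (λ x → :- x := (:- con (+ 1)) :* x) refl _)))) ]′
        (same-abs (mono a a′ e e′) (mono a′ a e′ e) equal)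
        where
        k l : ℤ
        k = a ℤ.⊖ a′
        l = e ℤ.⊖ e′
        k≢0 : k ≢ + 0
        k≢0 h = a≢a′ (ℤ.+-injective (ℤ.i-j≡0⇒i≡j (+ a) (+ a′) (trans (ℤ.m-n≡m⊖n a a′) h)))
        same-abs : ∀ x y → ℤ.∣ x ∣ ≡ ℤ.∣ y ∣ → x ≡ y ⊎ x ≡ ℤ.- y
        same-abs (+ m) (+ n) refl = inj₁ refl
        same-abs (+ m) -[1+ n ] refl = inj₂ refl
        same-abs -[1+ m ] (+ n) refl = inj₂ refl
        same-abs -[1+ m ] -[1+ n ] refl = inj₁ refl
        Z = ι g ^ (a ℕ.+ a′) * ι d ^ (e ℕ.+ e′)
        Z≢0 : Z ≢ 0#
        Z≢0 = *-≢0 (^≢0 (a ℕ.+ a′) (ιₙ≢0 (den≢0 B))) (^≢0 (e ℕ.+ e′) (ιₙ≢0 (den≢0 C)))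
        ι-mono′ : ι (mono a′ a e′ e) ≡ B ^ a′ * C ^ e′ * Z
        ι-mono′ = trans (ι-mono a′ a e′ e) (cong₂ (λ i j → B ^ a′ * C ^ e′ * (ι g ^ i * ι d ^ j)) (ℕ.+-comm a′ a) (ℕ.+-comm e′ e))
        cancelZ : ∀ {x y} → x * Z ≡ y * Z → x ≡ y
        cancelZ {x} {y} h = *-cancelˡ x y Z≢0 (trans (*-comm Z x) (trans h (*-comm y Z)))
        compare-powers : mono a a′ e e′ ≡ mono a′ a e′ e → B ^ a * C ^ e ≡ B ^ a′ * C ^ e′
        compare-powers h = cancelZ (trans (sym (ι-mono a a′ e e′)) (trans (cong ι h) ι-mono′))
        compare-powers⁻ : mono a a′ e e′ ≡ ℤ.- mono a′ a e′ e → B ^ a * C ^ e ≡ - (B ^ a′ * C ^ e′)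
        compare-powers⁻ h = cancelZ (trans (sym (ι-mono a a′ e e′)) (trans (cong ι h) (trans (ι-neg (mono a′ a e′ e)) (trans (cong -_ ι-mono′) (solve 2 (λ x z → :- (x :* z) := (:- x) :* z) refl (B ^ a′ * C ^ e′) Z)))))
        ratio : ∀ s → B ^ a * C ^ e ≡ s * (B ^ a′ * C ^ e′) → B ^ℤ k * C ^ℤ l ≡ s
        ratio s h = *-cancelˡ (B ^ℤ k * C ^ℤ l) s (*-≢0 (^≢0 a′ B≢0) (^≢0 e′ C≢0)) (begin
          B ^ a′ * C ^ e′ * (B ^ℤ k * C ^ℤ l)       ≡⟨ solve 4 (λ b c x y → b :* c :* (x :* y) := (x :* b) :* (y :* c)) refl (B ^ a′) (C ^ e′) (B ^ℤ k) (C ^ℤ l) ⟩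
          B ^ℤ k * B ^ a′ * (C ^ℤ l * C ^ e′)       ≡⟨ cong₂ _*_ (^ℤ-⊖ a a′ B≢0) (^ℤ-⊖ e e′ C≢0) ⟩
          B ^ a * C ^ e                             ≡⟨ h ⟩
          s * (B ^ a′ * C ^ e′)                     ≡⟨ *-comm s (B ^ a′ * C ^ e′) ⟩
          B ^ a′ * C ^ e′ * s                       ∎)

      -- A prime that divides no numerator of u n, because C ^ n ≢ B modulo p for all n.
      primes : ∀ b → b > 0 → ∀ N → ∃ λ p → p > N × Prime p × gcd b p ≡ 1 ×
        (∀ n x → (∃ λ k → den x ∣ℕ b ℕ.^ k) → u n ≢ ιₙ p * x)
      primes b b>0 N = fromPrime (separating-prime-for c d f g c≢0 d≢0 f≢0 g≢0 independent D 0<D)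
        where
        β γ : ℤ
        β = num b₁
        γ = num c₂
        δ θ : ℕ
        δ = den b₁
        θ = den c₁
        -- N ! forces p > N, and b gives gcd b p = 1. The remaining factors make the numerators of
        -- b₁ and c₂ and the denominator of c₁ units modulo p, as well as c and d, which
        -- `meets-inverse` inverts.
        D : ℕ
        D = N ! ℕ.* b ℕ.* (ℤ.∣ β ∣ ℕ.* ℤ.∣ γ ∣) ℕ.* (θ ℕ.* (ℤ.∣ c ∣ ℕ.* ℤ.∣ d ∣))
        pos : ∀ {a} → a ≢ + 0 → 0 < ℤ.∣ a ∣
        pos a≢0 = ℕ.n≢0⇒n>0 (λ e → a≢0 (ℤ.∣i∣≡0⇒i≡0 e))
        0<D : 0 < D
        0<D = ℕ.*-mono-≤ (ℕ.*-mono-≤ (ℕ.*-mono-≤ (ℕ.>-nonZero⁻¹ (N !) {{N ℕ.!≢0}}) b>0) (ℕ.*-mono-≤ (pos (num≢0 b₁ b₁≢0)) (pos (num≢0 c₂ c₂≢0))))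
          (ℕ.*-mono-≤ (ℕ.n≢0⇒n>0 (den≢0 c₁)) (ℕ.*-mono-≤ (pos c≢0) (pos d≢0)))
        N!∣D : N ! ∣ℕ D
        N!∣D = ℕ∣.∣m⇒∣m*n _ (ℕ∣.∣m⇒∣m*n _ (ℕ∣.m∣m*n b))
        b∣D : b ∣ℕ D
        b∣D = ℕ∣.∣m⇒∣m*n _ (ℕ∣.∣m⇒∣m*n _ (ℕ∣.n∣m*n (N !)))
        β∣D : ℤ.∣ β ∣ ∣ℕ D
        β∣D = ℕ∣.∣m⇒∣m*n _ (ℕ∣.∣n⇒∣m*n (N ! ℕ.* b) (ℕ∣.m∣m*n ℤ.∣ γ ∣))
        γ∣D : ℤ.∣ γ ∣ ∣ℕ D
        γ∣D = ℕ∣.∣m⇒∣m*n _ (ℕ∣.∣n⇒∣m*n (N ! ℕ.* b) (ℕ∣.n∣m*n ℤ.∣ β ∣))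
        rest∣D : ∀ {k} → k ∣ℕ θ ℕ.* (ℤ.∣ c ∣ ℕ.* ℤ.∣ d ∣) → k ∣ℕ D
        rest∣D h = ℕ∣.∣n⇒∣m*n (N ! ℕ.* b ℕ.* (ℤ.∣ β ∣ ℕ.* ℤ.∣ γ ∣)) h
        Result : Set
        Result = ∃ λ p → p > N × Prime p × gcd b p ≡ 1 × (∀ n x → (∃ λ k → den x ∣ℕ b ℕ.^ k) → u n ≢ ιₙ p * x)
        fromPrime : NonMeeting c d f g D → Result
        fromPrime (p , prime-p , p∤D , none) = p , p>N , prime-p , Coprimality.coprime⇒gcd≡1 (Coprimality.sym (prime∤⇒coprime prime-p (avoids b∣D))) , not-divisible
          where
          avoids : ∀ {k} → k ∣ℕ D → ¬ (p ∣ℕ k)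
          avoids k∣D p∣k = p∤D (ℕ∣.∣-trans p∣k k∣D)
          p>N : p > N
          p>N = ℕ.≰⇒> (λ p≤N → avoids N!∣D (ℕ∣.∣-trans (self p (prime⇒nonZero prime-p)) (ℕ∣.m≤n⇒m!∣n! p≤N)))
            where
            self : ∀ p → NonZero p → p ∣ℕ p !
            self (suc p) _ = ℕ∣.m∣m*n (p !)
          p∤c = avoids (rest∣D (ℕ∣.∣n⇒∣m*n θ (ℕ∣.m∣m*n ℤ.∣ d ∣)))
          p∤d = avoids (rest∣D (ℕ∣.∣n⇒∣m*n θ (ℕ∣.n∣m*n ℤ.∣ c ∣)))
          p∤^ : ∀ a → ¬ (p ∣ℕ ℤ.∣ a ∣) → ∀ n → ¬ (p ∣ℕ ℤ.∣ a ^ᵢ n ∣)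
          p∤^ a p∤a zero = prime∤1 prime-p
          p∤^ a p∤a (suc n) h = [ p∤a , p∤^ a p∤a n ]′ (euclidsLemma ℤ.∣ a ∣ ℤ.∣ a ^ᵢ n ∣ prime-p (subst (p ∣ℕ_) (ℤ.abs-* a (a ^ᵢ n)) h))
          -- Clearing denominators: w stands for c ^ n g - f d ^ n, and e, v for units modulo p.
          numerator : ∀ w v z y → ¬ (p ∣ℕ ℤ.∣ v ∣) → ι w * ι v ≡ z * ι y → ∀ x → (∃ λ k → den x ∣ℕ b ℕ.^ k) → z ≡ ιₙ p * x → p ∣ℕ ℤ.∣ w ∣
          numerator w v z y p∤v e x (k , ℕ∣.divides j ej) z≡ = strip (∣⇒ (num x ℤ.* + j ℤ.* y , ι-injective (begin
            ι (w ℤ.* v ℤ.* + (b ℕ.^ k))                  ≡⟨ trans (ι-* (w ℤ.* v) (+ (b ℕ.^ k))) (cong (_* ιₙ (b ℕ.^ k)) (ι-* w v)) ⟩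
            ι w * ι v * ιₙ (b ℕ.^ k)                      ≡⟨ cong₂ _*_ (trans e (cong (_* ι y) z≡)) (trans (cong ιₙ ej) (ιₙ-* j (den x))) ⟩
            ιₙ p * x * ι y * (ιₙ j * ιₙ (den x))          ≡⟨ solve 5 (λ p x y j d → p :* x :* y :* (j :* d) := p :* (x :* d :* j :* y)) refl (ιₙ p) x (ι y) (ιₙ j) (ιₙ (den x)) ⟩
            ιₙ p * (x * ιₙ (den x) * ιₙ j * ι y)          ≡⟨ cong (λ t → ιₙ p * (t * ιₙ j * ι y)) (num-den x) ⟩
            ιₙ p * (ι (num x) * ιₙ j * ι y)               ≡⟨ sym (trans (ι-* (+ p) (num x ℤ.* + j ℤ.* y)) (cong (ιₙ p *_) (trans (ι-* (num x ℤ.* + j) y) (cong (_* ι y) (ι-* (num x) (+ j)))))) ⟩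
            ι (+ p ℤ.* (num x ℤ.* + j ℤ.* y))             ∎)))
            where
            ∣⇒ : ∀ {n} → (∃ λ q → n ≡ + p ℤ.* q) → p ∣ℕ ℤ.∣ n ∣
            ∣⇒ (q , refl) = subst (p ∣ℕ_) (sym (ℤ.abs-* (+ p) q)) (ℕ∣.m∣m*n ℤ.∣ q ∣)
            p∤b^ : ∀ k → ¬ (p ∣ℕ b ℕ.^ k)
            p∤b^ zero = prime∤1 prime-p
            p∤b^ (suc k) h = [ avoids b∣D , p∤b^ k ]′ (euclidsLemma b (b ℕ.^ k) prime-p h)
            strip : p ∣ℕ ℤ.∣ w ℤ.* v ℤ.* + (b ℕ.^ k) ∣ → p ∣ℕ ℤ.∣ w ∣
            strip h = [ (λ h′ → [ (λ h″ → h″) , (λ h″ → ⊥-elim (p∤v h″)) ]′ (euclidsLemma ℤ.∣ w ∣ ℤ.∣ v ∣ prime-p (subst (p ∣ℕ_) (ℤ.abs-* w v) h′))) , (λ h′ → ⊥-elim (p∤b^ k h′)) ]′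
              (euclidsLemma ℤ.∣ w ℤ.* v ∣ (b ℕ.^ k) prime-p (subst (p ∣ℕ_) (ℤ.abs-* (w ℤ.* v) (+ (b ℕ.^ k))) h))
          unit : ∀ a n → ¬ (p ∣ℕ ℤ.∣ a ∣) → ¬ (p ∣ℕ ℤ.∣ β ℤ.* a ^ᵢ n ∣)
          unit a n p∤a h = [ avoids β∣D , p∤^ a p∤a n ]′ (euclidsLemma ℤ.∣ β ∣ ℤ.∣ a ^ᵢ n ∣ prime-p (subst (p ∣ℕ_) (ℤ.abs-* β (a ^ᵢ n)) h))
          ι-difference : ∀ x n y → ι (x ^ᵢ n ℤ.* g ℤ.- f ℤ.* y ^ᵢ n) ≡ ι x ^ n * ι g + - (B * ι g * ι y ^ n)
          ι-difference x n y = trans (ι-+ (x ^ᵢ n ℤ.* g) (ℤ.- (f ℤ.* y ^ᵢ n))) (cong₂ _+_ (trans (ι-* (x ^ᵢ n) g) (cong (_* ι g) (ι-^ F x n)))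
            (trans (ι-neg (f ℤ.* y ^ᵢ n)) (cong -_ (trans (ι-* f (y ^ᵢ n)) (cong₂ _*_ (sym (num-den B)) (ι-^ F y n))))))
          ι-C : ∀ n → ι c ^ n ≡ C ^ n * ι d ^ n
          ι-C n = trans (cong (_^ n) (sym (num-den C))) (^-distrib-* C (ι d) n)
          c₁^ : ∀ n → c₁ ^ n ≡ C ^ n * c₂ ^ n
          c₁^ n = trans (cong (_^ n) (sym Cc₂≡c₁)) (^-distrib-* C c₂ n)
          ι-unit : ∀ q n → ι (β ℤ.* (num q) ^ᵢ n) ≡ b₁ * ιₙ δ * (q ^ n * ιₙ (den q) ^ n)
          ι-unit q n = trans (ι-* β ((num q) ^ᵢ n)) (cong₂ _*_ (sym (num-den b₁)) (trans (ι-^ F (num q) n) (trans (cong (_^ n) (sym (num-den q))) (^-distrib-* q (ιₙ (den q)) n))))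
          -- For n ≥ 0 the term is b₁ c₂ ^ n (C ^ n - B). For n = -m, multiplication by c₁ ^ m turns
          -- it into b₁ (1 - B C ^ m), so p would give C ^ (-m) ≡ B, which `meets-inverse` converts
          -- to a positive exponent.
          not-divisible : ∀ n x → (∃ λ k → den x ∣ℕ b ℕ.^ k) → u n ≢ ιₙ p * x
          not-divisible (+ n) x x∈ e = none n (numerator (c ^ᵢ n ℤ.* g ℤ.- f ℤ.* d ^ᵢ n) (β ℤ.* γ ^ᵢ n) (u (+ n)) (+ δ ℤ.* (+ den c₂) ^ᵢ n ℤ.* (d ^ᵢ n ℤ.* g)) (unit γ n (avoids γ∣D)) (begin
            ι (c ^ᵢ n ℤ.* g ℤ.- f ℤ.* d ^ᵢ n) * ι (β ℤ.* γ ^ᵢ n)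
              ≡⟨ cong₂ _*_ (trans (ι-difference c n d) (cong (λ z → z * ι g + - (B * ι g * ι d ^ n)) (ι-C n))) (ι-unit c₂ n) ⟩
            (C ^ n * ι d ^ n * ι g + - (B * ι g * ι d ^ n)) * (b₁ * ιₙ δ * (c₂ ^ n * ιₙ (den c₂) ^ n))
              ≡⟨ solve 8 (λ C d g B b δ c D → (C :* d :* g :- B :* g :* d) :* (b :* δ :* (c :* D)) := (b :* (C :* c) :+ (:- (b :* B)) :* c) :* (δ :* D :* (d :* g))) refl (C ^ n) (ι d ^ n) (ι g) B b₁ (ιₙ δ) (c₂ ^ n) (ιₙ (den c₂) ^ n) ⟩
            (b₁ * (C ^ n * c₂ ^ n) + - (b₁ * B) * c₂ ^ n) * (ιₙ δ * ιₙ (den c₂) ^ n * (ι d ^ n * ι g))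
              ≡⟨ cong₂ _*_ (cong₂ (λ x y → b₁ * x + y * c₂ ^ n) (sym (c₁^ n)) (sym b₂≡)) (sym (trans (ι-* (+ δ ℤ.* (+ den c₂) ^ᵢ n) (d ^ᵢ n ℤ.* g)) (cong₂ _*_ (trans (ι-* (+ δ) ((+ den c₂) ^ᵢ n)) (cong (ιₙ δ *_) (ι-^ F (+ den c₂) n))) (trans (ι-* (d ^ᵢ n) g) (cong (_* ι g) (ι-^ F d n)))))) ⟩
            u (+ n) * ι (+ δ ℤ.* (+ den c₂) ^ᵢ n ℤ.* (d ^ᵢ n ℤ.* g)) ∎) x x∈ e)
          not-divisible -[1+ n ] x x∈ e = uncurry-none (meets-inverse c d f g prime-p p∤c p∤d m (numerator (d ^ᵢ m ℤ.* g ℤ.- f ℤ.* c ^ᵢ m) (β ℤ.* (+ θ) ^ᵢ m) (u -[1+ n ]) (+ δ ℤ.* (num c₁) ^ᵢ m ℤ.* (d ^ᵢ m ℤ.* g)) (unit (+ θ) m (avoids (rest∣D (ℕ∣.m∣m*n (ℤ.∣ c ∣ ℕ.* ℤ.∣ d ∣))))) (begin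
            ι (d ^ᵢ m ℤ.* g ℤ.- f ℤ.* c ^ᵢ m) * ι (β ℤ.* (+ θ) ^ᵢ m)
              ≡⟨ cong₂ _*_ (trans (ι-difference d m c) (cong (λ z → ι d ^ m * ι g + - (B * ι g * z)) (ι-C m))) (trans (ι-* β ((+ θ) ^ᵢ m)) (cong₂ _*_ (sym (num-den b₁)) (ι-^ F (+ θ) m))) ⟩
            (ι d ^ m * ι g + - (B * ι g * (C ^ m * ι d ^ m))) * (b₁ * ιₙ δ * ιₙ θ ^ m)
              ≡⟨ solve 7 (λ C d g B b δ t → (d :* g :- B :* g :* (C :* d)) :* (b :* δ :* t) := (b :- b :* B :* C) :* (δ :* t :* (d :* g))) refl (C ^ m) (ι d ^ m) (ι g) B b₁ (ιₙ δ) (ιₙ θ ^ m) ⟩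
            (b₁ + - (b₁ * B * C ^ m)) * (ιₙ δ * ιₙ θ ^ m * (ι d ^ m * ι g))
              ≡⟨ cong (_* (ιₙ δ * ιₙ θ ^ m * (ι d ^ m * ι g))) cleared ⟩
            u -[1+ n ] * c₁ ^ m * (ιₙ δ * ιₙ θ ^ m * (ι d ^ m * ι g))
              ≡⟨ solve 5 (λ u c δ t d → u :* c :* (δ :* t :* d) := u :* (δ :* (c :* t) :* d)) refl (u -[1+ n ]) (c₁ ^ m) (ιₙ δ) (ιₙ θ ^ m) (ι d ^ m * ι g) ⟩
            u -[1+ n ] * (ιₙ δ * (c₁ ^ m * ιₙ θ ^ m) * (ι d ^ m * ι g))
              ≡⟨ cong (u -[1+ n ] *_) (sym (trans (ι-* (+ δ ℤ.* (num c₁) ^ᵢ m) (d ^ᵢ m ℤ.* g)) (cong₂ _*_ (trans (ι-* (+ δ) ((num c₁) ^ᵢ m)) (cong (ιₙ δ *_) (trans (ι-^ F (num c₁) m) (trans (cong (_^ m) (sym (num-den c₁))) (^-distrib-* c₁ (ιₙ θ) m))))) (trans (ι-* (d ^ᵢ m) g) (cong (_* ι g) (ι-^ F d m)))))) ⟩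
            u -[1+ n ] * ι (+ δ ℤ.* (num c₁) ^ᵢ m ℤ.* (d ^ᵢ m ℤ.* g)) ∎) x x∈ e))
            where
            m = suc n
            uncurry-none : (∃ λ n → Meets c d f g p n) → ⊥
            uncurry-none (n , h) = none n h
            cleared : b₁ + - (b₁ * B * C ^ m) ≡ u -[1+ n ] * c₁ ^ m
            cleared = sym (begin
              (b₁ * c₁ ^ℤ -[1+ n ] + b₂ * c₂ ^ℤ -[1+ n ]) * c₁ ^ m
                ≡⟨ solve 5 (λ b x d y c → (b :* x :+ d :* y) :* c := b :* (x :* c) :+ d :* (y :* c)) refl b₁ (c₁ ^ℤ -[1+ n ]) b₂ (c₂ ^ℤ -[1+ n ]) (c₁ ^ m) ⟩
              b₁ * (c₁ ^ℤ -[1+ n ] * c₁ ^ m) + b₂ * (c₂ ^ℤ -[1+ n ] * c₁ ^ m)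
                ≡⟨ cong₂ (λ x y → b₁ * x + b₂ * (c₂ ^ℤ -[1+ n ] * y)) (^ℤ-cancel n c₁≢0) (c₁^ m) ⟩
              b₁ * 1# + b₂ * (c₂ ^ℤ -[1+ n ] * (C ^ m * c₂ ^ m))
                ≡⟨ solve 5 (λ b d y C c → b :* con (+ 1) :+ d :* (y :* (C :* c)) := b :+ d :* C :* (y :* c)) refl b₁ b₂ (c₂ ^ℤ -[1+ n ]) (C ^ m) (c₂ ^ m) ⟩
              b₁ + b₂ * C ^ m * (c₂ ^ℤ -[1+ n ] * c₂ ^ m)
                ≡⟨ cong₂ (λ x y → b₁ + x * C ^ m * y) b₂≡ (^ℤ-cancel n c₂≢0) ⟩
              b₁ + - (b₁ * B) * C ^ m * 1#
                ≡⟨ solve 3 (λ b B C → b :+ (:- (b :* B)) :* C :* con (+ 1) := b :- b :* B :* C) refl b₁ B (C ^ m) ⟩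
              b₁ + - (b₁ * B * C ^ m) ∎)

-- Rational numbers

open import Defs
open import Data.Rational using (ℚ; 0ℚ; 1ℚ; _+_; _*_; _-_; -_)
import Data.Rational as ℚ
import Data.Rational.Properties as ℚ
import Data.Rational.Unnormalised as ℚᵘ
import Data.Rational.Unnormalised.Properties as ℚᵘ

fraction : ℤ → ℚ
fraction n = n ℚ./ 1

fraction-+ : ∀ m n → fraction (m ℤ.+ n) ≡ fraction m + fraction n
fraction-+ m n = ℚ.toℚᵘ-injective (begin
  ℚ.toℚᵘ (fraction (m ℤ.+ n))                      ≈⟨ ℚ.toℚᵘ-fromℚᵘ (ℚᵘ.mkℚᵘ (m ℤ.+ n) 0) ⟩
  ℚᵘ.mkℚᵘ (m ℤ.+ n) 0                              ≈⟨ ℚᵘ.*≡* (cong (ℤ._* ℤ.+ 1) (cong₂ ℤ._+_ (sym (ℤ.*-identityʳ m)) (sym (ℤ.*-identityʳ n)))) ⟩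
  ℚᵘ.mkℚᵘ m 0 ℚᵘ.+ ℚᵘ.mkℚᵘ n 0                     ≈⟨ ℚᵘ.+-cong (ℚᵘ.≃-sym (ℚ.toℚᵘ-fromℚᵘ (ℚᵘ.mkℚᵘ m 0))) (ℚᵘ.≃-sym (ℚ.toℚᵘ-fromℚᵘ (ℚᵘ.mkℚᵘ n 0))) ⟩
  ℚ.toℚᵘ (fraction m) ℚᵘ.+ ℚ.toℚᵘ (fraction n)     ≈⟨ ℚᵘ.≃-sym (ℚ.toℚᵘ-homo-+ (fraction m) (fraction n)) ⟩
  ℚ.toℚᵘ (fraction m + fraction n)                 ∎)
  where open ℚᵘ.≃-Reasoning

fraction-* : ∀ m n → fraction (m ℤ.* n) ≡ fraction m * fraction n
fraction-* m n = ℚ.toℚᵘ-injective (begin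
  ℚ.toℚᵘ (fraction (m ℤ.* n))                      ≈⟨ ℚ.toℚᵘ-fromℚᵘ (ℚᵘ.mkℚᵘ (m ℤ.* n) 0) ⟩
  ℚᵘ.mkℚᵘ m 0 ℚᵘ.* ℚᵘ.mkℚᵘ n 0                     ≈⟨ ℚᵘ.*-cong (ℚᵘ.≃-sym (ℚ.toℚᵘ-fromℚᵘ (ℚᵘ.mkℚᵘ m 0))) (ℚᵘ.≃-sym (ℚ.toℚᵘ-fromℚᵘ (ℚᵘ.mkℚᵘ n 0))) ⟩
  ℚ.toℚᵘ (fraction m) ℚᵘ.* ℚ.toℚᵘ (fraction n)     ≈⟨ ℚᵘ.≃-sym (ℚ.toℚᵘ-homo-* (fraction m) (fraction n)) ⟩
  ℚ.toℚᵘ (fraction m * fraction n)                 ∎)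
  where open ℚᵘ.≃-Reasoning

ℚ-ring : Ring
ℚ-ring = record
  { Carrier = ℚ
  ; isCommutativeRing = ℚ.+-*-isCommutativeRing
  ; _≟_ = ℚ._≟_
  ; ι = fraction
  ; ι-+ = fraction-+
  ; ι-* = fraction-*
  ; ι-1 = refl
  }

fraction-injective : ∀ {m n} → fraction m ≡ fraction n → m ≡ n
fraction-injective {m} {n} e = unwrap (ℚ./-injective-≃ (ℚᵘ.mkℚᵘ m 0) (ℚᵘ.mkℚᵘ n 0) e)
  where
  unwrap : ℚᵘ.mkℚᵘ m 0 ℚᵘ.≃ ℚᵘ.mkℚᵘ n 0 → m ≡ n
  unwrap (ℚᵘ.*≡* h) = trans (sym (ℤ.*-identityʳ m)) (trans h (ℤ.*-identityʳ n))

numerator-denominator : ∀ q → q * fraction (ℤ.+ ℚ.denominatorℕ q) ≡ fraction (ℚ.numerator q)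
numerator-denominator q@record{} = ℚ.toℚᵘ-injective (begin
  ℚ.toℚᵘ (q * fraction d)                          ≈⟨ ℚ.toℚᵘ-homo-* q (fraction d) ⟩
  ℚ.toℚᵘ q ℚᵘ.* ℚ.toℚᵘ (fraction d)                ≈⟨ ℚᵘ.*-cong (ℚᵘ.≃-refl {ℚ.toℚᵘ q}) (ℚ.toℚᵘ-fromℚᵘ (ℚᵘ.mkℚᵘ d 0)) ⟩
  ℚ.toℚᵘ q ℚᵘ.* ℚᵘ.mkℚᵘ d 0                        ≈⟨ ℚᵘ.*≡* (trans (ℤ.*-identityʳ (ℚ.numerator q ℤ.* d)) (cong (λ z → ℚ.numerator q ℤ.* z) (sym (ℤ.*-identityʳ d)))) ⟩
  ℚᵘ.mkℚᵘ (ℚ.numerator q) 0                        ≈⟨ ℚᵘ.≃-sym (ℚ.toℚᵘ-fromℚᵘ (ℚᵘ.mkℚᵘ (ℚ.numerator q) 0)) ⟩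
  ℚ.toℚᵘ (fraction (ℚ.numerator q))                ∎)
  where
  open ℚᵘ.≃-Reasoning
  d = ℤ.+ ℚ.denominatorℕ q

*-inv : ∀ q → q ≢ 0ℚ → q * inv q ≡ 1ℚ
*-inv q@(ℚ.mkℚ (ℤ.+ ℕ.zero) d c) q≢0 = ⊥-elim (q≢0 (ℚ.↥p≡0⇒p≡0 q refl))
*-inv q@(ℚ.mkℚ (ℤ.+ ℕ.suc n) d c) _ = ℚ.*-inverseʳ q
*-inv q@(ℚ.mkℚ ℤ.-[1+ n ] d c) _ = ℚ.*-inverseʳ q

ℚ-domain : Ring.IsDomain ℚ-ring
ℚ-domain p q e = decide (p ℚ.≟ 0ℚ)
  where
  open Ring ℚ-ring using (*-assoc; *-comm; *-identityˡ; zeroʳ)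
  open ≡-Reasoning
  decide : Dec (p ≡ 0ℚ) → p ≡ 0ℚ ⊎ q ≡ 0ℚ
  decide (yes p≡0) = inj₁ p≡0
  decide (no p≢0) = inj₂ (begin
    q                  ≡⟨ sym (*-identityˡ q) ⟩
    1ℚ * q             ≡⟨ cong (_* q) (trans (sym (*-inv p p≢0)) (*-comm p (inv p))) ⟩
    inv p * p * q      ≡⟨ *-assoc (inv p) p q ⟩
    inv p * (p * q)    ≡⟨ cong (inv p *_) e ⟩
    inv p * 0ℚ         ≡⟨ zeroʳ (inv p) ⟩
    0ℚ                 ∎)

module Q = FractionField ℚ-ring ℚ-domain fraction-injective ℚ.numerator ℚ.denominatorℕ (λ _ ()) numerator-denominator inv *-inv

^ℤ≡ : ∀ q n → q ^ℤ n ≡ q Q.^ℤ n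
^ℤ≡ q (ℤ.+ n) = power n
  where
  power : ∀ n → q ^ℕ n ≡ Ring._^_ ℚ-ring q n
  power ℕ.zero = refl
  power (ℕ.suc n) = cong (q *_) (power n)
^ℤ≡ q ℤ.-[1+ n ] = cong inv (^ℤ≡ q (ℤ.+ ℕ.suc n))

-- Zero terms and primes that divide no term

mainTheorem2 : (a₁ a₂ c₁ c₂ : ℚ) → a₂ ≢ 0ℚ → (a₁ * a₁ + (ℤ.+ 4 Data.Rational./ 1) * a₂) ≢ 0ℚ
    → c₁ * c₁ - a₁ * c₁ - a₂ ≡ 0ℚ → c₂ * c₂ - a₁ * c₂ - a₂ ≡ 0ℚ → c₁ ≢ c₂
    → (b : ℕ) → b > 0
    → (u : ℤ → ℚ) → (∀ n → InZ[1/ b ] (u n))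
    → (∀ n → u (n ℤ.+ ℤ.+ 2) ≡ a₁ * u (n ℤ.+ ℤ.+ 1) + a₂ * u n)
    → (b₁ b₂ : ℚ) → (∀ n → u n ≡ b₁ * (c₁ ^ℤ n) + b₂ * (c₂ ^ℤ n))
    → b₁ ≢ 0ℚ → b₂ ≢ 0ℚ
    → let B = - b₂ * inv b₁
          C = c₁ * inv c₂
      in ((∃ λ (m : ℤ) → C ^ℤ m ≡ B)
          ⊎ (C ≡ 1ℚ × B ≡ - 1ℚ)
          ⊎ (∀ (k : ℤ) → k ≢ ℤ.0ℤ → ∀ (ℓ : ℤ) → (B ^ℤ k) * (C ^ℤ ℓ) ≢ 1ℚ × (B ^ℤ k) * (C ^ℤ ℓ) ≢ - 1ℚ))
      → ((∀ n → u n ≢ 0ℚ)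
         ⇔ (∀ (N : ℕ) → ∃ λ (p : ℕ) → p > N × Prime p × gcd b p ≡ 1
              × (∀ (n : ℤ) → ¬ InpZ[1/ b ] p (u n))))
mainTheorem2 a₁ a₂ c₁ c₂ a₂≢0 _ root₁ root₂ c₁≢c₂ b b>0 u _ _ b₁ b₂ u≡ b₁≢0 b₂≢0 cases = mk⇔ (forward cases) backward
  where
  open Ring ℚ-ring using (module Solver; *-assoc; *-comm; *-identityˡ; *-identityʳ; zeroˡ; zeroʳ; module Domain)
  open Solver using (solve; _:+_; _:-_; _:*_; :-_; _:=_; con)
  open Domain ℚ-domain using (*-≢0)
  open ≡-Reasoning
  B C : ℚ
  B = - b₂ * inv b₁
  C = c₁ * inv c₂
  root≢0 : ∀ c → c * c - a₁ * c - a₂ ≡ 0ℚ → c ≢ 0ℚ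
  root≢0 c e refl = a₂≢0 (begin
    a₂                                ≡⟨ solve 2 (λ a b → b := :- (con (ℤ.+ 0) :* con (ℤ.+ 0) :- a :* con (ℤ.+ 0) :- b)) refl a₁ a₂ ⟩
    - (0ℚ * 0ℚ - a₁ * 0ℚ - a₂)        ≡⟨ cong -_ e ⟩
    0ℚ                                ∎)
  c₁≢0 = root≢0 c₁ root₁
  c₂≢0 = root≢0 c₂ root₂
  inv≢0 : ∀ {q} → q ≢ 0ℚ → inv q ≢ 0ℚ
  inv≢0 {q} q≢0 e = Q.1≢0 (trans (sym (*-inv q q≢0)) (trans (cong (q *_) e) (zeroʳ q)))
  -b₂≢0 : - b₂ ≢ 0ℚ
  -b₂≢0 e = b₂≢0 (trans (solve 1 (λ x → x := :- (:- x)) refl b₂) (cong -_ e))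
  Cc₂≡c₁ : C * c₂ ≡ c₁
  Cc₂≡c₁ = trans (*-assoc c₁ (inv c₂) c₂) (trans (cong (c₁ *_) (trans (*-comm (inv c₂) c₂) (*-inv c₂ c₂≢0))) (*-identityʳ c₁))
  b₁B≡-b₂ : b₁ * B ≡ - b₂
  b₁B≡-b₂ = trans (solve 3 (λ x y z → x :* (y :* z) := y :* (x :* z)) refl b₁ (- b₂) (inv b₁)) (trans (cong (- b₂ *_) (*-inv b₁ b₁≢0)) (*-identityʳ (- b₂)))
  module S = Q.Sequence c₁ c₂ b₁ b₂ C B c₁≢0 c₂≢0 b₁≢0 (*-≢0 c₁≢0 (inv≢0 c₂≢0)) (*-≢0 -b₂≢0 (inv≢0 b₁≢0)) Cc₂≡c₁ b₁B≡-b₂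
  u≡S : ∀ n → u n ≡ S.u n
  u≡S n = trans (u≡ n) (cong₂ (λ x y → b₁ * x + b₂ * y) (^ℤ≡ c₁ n) (^ℤ≡ c₂ n))
  Primes : Set
  Primes = ∀ (N : ℕ) → ∃ λ (p : ℕ) → p > N × Prime p × gcd b p ≡ 1 × (∀ (n : ℤ) → ¬ InpZ[1/ b ] p (u n))
  backward : Primes → ∀ n → u n ≢ 0ℚ
  -- 0 = p · 0 lies in pℤ[1/b], so a single prime, here the one for N = 0, refutes a zero term.
  backward primes n un≡0 = proj₂ (proj₂ (proj₂ (proj₂ (primes 0)))) n (0ℚ , (0 , ℕ∣.∣-refl) , trans un≡0 (sym (zeroʳ (fraction (ℤ.+ proj₁ (primes 0))))))
  forward : (∃ λ m → C ^ℤ m ≡ B) ⊎ (C ≡ 1ℚ × B ≡ - 1ℚ) ⊎ (∀ k → k ≢ ℤ.0ℤ → ∀ l → (B ^ℤ k) * (C ^ℤ l) ≢ 1ℚ × (B ^ℤ k) * (C ^ℤ l) ≢ - 1ℚ) → (∀ n → u n ≢ 0ℚ) → Primes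
  forward (inj₁ (m , e)) u≢0 = ⊥-elim (u≢0 m (trans (u≡S m) (S.zero-term m (trans (sym (^ℤ≡ C m)) e))))
  -- C = 1 would mean c₁ = c₂.
  forward (inj₂ (inj₁ (C≡1 , _))) _ = ⊥-elim (c₁≢c₂ (trans (sym Cc₂≡c₁) (trans (cong (_* c₂) C≡1) (*-identityˡ c₂))))
  forward (inj₂ (inj₂ independent)) _ N = found (S.Independent.primes indep b b>0 N)
    where
    indep : ∀ k → k ≢ ℤ.+ 0 → ∀ l → B Q.^ℤ k * C Q.^ℤ l ≢ 1ℚ × B Q.^ℤ k * C Q.^ℤ l ≢ - 1ℚ
    indep k k≢0 l = (λ e → proj₁ (independent k k≢0 l) (trans product e)) , (λ e → proj₂ (independent k k≢0 l) (trans product e))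
      where
      product : B ^ℤ k * C ^ℤ l ≡ B Q.^ℤ k * C Q.^ℤ l
      product = cong₂ _*_ (^ℤ≡ B k) (^ℤ≡ C l)
    found : (∃ λ p → p > N × Prime p × gcd b p ≡ 1 × (∀ n x → InZ[1/ b ] x → S.u n ≢ fraction (ℤ.+ p) * x)) →
            ∃ λ p → p > N × Prime p × gcd b p ≡ 1 × (∀ n → ¬ InpZ[1/ b ] p (u n))
    found (p , p>N , prime-p , gcd≡1 , none) = p , p>N , prime-p , gcd≡1 , λ { n (x , x∈ , e) → none n x x∈ (trans (sym (u≡S n)) e) }
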